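{- Let $d\ge3$ be odd, $n>d^2$, let $V$ be a $d$-dimensional complex vector space, and let $\sigma$ be a $d$-admissible signature of size $n$. Then all cluster and frozen variables in the cluster algebra $\mathcal A_\sigma$ are multi-homogeneous, i.e. homogeneous in each of the $n$ arguments $u_1,\dots,u_n$ (with respect to the multigrading of $R_\sigma(V)=\mathbb C[V^\sigma]^{\mathrm{SL}(V)}$ by the $n$-dimensional torus rescaling the $n$ factors of $V^\sigma$).
   Context: **Signatures.** A signature of size $n$ and type $(a,b)$, $a+b=n\ge3$, is a map $\sigma:\mathbb Z\to\{1,-1\}$ with $\sigma(j+n)=\sigma(j)$, taking the value $1$ ("black") $a$ times and $-1$ ("white") $b$ times on $\{1,\dots,n\}$. It is $d$-admissible if for all $j\in\mathbb Z$ and $k\in\{0,\dots,d-1\}$ there is $j'\ge j$ with $\sum_{i=j}^{j'}\sigma(i)\equiv k \pmod d$. **Mixed wedge.** Fix a volume form $e\in\bigwedge^dV$ (defining $\det$) and identify $\bigwedge^dV$ with $\bigwedge^0V=\mathbb C$ via $e$. For $u=u_1\wedge\cdots\wedge u_p$ and $v\in\bigwedge^qV$ with $p+q\ge d$ put $u\cap v=\sum_\tau \mathrm{sgn}(\tau)\det(u_{\tau(1)}\wedge\cdots\wedge u_{\tau(d-q)}\wedge v)\,u_{\tau(d-q+1)}\wedge\cdots\wedge u_{\tau(p)}$, the sum over permutations $\tau$ of $\{1,\dots,p\}$ increasing on the first $d-q$ and on the last $p+q-d$ positions (extended bilinearly). The mixed wedge of $u\in\bigwedge^pV$, $v\in\bigwedge^qV$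 is $u\curlywedge v=u\wedge v$ if $p+q\le d$ and $u\cap v$ if $p+q\ge d$ (these agree if $p+q=d$). A covector $u^*\in V^*$ is identified with the element $\psi(u^*)\in\bigwedge^{d-1}V$ such that $v\wedge\psi(u^*)=u^*(v)e$ for all $v\in V$. Iterated mixed wedges are evaluated from right to left. **Rings.** $V^\sigma$ is the product of $n$ factors, the $j$-th being $V$ if $\sigma(j)=1$ and $V^*$ if $\sigma(j)=-1$; its points are $\mathbf u=(u_1,\dots,u_n)$, and $u_{j+n}=u_j$. $\mathrm{SL}(V)$ acts naturally; $R_\sigma(V)=\mathbb C[V^\sigma]^{\mathrm{SL}(V)}$ and $K_\sigma$ is its fraction field. **Flags.** A decorated flag is $\mathcal G=(\mathcal G^1,\dots,\mathcal G^{d-1})$ with $0\ne\mathcal G^k\in\bigwedge^kV$ and $\mathcal G^{k+1}=\mathcal G^k\wedge v$ for some $v\in V$ ($1\le k<d-1$). Convention: $\mathcal G^0=1$, $\mathcal G^d=e$. Flags $\mathcal G,\mathcal H$ are in relative position $s_k$ if $\mathcal G^i=\mathcal H^i$ for $i\ne k$ and $\mathcal H^k$ is not proportional to $\mathcal G^k$; the crossing value $\langle\mathcal G,\mathcal H\rangle_k\in\mathbb C\setminus\{0\}$ is then defined by $\mathcal H^k=\mathcal G^{k-1}\wedge y$, $\mathcal G^k\wedge y=\langle\mathcal G,\mathcal H\rangle_k\,\mathcal G^{k+1}$ ($y\in V$). For generic $\mathbf u\in V^\sigma$, $j\in\mathbb Z$, $1\le k\le d-1$, let $j'\ge j$ be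 smallest with $\sum_{i=j}^{j'}\sigma(i)\equiv k\pmod d$ and $\mathcal F_j^k=u_j\curlywedge u_{j+1}\curlywedge\cdots\curlywedge u_{j'}$; then $\mathcal F_j=(\mathcal F_j^1,\dots,\mathcal F_j^{d-1})$ is a decorated flag, $\mathcal F_{j+n}=\mathcal F_j$. **Words.** Letters are in $\{1,\dots,d-1\}$; a marked word has some letters marked. Let $\rho_j=12\cdots(d-1)$ if $\sigma(j)=1$, $\rho_j=(d-1)\cdots21$ if $\sigma(j)=-1$, with only the last letter marked. For $p<q$ let $\beta(p,q)=\rho_p\rho_{p+1}\cdots\rho_{q-1}$. It is decorated by placing flags in the gaps between letters and at the ends: to the left of the $k$-th letter of $\rho_j$ stands $\mathcal F_{j,k}$, where, if $\sigma(j)=1$, $\mathcal F_{j,k}^i=\mathcal F_j^i$ for $i\ge k$ and $\mathcal F_{j+1}^i$ for $i<k$; if $\sigma(j)=-1$, $\mathcal F_{j,k}^i=\mathcal F_j^i$ for $i\le d-k$ and $\mathcal F_{j+1}^i$ for $i>d-k$; at the right end stands $\mathcal F_q$. Flags on the two sides of a letter $k$ are in relative position $s_k$, with crossing value $1$ if the letter is unmarked. **Demazure weaves.** A Demazure weave $\mathfrak w:\beta\rightrightarrows\beta'$ is a planar graph in a rectangle, read from top to bottom, given by a sequence of moves transforming the (marked) top word $\beta$ into the bottom word $\beta'$: $ii\to i$ (trivalent vertex), $ij\to ji$ with $|i-j|>1$ (4-valent vertex), $iji\to jij$ with $|i-j|=1$ (6-valent vertex). Edges are colored by letters. It is reduced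 if $\beta'$ is a reduced word in the symmetric group $S_d$. **Cycles.** Each marked top letter and each trivalent vertex $v$ defines a cycle $\gamma=\gamma_v$, a function from edges to $\mathbb Z_{\ge0}$: $\gamma=0$ on edges starting above $v$ and on other edges starting at the same level (in particular other top edges), $\gamma=1$ on the edge going down from $v$, and below $v$: at a trivalent vertex with incoming $a$ (left), $c$ (right), outgoing $b$: $\gamma(b)=\min(\gamma(a),\gamma(c))$; at a 4-valent vertex weights are carried along straight strands; at a 6-valent vertex with incoming $a,f,e$ (left to right) and outgoing $b,c,d$ (left to right): $\gamma(c)=\min(\gamma(a),\gamma(e))$, $\gamma(b)=\gamma(f)+\gamma(e)-\gamma(c)$, $\gamma(d)=\gamma(a)+\gamma(f)-\gamma(c)$. A cycle is frozen if it comes from a marked top letter or is nonzero on some bottom edge; otherwise mutable. **Quiver.** For numbers put $D(x,y,z;x',y',z')=\det\begin{pmatrix}1&1&1\\ x&y&z\\ x'&y'&z'\end{pmatrix}$. The intersection pairing is $\langle\gamma,\gamma'\rangle=\sum_v\langle\gamma,\gamma'\rangle_v$ over internal vertices, with $\langle\gamma,\gamma'\rangle_v=D(\gamma(a),\gamma(b),\gamma(c);\gamma'(a),\gamma'(b),\gamma'(c))$ at trivalent vertices, $\frac12\big[D(\gamma(a),\gamma(c),\gamma(e);\gamma'(a),\gamma'(c),\gamma'(e))+D(\gamma(b),\gamma(d),\gamma(f);\gamma'(b),\gamma'(d),\gamma'(f))\big]$ at 6-valent vertices, $0$ at 4-valent vertices (here, at a trivalent vertex, $a$ and $c$ are the left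 and right incoming edges and $b$ is the outgoing edge; at a 6-valent vertex, $a,f,e$ are the incoming edges and $b,c,d$ the outgoing edges, each listed from left to right). The quiver $Q(\mathfrak w)$ has the cycles as vertices (frozen/mutable accordingly) and $\langle\gamma,\gamma'\rangle$ arrows from $\gamma$ to $\gamma'$ (negative means reversed); arrows between frozen vertices are kept. **Cluster variables.** For generic $\mathbf u$ the decoration of the top word extends uniquely to an assignment of decorated flags to all regions of $\mathfrak w$, with unique numbers $\Delta_\gamma\ne0$ (one per cycle), such that for each edge $e$ of color $k$ with left region $U$ and right region $W$, the flags are in relative position $s_k$ and $\langle\mathcal F_U,\mathcal F_W\rangle_k=\prod_\gamma\Delta_\gamma^{\gamma(e)}$. The $\Delta_\gamma$ are $\mathrm{SL}(V)$-invariant rational functions of $\mathbf u$, i.e. elements of $K_\sigma$. The seed of $\mathfrak w$ is $\Sigma(\mathfrak w)=(Q(\mathfrak w),\{\Delta_\gamma\})$. **The cluster algebra.** A valid cut is a pair $1\le p\le q\le n$ with $\min(q-p,\,n-(q-p))\ge d+1$. Choose reduced Demazure weaves $\mathfrak w_1:\beta(p,q)\rightrightarrows\beta_1'$ and $\mathfrak w_2:\beta(q,p+n)\rightrightarrows\beta_2'$ with $\beta_2'$ the reverse of $\beta_1'$ (both are reduced words for the longest element of $S_d$). The seeds $\Sigma(\mathfrak w_1),\Sigma(\mathfrak w_2)$ share the frozen variables $\mathbf z_0=\{\mathcal F_p^k\wedge\mathcal F_q^{d-k}:1\le k\le d-1\}$. The seed $\Sigma_\sigma(p,q)$ is their amalgamation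 along $\mathbf z_0$: take the union of both quivers, identify vertices carrying the same element of $\mathbf z_0$, add the arrow numbers between identified vertices, and declare the identified vertices mutable; the extended cluster is the union of the two. $\mathcal A_\sigma$ is the cluster algebra (over $\mathbb C$, generated by all cluster and frozen variables in all seeds mutation equivalent to $\Sigma_\sigma(p,q)$; frozen variables are not inverted). It does not depend on the choices of $\mathfrak w_1,\mathfrak w_2$ nor on the valid cut, and its cluster and frozen variables are those appearing in these mutation equivalent seeds. -}

module Defs where

open import Algebra.Bundles using (CommutativeMonoid)
open import Algebra.Bundles.Raw using (RawRing; RawSemiring)
open import Data.Bool.Base using (Bool; true; false; if_then_else_; _∨_) renaming (_∧_ to _∧ᵇ_)
import Data.Bool.Properties as Bool
open import Data.Empty using (⊥)
open import Data.Fin.Base using (Fin; toℕ; fromℕ<)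
import Data.Fin.Properties as Fin
open import Data.Fin.Subset using (Subset; inside; outside; ⁅_⁆; ∁; _∪_; _─_) renaming (∣_∣ to card; ⊤ to full; ⊥ to empty)
open import Data.Fin.Subset.Properties using (_⊆?_)
open import Data.Integer.Base as ℤ using (ℤ; +_; -[1+_]; _◃_)
import Data.Integer.DivMod as ℤ
open import Data.Integer.Divisibility using (_∣_)
open import Data.List.Base using (List; []; _∷_; length; map; upTo; cartesianProduct; reverse)
open import Data.List.Relation.Unary.All using (All; []; _∷_; universal)
open import Data.List.Relation.Unary.All.Properties using (map⁺)
open import Data.Nat.Base as ℕ using (ℕ; zero; suc; _∸_; ∣_-_∣)
import Data.Nat.Divisibility as ℕ
import Data.Nat.Properties as ℕ
open import Data.Product.Base using (∃; _,_; proj₁; proj₂; _×_)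
open import Data.Rational.Base as ℚ using (ℚ; 0ℚ; 1ℚ; ½)
import Data.Rational.Properties as ℚ
open import Data.Sign.Base using (Sign)
open import Data.Sum.Base using (_⊎_)
open import Data.Unit.Base using (⊤)
open import Data.Vec.Base using ([]; _∷_)
import Data.Vec.Properties as Vec
open import Function.Base using (_∘_)
open import Level using (0ℓ)
open import Relation.Binary.Construct.Closure.ReflexiveTransitive using (Star)
open import Relation.Binary.PropositionalEquality.Core using (_≡_; _≢_; refl; sym; trans; cong; cong₂; subst)
open import Relation.Nullary using (¬_; Dec; does; yes; no; _×-dec_)

import Algebra.Definitions.RawMonoid as RawMonoidDefs
import Algebra.Definitions.RawSemiring as RawSemiringDefs
open import Algebra.Properties.CommutativeSemigroup (CommutativeMonoid.commutativeSemigroup ℚ.+-0-commutativeMonoid) using () renaming (interchange to +-interchange)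

-- Real numbers: Cauchy sequences of rationals, equal when their difference tends to 0.

Cauchy : (ℕ → ℚ) → Set
Cauchy x = ∀ ε → 0ℚ ℚ.< ε → ∃ λ N → ∀ m n → N ℕ.≤ m → N ℕ.≤ n → ℚ.∣ x m ℚ.- x n ∣ ℚ.< ε

record ℝ : Set where
  constructor mkℝ
  field
    seq    : ℕ → ℚ
    cauchy : Cauchy seq
open ℝ public

module CauchyClosure where
  open ℚ.≤-Reasoning

  telescope : ∀ p q r → p ℚ.- r ≡ (p ℚ.- q) ℚ.+ (q ℚ.- r)
  telescope p q r = sym (begin-equality
    (p ℚ.- q) ℚ.+ (q ℚ.- r)      ≡⟨ ℚ.+-assoc p (ℚ.- q) (q ℚ.- r) ⟩
    p ℚ.+ (ℚ.- q ℚ.+ (q ℚ.- r))  ≡⟨ cong (p ℚ.+_) (ℚ.+-assoc (ℚ.- q) q (ℚ.- r)) ⟨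
    p ℚ.+ ((ℚ.- q ℚ.+ q) ℚ.- r)  ≡⟨ cong (λ z → p ℚ.+ (z ℚ.- r)) (ℚ.+-inverseˡ q) ⟩
    p ℚ.+ (0ℚ ℚ.- r)             ≡⟨ cong (p ℚ.+_) (ℚ.+-identityˡ (ℚ.- r)) ⟩
    p ℚ.- r                      ∎)

  +-minus : ∀ a b c d → (a ℚ.+ b) ℚ.- (c ℚ.+ d) ≡ (a ℚ.- c) ℚ.+ (b ℚ.- d)
  +-minus a b c d = trans (cong ((a ℚ.+ b) ℚ.+_) (ℚ.neg-distrib-+ c d))
                          (+-interchange a b (ℚ.- c) (ℚ.- d))

  *-minusˡ : ∀ a b c → a ℚ.* b ℚ.- a ℚ.* c ≡ a ℚ.* (b ℚ.- c)
  *-minusˡ a b c = trans (cong (a ℚ.* b ℚ.+_) (ℚ.neg-distribʳ-* a c))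
                         (sym (ℚ.*-distribˡ-+ a b (ℚ.- c)))

  *-minus : ∀ a b c d → a ℚ.* b ℚ.- c ℚ.* d ≡ a ℚ.* (b ℚ.- d) ℚ.+ d ℚ.* (a ℚ.- c)
  *-minus a b c d = trans (telescope (a ℚ.* b) (a ℚ.* d) (c ℚ.* d)) (cong₂ ℚ._+_ (*-minusˡ a b d)
    (trans (cong₂ ℚ._-_ (ℚ.*-comm a d) (ℚ.*-comm c d)) (*-minusˡ d a c)))

  a≡b+[a-b] : ∀ a b → a ≡ b ℚ.+ (a ℚ.- b)
  a≡b+[a-b] a b = sym (begin-equality
    b ℚ.+ (a ℚ.- b)      ≡⟨ ℚ.+-comm b (a ℚ.- b) ⟩
    (a ℚ.- b) ℚ.+ b      ≡⟨ ℚ.+-assoc a (ℚ.- b) b ⟩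
    a ℚ.+ (ℚ.- b ℚ.+ b)  ≡⟨ cong (a ℚ.+_) (ℚ.+-inverseˡ b) ⟩
    a ℚ.+ 0ℚ             ≡⟨ ℚ.+-identityʳ a ⟩
    a                    ∎)

  half+half : ∀ ε → ½ ℚ.* ε ℚ.+ ½ ℚ.* ε ≡ ε
  half+half ε = trans (sym (ℚ.*-distribʳ-+ ε ½ ½)) (ℚ.*-identityˡ ε)

  0<½ε : ∀ ε → 0ℚ ℚ.< ε → 0ℚ ℚ.< ½ ℚ.* ε
  0<½ε ε 0<ε = subst (ℚ._< ½ ℚ.* ε) (ℚ.*-zeroʳ ½) (ℚ.*-monoʳ-<-pos ½ 0<ε)

  +-cauchy : ∀ x y → Cauchy x → Cauchy y → Cauchy (λ n → x n ℚ.+ y n)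
  +-cauchy x y cx cy ε 0<ε = Nx ℕ.⊔ Ny , bound
    where
    Nx = proj₁ (cx (½ ℚ.* ε) (0<½ε ε 0<ε))
    Ny = proj₁ (cy (½ ℚ.* ε) (0<½ε ε 0<ε))
    bound : ∀ m n → Nx ℕ.⊔ Ny ℕ.≤ m → Nx ℕ.⊔ Ny ℕ.≤ n →
            ℚ.∣ (x m ℚ.+ y m) ℚ.- (x n ℚ.+ y n) ∣ ℚ.< ε
    bound m n N≤m N≤n = begin-strict
      ℚ.∣ (x m ℚ.+ y m) ℚ.- (x n ℚ.+ y n) ∣
        ≡⟨ cong ℚ.∣_∣ (+-minus (x m) (y m) (x n) (y n)) ⟩
      ℚ.∣ (x m ℚ.- x n) ℚ.+ (y m ℚ.- y n) ∣
        ≤⟨ ℚ.∣p+q∣≤∣p∣+∣q∣ (x m ℚ.- x n) (y m ℚ.- y n) ⟩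
      ℚ.∣ x m ℚ.- x n ∣ ℚ.+ ℚ.∣ y m ℚ.- y n ∣
        <⟨ ℚ.+-mono-<
             (proj₂ (cx _ (0<½ε ε 0<ε)) m n (ℕ.m⊔n≤o⇒m≤o Nx Ny N≤m) (ℕ.m⊔n≤o⇒m≤o Nx Ny N≤n))
             (proj₂ (cy _ (0<½ε ε 0<ε)) m n (ℕ.m⊔n≤o⇒n≤o Nx Ny N≤m) (ℕ.m⊔n≤o⇒n≤o Nx Ny N≤n)) ⟩
      ½ ℚ.* ε ℚ.+ ½ ℚ.* ε
        ≡⟨ half+half ε ⟩
      ε ∎

  neg-cauchy : ∀ x → Cauchy x → Cauchy (λ n → ℚ.- x n)
  neg-cauchy x cx ε 0<ε = proj₁ (cx ε 0<ε) , λ m n N≤m N≤n → begin-strict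
    ℚ.∣ ℚ.- x m ℚ.- ℚ.- x n ∣
      ≡⟨ cong ℚ.∣_∣ (sym (ℚ.neg-distrib-+ (x m) (ℚ.- x n))) ⟩
    ℚ.∣ ℚ.- (x m ℚ.- x n) ∣
      ≡⟨ ℚ.∣-p∣≡∣p∣ (x m ℚ.- x n) ⟩
    ℚ.∣ x m ℚ.- x n ∣
      <⟨ proj₂ (cx ε 0<ε) m n N≤m N≤n ⟩
    ε ∎

  const-cauchy : ∀ r → Cauchy (λ _ → r)
  const-cauchy r ε 0<ε = 0 , λ _ _ _ _ → begin-strict
    ℚ.∣ r ℚ.- r ∣ ≡⟨ cong ℚ.∣_∣ (ℚ.+-inverseʳ r) ⟩
    0ℚ            <⟨ 0<ε ⟩
    ε             ∎

  bounded : ∀ x → Cauchy x →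
            ∃ λ N → ∃ λ B → ℚ.Positive B × (∀ m → N ℕ.≤ m → ℚ.∣ x m ∣ ℚ.≤ B)
  bounded x cx = N , ℚ.∣ x N ∣ ℚ.+ 1ℚ ,
      ℚ.positive (ℚ.+-mono-≤-< (ℚ.0≤∣p∣ (x N)) (ℚ.positive⁻¹ 1ℚ)) , λ m N≤m → begin
    ℚ.∣ x m ∣
      ≡⟨ cong ℚ.∣_∣ (a≡b+[a-b] (x m) (x N)) ⟩
    ℚ.∣ x N ℚ.+ (x m ℚ.- x N) ∣
      ≤⟨ ℚ.∣p+q∣≤∣p∣+∣q∣ (x N) (x m ℚ.- x N) ⟩
    ℚ.∣ x N ∣ ℚ.+ ℚ.∣ x m ℚ.- x N ∣
      ≤⟨ ℚ.+-monoʳ-≤ ℚ.∣ x N ∣ (ℚ.<⇒≤ (proj₂ c₁ m N N≤m ℕ.≤-refl)) ⟩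
    ℚ.∣ x N ∣ ℚ.+ 1ℚ ∎
    where
    c₁ = cx 1ℚ (ℚ.positive⁻¹ 1ℚ)
    N  = proj₁ c₁

  *-cauchy : ∀ x y → Cauchy x → Cauchy y → Cauchy (λ n → x n ℚ.* y n)
  *-cauchy x y cx cy ε 0<ε with bounded x cx | bounded y cy
  ... | Mx , Bx , Bx>0 , x≤Bx | My , By , By>0 , y≤By = N , bound
    where
    instance
      _ = Bx>0
      _ = By>0
      _ = ℚ.positive 0<ε
      B>0 = ℚ.pos+pos⇒pos Bx By
      B≢0 = ℚ.pos⇒nonZero (Bx ℚ.+ By)
      1/B>0 = ℚ.1/pos⇒pos (Bx ℚ.+ By)
      Bx≥0 = ℚ.pos⇒nonNeg Bx
      By≥0 = ℚ.pos⇒nonNeg By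
    ε′ = ℚ.1/ (Bx ℚ.+ By) ℚ.* ε
    0<ε′ : 0ℚ ℚ.< ε′
    0<ε′ = ℚ.positive⁻¹ ε′ {{ℚ.pos*pos⇒pos (ℚ.1/ (Bx ℚ.+ By)) ε}}
    Nx = proj₁ (cx ε′ 0<ε′)
    Ny = proj₁ (cy ε′ 0<ε′)
    N = (Mx ℕ.⊔ My) ℕ.⊔ (Nx ℕ.⊔ Ny)
    bound : ∀ m n → N ℕ.≤ m → N ℕ.≤ n → ℚ.∣ x m ℚ.* y m ℚ.- x n ℚ.* y n ∣ ℚ.< ε
    bound m n N≤m N≤n = begin-strict
      ℚ.∣ x m ℚ.* y m ℚ.- x n ℚ.* y n ∣
        ≡⟨ cong ℚ.∣_∣ (*-minus (x m) (y m) (x n) (y n)) ⟩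
      ℚ.∣ x m ℚ.* (y m ℚ.- y n) ℚ.+ y n ℚ.* (x m ℚ.- x n) ∣
        ≤⟨ ℚ.∣p+q∣≤∣p∣+∣q∣ (x m ℚ.* (y m ℚ.- y n)) (y n ℚ.* (x m ℚ.- x n)) ⟩
      ℚ.∣ x m ℚ.* (y m ℚ.- y n) ∣ ℚ.+ ℚ.∣ y n ℚ.* (x m ℚ.- x n) ∣
        ≡⟨ cong₂ ℚ._+_ (ℚ.∣p*q∣≡∣p∣*∣q∣ (x m) (y m ℚ.- y n)) (ℚ.∣p*q∣≡∣p∣*∣q∣ (y n) (x m ℚ.- x n)) ⟩
      ℚ.∣ x m ∣ ℚ.* ℚ.∣ y m ℚ.- y n ∣ ℚ.+ ℚ.∣ y n ∣ ℚ.* ℚ.∣ x m ℚ.- x n ∣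
        ≤⟨ ℚ.+-mono-≤
             (ℚ.*-monoʳ-≤-nonNeg ℚ.∣ y m ℚ.- y n ∣ {{ℚ.∣-∣-nonNeg (y m ℚ.- y n)}} (x≤Bx m Mx≤m))
             (ℚ.*-monoʳ-≤-nonNeg ℚ.∣ x m ℚ.- x n ∣ {{ℚ.∣-∣-nonNeg (x m ℚ.- x n)}} (y≤By n My≤n)) ⟩
      Bx ℚ.* ℚ.∣ y m ℚ.- y n ∣ ℚ.+ By ℚ.* ℚ.∣ x m ℚ.- x n ∣
        <⟨ ℚ.+-mono-<
             (ℚ.*-monoʳ-<-pos Bx (proj₂ (cy ε′ 0<ε′) m n Ny≤m Ny≤n))
             (ℚ.*-monoʳ-<-pos By (proj₂ (cx ε′ 0<ε′) m n Nx≤m Nx≤n)) ⟩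
      Bx ℚ.* ε′ ℚ.+ By ℚ.* ε′
        ≡⟨ ℚ.*-distribʳ-+ ε′ Bx By ⟨
      (Bx ℚ.+ By) ℚ.* ε′
        ≡⟨ ℚ.*-assoc (Bx ℚ.+ By) (ℚ.1/ (Bx ℚ.+ By)) ε ⟨
      (Bx ℚ.+ By) ℚ.* ℚ.1/ (Bx ℚ.+ By) ℚ.* ε
        ≡⟨ cong (ℚ._* ε) (ℚ.*-inverseʳ (Bx ℚ.+ By)) ⟩
      1ℚ ℚ.* ε
        ≡⟨ ℚ.*-identityˡ ε ⟩
      ε ∎
      where
      Mx≤m = ℕ.m⊔n≤o⇒m≤o Mx My (ℕ.m⊔n≤o⇒m≤o (Mx ℕ.⊔ My) (Nx ℕ.⊔ Ny) N≤m)
      My≤n = ℕ.m⊔n≤o⇒n≤o Mx My (ℕ.m⊔n≤o⇒m≤o (Mx ℕ.⊔ My) (Nx ℕ.⊔ Ny) N≤n)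
      Nx≤m = ℕ.m⊔n≤o⇒m≤o Nx Ny (ℕ.m⊔n≤o⇒n≤o (Mx ℕ.⊔ My) (Nx ℕ.⊔ Ny) N≤m)
      Nx≤n = ℕ.m⊔n≤o⇒m≤o Nx Ny (ℕ.m⊔n≤o⇒n≤o (Mx ℕ.⊔ My) (Nx ℕ.⊔ Ny) N≤n)
      Ny≤m = ℕ.m⊔n≤o⇒n≤o Nx Ny (ℕ.m⊔n≤o⇒n≤o (Mx ℕ.⊔ My) (Nx ℕ.⊔ Ny) N≤m)
      Ny≤n = ℕ.m⊔n≤o⇒n≤o Nx Ny (ℕ.m⊔n≤o⇒n≤o (Mx ℕ.⊔ My) (Nx ℕ.⊔ Ny) N≤n)

open CauchyClosure

-- Opaque so that normalised types stay small.
opaque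
  infix  4 _≈ℝ_
  infixl 6 _+ℝ_
  infixl 7 _*ℝ_
  infix  8 -ℝ_

  _≈ℝ_ : ℝ → ℝ → Set
  x ≈ℝ y = ∀ ε → 0ℚ ℚ.< ε → ∃ λ N → ∀ n → N ℕ.≤ n → ℚ.∣ seq x n ℚ.- seq y n ∣ ℚ.< ε

  _+ℝ_ _*ℝ_ : ℝ → ℝ → ℝ
  x +ℝ y = mkℝ (λ n → seq x n ℚ.+ seq y n) (+-cauchy (seq x) (seq y) (cauchy x) (cauchy y))
  x *ℝ y = mkℝ (λ n → seq x n ℚ.* seq y n) (*-cauchy (seq x) (seq y) (cauchy x) (cauchy y))

  -ℝ_ : ℝ → ℝ
  -ℝ x = mkℝ (λ n → ℚ.- seq x n) (neg-cauchy (seq x) (cauchy x))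

  fromℚ : ℚ → ℝ
  fromℚ r = mkℝ (λ _ → r) (const-cauchy r)

record ℂ : Set where
  constructor _+i_
  field
    re im : ℝ
open ℂ public

ℂ-rawRing : RawRing 0ℓ 0ℓ
ℂ-rawRing = record
  { Carrier = ℂ
  ; _≈_     = λ z w → (re z ≈ℝ re w) × (im z ≈ℝ im w)
  ; _+_     = λ z w → (re z +ℝ re w) +i (im z +ℝ im w)
  ; _*_     = λ z w → (re z *ℝ re w +ℝ -ℝ (im z *ℝ im w)) +i (re z *ℝ im w +ℝ im z *ℝ re w)
  ; -_      = λ z → (-ℝ re z) +i (-ℝ im z)
  ; 0#      = fromℚ 0ℚ +i fromℚ 0ℚ
  ; 1#      = fromℚ 1ℚ +i fromℚ 0ℚ
  }

open RawRing ℂ-rawRing public using (_≈_; _+_; _*_; -_; 0#; 1#)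
open RawSemiringDefs (RawRing.rawSemiring ℂ-rawRing) public using (sum; product; _^_)

-- The constructive form of "nonzero" in ℂ; classically it is ¬ (z ≈ 0#).
_≠0 : ℂ → Set
z ≠0 = ∃ λ w → z * w ≈ 1#

record ℂˣ : Set where
  field
    value inverse : ℂ
    isInverse     : value * inverse ≈ 1#
open ℂˣ public

_^ᶻ_ : ℂˣ → ℤ → ℂ
t ^ᶻ (+ m)    = value t ^ m
t ^ᶻ -[1+ m ] = inverse t ^ suc m

-- The exterior algebra of V = ℂ^d.  An element is its family of coordinates in the basis
-- e_S = e_{s₁} ∧ … ∧ e_{sₖ}, S = {s₁ < … < sₖ} ⊆ {1,…,d}; the volume form is e₁ ∧ … ∧ e_d.

Λ : ℕ → Set
Λ d = Subset d → ℂ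

sumSubsets : ∀ {d} → (Subset d → ℂ) → ℂ
sumSubsets {zero}  f = f []
sumSubsets {suc d} f = sumSubsets (f ∘ (inside ∷_)) + sumSubsets (f ∘ (outside ∷_))

-- The number of pairs a ∈ A, b ∈ B with b < a.
inversions : ∀ {d} → Subset d → Subset d → ℕ
inversions []      []            = 0
inversions (_ ∷ A) (inside  ∷ B) = card A ℕ.+ inversions A B
inversions (_ ∷ A) (outside ∷ B) = inversions A B

-- For disjoint A and B: the sign with e_A ∧ e_B = sgn A B e_{A ∪ B}.
sgn : ∀ {d} → Subset d → Subset d → ℂ
sgn A B = (- 1#) ^ inversions A B

basis : ∀ {d} → Subset d → Λ d
basis S T = if does (Vec.≡-dec Bool._≟_ S T) then 1# else 0#

module _ {d : ℕ} where

  infix 4 _≈ᴸ_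
  infixr 7 _∧_
  infixr 8 _·ᴸ_

  _≈ᴸ_ : Λ d → Λ d → Set
  u ≈ᴸ v = ∀ S → u S ≈ v S

  _·ᴸ_ : ℂ → Λ d → Λ d
  (c ·ᴸ u) S = c * u S

  one vol : Λ d
  one = basis empty
  vol = basis full

  det : Λ d → ℂ
  det u = u full

  _∧_ : Λ d → Λ d → Λ d
  (u ∧ v) T = sumSubsets λ A →
    if does (A ⊆? T) then sgn A (T ─ A) * (u A * v (T ─ A)) else 0#

  -- For v of degree q.  The shuffles τ applied to u = e_S correspond to the subsets A ⊆ S with
  -- |A| = d - q, the sign of τ is sgn A (S ─ A), and the term is a multiple of e_T, T = S ─ A.
  cap : ℕ → Λ d → Λ d → Λ d
  cap q u v T = sumSubsets λ A →
    if does ((A ⊆? ∁ T) ×-dec (card A ℕ.+ q ℕ.≟ d))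
    then sgn A T * (u (A ∪ T) * det (basis A ∧ v)) else 0#

  -- Elements of the exterior powers, tagged with their degree.
  infixr 7 _⋎_
  _⋎_ : ℕ × Λ d → ℕ × Λ d → ℕ × Λ d
  (p , u) ⋎ (q , v) = if does (p ℕ.+ q ℕ.≤? d)
    then (p ℕ.+ q , u ∧ v)
    else (p ℕ.+ q ∸ d , cap q u v)

  vector : (Fin d → ℂ) → Λ d
  vector x S = sum λ i → x i * basis ⁅ i ⁆ S

  -- The covector φ has coordinates φ i = φ(eᵢ), so that vector x ∧ covector φ = φ(x) e.
  covector : (Fin d → ℂ) → Λ d
  covector φ S = sum λ i → φ i * (sgn ⁅ i ⁆ (∁ ⁅ i ⁆) * basis (∁ ⁅ i ⁆) S)

-- Decorated flags, including the conventional G 0 and G d; the values beyond d are irrelevant.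

Flag : ℕ → Set
Flag d = ℕ → Λ d

record IsDecoratedFlag {d : ℕ} (G : Flag d) : Set where
  field
    bottom  : G 0 ≈ᴸ one
    top     : G d ≈ᴸ vol
    degree  : ∀ k → 1 ℕ.≤ k → k ℕ.< d → ∀ S → card S ≢ k → G k S ≈ 0#
    nonzero : ∀ k → 1 ℕ.≤ k → k ℕ.< d → ¬ (∀ S → G k S ≈ 0#)
    step    : ∀ k → 1 ℕ.≤ k → suc k ℕ.< d → ∃ λ y → G (suc k) ≈ᴸ G k ∧ vector y

RelativePosition : ∀ {d} → ℕ → Flag d → Flag d → Set
RelativePosition {d} k G H =
  (∀ i → i ℕ.≤ d → i ≢ k → G i ≈ᴸ H i) × ¬ (∃ λ c → H k ≈ᴸ c ·ᴸ G k)

CrossingValue : ∀ {d} → ℕ → Flag d → Flag d → ℂ → Set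
CrossingValue k G H c =
  ∃ λ y → (H k ≈ᴸ G (k ∸ 1) ∧ vector y) × (G k ∧ vector y ≈ᴸ c ·ᴸ G (suc k))

-- Demazure weaves.  A letter of a word is an edge of the corresponding horizontal slice.

Word : Set
Word = List ℕ

data Move : Word → Word → Set where
  trivalent : ∀ {i β} → Move (i ∷ i ∷ β) (i ∷ β)
  4-valent  : ∀ {i j β} → 1 ℕ.< ∣ i - j ∣ → Move (i ∷ j ∷ β) (j ∷ i ∷ β)
  6-valent  : ∀ {i j β} → ∣ i - j ∣ ≡ 1 → Move (i ∷ j ∷ i ∷ β) (j ∷ i ∷ j ∷ β)
  skip      : ∀ {i β β′} → Move β β′ → Move (i ∷ β) (i ∷ β′)

data Weave : Word → Word → Set where
  []  : ∀ {β} → Weave β β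
  _∷_ : ∀ {β β′ β″} → Move β β′ → Weave β′ β″ → Weave β β″

moveTrivalents : ∀ {β β′} → Move β β′ → ℕ
moveTrivalents trivalent    = 1
moveTrivalents (4-valent _) = 0
moveTrivalents (6-valent _) = 0
moveTrivalents (skip m)     = moveTrivalents m

trivalents : ∀ {β β′} → Weave β β′ → ℕ
trivalents []      = 0
trivalents (m ∷ w) = moveTrivalents m ℕ.+ trivalents w

-- Cycles are numbered: first the marked top letters, then the trivalent vertices from top to
-- bottom.  An edge carries the function sending each cycle to its value on that edge.

Weights : Word → Set
Weights β = All (λ _ → ℕ → ℕ) β

-- The outgoing weights, v being the number of the trivalent vertex.
trivalentOut : (v : ℕ) (a c : ℕ → ℕ) → ℕ → ℕ
trivalentOut v a c γ = if γ ℕ.≡ᵇ v then 1 else a γ ℕ.⊓ c γ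

module SixValent (a f e : ℕ → ℕ) where
  b c d : ℕ → ℕ
  c γ = a γ ℕ.⊓ e γ
  b γ = f γ ℕ.+ e γ ∸ c γ
  d γ = a γ ℕ.+ f γ ∸ c γ

moveWeights : ∀ {β β′} → Move β β′ → (v : ℕ) → Weights β → Weights β′
moveWeights trivalent    v (a ∷ c ∷ γs)     = trivalentOut v a c ∷ γs
moveWeights (4-valent _) v (a ∷ c ∷ γs)     = c ∷ a ∷ γs
moveWeights (6-valent _) v (a ∷ f ∷ e ∷ γs) = b ∷ c ∷ d ∷ γs where open SixValent a f e
moveWeights (skip m)     v (a ∷ γs)         = a ∷ moveWeights m v γs

bottomWeights : ∀ {β β′} → Weave β β′ → (v : ℕ) → Weights β → Weights β′
bottomWeights []      v γs = γs
bottomWeights (m ∷ w) v γs = bottomWeights w (v ℕ.+ moveTrivalents m) (moveWeights m v γs)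

D : (x y z x′ y′ z′ : ℕ) → ℤ
D x y z x′ y′ z′ = ((+ y ℤ.* + z′) ℤ.- (+ z ℤ.* + y′))
             ℤ.- ((+ x ℤ.* + z′) ℤ.- (+ z ℤ.* + x′))
             ℤ.+ ((+ x ℤ.* + y′) ℤ.- (+ y ℤ.* + x′))

movePairing : ∀ {β β′} → Move β β′ → (v : ℕ) → Weights β → (γ γ′ : ℕ) → ℚ
movePairing trivalent v (a ∷ c ∷ _) γ γ′ = D (a γ) (b γ) (c γ) (a γ′) (b γ′) (c γ′) ℚ./ 1
  where b = trivalentOut v a c
movePairing (4-valent _) v _ γ γ′ = 0ℚ
movePairing (6-valent _) v (a ∷ f ∷ e ∷ _) γ γ′ =
  (D (a γ) (c γ) (e γ) (a γ′) (c γ′) (e γ′) ℤ.+ D (b γ) (d γ) (f γ) (b γ′) (d γ′) (f γ′)) ℚ./ 2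
  where open SixValent a f e
movePairing (skip m) v (_ ∷ γs) γ γ′ = movePairing m v γs γ γ′

pairing : ∀ {β β′} → Weave β β′ → (v : ℕ) → Weights β → (γ γ′ : ℕ) → ℚ
pairing []      v γs γ γ′ = 0ℚ
pairing (m ∷ w) v γs γ γ′ =
  movePairing m v γs γ γ′ ℚ.+ pairing w (v ℕ.+ moveTrivalents m) (moveWeights m v γs) γ γ′

isNonzeroOn : ∀ {β} → Weights β → ℕ → Bool
isNonzeroOn []       γ = false
isNonzeroOn (a ∷ γs) γ = (0 ℕ.<ᵇ a γ) ∨ isNonzeroOn γs γ

transposition : ℕ → ℕ → ℕ
transposition k x =
  if x ℕ.≡ᵇ k then suc k else (if x ℕ.≡ᵇ suc k then k else x)

permutation : Word → ℕ → ℕ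
permutation []      x = x
permutation (k ∷ β) x = transposition k (permutation β x)

ReducedWord : ℕ → Word → Set
ReducedWord d β = ∀ β′ → All (λ k → 1 ℕ.≤ k × k ℕ.< d) β′ →
  (∀ x → permutation β′ x ≡ permutation β x) → length β ℕ.≤ length β′

-- Decorations of a weave by flags.  A slice is decorated by the flag of its leftmost region
-- (which is the same for all slices) and, for each letter, the flag to the right of it.

Regions : ℕ → Word → Set
Regions d β = All (λ _ → Flag d) β

-- The flags of the regions starting at the vertex of a move.
NewFlags : ∀ {β β′} → ℕ → Move β β′ → Set
NewFlags d trivalent    = ⊤
NewFlags d (4-valent _) = Flag d
NewFlags d (6-valent _) = Flag d × Flag d
NewFlags d (skip m)     = NewFlags d m

moveRegions : ∀ {d β β′} (m : Move β β′) → NewFlags d m → Regions d β → Regions d β′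
moveRegions trivalent    _       (_ ∷ W ∷ Gs)     = W ∷ Gs
moveRegions (4-valent _) M       (_ ∷ W ∷ Gs)     = M ∷ W ∷ Gs
moveRegions (6-valent _) (M , N) (_ ∷ _ ∷ W ∷ Gs) = M ∷ N ∷ W ∷ Gs
moveRegions (skip m)     new     (W ∷ Gs)         = W ∷ moveRegions m new Gs

module _ {d N : ℕ} (Δ : Fin N → ℂ) where

  SliceDecoration : ∀ {β} → Weights β → (U : Flag d) → Regions d β → Set
  SliceDecoration []               U []       = IsDecoratedFlag U
  SliceDecoration (_∷_ {x = k} a γs) U (W ∷ Gs) =
    IsDecoratedFlag U
    × RelativePosition k U W
    × CrossingValue k U W (product λ γ → Δ γ ^ a (toℕ γ))
    × SliceDecoration γs W Gs

  Decoration : ∀ {β β′} → Weave β β′ → (v : ℕ) → Weights β → (U : Flag d) → Regions d β → Set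
  Decoration []      v γs U Gs = SliceDecoration γs U Gs
  Decoration (m ∷ w) v γs U Gs = SliceDecoration γs U Gs ×
    ∃ λ (new : NewFlags d m) →
      Decoration w (v ℕ.+ moveTrivalents m) (moveWeights m v γs) U (moveRegions m new Gs)

-- Signatures.  Sign.+ is black, Sign.- is white.

record Signature (n : ℕ) : Set where
  field
    sign     : ℤ → Sign
    periodic : ∀ j → sign (j ℤ.+ + n) ≡ sign j
    size     : 3 ℕ.≤ n
open Signature public

-- σ(j) + σ(j+1) + … + σ(j+m)
partialSum : ∀ {n} → Signature n → ℤ → ℕ → ℤ
partialSum σ j zero    = sign σ j ◃ 1
partialSum σ j (suc m) = partialSum σ j m ℤ.+ (sign σ (j ℤ.+ + suc m) ◃ 1)

Hits : ∀ {n} → ℕ → Signature n → ℤ → ℕ → ℕ → Set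
Hits d σ j k m = (+ d) ∣ (partialSum σ j m ℤ.- + k)

record Admissible {n : ℕ} (d : ℕ) (σ : Signature n) : Set where
  field
    hits : ∀ j k → k ℕ.< d → ∃ λ m → Hits d σ j k m
open Admissible public

-- The least m ≤ b satisfying P, provided that P b.
least : {P : ℕ → Set} → (∀ m → Dec (P m)) → (b : ℕ) → ℕ
least P? zero    = zero
least P? (suc b) = if does (P? zero) then zero else suc (least (P? ∘ suc) b)

-- Points of V^σ and regular functions on it.  The factors are indexed by residue classes mod n,
-- i : Fin n standing for the class of toℕ i; V and V* are coordinatised by Fin d → ℂ using dual
-- bases.  Since ℂ is infinite, a regular function is a polynomial expression up to equality of
-- values at all points.

Point : ℕ → ℕ → Set
Point d n = Fin n → Fin d → ℂ

data Polynomial (d n : ℕ) : Set where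
  const     : ℂ → Polynomial d n
  var       : Fin n → Fin d → Polynomial d n
  _:+_ _:*_ : Polynomial d n → Polynomial d n → Polynomial d n

eval : ∀ {d n} → Polynomial d n → Point d n → ℂ
eval (const c) u = c
eval (var i c) u = u i c
eval (f :+ g)  u = eval f u + eval g u
eval (f :* g)  u = eval f u * eval g u

Nonvanishing : ∀ {d n} → Polynomial d n → Set
Nonvanishing f = ∃ λ u → eval f u ≠0

rescale : ∀ {d n} → (Fin n → ℂˣ) → Point d n → Point d n
rescale t u i c = value (t i) * u i c

-- Formal fractions of regular functions, equal when they cross-multiply to the same function.
-- Only those with Nonvanishing denominator, such as elements of K below, are rational functions.

record Fraction (d n : ℕ) : Set where
  constructor _÷_
  field
    numerator denominator : Polynomial d n
open Fraction public

fractions : ℕ → ℕ → RawSemiring 0ℓ 0ℓ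
fractions d n = record
  { Carrier = Fraction d n
  ; _≈_     = λ x y → ∀ u → eval (numerator x) u * eval (denominator y) u
                          ≈ eval (numerator y) u * eval (denominator x) u
  ; _+_     = λ x y → ((numerator x :* denominator y) :+ (numerator y :* denominator x))
                      ÷ (denominator x :* denominator y)
  ; _*_     = λ x y → (numerator x :* numerator y) ÷ (denominator x :* denominator y)
  ; 0#      = const 0# ÷ const 1#
  ; 1#      = const 1# ÷ const 1#
  }

-- SL(V) acts on the covector factors of V^σ by (g φ)(v) = φ(g⁻¹ v).

wedgeAll : ∀ {d m} → (Fin m → Fin d → ℂ) → Λ d
wedgeAll {m = zero}  x = one
wedgeAll {m = suc m} x = vector (x Fin.zero) ∧ wedgeAll (x ∘ Fin.suc)

δ : ∀ {d} → Fin d → Fin d → ℂ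
δ a b = if does (a Fin.≟ b) then 1# else 0#

record SL (d : ℕ) : Set where
  field
    mat inv     : Fin d → Fin d → ℂ
    isInverseʳ  : ∀ a c → sum (λ b → mat a b * inv b c) ≈ δ a c
    isInverseˡ  : ∀ a c → sum (λ b → inv a b * mat b c) ≈ δ a c
    unimodular  : wedgeAll (λ b a → mat a b) ≈ᴸ vol
open SL public

module _ (d : ℕ) {n : ℕ} (σ : Signature n) where

  act : SL d → Point d n → Point d n
  act g u i c with sign σ (+ toℕ i)
  ... | Sign.+ = sum λ b → mat g c b * u i b
  ... | Sign.- = sum λ b → u i b * inv g b c

  -- R_σ(V)
  record R : Set where
    field
      function  : Polynomial d n
      invariant : ∀ g u → eval function (act g u) ≈ eval function u
  open R public

  -- K_σ, the fraction field of R_σ(V)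
  record K : Set where
    field
      num den : R
      den≠0   : Nonvanishing (function den)
  open K public

module _ {d n : ℕ} {σ : Signature n} where

  fraction : K d σ → Fraction d n
  fraction x = function (num x) ÷ function (den x)

  infix 4 _≈ᴷ_
  _≈ᴷ_ : K d σ → K d σ → Set
  x ≈ᴷ y = RawSemiring._≈_ (fractions d n) (fraction x) (fraction y)

  -- x(u) = c, the denominator being nonzero at u.
  HasValue : K d σ → Point d n → ℂ → Set
  HasValue x u c = eval (function (den x)) u ≠0
                 × eval (function (num x)) u ≈ c * eval (function (den x)) u

  -- x(t u) = t^δ x(u), cleared of denominators, for all t in the n-dimensional torus: x lies in
  -- the δ-weight space of K_σ.  If x is in R_σ(V), this is the graded component of degree δ.
  HomogeneousOfDegree : (Fin n → ℤ) → K d σ → Set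
  HomogeneousOfDegree δ x = ∀ (t : Fin n → ℂˣ) (u : Point d n) →
    eval (function (num x)) (rescale t u) * eval (function (den x)) u
    ≈ product (λ i → t i ^ᶻ δ i)
      * (eval (function (num x)) u * eval (function (den x)) (rescale t u))

  MultiHomogeneous : K d σ → Set
  MultiHomogeneous x = ∃ λ (δ : Fin n → ℤ) → HomogeneousOfDegree δ x

module _ {d n : ℕ} {σ : Signature n} (adm : Admissible d σ) where

  private instance
    n≢0 : ℕ.NonZero n
    n≢0 = ℕ.>-nonZero (ℕ.≤-trans (ℕ.s≤s ℕ.z≤n) (size σ))

  component : Point d n → ℤ → Fin d → ℂ
  component u j = u (fromℕ< (ℤ.n%ℕd<d j n))

  element : Point d n → ℤ → ℕ × Λ d
  element u j with sign σ j
  ... | Sign.+ = 1 , vector (component u j)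
  ... | Sign.- = d ∸ 1 , covector (component u j)

  -- u_j ⋎ u_{j+1} ⋎ … ⋎ u_{j+m}
  mixedProduct : Point d n → ℤ → ℕ → ℕ × Λ d
  mixedProduct u j zero    = element u j
  mixedProduct u j (suc m) = element u j ⋎ mixedProduct u (j ℤ.+ + 1) m

  firstHit : (j : ℤ) (k : ℕ) → k ℕ.< d → ℕ
  firstHit j k k<d = least (λ m → d ℕ.∣? ℤ.∣ partialSum σ j m ℤ.- + k ∣) (proj₁ (hits adm j k k<d))

  𝓕 : Point d n → ℤ → Flag d
  𝓕 u j zero    = one
  𝓕 u j (suc k) with suc k ℕ.<? d
  ... | yes k<d = proj₂ (mixedProduct u j (firstHit j (suc k) k<d))
  ... | no  _   = vol

  -- F_{j,k}; for k = d it is F_{j+1}.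
  intermediate : Point d n → ℤ → ℕ → Flag d
  intermediate u j k i with sign σ j
  ... | Sign.+ = if does (k ℕ.≤? i)     then 𝓕 u j i else 𝓕 u (j ℤ.+ + 1) i
  ... | Sign.- = if does (i ℕ.≤? d ∸ k) then 𝓕 u j i else 𝓕 u (j ℤ.+ + 1) i

  -- The k-th letter of ρ_j.
  letter : ℤ → ℕ → ℕ
  letter j k with sign σ j
  ... | Sign.+ = k
  ... | Sign.- = d ∸ k

  -- The pair (i , k) is the position of the k-th letter of the factor ρ_{p+i} of β(p,p+l).
  positions : (l : ℕ) → List (ℕ × ℕ)
  positions l = cartesianProduct (upTo l) (map suc (upTo (d ∸ 1)))

  topLetter : ℤ → ℕ × ℕ → ℕ
  topLetter p (i , k) = letter (p ℤ.+ + i) k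

  -- β(p,p+l)
  topWord : (p : ℤ) (l : ℕ) → Word
  topWord p l = map (topLetter p) (positions l)

  -- The marked letters are the last letters of the factors: the cycle number i < l comes from
  -- the last letter of ρ_{p+i}.
  topWeights : (p : ℤ) (l : ℕ) → Weights (topWord p l)
  topWeights p l = map⁺ {f = topLetter p} (universal
    (λ (i , k) γ → if (k ℕ.≡ᵇ d ∸ 1) ∧ᵇ (γ ℕ.≡ᵇ i) then 1 else 0) (positions l))

  topRegions : Point d n → (p : ℤ) (l : ℕ) → Regions d (topWord p l)
  topRegions u p l = map⁺ {f = topLetter p} (universal
    (λ (i , k) → intermediate u (p ℤ.+ + i) (suc k)) (positions l))

  module _ (p : ℤ) (l : ℕ) {β′ : Word} (w : Weave (topWord p l) β′) where

    #cycles : ℕ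
    #cycles = l ℕ.+ trivalents w

    arrows : Fin #cycles → Fin #cycles → ℚ
    arrows γ γ′ = pairing w l (topWeights p l) (toℕ γ) (toℕ γ′)

    isFrozen : Fin #cycles → Bool
    isFrozen γ = (toℕ γ ℕ.<ᵇ l) ∨ isNonzeroOn (bottomWeights w l (topWeights p l)) (toℕ γ)

    -- "Generic" means: outside the zero set of some nonzero regular function h.
    AreWeaveVariables : (Fin #cycles → K d σ) → Set
    AreWeaveVariables Δ = ∃ λ (h : Polynomial d n) → Nonvanishing h ×
      (∀ u → eval h u ≠0 → ∃ λ (c : Fin #cycles → ℂ) →
        (∀ γ → HasValue (Δ γ) u (c γ) × c γ ≠0)
        × Decoration c w l (topWeights p l) (intermediate u p 1) (topRegions u p l))

-- Seeds in K_σ.  arrow i j is the number of arrows from i to j minus the number of arrows from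
-- j to i; it is rational because arrows between frozen vertices of a weave can be half-integral.

record Seed (d : ℕ) {n : ℕ} (σ : Signature n) (N : ℕ) : Set where
  field
    arrow           : Fin N → Fin N → ℚ
    frozen          : Fin N → Bool
    extendedCluster : Fin N → K d σ
open Seed public

weaveSeed : ∀ {d n} {σ : Signature n} (adm : Admissible d σ) p l {β′} (w : Weave (topWord adm p l) β′) →
            (Fin (#cycles adm p l w) → K d σ) → Seed d σ (#cycles adm p l w)
weaveSeed adm p l w Δ = record
  { arrow           = arrows adm p l w
  ; frozen          = isFrozen adm p l w
  ; extendedCluster = Δ
  }

open RawMonoidDefs ℚ.+-0-rawMonoid public using () renaming (sum to sumℚ)

pushforward : ∀ {M N} → (Fin M → Fin N) → (Fin M → Fin M → ℚ) → Fin N → Fin N → ℚ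
pushforward ι b i j = sumℚ λ γ → sumℚ λ γ′ →
  if does ((ι γ Fin.≟ i) ×-dec (ι γ′ Fin.≟ j)) then b γ γ′ else 0ℚ

-- The vertices of S are the union of those of S₁ (via ι₁) and of S₂ (via ι₂), where c₁ k and c₂ k
-- are identified and become mutable.
record IsAmalgamation {d n : ℕ} {σ : Signature n} {m N₁ N₂ N : ℕ}
                      (S₁ : Seed d σ N₁) (c₁ : Fin m → Fin N₁)
                      (S₂ : Seed d σ N₂) (c₂ : Fin m → Fin N₂)
                      (S : Seed d σ N) : Set where
  field
    ι₁ : Fin N₁ → Fin N
    ι₂ : Fin N₂ → Fin N
    ι₁-injective : ∀ {γ γ′} → ι₁ γ ≡ ι₁ γ′ → γ ≡ γ′
    ι₂-injective : ∀ {γ γ′} → ι₂ γ ≡ ι₂ γ′ → γ ≡ γ′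
    covering     : ∀ i → (∃ λ γ → ι₁ γ ≡ i) ⊎ (∃ λ γ → ι₂ γ ≡ i)
    identified   : ∀ k → ι₁ (c₁ k) ≡ ι₂ (c₂ k)
    separated    : ∀ {γ₁ γ₂} → ι₁ γ₁ ≡ ι₂ γ₂ → ∃ λ k → γ₁ ≡ c₁ k × γ₂ ≡ c₂ k
    arrow-sum    : ∀ i j → arrow S i j ≡
                   pushforward ι₁ (arrow S₁) i j ℚ.+ pushforward ι₂ (arrow S₂) i j
    unfrozen     : ∀ k → frozen S (ι₁ (c₁ k)) ≡ false
    frozen₁      : ∀ γ → (∀ k → γ ≢ c₁ k) → frozen S (ι₁ γ) ≡ frozen S₁ γ
    frozen₂      : ∀ γ → (∀ k → γ ≢ c₂ k) → frozen S (ι₂ γ) ≡ frozen S₂ γ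
    variable₁    : ∀ γ → extendedCluster S (ι₁ γ) ≈ᴷ extendedCluster S₁ γ
    variable₂    : ∀ γ → extendedCluster S (ι₂ γ) ≈ᴷ extendedCluster S₂ γ

[_]₊ : ℚ → ℚ
[ r ]₊ = r ℚ.⊔ 0ℚ

record IsMutation {d n N : ℕ} {σ : Signature n} (k : Fin N) (S S′ : Seed d σ N) : Set where
  open RawSemiring (fractions d n) using () renaming (_≈_ to _≈ᶠ_; _+_ to _+ᶠ_; _*_ to _*ᶠ_)
  open RawSemiringDefs (fractions d n) using () renaming (product to productᶠ; _^_ to _^ᶠ_)
  field
    mutable        : frozen S k ≡ false
    frozen-same    : ∀ i → frozen S′ i ≡ frozen S i
    arrow-at-k     : ∀ i j → i ≡ k ⊎ j ≡ k → arrow S′ i j ≡ ℚ.- arrow S i j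
    arrow-off-k    : ∀ i j → i ≢ k → j ≢ k → arrow S′ i j ≡
                     arrow S i j ℚ.+ ([ arrow S i k ]₊ ℚ.* [ arrow S k j ]₊
                                      ℚ.- [ arrow S j k ]₊ ℚ.* [ arrow S k i ]₊)
    variable-off-k : ∀ i → i ≢ k → extendedCluster S′ i ≈ᴷ extendedCluster S i
    -- The exponents in the exchange relation: the numbers of arrows i → k and k → i.
    in# out#       : Fin N → ℕ
    in#-arrows     : ∀ i → (+ in# i) ℚ./ 1 ≡ [ arrow S i k ]₊
    out#-arrows    : ∀ i → (+ out# i) ℚ./ 1 ≡ [ arrow S k i ]₊
    -- Makes the division by the old variable in the exchange relation meaningful.
    divisor≠0      : Nonvanishing (function (num (extendedCluster S k)))
    exchange       : fraction (extendedCluster S k) *ᶠ fraction (extendedCluster S′ k) ≈ᶠ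
                     productᶠ (λ i → fraction (extendedCluster S i) ^ᶠ in# i)
                     +ᶠ productᶠ (λ i → fraction (extendedCluster S i) ^ᶠ out# i)

-- The choices defining a seed Σ_σ(p,q), together with this seed.
record InitialSeed (d : ℕ) {n : ℕ} (σ : Signature n) (adm : Admissible d σ) : Set where
  field
    p q        : ℕ
    1≤p        : 1 ℕ.≤ p
    p≤q        : p ℕ.≤ q
    q≤n        : q ℕ.≤ n
    valid-cut  : suc d ℕ.≤ (q ∸ p) ℕ.⊓ (n ∸ (q ∸ p))
    β₁′ β₂′    : Word
    w₁         : Weave (topWord adm (+ p) (q ∸ p)) β₁′
    w₂         : Weave (topWord adm (+ q) (p ℕ.+ n ∸ q)) β₂′
    reduced₁   : ReducedWord d β₁′
    reduced₂   : ReducedWord d β₂′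
    reversed   : β₂′ ≡ reverse β₁′
    Δ₁         : Fin (#cycles adm (+ p) (q ∸ p) w₁) → K d σ
    Δ₂         : Fin (#cycles adm (+ q) (p ℕ.+ n ∸ q) w₂) → K d σ
    variables₁ : AreWeaveVariables adm (+ p) (q ∸ p) w₁ Δ₁
    variables₂ : AreWeaveVariables adm (+ q) (p ℕ.+ n ∸ q) w₂ Δ₂
    -- The frozen vertices carrying F_p^k ∧ F_q^{d-k}, where k ∈ {1,…,d-1} is suc (toℕ i).
    c₁         : Fin (d ∸ 1) → Fin (#cycles adm (+ p) (q ∸ p) w₁)
    c₂         : Fin (d ∸ 1) → Fin (#cycles adm (+ q) (p ℕ.+ n ∸ q) w₂)
    frozen₁    : ∀ i → isFrozen adm (+ p) (q ∸ p) w₁ (c₁ i) ≡ true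
    frozen₂    : ∀ i → isFrozen adm (+ q) (p ℕ.+ n ∸ q) w₂ (c₂ i) ≡ true
  z₀ : Fin (d ∸ 1) → Point d n → ℂ
  z₀ i u = det (𝓕 adm u (+ p) (suc (toℕ i)) ∧ 𝓕 adm u (+ q) (d ∸ suc (toℕ i)))
  field
    carries₁   : ∀ i u → eval (function (num (Δ₁ (c₁ i)))) u ≈ z₀ i u * eval (function (den (Δ₁ (c₁ i)))) u
    carries₂   : ∀ i u → eval (function (num (Δ₂ (c₂ i)))) u ≈ z₀ i u * eval (function (den (Δ₂ (c₂ i)))) u
    rank       : ℕ
    seed       : Seed d σ rank
    amalgam    : IsAmalgamation (weaveSeed adm (+ p) (q ∸ p) w₁ Δ₁) c₁ (weaveSeed adm (+ q) (p ℕ.+ n ∸ q) w₂ Δ₂) c₂ seed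

IsVariable : ∀ {d n} {σ : Signature n} {adm : Admissible d σ} → InitialSeed d σ adm → K d σ → Set
IsVariable {d} {σ = σ} A x =
  ∃ λ (S : Seed d σ (InitialSeed.rank A)) →
    Star (λ S S′ → ∃ λ k → IsMutation k S S′) (InitialSeed.seed A) S
    × ∃ λ i → x ≈ᴷ extendedCluster S i

{-# OPTIONS --safe #-}
-- The flags F_j are multihomogeneous, and decorations are unique, so every weave variable is multihomogeneous.
-- Along a weave the degrees of the variables telescope: sum_c <c,c'> deg c is the flux of c' through the top minus that through
-- the bottom.  It vanishes for mutable c'.  At the cut only the cycle carrying F_p^k ^ F_q^(d-k) separates the strands k and k+1
-- (the weave variables are independent: a tangent vector killing all relations vanishes), so the two bottom fluxes cancel.
-- Hence both monomials of each exchange relation have the same degree, a property preserved by mutation.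
module Submission where
open import Algebra.Bundles using(CommutativeRing;Semiring;CommutativeSemiring)
open import Algebra.Bundles.Raw using(RawSemiring)
import Algebra.Definitions.RawSemiring as RawSemiringDefs
import Algebra.Properties.AbelianGroup as AbelianGroupProperties
import Algebra.Properties.CommutativeMonoid.Sum as CommutativeMonoidSum
import Algebra.Properties.CommutativeSemiring.Exp as CommutativeSemiringExp
import Algebra.Properties.Ring as RingProperties
import Algebra.Properties.Semiring.Exp as SemiringExp
import Algebra.Properties.Semiring.Mult as SemiringMult
import Algebra.Properties.Semiring.Sum as SemiringSum
import Algebra.Solver.Ring as RingSolver
open import Algebra.Solver.Ring.AlmostCommutativeRing using(fromCommutativeRing;_-Raw-AlmostCommutative⟶_)
open import Algebra.Structures using(IsCommutativeRing)
open import Data.Bool.Base using(true;false;if_then_else_;Bool;_∧_;_∨_)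
open import Data.Bool.Properties as Bool using(∧-zeroʳ)
open import Data.Empty using(⊥-elim)
open import Data.Fin.Base as Fin using(Fin;toℕ;punchIn;fromℕ<;remQuot;_↑ˡ_;_↑ʳ_;splitAt)
import Data.Fin.Properties as O
open import Data.Fin.Subset using(Subset;inside;outside;⁅_⁆;_─_;∁;_∪_)renaming(∣_∣ to card;⊤ to full;⊥ to empty)
open import Data.Fin.Subset.Properties using(_⊆?_;∣p∣≡n⇒p≡⊤)
open import Data.Integer.Base as I using(ℤ;+_;-[1+_];_◃_;_⊖_)
import Data.Integer.DivMod as I
import Data.Integer.Properties as I
open import Data.List.Base using([];_∷_;List;_++_;length;map;upTo;applyUpTo;cartesianProduct;reverse)
import Data.List.Properties as List
open import Data.List.Relation.Unary.All as All using([];_∷_;All;universal)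
open import Data.List.Relation.Unary.All.Properties as All using(++⁺)
open import Data.Maybe.Base using(Maybe;just;nothing)
open import Data.Nat.Base as N using(ℕ;zero;suc;_∸_;_⊔_;_⊓_;s≤s;z≤n)
import Data.Nat.DivMod as N
import Data.Nat.Divisibility as N
import Data.Nat.Properties as N
open import Data.Product.Base using(∃;_,_;proj₁;proj₂;_×_;map₂)
open import Data.Rational.Base as Q using(ℚ;0ℚ;1ℚ;½)
import Data.Rational.Properties as Q
import Data.Rational.Unnormalised.Base as ℚᵘ
import Data.Rational.Unnormalised.Properties as ℚᵘ
open import Data.Sign.Base as Sign using(Sign)
open import Data.Sum.Base as Sum using(inj₁;inj₂;_⊎_)
open import Data.Unit.Base using(⊤;tt)
open import Data.Vec.Base using([];_∷_)
open import Defs as Defs using(module CauchyClosure;Cauchy;ℝ;mkℝ;seq;cauchy;_≈ℝ_;_+ℝ_;_*ℝ_;-ℝ_;fromℚ;_+i_;[];_∷_;Word;Move;trivalent;4-valent;6-valent;skip;Weave;Weights;moveWeights;bottomWeights;moveTrivalents;trivalentOut;trivalents;transposition;permutation;ReducedWord;Signature;Admissible;letter;positions;topLetter;topWord;module SixValent;movePairing;pairing;sumℚ;topWeights;ℂ;Point;Polynomial;const;var;eval;Nonvanishing;Λ;sumSubsets;inversions;sgn;vol;vector;IsDecoratedFlag;RelativePosition;CrossingValue;NewFlags;moveRegions;SliceDecoration;Decoration;basis;covector;cap;_⋎_;periodic;size;hits;partialSum;component;element;mixedProduct;firstHit;𝓕;intermediate;ℂˣ;_^ᶻ_;isInverse;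rescale;Flag;AreWeaveVariables;K;HasValue;function;HomogeneousOfDegree;isNonzeroOn;arrows;isFrozen;InitialSeed;numerator;denominator;fractions;den≠0;fraction;_≈ᴷ_;Seed;arrow;frozen;extendedCluster;IsMutation;[_]₊;IsVariable;MultiHomogeneous;IsAmalgamation;pushforward)
open import Function.Base using(_∘_;id)
open import Level using(0ℓ)
open import Relation.Binary.Construct.Closure.ReflexiveTransitive using(Star;_◅_)
open import Relation.Binary.Definitions using(tri<;tri≈;tri>)
open import Relation.Binary.PropositionalEquality.Core as P using(_≡_;_≢_)
open import Relation.Binary.PropositionalEquality.Properties using(module ≡-Reasoning)
import Relation.Binary.Reasoning.Setoid as SetoidReasoning
open import Relation.Nullary using(yes;no;¬_;Dec;does;_×-dec_)
open import Relation.Nullary.Decidable using(dec-true;dec-false;decidable-stable)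
open import Relation.Nullary.Negation using(¬¬-map)
import Data.Nat.Solver
open import Algebra.Properties.Group Q.+-0-group using()renaming(⁻¹-involutive to neg-involutive-ℚ)
module IS where
 module In(R : CommutativeRing 0ℓ 0ℓ)where
  open CommutativeRing R
  open RingProperties ring
  open AbelianGroupProperties +-abelianGroup using(⁻¹-∙-comm)
  open SemiringMult semiring renaming(_×_ to _•_)using(×-homo-+;×1-homo-*)
  open SetoidReasoning setoid
  ⟦_ah : ℤ → Carrier
  ⟦ + n ah = n • 1#
  ⟦ -[1+ n ] ah = -(suc n • 1#)
  hf : ∀ m n → ⟦ m I.⊖ n ah ≈ m • 1# + -(n • 1#)
  hf m zero = trans(sym(+-identityʳ _))(sym(+-congˡ -0#≈0#))
  hf zero(suc n)= sym(+-identityˡ _)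
  hf(suc m)(suc n)= trans(reflexive(P.cong ⟦_ah(I.[1+m]⊖[1+n]≡m⊖n m n)))(trans(hf m n)(trans(sym(+-congʳ(+-identityˡ _)))(trans(sym(+-congʳ(+-congʳ
   (-‿inverseʳ 1#))))(trans(+-congʳ(+-assoc _ _ _))(trans(+-congʳ(+-congˡ(+-comm _ _)))(trans(sym(+-congʳ(+-assoc _ _ _)))(trans(+-assoc _ _
   _)(+-congˡ(⁻¹-∙-comm 1# _)))))))))
  nh : ∀ i → ⟦ I.- i ah ≈ - ⟦ i ah
  nh(+ zero)= sym -0#≈0#
  nh(+ suc n)= refl
  nh -[1+ n ] = sym(-‿involutive _)
  +-homo : ∀ i j → ⟦ i I.+ j ah ≈ ⟦ i ah + ⟦ j ah
  +-homo(+ m)(+ n)= ×-homo-+ 1# m n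
  +-homo(+ m)-[1+ n ] = hf m(suc n)
  +-homo -[1+ m ](+ n)= trans(hf n(suc m))(+-comm _ _)
  +-homo -[1+ m ] -[1+ n ] = trans(sym(reflexive(P.cong(λ k → -(suc k • 1#))(N.+-suc m n))))(trans(-‿cong(×-homo-+ 1#(suc m)(suc n)))(sym(⁻¹-∙-comm _ _)))
  hh : ∀ m n → ⟦ + m I.* + n ah ≈ ⟦ + m ah * ⟦ + n ah
  hh m n = trans(sym(reflexive(P.cong ⟦_ah(I.pos-* m n))))(×1-homo-* m n)
  *-homo : ∀ i j → ⟦ i I.* j ah ≈ ⟦ i ah * ⟦ j ah
  *-homo(+ m)(+ n)= hh m n
  *-homo(+ m)-[1+ n ] = trans(sym(reflexive(P.cong ⟦_ah(I.neg-distribʳ-*(+ m)(+ suc n)))))(trans(nh(+ m I.* + suc n))(trans(-‿cong(hh m(suc n)))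
   (-‿distribʳ-* _ _)))
  *-homo -[1+ m ](+ n)= trans(sym(reflexive(P.cong ⟦_ah(I.neg-distribˡ-*(+ suc m)(+ n)))))(trans(nh(+ suc m I.* + n))(trans(-‿cong(hh(suc m)n))
   (-‿distribˡ-* _ _)))
  *-homo -[1+ m ] -[1+ n ] = trans(hh(suc m)(suc n))(trans(sym(-‿involutive _))(trans(-‿cong(-‿distribˡ-* _ _))(-‿distribʳ-* _ _)))
  m4 : I.+-*-rawRing -Raw-AlmostCommutative⟶ fromCommutativeRing R
  m4 = record
   {⟦_⟧ = ⟦_ah
   ;+-homo = +-homo
   ;*-homo = *-homo
   ;-‿homo = nh
   ;0-homo = refl
   ;1-homo = +-identityʳ 1#
   }
  S+ : ∀ i j → Maybe(⟦ i ah ≈ ⟦ j ah)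
  S+ i j with i I.≟ j
  ... | yes P.refl = just refl
  ... | no _ = nothing
  open RingSolver I.+-*-rawRing(fromCommutativeRing R)m4 S+ public
   using(solve;_:=_;_:+_;_:*_;_:-_;:-_;con)
module RN where
 open IS
 open import Defs using(_≈_;_+_;_*_;-_;0#;1#)
 open import Relation.Binary.PropositionalEquality.Core using(refl;sym;trans;cong;cong₂;subst)
 open CauchyClosure
 Nu :(ℕ → ℚ)→ Set
 Nu z = ∀ ε → 0ℚ Q.< ε → ∃ λ N → ∀ n → N N.≤ n → Q.∣ z n ∣ Q.< ε
 nu : ∀ z w →(∀ n → z n ≡ w n)→ Nu z → Nu w
 nu z w eq z0 ε a? = map₂(λ f n Nd → subst(λ r → Q.∣ r ∣ Q.< ε)(eq n)(f n Nd))(z0 ε a?)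
 nY : Nu(λ _ → 0ℚ)
 nY ε a? = 0 , λ _ _ → a?
 nJ : ∀ z → Nu z → Nu(λ n → Q.- z n)
 nJ z z0 ε a? =
  map₂(λ f n Nd → subst(Q._< ε)(sym(Q.∣-p∣≡∣p∣(z n)))(f n Nd))(z0 ε a?)
 nM : ∀ z w → Nu z → Nu w → Nu(λ n → z n Q.+ w n)
 nM z w z0 w0 ε a? = Nz N.⊔ Nw , λ n Nd → begin-strict
  Q.∣ z n Q.+ w n ∣ ≤⟨ Q.∣p+q∣≤∣p∣+∣q∣(z n)(w n)⟩
  Q.∣ z n ∣ Q.+ Q.∣ w n ∣ <⟨ Q.+-mono-<
   (proj₂(z0 _(0<½ε ε a?))n(N.m⊔n≤o⇒m≤o Nz Nw Nd))
   (proj₂(w0 _(0<½ε ε a?))n(N.m⊔n≤o⇒n≤o Nz Nw Nd))⟩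
  ½ Q.* ε Q.+ ½ Q.* ε ≡⟨ half+half ε ⟩
  ε ∎
  where
  open Q.≤-Reasoning
  Nz = proj₁(z0 _(0<½ε ε a?))
  Nw = proj₁(w0 _(0<½ε ε a?))
 nv : ∀(b z : ℕ → ℚ)→(∃ λ N → ∃ λ B → Q.Positive B ×(∀ m → N N.≤ m → Q.∣ b m ∣ Q.≤ B))→ Nu z → Nu(λ n → b n Q.* z n)
 nv b z(M , B , Bx , Bs)z0 ε a? = M N.⊔ N , λ n Nd → begin-strict
  Q.∣ b n Q.* z n ∣ ≡⟨ Q.∣p*q∣≡∣p∣*∣q∣(b n)(z n)⟩
  Q.∣ b n ∣ Q.* Q.∣ z n ∣ ≤⟨ Q.*-monoʳ-≤-nonNeg Q.∣ z n ∣{{Q.∣-∣-nonNeg(z n)}}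
   (Bs n(N.m⊔n≤o⇒m≤o M N Nd))⟩
  B Q.* Q.∣ z n ∣ <⟨ Q.*-monoʳ-<-pos B(proj₂(z0 bQ 0<ε′)n(N.m⊔n≤o⇒n≤o M N Nd))⟩
  B Q.*(Q.1/ B Q.* ε)≡⟨ Q.*-assoc B(Q.1/ B)ε ⟨
  B Q.* Q.1/ B Q.* ε ≡⟨ cong(Q._* ε)(Q.*-inverseʳ B)⟩
  1ℚ Q.* ε ≡⟨ Q.*-identityˡ ε ⟩
  ε ∎
  where
  open Q.≤-Reasoning
  instance
   _ = Bx
   _ = Q.positive a?
   B0 = Q.pos⇒nonZero B
   BB = Q.1/pos⇒pos B
  bQ = Q.1/ B Q.* ε
  0<ε′ : 0ℚ Q.< bQ
  0<ε′ = Q.positive⁻¹ bQ{{Q.pos*pos⇒pos(Q.1/ B)ε}}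
  N = proj₁(z0 bQ 0<ε′)
 nS : ∀ b z → Cauchy b → Nu z → Nu(λ n → b n Q.* z n)
 nS b z cb = nv b z(bounded b cb)
 AH :(ℕ → ℚ)→ Set
 AH z = ∃ λ ε → 0ℚ Q.< ε × ∃ λ N → ∀ n → N N.≤ n → ε Q.< Q.∣ z n ∣
 a^ : ∀{z}→ AH z → ¬ Nu z
 a^(ε , a? , N , fv)z0 with z0 ε a?
 ... | M , nd = Q.<-asym(fv(N N.⊔ M)(N.m≤m⊔n N M))(nd(N N.⊔ M)(N.m≤n⊔m N M))
 aY : ∀{z}→ Cauchy z → ¬ AH z → Nu z
 aY{z}cz nK = n8
  where
  open Q.≤-Reasoning
  n8 : Nu z
  n8 ε a? with cz(½ Q.*(½ Q.* ε))(0<½ε _(0<½ε ε a?))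
  ... | N , CW with Q.∣ z N ∣ Q.<? ½ Q.* ε
  ... | no zu = ⊥-elim(nK(ρ , b1 , N , fv))
   where
   ρ = ½ Q.*(½ Q.* ε)
   b1 = 0<½ε _(0<½ε ε a?)
   fv : ∀ n → N N.≤ n → ρ Q.< Q.∣ z n ∣
   fv n Nd = Q.≰⇒> λ zz → Q.<-irrefl{x = ½ Q.* ε}refl(begin-strict
    ½ Q.* ε ≤⟨ Q.≮⇒≥ zu ⟩
    Q.∣ z N ∣ ≡⟨ cong Q.∣_∣(a≡b+[a-b](z N)(z n))⟩
    Q.∣ z n Q.+(z N Q.- z n)∣ ≤⟨ Q.∣p+q∣≤∣p∣+∣q∣(z n)_ ⟩
    Q.∣ z n ∣ Q.+ Q.∣ z N Q.- z n ∣ <⟨ Q.+-mono-≤-< zz(CW N n N.≤-refl Nd)⟩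
    ρ Q.+ ρ ≡⟨ half+half(½ Q.* ε)⟩
    ½ Q.* ε ∎)
  ... | yes zA = N , λ n Nd → begin-strict
   Q.∣ z n ∣ ≡⟨ cong Q.∣_∣(a≡b+[a-b](z n)(z N))⟩
   Q.∣ z N Q.+(z n Q.- z N)∣ ≤⟨ Q.∣p+q∣≤∣p∣+∣q∣(z N)_ ⟩
   Q.∣ z N ∣ Q.+ Q.∣ z n Q.- z N ∣ <⟨ Q.+-mono-< zA(Q.<-trans(CW n N Nd N.≤-refl)e8)⟩
   ½ Q.* ε Q.+ ½ Q.* ε ≡⟨ half+half ε ⟩
   ε ∎
   where
   ρ = ½ Q.*(½ Q.* ε)
   e8 : ρ Q.< ½ Q.* ε
   e8 = subst(ρ Q.<_)(half+half(½ Q.* ε))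
    (subst(Q._< ρ Q.+ ρ)(Q.+-identityʳ ρ)(Q.+-monoʳ-< ρ(0<½ε _(0<½ε ε a?))))
 r9 : ℚ → ℚ
 r9 r with r Q.≟ 0ℚ
 ... | yes _ = 0ℚ
 ... | no Ru = Q.1/_ r{{Q.≢-nonZero Ru}}
 r' : ∀{r}→ 0ℚ Q.< Q.∣ r ∣ → r Q.* r9 r ≡ 1ℚ
 r'{r}Rt with r Q.≟ 0ℚ
 ... | yes refl = ⊥-elim(Q.<-irrefl refl Rt)
 ... | no Ru = Q.*-inverseʳ r{{Q.≢-nonZero Ru}}
 module Rr{z : ℕ → ℚ}(cz : Cauchy z){ρ}(b1 : 0ℚ Q.< ρ){Nf}(fv : ∀ n → Nf N.≤ n → ρ Q.< Q.∣ z n ∣)where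
  open Q.≤-Reasoning
  instance
   _ = Q.positive b1
   g4 = Q.pos⇒nonZero ρ
  w : ℕ → ℚ
  w n = r9(z n)
  wr : ∀ n → Nf N.≤ n → z n Q.* w n ≡ 1ℚ
  wr n Nn = r'(Q.<-trans b1(fv n Nn))
  wB : ∀ n → Nf N.≤ n → ρ Q.* Q.∣ w n ∣ Q.≤ 1ℚ
  wB n Nn = begin
   ρ Q.* Q.∣ w n ∣ ≤⟨ Q.*-monoʳ-≤-nonNeg Q.∣ w n ∣{{Q.∣-∣-nonNeg(w n)}}(Q.<⇒≤(fv n Nn))⟩
   Q.∣ z n ∣ Q.* Q.∣ w n ∣ ≡⟨ Q.∣p*q∣≡∣p∣*∣q∣(z n)(w n)⟨
   Q.∣ z n Q.* w n ∣ ≡⟨ cong Q.∣_∣(wr n Nn)⟩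
   1ℚ ∎
  w1 : ∀ n → Nf N.≤ n → Q.∣ w n ∣ Q.≤ Q.1/ ρ
  w1 n Nn = Q.*-cancelˡ-≤-pos ρ(begin
   ρ Q.* Q.∣ w n ∣ ≤⟨ wB n Nn ⟩
   1ℚ ≡⟨ Q.*-inverseʳ ρ ⟨
   ρ Q.* Q.1/ ρ ∎)
  dn : ∀ m n → Nf N.≤ m → Nf N.≤ n → w m Q.- w n ≡ w m Q.*(w n Q.*(z n Q.- z m))
  dn m n Nm Nn = sym(begin-equality
   w m Q.*(w n Q.*(z n Q.- z m))≡⟨ cong(w m Q.*_)(*-minusˡ(w n)(z n)(z m))⟨
   w m Q.*(w n Q.* z n Q.- w n Q.* z m)≡⟨ *-minusˡ(w m)(w n Q.* z n)(w n Q.* z m)⟨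
   w m Q.*(w n Q.* z n)Q.- w m Q.*(w n Q.* z m)≡⟨ cong₂ Q._-_
    (trans(cong(w m Q.*_)(trans(Q.*-comm(w n)(z n))(wr n Nn)))(Q.*-identityʳ(w m)))
    (trans(cong(w m Q.*_)(Q.*-comm(w n)(z m)))(trans(sym(Q.*-assoc(w m)(z m)(w n)))
     (trans(cong(Q._* w n)(trans(Q.*-comm(w m)(z m))(wr m Nm)))(Q.*-identityˡ(w n)))))⟩
   w m Q.- w n ∎)
  wO : Cauchy w
  wO ε a? = Nf N.⊔ N , bound
   where
   bQ = ρ Q.*(ρ Q.* ε)
   0<ε′ : 0ℚ Q.< bQ
   0<ε′ = Q.positive⁻¹ bQ{{Q.pos*pos⇒pos ρ(ρ Q.* ε){{Q.pos*pos⇒pos ρ ε{{Q.positive a?}}}}}}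
   N = proj₁(cz bQ 0<ε′)
   instance
    g5 = Q.1/pos⇒pos ρ
    f$ = Q.pos⇒nonNeg(Q.1/ ρ)
   bound : ∀ m n → Nf N.⊔ N N.≤ m → Nf N.⊔ N N.≤ n → Q.∣ w m Q.- w n ∣ Q.< ε
   bound m n Nh Nd = begin-strict
    Q.∣ w m Q.- w n ∣ ≡⟨ cong Q.∣_∣(dn m n Nm Nn)⟩
    Q.∣ w m Q.*(w n Q.*(z n Q.- z m))∣ ≡⟨ trans(Q.∣p*q∣≡∣p∣*∣q∣(w m)_)
     (cong(Q.∣ w m ∣ Q.*_)(Q.∣p*q∣≡∣p∣*∣q∣(w n)_))⟩
    Q.∣ w m ∣ Q.*(Q.∣ w n ∣ Q.* Q.∣ z n Q.- z m ∣)≤⟨ Q.*-monoʳ-≤-nonNeg _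
     {{Q.nonNeg*nonNeg⇒nonNeg Q.∣ w n ∣{{Q.∣-∣-nonNeg(w n)}}Q.∣ z n Q.- z m ∣{{Q.∣-∣-nonNeg(z n Q.- z m)}}}}
     (w1 m Nm)⟩
    Q.1/ ρ Q.*(Q.∣ w n ∣ Q.* Q.∣ z n Q.- z m ∣)≤⟨ Q.*-monoˡ-≤-nonNeg(Q.1/ ρ)
     (Q.*-monoʳ-≤-nonNeg Q.∣ z n Q.- z m ∣{{Q.∣-∣-nonNeg(z n Q.- z m)}}(w1 n Nn))⟩
    Q.1/ ρ Q.*(Q.1/ ρ Q.* Q.∣ z n Q.- z m ∣)<⟨ Q.*-monoʳ-<-pos(Q.1/ ρ)
     (Q.*-monoʳ-<-pos(Q.1/ ρ)(proj₂(cz bQ 0<ε′)n m(N.m⊔n≤o⇒n≤o Nf N Nd)(N.m⊔n≤o⇒n≤o Nf N Nh)))⟩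
    Q.1/ ρ Q.*(Q.1/ ρ Q.* bQ)≡⟨ cong(Q.1/ ρ Q.*_)(cancel(ρ Q.* ε))⟩
    Q.1/ ρ Q.*(ρ Q.* ε)≡⟨ cancel ε ⟩
    ε ∎
    where
    Nm = N.m⊔n≤o⇒m≤o Nf N Nh
    Nn = N.m⊔n≤o⇒m≤o Nf N Nd
    cancel : ∀ r → Q.1/ ρ Q.*(ρ Q.* r)≡ r
    cancel r = trans(sym(Q.*-assoc(Q.1/ ρ)ρ r))(trans(cong(Q._* r)(Q.*-inverseˡ ρ))(Q.*-identityˡ r))
 SM : ∀ r → 0ℚ Q.≤ r Q.* r
 SM r with Q.≤-total 0ℚ r
 ... | inj₁ Ri = subst(Q._≤ r Q.* r)(Q.*-zeroʳ r)(Q.*-monoˡ-≤-nonNeg r{{Q.nonNegative Ri}}Ri)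
 ... | inj₂ Rj = subst(Q._≤ r Q.* r)(Q.*-zeroʳ r)(Q.*-monoˡ-≤-nonPos r{{Q.nonPositive Rj}}Rj)
 p? : ∀ p → p Q.≤ Q.∣ p ∣
 p? p with Q.≤-total 0ℚ p
 ... | inj₁ PA = Q.≤-reflexive(sym(Q.0≤p⇒∣p∣≡p PA))
 ... | inj₂ PB = Q.≤-trans PB(Q.0≤∣p∣ p)
 fr : ∀ ρ x y → 0ℚ Q.< ρ → ρ Q.< Q.∣ x ∣ → ρ Q.* ρ Q.< Q.∣ x Q.* x Q.+ y Q.* y ∣
 fr ρ x y b1 xn = begin-strict
  ρ Q.* ρ <⟨ Q.*-monoʳ-<-pos ρ{{Q.positive b1}}xn ⟩
  ρ Q.* Q.∣ x ∣ ≤⟨ Q.*-monoʳ-≤-nonNeg Q.∣ x ∣{{Q.∣-∣-nonNeg x}}(Q.<⇒≤ xn)⟩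
  Q.∣ x ∣ Q.* Q.∣ x ∣ ≡⟨ Q.∣p*q∣≡∣p∣*∣q∣ x x ⟨
  Q.∣ x Q.* x ∣ ≡⟨ Q.0≤p⇒∣p∣≡p(SM x)⟩
  x Q.* x ≡⟨ Q.+-identityʳ(x Q.* x)⟨
  x Q.* x Q.+ 0ℚ ≤⟨ Q.+-monoʳ-≤(x Q.* x)(SM y)⟩
  x Q.* x Q.+ y Q.* y ≤⟨ p?(x Q.* x Q.+ y Q.* y)⟩
  Q.∣ x Q.* x Q.+ y Q.* y ∣ ∎
  where open Q.≤-Reasoning
 opaque
  unfolding _≈ℝ_
  pi : ∀ x y →(∀ n → seq x n ≡ seq y n)→ x ≈ℝ y
  pi x y eq = nu(λ _ → 0ℚ)(λ n → seq x n Q.- seq y n)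
   (λ n → sym(trans(cong(Q._- seq y n)(eq n))(Q.+-inverseʳ(seq y n))))nY
  ry : ∀{x}→ x ≈ℝ x
  ry{x}= pi x x λ _ → refl
  S' : ∀{x y}→ x ≈ℝ y → y ≈ℝ x
  S'{x}{y}xl = nu(λ n → Q.-(seq x n Q.- seq y n))(λ n → seq y n Q.- seq x n)
   (λ n → trans(Q.neg-distrib-+(seq x n)(Q.- seq y n))
   (trans(cong(Q.- seq x n Q.+_)(neg-involutive-ℚ(seq y n)))(Q.+-comm(Q.- seq x n)(seq y n))))
   (nJ(λ n → seq x n Q.- seq y n)xl)
  tn : ∀{x y z}→ x ≈ℝ y → y ≈ℝ z → x ≈ℝ z
  tn{x}{y}{z}xl yz = nu _(λ n → seq x n Q.- seq z n)
   (λ n → sym(telescope(seq x n)(seq y n)(seq z n)))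
   (nM(λ n → seq x n Q.- seq y n)(λ n → seq y n Q.- seq z n)xl yz)
  cq : ∀{x xa y ya}→ x ≈ℝ xa → y ≈ℝ ya → x +ℝ y ≈ℝ xa +ℝ ya
  cq{x}{xa}{y}{ya}p q =
   nu _(λ n →(seq x n Q.+ seq y n)Q.-(seq xa n Q.+ seq ya n))
    (λ n → sym(+-minus(seq x n)(seq y n)(seq xa n)(seq ya n)))
    (nM(λ n → seq x n Q.- seq xa n)(λ n → seq y n Q.- seq ya n)p q)
  cM : ∀{x xa y ya}→ x ≈ℝ xa → y ≈ℝ ya → x *ℝ y ≈ℝ xa *ℝ ya
  cM{x}{xa}{y}{ya}p q =
   nu _(λ n →(seq x n Q.* seq y n)Q.-(seq xa n Q.* seq ya n))
    (λ n → sym(*-minus(seq x n)(seq y n)(seq xa n)(seq ya n)))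
    (nM(λ n → seq x n Q.*(seq y n Q.- seq ya n))(λ n → seq ya n Q.*(seq x n Q.- seq xa n))
     (nS(seq x)(λ n → seq y n Q.- seq ya n)(cauchy x)q)
     (nS(seq ya)(λ n → seq x n Q.- seq xa n)(cauchy ya)p))
  nc : ∀{x xa}→ x ≈ℝ xa → -ℝ x ≈ℝ -ℝ xa
  nc{x}{xa}p = nu _(λ n →(Q.- seq x n)Q.-(Q.- seq xa n))
   (λ n → Q.neg-distrib-+(seq x n)(Q.- seq xa n))(nJ(λ n → seq x n Q.- seq xa n)p)
  a% : ∀ x y z →(x +ℝ y)+ℝ z ≈ℝ x +ℝ(y +ℝ z)
  a% x y z = pi((x +ℝ y)+ℝ z)(x +ℝ(y +ℝ z))λ n → Q.+-assoc(seq x n)(seq y n)(seq z n)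
  cC : ∀ x y → x +ℝ y ≈ℝ y +ℝ x
  cC x y = pi(x +ℝ y)(y +ℝ x)λ n → Q.+-comm(seq x n)(seq y n)
  ih : ∀ x → fromℚ 0ℚ +ℝ x ≈ℝ x
  ih x = pi(fromℚ 0ℚ +ℝ x)x λ n → Q.+-identityˡ(seq x n)
  iu : ∀ x → -ℝ x +ℝ x ≈ℝ fromℚ 0ℚ
  iu x = pi(-ℝ x +ℝ x)(fromℚ 0ℚ)λ n → Q.+-inverseˡ(seq x n)
  Au : ∀ x y z →(x *ℝ y)*ℝ z ≈ℝ x *ℝ(y *ℝ z)
  Au x y z = pi((x *ℝ y)*ℝ z)(x *ℝ(y *ℝ z))λ n → Q.*-assoc(seq x n)(seq y n)(seq z n)
  cw : ∀ x y → x *ℝ y ≈ℝ y *ℝ x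
  cw x y = pi(x *ℝ y)(y *ℝ x)λ n → Q.*-comm(seq x n)(seq y n)
  ij : ∀ x → fromℚ 1ℚ *ℝ x ≈ℝ x
  ij x = pi(fromℚ 1ℚ *ℝ x)x λ n → Q.*-identityˡ(seq x n)
  dH : ∀ x y z → x *ℝ(y +ℝ z)≈ℝ x *ℝ y +ℝ x *ℝ z
  dH x y z = pi(x *ℝ(y +ℝ z))(x *ℝ y +ℝ x *ℝ z)
   λ n → Q.*-distribˡ-+(seq x n)(seq y n)(seq z n)
  mT : ∀{x}→ Nu(seq x)→ x ≈ℝ fromℚ 0ℚ
  mT{x}= nu(seq x)(λ n → seq x n Q.- 0ℚ)(λ n → sym(Q.+-identityʳ(seq x n)))
  iP : ∀ x → ¬(x ≈ℝ fromℚ 0ℚ)→ ¬ ¬(∃ λ y → x *ℝ y ≈ℝ fromℚ 1ℚ)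
  iP x xM = ¬¬-map rZ λ nK → xM(mT{x}(aY(cauchy x)nK))
   where
   rZ : AH(seq x)→ ∃ λ y → x *ℝ y ≈ℝ fromℚ 1ℚ
   rZ(ρ , b1 , N , fv)= mkℝ w wO , λ ε a? → N , λ n Nd →
    subst(Q._< ε)(sym(cong Q.∣_∣(trans(cong(Q._- 1ℚ)(wr n Nd))(Q.+-inverseʳ 1ℚ))))a?
    where open Rr(cauchy x)b1 fv
  sN : ∀ x y → x *ℝ x +ℝ y *ℝ y ≈ℝ fromℚ 0ℚ → x ≈ℝ fromℚ 0ℚ
  sN x y x0 = mT{x}(aY(cauchy x)λ(ρ , b1 , N , fv)→
   a^(ρ Q.* ρ , Q.positive⁻¹ _{{Q.pos*pos⇒pos ρ{{Q.positive b1}}ρ{{Q.positive b1}}}}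
    , N , λ n Nd → fr ρ(seq x n)(seq y n)b1(fv n Nd))
    (nu(λ n → seq x n Q.* seq x n Q.+ seq y n Q.* seq y n Q.- 0ℚ)_
     (λ n → Q.+-identityʳ(seq x n Q.* seq x n Q.+ seq y n Q.* seq y n))x0))
  SN : ∀ x y → ¬ ¬(x ≈ℝ y)→ x ≈ℝ y
  SN x y xA = aY(cauchy(x +ℝ -ℝ y))λ AA → xA(a^ AA)
 r0 : CommutativeRing 0ℓ 0ℓ
 r0 = record
  {Carrier = ℝ
  ;_≈_ = _≈ℝ_
  ;_+_ = _+ℝ_
  ;_*_ = _*ℝ_
  ;-_ = -ℝ_
  ;0# = fromℚ 0ℚ
  ;1# = fromℚ 1ℚ
  ;isCommutativeRing = record
   {isRing = record
    {+-isAbelianGroup = record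
     {isGroup = record
      {isMonoid = record
       {isSemigroup = record
        {isMagma = record
         {isEquivalence = record{refl = ry ;sym = S' ;trans = tn}
         ;∙-cong = cq}
        ;assoc = a%}
       ;identity = ih , λ x → tn(cC x _)(ih x)}
      ;inverse = iu , λ x → tn(cC x _)(iu x)
      ;⁻¹-cong = nc}
     ;comm = cC}
    ;*-cong = cM
    ;*-assoc = Au
    ;*-identity = ij , λ x → tn(cw x _)(ij x)
    ;distrib = dH , λ x y z → tn(cw _ x)(tn(dH x y z)
     (cq(cw x y)(cw x z)))}
   ;*-comm = cw} }
 module g6 = CommutativeRing r0
module CN where
 open IS
 open RN
 open import Defs using(_≈_;_+_;_*_;-_;0#;1#)
 open import Relation.Binary.PropositionalEquality.Core using(refl;sym;trans)
 open CauchyClosure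
 module Co where
  open CommutativeRing r0 using(zeroˡ)renaming(+-identityʳ to iF;-‿inverseʳ to i4)
  open In r0
  AB : ∀ a b c d e f →(a *ℝ c +ℝ -ℝ(b *ℝ d))*ℝ e +ℝ -ℝ((a *ℝ d +ℝ b *ℝ c)*ℝ f)
   ≈ℝ a *ℝ(c *ℝ e +ℝ -ℝ(d *ℝ f))+ℝ -ℝ(b *ℝ(c *ℝ f +ℝ d *ℝ e))
  AB = solve 6(λ a b c d e f →(a :* c :+ :-(b :* d)):* e :+ :-((a :* d :+ b :* c):* f)
   := a :*(c :* e :+ :-(d :* f)):+ :-(b :*(c :* f :+ d :* e)))ry
  AD : ∀ a b c d e f →(a *ℝ c +ℝ -ℝ(b *ℝ d))*ℝ f +ℝ(a *ℝ d +ℝ b *ℝ c)*ℝ e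
   ≈ℝ a *ℝ(c *ℝ f +ℝ d *ℝ e)+ℝ b *ℝ(c *ℝ e +ℝ -ℝ(d *ℝ f))
  AD = solve 6(λ a b c d e f →(a :* c :+ :-(b :* d)):* f :+(a :* d :+ b :* c):* e
   := a :*(c :* f :+ d :* e):+ b :*(c :* e :+ :-(d :* f)))ry
  d* : ∀ a b c d e f → a *ℝ(c +ℝ e)+ℝ -ℝ(b *ℝ(d +ℝ f))
   ≈ℝ(a *ℝ c +ℝ -ℝ(b *ℝ d))+ℝ(a *ℝ e +ℝ -ℝ(b *ℝ f))
  d* = solve 6(λ a b c d e f → a :*(c :+ e):+ :-(b :*(d :+ f))
   :=(a :* c :+ :-(b :* d)):+(a :* e :+ :-(b :* f)))ry
  d+ : ∀ a b c d e f → a *ℝ(d +ℝ f)+ℝ b *ℝ(c +ℝ e)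
   ≈ℝ(a *ℝ d +ℝ b *ℝ c)+ℝ(a *ℝ f +ℝ b *ℝ e)
  d+ = solve 6(λ a b c d e f → a :*(d :+ f):+ b :*(c :+ e)
   :=(a :* d :+ b :* c):+(a :* f :+ b :* e))ry
  CJ : ∀ a b c d → a *ℝ d +ℝ b *ℝ c ≈ℝ c *ℝ b +ℝ d *ℝ a
  CJ a b c d = tn(cC _ _)(cq(cw b c)(cw a d))
  Bp : ∀ b a → fromℚ 1ℚ *ℝ b +ℝ fromℚ 0ℚ *ℝ a ≈ℝ b
  Bp b a = tn(cq(ij b)(zeroˡ a))(iF b)
  AV : ∀ a b → fromℚ 1ℚ *ℝ a +ℝ -ℝ(fromℚ 0ℚ *ℝ b)≈ℝ a
  AV a b = tn(cq(ij a)
   (tn(nc(zeroˡ b))(RingProperties.-0#≈0#(CommutativeRing.ring r0))))(iF a)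
  Rk : ∀{z}→ z ≈ z
  Rk = ry , ry
  tE : ∀{z w v}→ z ≈ w → w ≈ v → z ≈ v
  tE(p , q)(p′ , qa)= tn p p′ , tn q qa
  c< : ∀{z za w wb}→ z ≈ za → w ≈ wb → z + w ≈ za + wb
  c<(p , q)(p′ , qa)= cq p p′ , cq q qa
  Ck : ∀ z w → z + w ≈ w + z
  Ck z w = cC _ _ , cC _ _
  cN : ∀ z w → z * w ≈ w * z
  cN(a +i b)(c +i d)= cq(cw a c)(nc(cw b d)), CJ a b c d
  iQ : ∀ z → 1# * z ≈ z
  iQ(a +i b)= AV a b , Bp b a
  dI : ∀ z w v → z *(w + v)≈ z * w + z * v
  dI(a +i b)(c +i d)(e +i f)= d* a b c d e f , d+ a b c d e f
  isCommutativeRing : IsCommutativeRing _≈_ _+_ _*_ -_ 0# 1#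
  isCommutativeRing = record
   {isRing = record
    {+-isAbelianGroup = record
     {isGroup = record
      {isMonoid = record
       {isSemigroup = record
        {isMagma = record
         {isEquivalence = record
          {refl = Rk
          ;sym = λ(p , q)→ S' p , S' q
          ;trans = tE}
         ;∙-cong = c<}
        ;assoc = λ z w v → a% _ _ _ , a% _ _ _}
       ;identity =(λ z → ih _ , ih _), λ z → iF _ , iF _}
      ;inverse =(λ z → iu _ , iu _), λ z → i4 _ , i4 _
      ;⁻¹-cong = λ(p , q)→ nc p , nc q}
     ;comm = Ck}
    ;*-cong = λ(p , q)(p′ , qa)→
     cq(cM p p′)(nc(cM q qa)), cq(cM p qa)(cM q p′)
    ;*-assoc = λ(a +i b)(c +i d)(e +i f)→ AB a b c d e f , AD a b c d e f
    ;*-identity = iQ , λ z → tE(cN z 1#)(iQ z)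
    ;distrib = dI , λ z w v → tE(cN(w + v)z)(tE(dI z w v)
     (c<(cN z w)(cN z v)))}
   ;*-comm = cN}
  c& : ∀ a b r → a *ℝ(a *ℝ r)+ℝ -ℝ(b *ℝ(-ℝ b *ℝ r))≈ℝ(a *ℝ a +ℝ b *ℝ b)*ℝ r
  c& = solve 3(λ a b r → a :*(a :* r):+ :-(b :*(:- b :* r)):=(a :* a :+ b :* b):* r)ry
  c/ : ∀ a b r → a *ℝ(-ℝ b *ℝ r)+ℝ b *ℝ(a *ℝ r)≈ℝ fromℚ 0ℚ
  c/ = solve 3(λ a b r → a :*(:- b :* r):+ b :*(a :* r):= con(I.+ 0))ry
  stable : ∀ z w → ¬ ¬(z ≈ w)→ z ≈ w
  stable z w zB = SN _ _(¬¬-map proj₁ zB), SN _ _(¬¬-map proj₂ zB)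
  iv : ∀ z → ¬(z ≈ 0#)→ ¬ ¬(∃ λ w → z * w ≈ 1#)
  iv(a +i b)zP = ¬¬-map c'(iP(a *ℝ a +ℝ b *ℝ b)λ n0 →
   zP(sN a b n0 , sN b a(tn(cC _ _)n0)))
   where
   c' :(∃ λ r →(a *ℝ a +ℝ b *ℝ b)*ℝ r ≈ℝ fromℚ 1ℚ)→ ∃ λ w →(a +i b)* w ≈ 1#
   c'(r , nT)=((a *ℝ r)+i(-ℝ b *ℝ r)),
    tn(c& a b r)nT , c/ a b r
 ri : CommutativeRing 0ℓ 0ℓ
 ri = record{isCommutativeRing = Co.isCommutativeRing}
module Ex where
 open IS
 module EA(R : CommutativeRing 0ℓ 0ℓ)where
  open CommutativeRing R
  open RingProperties ring
  open In R
  open SetoidReasoning setoid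
  Et : ℕ → Set
  Et d = Subset d → Carrier
  infix 4 _ap_
  infixl 6 _⊕_
  infixr 7 _aX_
  infixl 7 _aI_ _af_
  _ap_ : ∀{d}→ Et d → Et d → Set
  u ap v = ∀ S → u S ≈ v S
  _⊕_ : ∀{d}→ Et d → Et d → Et d
  (u ⊕ v)S = u S + v S
  _aX_ : ∀{d}→ Carrier → Et d → Et d
  (c aX u)S = c * u S
  un : ∀{d}→ Et d
  un [] = 1#
  un(inside ∷ S)= 0#
  un(outside ∷ S)= un S
  vf : ∀{d}→(Fin d → Carrier)→ Et d
  vf x [] = 0#
  vf x(inside ∷ S)= x Fin.zero * un S
  vf x(outside ∷ S)= vf(x ∘ Fin.suc)S
  bh : ∀{d}→ Et d → Et d
  bh u [] = u []
  bh u(inside ∷ S)= - bh(u ∘(inside ∷_))S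
  bh u(outside ∷ S)= bh(u ∘(outside ∷_))S
  _aI_ : ∀{d}→ Et d → Et d → Et d
  (u aI v)[] = u [] * v []
  (u aI v)(inside ∷ S)=((u ∘(inside ∷_))aI(v ∘(outside ∷_)))S +(bh(u ∘(outside ∷_))aI(v ∘(inside ∷_)))S
  (u aI v)(outside ∷ S)=((u ∘(outside ∷_))aI(v ∘(outside ∷_)))S
  _af_ : ∀{d}→ Et d →(Fin d → Carrier)→ Et d
  u af x = u aI vf x
  ct : ∀{d}→ Fin d → Et d → Et d
  ct Fin.zero u(inside ∷ S)= 0#
  ct Fin.zero u(outside ∷ S)= bh(u ∘(inside ∷_))S
  ct(Fin.suc i)u(b ∷ S)= ct i(u ∘(b ∷_))S
  top : ∀{d}→ Et d → Carrier
  top u = u full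
  ra : ∀{d}{u : Et d}→ u ap u
  ra S = refl
  sy : ∀{d}{u v : Et d}→ u ap v → v ap u
  sy uv S = sym(uv S)
  tr : ∀{d}{u v w : Et d}→ u ap v → v ap w → u ap w
  tr uv v> S = trans(uv S)(v> S)
  br : ∀{d}{u v : Et d}→ u ap v → bh u ap bh v
  br uv [] = uv []
  br uv(inside ∷ S)= -‿cong(br(uv ∘(inside ∷_))S)
  br uv(outside ∷ S)= br(uv ∘(outside ∷_))S
  bB : ∀{d}(u v : Et d)→ bh(u ⊕ v)ap bh u ⊕ bh v
  bB u v [] = refl
  bB u v(inside ∷ S)= trans(-‿cong(bB _ _ S))(solve 2(λ a b → :-(a :+ b):= :- a :+ :- b)refl _ _)
  bB u v(outside ∷ S)= bB _ _ S
  bg : ∀{d}c(u : Et d)→ bh(c aX u)ap c aX bh u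
  bg c u [] = refl
  bg c u(inside ∷ S)= trans(-‿cong(bg c _ S))(-‿distribʳ-* _ _)
  bg c u(outside ∷ S)= bg c _ S
  bi : ∀{d}(u : Et d)→ bh(bh u)ap u
  bi u [] = refl
  bi u(inside ∷ S)= trans(-‿cong(br(λ S → sym(-1*x≈-x _))S))(trans(-‿cong(bg(- 1#)_ S))(trans(-‿cong(-1*x≈-x _))(trans(-‿involutive _)(bi _
   S))))
  bi u(outside ∷ S)= bi _ S
  bu : ∀{d}→ bh{d}un ap un
  bu [] = refl
  bu(inside ∷ S)= trans(-‿cong(bF S))-0#≈0#
   where
   bF : ∀{d}→ bh{d}(λ _ → 0#)ap(λ _ → 0#)
   bF [] = refl
   bF(inside ∷ S)= trans(-‿cong(bF S))-0#≈0#
   bF(outside ∷ S)= bF S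
  bu(outside ∷ S)= bu S
  co : ∀{d}{u uc v vb : Et d}→ u ap uc → v ap vb → u aI v ap uc aI vb
  co p q [] = *-cong(p [])(q [])
  co p q(inside ∷ S)= +-cong(co(p ∘(inside ∷_))(q ∘(outside ∷_))S)
   (co(br(p ∘(outside ∷_)))(q ∘(inside ∷_))S)
  co p q(outside ∷ S)= co(p ∘(outside ∷_))(q ∘(outside ∷_))S
  di : ∀{d}(u uc v : Et d)→(u ⊕ uc)aI v ap u aI v ⊕ uc aI v
  di u uc v [] = distribʳ _ _ _
  di u uc v(inside ∷ S)= trans
   (+-cong(di _ _ _ S)(trans(co(bB _ _)ra S)(di _ _ _ S)))
   (solve 4(λ a b c d →(a :+ b):+(c :+ d):=(a :+ c):+(b :+ d))refl _ _ _ _)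
  di u uc v(outside ∷ S)= di _ _ _ S
  ds : ∀{d}(u v vb : Et d)→ u aI(v ⊕ vb)ap u aI v ⊕ u aI vb
  ds u v vb [] = distribˡ _ _ _
  ds u v vb(inside ∷ S)= trans(+-cong(ds _ _ _ S)(ds _ _ _ S))
   (solve 4(λ a b c d →(a :+ b):+(c :+ d):=(a :+ c):+(b :+ d))refl _ _ _ _)
  ds u v vb(outside ∷ S)= ds _ _ _ S
  ak : ∀{d}c(u v : Et d)→(c aX u)aI v ap c aX(u aI v)
  ak c u v [] = *-assoc _ _ _
  ak c u v(inside ∷ S)= trans
   (+-cong(ak c _ _ S)(trans(co(bg c _)ra S)(ak c _ _ S)))
   (sym(distribˡ _ _ _))
  ak c u v(outside ∷ S)= ak c _ _ S
  ay : ∀{d}c(u v : Et d)→ u aI(c aX v)ap c aX(u aI v)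
  ay c u v [] = solve 3(λ c u v → u :*(c :* v):= c :*(u :* v))refl _ _ _
  ay c u v(inside ∷ S)= trans(+-cong(ay c _ _ S)(ay c _ _ S))(sym(distribˡ _ _ _))
  ay c u v(outside ∷ S)= ay c _ _ S
  aN : ∀{d}→ Et d
  aN S = 0#
  ⊝_ : ∀{d}→ Et d → Et d
  (⊝ u)S = - u S
  eZ : ∀{d}(u : Et d)→ aN ap 0# aX u
  eZ u S = sym(zeroˡ _)
  bO : ∀{d}(u : Et d)→ ⊝ u ap(- 1#)aX u
  bO u S = sym(-1*x≈-x _)
  zb : ∀{d}(v : Et d)→ aN aI v ap aN
  zb v S = trans(co(eZ aN)ra S)(trans(ak 0# aN v S)(zeroˡ _))
  zg : ∀{d}(u : Et d)→ u aI aN ap aN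
  zg u S = trans(co ra(eZ aN)S)(trans(ay 0# u aN S)(zeroˡ _))
  bG : ∀{d}(u v : Et d)→(⊝ u)aI v ap ⊝(u aI v)
  bG u v S = trans(co(bO u)ra S)(trans(ak _ _ _ S)(-1*x≈-x _))
  a2 : ∀{d}(u v : Et d)→ u aI(⊝ v)ap ⊝(u aI v)
  a2 u v S = trans(co ra(bO v)S)(trans(ay _ _ _ S)(-1*x≈-x _))
  Bf : ∀{d}(u : Et d)→ bh(⊝ u)ap ⊝ bh u
  Bf u S = trans(br(bO u)S)(trans(bg _ _ S)(-1*x≈-x _))
  bj : ∀{d}(u v : Et d)→ bh(u aI v)ap bh u aI bh v
  bj u v [] = refl
  bj u v(inside ∷ S)= trans(-‿cong(bB _ _ S))(trans(-‿cong(+-cong(bj ud vI S)(bj(bh ua)vQ S)))(trans(solve 2(λ a b → :-(a :+ b):= :- a :+ :- b)refl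
   _ _)(sym(+-cong(bG _ _ S)(a2 _ _ S)))))
   where
   ud = u ∘(inside ∷_)
   ua = u ∘(outside ∷_)
   vQ = v ∘(inside ∷_)
   vI = v ∘(outside ∷_)
  bj u v(outside ∷ S)= bj _ _ S
  aA : ∀{d}(u v w : Et d)→(u aI v)aI w ap u aI(v aI w)
  aA u v w [] = *-assoc _ _ _
  aA u v w(inside ∷ S)= trans(+-cong(di _ _ _ S)(co(bj ua vI)ra S))(trans(+-cong(+-cong(aA _ _ _ S)(aA _ _ _ S))(aA _ _ _ S))
   (trans(+-assoc _ _ _)(sym(+-congˡ(ds _ _ _ S)))))
   where
   ud = u ∘(inside ∷_)
   ua = u ∘(outside ∷_)
   vQ = v ∘(inside ∷_)
   vI = v ∘(outside ∷_)
   w₁ = w ∘(inside ∷_)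
   wT = w ∘(outside ∷_)
  aA u v w(outside ∷ S)= aA _ _ _ S
  iy : ∀{d}(u : Et d)→ un aI u ap u
  iy u [] = *-identityˡ _
  iy u(inside ∷ S)= trans
   (+-cong(zb _ S)(trans(co bu ra S)(iy _ S)))(+-identityˡ _)
  iy u(outside ∷ S)= iy _ S
  ie : ∀{d}(u : Et d)→ u aI un ap u
  ie u [] = *-identityʳ _
  ie u(inside ∷ S)= trans(+-cong(ie _ S)(zg _ S))(+-identityʳ _)
  ie u(outside ∷ S)= ie _ S
  vE : ∀{d}{x y : Fin d → Carrier}→(∀ i → x i ≈ y i)→ vf x ap vf y
  vE p [] = refl
  vE p(inside ∷ S)= *-congʳ(p Fin.zero)
  vE p(outside ∷ S)= vE(p ∘ Fin.suc)S
  vZ : ∀{d}(x y : Fin d → Carrier)→ vf(λ i → x i + y i)ap vf x ⊕ vf y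
  vZ x y [] = sym(+-identityˡ _)
  vZ x y(inside ∷ S)= distribʳ _ _ _
  vZ x y(outside ∷ S)= vZ _ _ S
  v0 : ∀{d}c(x : Fin d → Carrier)→ vf(λ i → c * x i)ap c aX vf x
  v0 c x [] = sym(zeroʳ c)
  v0 c x(inside ∷ S)= *-assoc _ _ _
  v0 c x(outside ∷ S)= v0 c _ S
  bC : ∀{d}(x : Fin d → Carrier)→ bh(vf x)ap ⊝ vf x
  bC x [] = sym -0#≈0#
  bC x(inside ∷ S)= -‿cong(trans(bg _ un S)(*-congˡ(bu S)))
  bC x(outside ∷ S)= bC _ S
  vF : ∀{d}(x : Fin d → Carrier)(u : Et d)→ vf x aI u ap bh u aI vf x
  vF x u [] = trans(zeroˡ _)(sym(zeroʳ _))
  vF{suc d}x u(inside ∷ S)= trans(+-cong(trans(ak xh un ua S)(*-congˡ(iy ua S)))(sym(bi _ S)))(trans(+-congˡ(br(tr(bj(bh(vf xa))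
   ud)(co(bi(vf xa))ra))S))(trans(+-congˡ(br(vF xa(bh ud))S))(trans(+-congˡ(br(co(bi ud)ra)S))
   (trans(+-cong(*-congˡ(sym(bi ua S)))(b3 xa ud S))(trans(+-comm _ _)(sym(+-congˡ(trans(ay xh(bh(bh ua))un S)(*-congˡ
   (ie(bh(bh ua))S))))))))))
   where
   xh = x Fin.zero
   xa = x ∘ Fin.suc
   ud = u ∘(inside ∷_)
   ua = u ∘(outside ∷_)
   b3 : ∀{d}(x : Fin d → Carrier)(u : Et d)→ bh(u aI vf x)ap(⊝ bh u)aI vf x
   b3 x u S = trans(bj u(vf x)S)(trans(co ra(bC x)S)(trans(a2(bh u)(vf x)S)(sym(bG(bh u)(vf x)S))))
  vF x u(outside ∷ S)= vF _ _ S
  cg : ∀{d}{u v : Et d}{x y : Fin d → Carrier}→ u ap v →(∀ i → x i ≈ y i)→ u af x ap v af y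
  cg p q = co p(vE q)
  cn : ∀{d}{u v : Et d}{x : Fin d → Carrier}→ u ap v → u af x ap v af x
  cn p = co p ra
  a< : ∀{d}(u : Et d)(x y : Fin d → Carrier)→ u af(λ i → x i + y i)ap u af x ⊕ u af y
  a< u x y = tr(co ra(vZ x y))(ds u(vf x)(vf y))
  aE : ∀{d}(u : Et d)c(x : Fin d → Carrier)→ u af(λ i → c * x i)ap c aX(u af x)
  aE u c x = tr(co ra(v0 c x))(ay c u(vf x))
  az : ∀{d}(u : Et d)(x y : Fin d → Carrier)→ u af x af y ap ⊝(u af y af x)
  az u x y S = trans(aA u(vf x)(vf y)S)(trans(co ra(vF x(vf y))S)(trans(co ra(co(bC y)ra)S)(trans(co
   ra(bG(vf y)(vf x))S)(trans(a2 u(vf y aI vf x)S)(sym(-‿cong(aA u(vf y)(vf x)S)))))))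
  vB : ∀{d}(x : Fin d → Carrier)→ vf x aI vf x ap aN
  vB x [] = zeroˡ _
  vB x(inside ∷ S)= trans(+-cong(ak xh un(vf xa)S)(trans(co(bC xa)ra S)(ay xh(⊝ vf xa)un S)))(trans(+-cong(*-congˡ(iy(vf
   xa)S))(*-congˡ(ie(⊝ vf xa)S)))(solve 2(λ a b → a :* b :+ a :* :- b := con(I.+ 0))refl xh(vf xa S)))
   where
   xh = x Fin.zero
   xa = x ∘ Fin.suc
  vB x(outside ∷ S)= vB _ S
  sq : ∀{d}(u : Et d)(x : Fin d → Carrier)→ u af x af x ap aN
  sq u x S = trans(aA u(vf x)(vf x)S)(trans(co ra(vB x)S)(zg u S))
  cp : ∀{d}i{u v : Et d}→ u ap v → ct i u ap ct i v
  cp Fin.zero p(inside ∷ S)= refl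
  cp Fin.zero p(outside ∷ S)= br(p ∘(inside ∷_))S
  cp(Fin.suc i)p(b ∷ S)= cp i(p ∘(b ∷_))S
  cL : ∀{d}i(u v : Et d)→ ct i(u ⊕ v)ap ct i u ⊕ ct i v
  cL Fin.zero u v(inside ∷ S)= sym(+-identityˡ _)
  cL Fin.zero u v(outside ∷ S)= bB _ _ S
  cL(Fin.suc i)u v(b ∷ S)= cL i _ _ S
  cx : ∀{d}i c(u : Et d)→ ct i(c aX u)ap c aX ct i u
  cx Fin.zero c u(inside ∷ S)= sym(zeroʳ c)
  cx Fin.zero c u(outside ∷ S)= bg c _ S
  cx(Fin.suc i)c u(b ∷ S)= cx i c _ S
  cy : ∀{d}i(u : Et d)→ ct i(bh u)ap ⊝ bh(ct i u)
  cy Fin.zero u(inside ∷ S)= trans(sym(trans(-‿involutive _)(Bq S)))(-‿cong refl)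
   where
   Bq : bh aN ap aN
   Bq S = trans(br(eZ aN)S)(trans(bg 0# aN S)(zeroˡ _))
  cy Fin.zero u(outside ∷ S)= Bf(bh(u ∘(inside ∷_)))S
  cy(Fin.suc i)u(inside ∷ S)= trans(cp i(bO(bh ud))S)(trans(cx i(- 1#)(bh ud)S)(trans(-1*x≈-x _)(-‿cong(cy i ud S))))
   where ud = u ∘(inside ∷_)
  cy(Fin.suc i)u(outside ∷ S)= cy i _ S
  ce : ∀{d}i(u : Et d)(x : Fin d → Carrier)→ ct i(u af x)⊕ ct i u af x ap x i aX u
  ce Fin.zero u x(inside ∷ S)= trans(trans(+-identityˡ _)(+-congʳ(zb(vf xa)S)))(trans(+-identityˡ _)(trans(ay xh(bh(bh ud))un S)(trans(*-congˡ(ie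
   _ S))(*-congˡ(bi ud S)))))
   where
   xh = x Fin.zero
   xa = x ∘ Fin.suc
   ud = u ∘(inside ∷_)
  ce Fin.zero u x(outside ∷ S)= trans(+-congʳ(trans(bB _ _ S)(+-cong(bj ud(vf xa)S)(bj(bh ua)(xh aX un)S))))(trans(+-congʳ(+-cong(trans(co ra
   (bC xa)S)(a2(bh ud)(vf xa)S))(co(bi ua)(tr(bg xh un)λ S → *-congˡ(bu S))S)))(trans(+-congʳ(+-congˡ
   (trans(ay xh ua un S)(*-congˡ(ie ua S)))))(solve 2(λ a b → :- a :+ b :+ a := b)refl _ _)))
   where
   xh = x Fin.zero
   xa = x ∘ Fin.suc
   ud = u ∘(inside ∷_)
   ua = u ∘(outside ∷_)
  ce(Fin.suc i)u x(inside ∷ S)= trans(+-cong(trans(cL i _ _ S)(+-congˡ(cp i(ug(bh ua))S)))(+-congˡ(ug(bh(ct i ua))S)))(trans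
   (+-congʳ(+-congˡ(trans(cx i xh(bh ua)S)(*-congˡ(cy i ua S)))))(trans(solve 4(λ a b c e → a :+ e :* :- b :+(c :+ e :* b)
   := a :+ c)refl _ _ _ _)(ce i ud xa S)))
   where
   xh = x Fin.zero
   xa = x ∘ Fin.suc
   ud = u ∘(inside ∷_)
   ua = u ∘(outside ∷_)
   ug : ∀ w → w aI(xh aX un)ap xh aX w
   ug w S = trans(ay xh w un S)(*-congˡ(ie w S))
  ce(Fin.suc i)u x(outside ∷ S)= ce i _ _ S
  tq : ∀{d}i(u : Et d)→ top(ct i u)≈ 0#
  tq Fin.zero u = refl
  tq(Fin.suc i)u = tq i(u ∘(inside ∷_))
  cA : ∀{d}(i : Fin d)→ ct i un ap aN
  cA Fin.zero(inside ∷ S)= refl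
  cA Fin.zero(outside ∷ S)= trans(br(eZ aN)S)(trans(bg 0# aN S)(zeroˡ _))
  cA(Fin.suc i)(inside ∷ S)= trans(cp i(eZ aN)S)(trans(cx i 0# aN S)(zeroˡ _))
  cA(Fin.suc i)(outside ∷ S)= cA i S
module FB where
 open IS
 open Ex
 open import Data.Bool.Base using(T)
 fa : ∀{m n}→ m ≢ n →(m N.≡ᵇ n)≡ false
 fa{m}{n}m' with m N.≡ᵇ n in eq
 ... | false = P.refl
 ... | true = ⊥-elim(m'(N.≡ᵇ⇒≡ m n(P.subst T(P.sym eq)_)))
 rl : ∀ n →(n N.≡ᵇ n)≡ true
 rl zero = P.refl
 rl(suc n)= rl n
 module Fm(R : CommutativeRing 0ℓ 0ℓ)(d : ℕ)where
  open CommutativeRing R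
  open RingProperties ring
  open In R
  open EA R
  open SetoidReasoning setoid
  Ve : Set
  Ve = Fin d → Carrier
  Fe : Set
  Fe = ℕ → Ve
  Fl : Set
  Fl = ℕ → Et d
  we : Fe → ℕ → Et d
  we g zero = un
  we g(suc k)= we g k af g(suc k)
  tail : Fe →(k m : ℕ)→ Et d → Et d
  tail g k zero u = u
  tail g k(suc m)u = tail g(suc k)m(u af g(suc k))
  de : Fe → Carrier
  de g = top(we g d)
  Sv : ℕ →(ℕ → Carrier)→ Carrier
  Sv zero f = 0#
  Sv(suc n)f = Sv n f + f n
  SO : ∀ n{f h : ℕ → Carrier}→(∀ j → f j ≈ h j)→ Sv n f ≈ Sv n h
  SO zero fw = refl
  SO(suc n)fw = +-cong(SO n fw)(fw n)
  Sb : ∀ n{f : ℕ → Carrier}→(∀ j → j N.< n → f j ≈ 0#)→ Sv n f ≈ 0#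
  Sb zero fK = refl
  Sb(suc n)fK = trans(+-cong(Sb n λ j jn → fK j(N.m<n⇒m<1+n jn))(fK n N.≤-refl))(+-identityˡ 0#)
  Sd : ∀ n k{f : ℕ → Carrier}→ k N.< n →(∀ j → j ≢ k → f j ≈ 0#)→ Sv n f ≈ f k
  Sd(suc n)k{f}K8 fK with k N.≟ n
  ... | yes P.refl = trans(+-congʳ(Sb n λ j jn → fK j(N.<⇒≢ jn)))(+-identityˡ _)
  ... | no KV = trans(+-cong(Sd n k(N.≤∧≢⇒<(N.s≤s⁻¹ K8)KV)fK)(fK n(KV ∘ P.sym)))(+-identityʳ _)
  tc : ∀ g k m{u v : Et d}→ u ap v → tail g k m u ap tail g k m v
  tc g k zero p = p
  tc g k(suc m)p = tc g(suc k)m(cn p)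
  tJ : ∀ g k m(u v : Et d)→ tail g k m(u ⊕ v)ap tail g k m u ⊕ tail g k m v
  tJ g k zero u v = ra
  tJ g k(suc m)u v = tr(tc g(suc k)m(di u v _))(tJ g(suc k)m _ _)
  td : ∀ g k m c(u : Et d)→ tail g k m(c aX u)ap c aX tail g k m u
  td g k zero c u = ra
  td g k(suc m)c u = tr(tc g(suc k)m(ak c u _))(td g(suc k)m c _)
  tM : ∀ g k m → tail g k m aN ap aN
  tM g k m S = trans(tc g k m(eZ aN)S)(trans(td g k m 0# aN S)(zeroˡ _))
  tI : ∀ g k m → tail g k m(we g k)≡ we g(k N.+ m)
  tI g k zero = P.cong(we g)(P.sym(N.+-identityʳ k))
  tI g k(suc m)= P.trans(tI g(suc k)m)(P.cong(we g)(P.sym(N.+-suc k m)))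
  tw : ∀ g k → k N.≤ d → top(tail g k(d ∸ k)(we g k))≈ de g
  tw g k kd = reflexive(P.trans(P.cong top(tI g k(d ∸ k)))
   (P.cong(top ∘ we g)(N.m+[n∸m]≡n kd)))
  tZ : ∀ g k u → k N.< d → tail g k(d ∸ k)u ≡ tail g(suc k)(d ∸ suc k)(u af g(suc k))
  tZ g k u kh = P.cong(λ m → tail g k m u)(N.+-∸-assoc 1 kh)
  cd : Fe → Ve → ℕ → Carrier
  cd g y j = top(tail g(suc j)(d ∸ suc j)(we g j af y))
  CU : ∀ g(y : Ve)i → y i * de g ≈ Sv d(λ j → g(suc j)i * cd g y j)
  CU g y i = trans(sym wI)(pa d N.≤-refl)
   where
   X : ℕ → Carrier
   X k = top(tail g k(d ∸ k)(ct i(we g k)af y))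
   wI : X d ≈ y i * de g
   wI = trans(reflexive(P.cong(λ m → top(tail g d m(ct i(we g d)af y)))(N.n∸n≡0 d)))(trans(sym(trans(+-congʳ(tq i(we g d af
    y)))(+-identityˡ _)))(ce i(we g d)y _))
   step : ∀ k → ct i(we g(suc k))af y
    ap g(suc k)i aX(we g k af y)⊕ ct i(we g k)af y af g(suc k)
   step k S = trans(cn(λ S → solve 2(λ a b → a :=(a :+ b):+ :- b)refl _ _)S)(trans(cn(λ S → +-congʳ(ce i u x S))S)(trans
    (di(x i aX u)(⊝(ct i u af x))(vf y)S)(+-cong(ak(x i)u(vf y)S)(trans(bG(ct i u af x)(vf y)S)(trans(-‿cong
    (az(ct i u)x y S))(-‿involutive _))))))
    where
    u = we g k
    x = g(suc k)
   pa : ∀ k → k N.≤ d → X k ≈ Sv k(λ j → g(suc j)i * cd g y j)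
   pa zero _ = trans(tc g 0 d(tr(cn(cA i))(zb(vf y)))_)(tM g 0 d _)
   pa(suc k)kh = trans(trans(tc g(suc k)(d ∸ suc k)(step k)_)(tJ g(suc k)(d ∸ suc k)_ _ _))(trans(+-cong(td g(suc k)(d ∸ suc k)_ _ _)
    (reflexive(P.cong top(P.sym(tZ g k _ kh)))))(trans(+-comm _ _)(+-congʳ(pa k(N.<⇒≤ kh)))))
  Sf : ∀(u : Et d)n(c : ℕ → Carrier)(x : ℕ → Ve)→
   u af(λ i → Sv n(λ j → x j i * c j))ap λ S → Sv n(λ j → c j *(u af x j)S)
  Sf u zero c x S = trans(cg ra(λ i → sym(zeroˡ 0#))S)(trans(aE u 0#(λ i → 0#)S)(zeroˡ _))
  Sf u(suc n)c x S = trans(a< u _ _ S)(+-cong(Sf u n c x S)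
   (trans(cg ra(λ i → *-comm _ _)S)(aE u(c n)(x n)S)))
  eO : ∀{g}→ de g ≈ 1# → ∀(u : Et d)y →
   u af y ap λ S → Sv d(λ j → cd g y j *(u af g(suc j))S)
  eO{g}d1 u y = tr
   (cg ra λ i → trans(sym(*-identityʳ _))(trans(*-congˡ(sym d1))(CU g y i)))
   (Sf u d(cd g y)(g ∘ suc))
  vh : ∀ g y k → we g k af y ap aN → ∀ m → we g(m N.+ k)af y ap aN
  vh g y k p zero = p
  vh g y k p(suc m)S = trans(az(we g(m N.+ k))_ y S)(trans(-‿cong(cn(vh g y k p m)S))(trans(-‿cong(zb _ S))-0#≈0#))
  vr : ∀ g y{k l}→ k N.≤ l → we g k af y ap aN → we g l af y ap aN
  vr g y{k}{l}KO p S = trans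
   (reflexive(P.cong(λ j →(we g j af y)S)(P.sym(N.m∸n+n≡m KO))))(vh g y k p(l ∸ k)S)
  Dj : ∀{g}→ de g ≈ 1# → ∀ k y → k N.< d → we g(suc k)af y ap aN →
   we g k af y ap cd g y k aX we g(suc k)
  Dj{g}d1 k y kh p S = trans(eO d1(we g k)y S)(Sd d k kh oh)
   where
   oh : ∀ j → j ≢ k → cd g y j *(we g k af g(suc j))S ≈ 0#
   oh j jk with j N.<? k
   ... | yes jg = trans(*-congˡ(vr g(g(suc j))jg(sq(we g j)(g(suc j)))S))(zeroʳ _)
   ... | no jh = trans(*-congʳ(trans
    (tc g(suc j)(d ∸ suc j)(vr g y(N.≤∧≢⇒<(N.≮⇒≥ jh)(jk ∘ P.sym))p)_)
    (tM g(suc j)(d ∸ suc j)_)))(zeroˡ _)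
  Re : Fe → Fl → Set
  Re g G = ∀ k → k N.≤ d → G k ap we g k
  Cr : ℕ → Fl → Fl → Carrier → Set
  Cr k U W t =(∀ i → i N.≤ d → i ≢ k → U i ap W i)
   × ∃ λ y → W k ap U(k ∸ 1)af y × U k af y ap t aX U(suc k)
  e9 : ℕ → Fe → Fl → Carrier
  e9 k g W = top(tail g k(d ∸ k)(W k))
  t' : ℕ → Carrier → Carrier → Carrier → Fe → Fe
  t' k z t ta g i = if i N.≡ᵇ k then(λ c → z * g k c + t * g(suc k)c)
   else if i N.≡ᵇ suc k then(λ c → - ta * g k c)else g i
  pP : ∀(u : Et d)a b c e(x y : Ve)→
   u af(λ i → a * x i + b * y i)af(λ i → c * x i + e * y i)ap(a * e + -(b * c))aX(u af x af y)
  pP u a b c e x y S = trans(trans(a< _ _ _ S)(+-cong(aE _ c x S)(aE _ e y S)))(trans(+-cong(*-congˡ(eK x))(*-congˡ(eK y)))(trans(+-cong(*-congˡ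
   (+-cong(*-congˡ(sq u x S))(*-congˡ(az u y x S))))(*-congˡ(+-congˡ(*-congˡ(sq u y S)))))(trans(+-cong(*-congˡ(+-congʳ
   (zeroʳ a)))(*-congˡ(+-congˡ(zeroʳ b))))(trans(+-cong(*-congˡ(+-identityˡ _))(*-congˡ(+-identityʳ _)))(solve 5(λ a b c e w → c :*(b :* :- w)
   :+ e :*(a :* w):=(a :* e :+ :-(b :* c)):* w)refl a b c e _)))))
   where
   eK : ∀ w →(u af(λ i → a * x i + b * y i)af w)S ≈ a *(u af x af w)S + b *(u af y af w)S
   eK w = trans(cn(tr(a< u _ _)(λ S → +-cong(aE u a x S)(aE u b y S)))S)
    (trans(di _ _ _ S)(+-cong(ak a _ _ S)(ak b _ _ S)))
  cu : ∀(u : Et d)a b(x y : Ve)→ u af(λ i → a * x i + b * y i)ap a aX(u af x)⊕ b aX(u af y)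
  cu u a b x y S = trans(a< u _ _ S)(+-cong(aE u a x S)(aE u b y S))
  module Tu{g}(d1 : de g ≈ 1#){k U W t}(kh : suc k N.< d)
   (rp : Re g U)(crossing : Cr(suc k)U W t)where
   z : Carrier
   z = e9(suc k)g W
   nV : Ve
   nV c = z * g(suc k)c + t * g(suc(suc k))c
   private
    y = proj₁(proj₂ crossing)
    ya : Ve
    ya c = y c + - t * g(suc(suc k))c
    ζ = cd g ya k
    KP : we g(suc k)af ya ap aN
    KP S = trans(trans(a< _ y _ S)(+-congˡ(aE _(- t)_ S)))(trans(sym(+-congʳ(cn(rp(suc k)(N.<⇒≤ kh))S)))(trans(+-congʳ(trans
     (proj₂(proj₂(proj₂ crossing))S)(*-congˡ(rp(suc(suc k))kh S))))(solve 2(λ t w → t :* w :+ :- t :* w := con(I.+ 0))refl t _)))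
    dO : W(suc k)ap ζ aX we g(suc k)⊕ t aX(we g k af g(suc(suc k)))
    dO S = trans(proj₁(proj₂(proj₂ crossing))S)(trans(cn(rp k(N.<⇒≤(N.<⇒≤ kh)))S)(trans(cg ra(λ c → solve 3(λ y t x → y :=
     (y :+ :- t :* x):+ t :* x)refl(y c)t(g(suc(suc k))c))S)(trans(trans(a< _ ya _ S)(+-congˡ(aE _ t _ S)))(+-congʳ(Dj d1 k ya
     (N.<⇒≤ kh)KP S)))))
    m = d ∸ suc k
    zH : z ≈ ζ
    zH = trans(trans(tc g(suc k)m dO _)(tJ g(suc k)m _ _ _))(trans(+-cong(td g(suc k)m ζ _ _)(td g(suc k)m t _ _))
     (trans(+-cong(*-congˡ(trans(tw g(suc k)(N.<⇒≤ kh))d1))(*-congˡ Rm))(trans(+-cong(*-identityʳ ζ)(zeroʳ t))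
     (+-identityʳ ζ))))
     where
     Rm : top(tail g(suc k)m(we g k af g(suc(suc k))))≈ 0#
     Rm = trans(reflexive(P.cong top(tZ g(suc k)_ kh)))
      (trans(tc g(suc(suc k))(d ∸ suc(suc k))(sq(we g k)(g(suc(suc k))))_)
       (tM g(suc(suc k))(d ∸ suc(suc k))_))
   nl : W(suc k)ap we g k af nV
   nl S = trans(dO S)(trans(+-congʳ(*-congʳ(sym zH)))(sym(cu(we g k)z t _ _ S)))
   module _{ta}(t1 : t * ta ≈ 1#)where
    turned : Fe
    turned = t'(suc k)z t ta g
    private
     bA : ∀{i}→ i N.< suc k → turned i ≡ g i
     bA{i}Im rewrite fa(N.<⇒≢ Im)| fa(N.<⇒≢(N.m<n⇒m<1+n Im))= P.refl
     aJ : ∀{i}→ suc(suc k)N.< i → turned i ≡ g i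
     aJ{i}KT rewrite fa(N.>⇒≢ KT)| fa(N.>⇒≢(N.<⇒≤ KT))= P.refl
     Ai : turned(suc k)≡ nV
     Ai rewrite rl k = P.refl
     AL : turned(suc(suc k))≡ λ c → - ta * g(suc k)c
     AL rewrite fa(N.1+n≢n{k})| rl k = P.refl
     wg : ∀ i → i N.< suc k → we turned i ap we g i
     wg zero _ = ra
     wg(suc i)Im = cg(wg i(N.<⇒≤ Im))(λ c → reflexive(P.cong(λ v → v c)(bA Im)))
     wP : we turned(suc k)ap W(suc k)
     wP = tr(cg(wg k N.≤-refl)(λ c → reflexive(P.cong(λ v → v c)Ai)))(sy nl)
     wv : ∀ j → we turned(j N.+ suc(suc k))ap we g(j N.+ suc(suc k))
     wv zero S = trans(cg(cg(wg k N.≤-refl)(λ c → reflexive(P.cong(λ v → v c)Ai)))(λ c → trans(reflexive(P.cong(λ v → v c)AL))(PG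
      c))S)(trans(pP(we g k)z t(- ta)0#(g(suc k))(g(suc(suc k)))S)(trans(*-congʳ(trans(+-cong(zeroʳ z)(solve 2(λ a b → :-(a :*
      :- b):= a :* b)refl t ta))(trans(+-identityˡ _)t1)))(*-identityˡ _)))
      where
      PG : ∀ c → - ta * g(suc k)c ≈ - ta * g(suc k)c + 0# * g(suc(suc k))c
      PG c = sym(trans(+-congˡ(zeroˡ _))(+-identityʳ _))
     wv(suc j)= cg(wv j)
      (λ c → reflexive(P.cong(λ v → v c)(aJ(N.s≤s(N.m≤n+m(suc(suc k))j)))))
     wF : ∀{i}→ suc(suc k)N.≤ i → we turned i ap we g i
     wF{i}KT = P.subst(λ l → we turned l ap we g l)(N.m∸n+n≡m KT)(wv(i ∸ suc(suc k)))
    tT : de turned ≈ 1#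
    tT = trans(wF kh _)d1
    tu : Re turned W
    tu i iJ with N.<-cmp i(suc k)
    ... | tri< Im _ _ = tr(sy(proj₁ crossing i iJ(N.<⇒≢ Im)))
     (tr(rp i iJ)(sy(wg i Im)))
    ... | tri≈ _ P.refl _ = sy wP
    ... | tri> _ _ KT = tr(sy(proj₁ crossing i iJ(N.>⇒≢ KT)))
     (tr(rp i iJ)(sy(wF KT)))
  tK : ∀{g}→ de g ≈ 1# → ∀{k U M W a b c}→ suc k N.< d → Re g U →
   Cr(suc k)U M a → Cr(suc k)M W c → Cr(suc k)U W b →
   b aX M(suc k)ap c aX U(suc k)⊕ a aX W(suc k)
  tK{g}d1{k}{U}{M}{W}{a}{b}{c}kh rp UM MW UW S = trans(*-congˡ(trans(Mb.nl S)(cu L Mb.z a x₁ x₂ S)))(trans(solve 6(λ a b z w p q → b :*(z :* p :+ a :* q):=(b :* z :+ :-(a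
   :* w)):* p :+ a :*(w :* p :+ b :* q))refl a b Mb.z Wa.z _ _)(+-cong(*-cong CK(sym(rp(suc k)(N.<⇒≤ kh)S)))(*-congˡ(sym(trans
   (Wa.nl S)(cu L Wa.z b x₁ x₂ S))))))
   where
   module Mb = Tu d1 kh rp UM
   module Wa = Tu d1 kh rp UW
   L = we g k
   x₁ = g(suc k)
   x₂ = g(suc(suc k))
   y = proj₁(proj₂ MW)
   kd = N.<⇒≤(N.<⇒≤ kh)
   My : c aX we g(suc(suc k))ap(b * Mb.z + -(a * Wa.z))aX we g(suc(suc k))
   My S = trans(*-congˡ(trans(sym(rp(suc(suc k))kh S))(proj₁ UM(suc(suc k))kh(λ())S)))(trans(sym(proj₂(proj₂(proj₂ MW))S))(trans
    (cn Mb.nl S)(trans(az L _ y S)(trans(-‿cong(cn(tr(cn(tr(sy(rp k kd))(proj₁ UM k kd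
    (N.1+n≢n ∘ P.sym))))(tr(sy(proj₁(proj₂(proj₂ MW))))Wa.nl))S))(trans(-‿cong(pP L Wa.z b Mb.z a x₁ x₂ S))(solve 5(λ a b z
    w p → :-((w :* a :+ :-(b :* z)):* p):=(b :* z :+ :-(a :* w)):* p)refl a b Mb.z Wa.z _))))))
   CK : b * Mb.z + -(a * Wa.z)≈ c
   CK = trans(sym(extract _))(trans(sym(tc g(suc(suc k))(d ∸ suc(suc k))My _))(extract c))
    where
    extract : ∀ r → top(tail g(suc(suc k))(d ∸ suc(suc k))(r aX we g(suc(suc k))))≈ r
    extract r = trans(td g(suc(suc k))(d ∸ suc(suc k))r _ _)(trans(*-congˡ(trans(tw g(suc(suc k))kh)d1))(*-identityʳ r))
  module He{g}(d1 : de g ≈ 1#){U Na Nb W : Fl}{tU tP t* : Carrier}(rp : Re g U)where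
   join : ∀{q}→ suc(suc q)N.≤ d →
    Cr(suc(suc q))U Na tU → Cr(suc q)Na Nb tP → Cr(suc(suc q))Nb W t* →
    tP aX Na(suc(suc q))ap ⊝(W(suc q)af g(suc q))
   join{q}qC UN NN NW S = trans(sym(proj₂(proj₂(proj₂ NN))S))(trans(cn(tr(sy(proj₁ UN(suc q)(N.<⇒≤ qC)(N.1+n≢n ∘ P.sym)))(rp(suc q)(N.<⇒≤
    qC)))S)(trans(az(we g q)_ y S)(trans(-‿cong(cn(cn(tr(sy(rp q qd))(proj₁ UN q qd(λ qI → N.<⇒≢
    (N.m<n⇒m<1+n N.≤-refl)qI))))S))(-‿cong(cn(tr(sy(proj₁(proj₂(proj₂ NN))))(proj₁ NW(suc q)(N.<⇒≤ qC)(N.1+n≢n ∘ P.sym)))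
    S)))))
    where
    y = proj₁(proj₂ NN)
    qd = N.<⇒≤(N.<⇒≤ qC)
   m% : ∀{p}→ suc(suc p)N.< d →(UN : Cr(suc p)U Na tU)→
    Cr(suc(suc p))Na Nb tP → Cr(suc p)Nb W t* →
    tP * e9(suc p)g Na ≈ - top(tail g(suc(suc(suc p)))(d ∸ suc(suc(suc p)))(W(suc(suc p))af g(suc(suc p))))
   m%{p}Pj UN NN NW = sym(trans(-‿cong(trans(tc g(suc q)(d ∸ suc q)mL _)(td g(suc q)(d ∸ suc q)_ _ _)))(trans(-‿cong(*-congˡ(trans(tw
    g(suc q)Pj)d1)))(trans(-‿cong(*-identityʳ _))(-‿involutive _))))
    where
    q = suc(suc p)
    module Nc = Tu d1(N.<⇒≤ Pj)rp UN
    y = proj₁(proj₂ NN)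
    qd = N.<⇒≤ Pj
    L = we g p
    n2 : Na(suc p)af g q ap Nc.z aX we g q
    n2 S = trans(cg Nc.nl(λ c → sym(trans(+-cong(zeroˡ _)(*-identityˡ _))(+-identityˡ _)))S)(trans(pP L Nc.z tU 0# 1#(g(suc p))(g q)
     S)(*-congʳ(trans(+-cong(*-identityʳ _)(trans(-‿cong(zeroʳ tU))-0#≈0#))(+-identityʳ _))))
    mL : W q af g q ap(-(tP * Nc.z))aX we g(suc q)
    mL S = trans(cn(tr(sy(proj₁ NW q qd N.1+n≢n))(proj₁(proj₂(proj₂ NN))))S)(trans(az(Na(suc p))y(g q)S)(trans(-‿cong
     (trans(cn n2 S)(ak Nc.z _ _ S)))(trans(-‿cong(*-congˡ(cn(tr(sy(rp q qd))(proj₁ UN q qd N.1+n≢n))S)))(trans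
     (-‿cong(*-congˡ(trans(proj₂(proj₂(proj₂ NN))S)(*-congˡ(trans(sym(proj₁ UN(suc q)Pj(λ e → N.<⇒≢(N.m<n⇒m<1+n N.≤-refl)(P.sym e))S))
     (rp(suc q)Pj S))))))(solve 3(λ z t w → :-(z :*(t :* w)):= :-(t :* z):* w)refl Nc.z tP _)))))
module Sl where
 open import Relation.Binary.PropositionalEquality.Core using(refl;sym;trans;cong;subst)
 open import Data.Bool.Base using(T)
 open import Data.Nat.Base using(_≤_;_<_)
 Ll : Set → Word → Set
 Ll X β = All(λ _ → X)β
 NL : ∀{β ae}→ Set → Move β ae → Set
 NL X trivalent = ⊤
 NL X(4-valent _)= X
 NL X(6-valent _)= X × X
 NL X(skip m)= NL X m
 rb : ∀{X β ae}(m : Move β ae)→ NL X m → Ll X β → Ll X ae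
 rb trivalent _(_ ∷ W ∷ Gs)= W ∷ Gs
 rb(4-valent _)M(_ ∷ W ∷ Gs)= M ∷ W ∷ Gs
 rb(6-valent _)(M , N)(_ ∷ _ ∷ W ∷ Gs)= M ∷ N ∷ W ∷ Gs
 rb(skip m)nw(W ∷ Gs)= W ∷ rb m nw Gs
 lL : ∀{X β}→ X → Ll X β → X
 lL U [] = U
 lL U(W ∷ Gs)= lL W Gs
 lr : ∀{X β ae}(m : Move β ae)nw(U : X)(Gs : Ll X β)→
  lL U(rb m nw Gs)≡ lL U Gs
 lr trivalent nw U(_ ∷ _ ∷ Gs)= refl
 lr(4-valent _)nw U(_ ∷ _ ∷ Gs)= refl
 lr(6-valent _)nw U(_ ∷ _ ∷ _ ∷ Gs)= refl
 lr(skip m)nw U(W ∷ Gs)= lr m nw W Gs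
 module La{X : Set}(P : ℕ →(ℕ → ℕ)→ X → X → Set)where
  Slice : ∀{β}→ Weights β → X → Ll X β → Set
  Slice [] U [] = ⊤
  Slice(_∷_{x = k}a γs)U(W ∷ Gs)= P k a U W × Slice γs W Gs
  Lb : ∀{β ae}→ Weave β ae →(v : ℕ)→ Weights β → X → Ll X β → Set
  Lb [] v γs U Gs = Slice γs U Gs
  Lb(m ∷ w)v γs U Gs = Slice γs U Gs ×
   ∃ λ nw → Lb w(v N.+ moveTrivalents m)(moveWeights m v γs)U(rb m nw Gs)
  tS : ∀{β ae}(w : Weave β ae){v γs U Gs}→ Lb w v γs U Gs → Slice γs U Gs
  tS [] s = s
  tS(m ∷ w)(s , _)= s
  bL : ∀{β ae}(w : Weave β ae){v γs U Gs}→ Lb w v γs U Gs → Ll X ae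
  bL []{Gs = Gs}_ = Gs
  bL(m ∷ w)(_ , _ , rt)= bL w rt
  bS : ∀{β ae}(w : Weave β ae){v γs U Gs}(l : Lb w v γs U Gs)→
   Slice(bottomWeights w v γs)U(bL w l)
  bS [] s = s
  bS(m ∷ w)(_ , _ , rt)= bS w rt
  ll : ∀{β ae}(w : Weave β ae){v γs U Gs}(l : Lb w v γs U Gs)→
   lL U(bL w l)≡ lL U Gs
  ll [] l = refl
  ll(m ∷ w){U = U}{Gs}(_ , nw , rt)=
   trans(ll w rt)(lr m nw U Gs)
 Be : ℕ →(ℕ → ℕ)→ Set
 Be v a = ∀ γ → v ≤ γ → a γ ≡ 0
 wN : ∀{v vb a}→ v ≤ vb → Be v a → Be vb a
 wN v7 b γ vR = b γ(N.≤-trans v7 vR)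
 data AW(Q :(ℕ → ℕ)→ Set): ∀{β}→ Weights β → Set where
  [] : AW Q []
  _∷_ : ∀{k β a}{γs : Weights β}→ Q a → AW Q γs → AW Q(_∷_{x = k}a γs)
 m* : ∀{Q Qa :(ℕ → ℕ)→ Set}{β}{γs : Weights β}→(∀{a}→ Q a → Qa a)→ AW Q γs → AW Qa γs
 m* f [] = []
 m* f(q ∷ qs)= f q ∷ m* f qs
 ti : ∀ v a c → trivalentOut v a c v ≡ 1
 ti v a c with v N.≡ᵇ v in eq
 ... | true = refl
 ... | false with()← subst T eq(N.≡⇒≡ᵇ v v refl)
 tO : ∀ v a c{γ}→(γ ≡ v → γ N.< 0)→ trivalentOut v a c γ ≡ a γ N.⊓ c γ
 tO v a c{γ}v3 with γ N.≡ᵇ v in eq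
 ... | false = refl
 ... | true with()← v3(N.≡ᵇ⇒≡ γ v(subst T(sym eq)tt))
 bJ : ∀{v a c}→ Be v a → Be v c → Be(suc v)(trivalentOut v a c)
 bJ{v}{a}{c}ba bc γ v! = trans
  (tO v a c λ{refl → ⊥-elim(N.<-irrefl refl v!)})
  (trans(cong(N._⊓ c γ)(ba γ(N.<⇒≤ v!)))refl)
 bm : ∀{β ae}(m : Move β ae)v(γs : Weights β)→ AW(Be v)γs →
  AW(Be(v N.+ moveTrivalents m))(moveWeights m v γs)
 bm trivalent v(a ∷ c ∷ γs)(ba ∷ bc ∷ bs)=
  wN{a = trivalentOut v a c}(N.≤-reflexive(N.+-comm 1 v))(bJ ba bc)
  ∷ m*(λ{a}→ wN{a = a}(N.m≤m+n v 1))bs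
 bm(4-valent _)v(a ∷ c ∷ γs)(ba ∷ bc ∷ bs)rewrite N.+-identityʳ v = bc ∷ ba ∷ bs
 bm(6-valent x)v(a ∷ f ∷ e ∷ γs)(ba ∷ bf ∷ be ∷ bs)rewrite N.+-identityʳ v =
  (λ γ vA → zI(ba γ vA)(bf γ vA)(be γ vA))∷(λ γ vA → cong(N._⊓ e γ)(ba γ vA))
  ∷(λ γ vA → zJ(ba γ vA)(bf γ vA)(be γ vA))∷ bs
  where
  zI : ∀{a f e}→ a ≡ 0 → f ≡ 0 → e ≡ 0 → f N.+ e N.∸(a N.⊓ e)≡ 0
  zI refl refl refl = refl
  zJ : ∀{a f e}→ a ≡ 0 → f ≡ 0 → e ≡ 0 → a N.+ f N.∸(a N.⊓ e)≡ 0
  zJ refl refl refl = refl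
 bm(skip m)v(a ∷ γs)(ba ∷ bs)=
  wN{a = a}(N.m≤m+n v(moveTrivalents m))ba ∷ bm m v γs bs
module KF where
 open IS
 open Ex
 open FB
 open Sl
 open import Data.Nat.Base using(∣_-_∣)
 m1 : ∀ m n → ∣ m - n ∣ ≡ 1 → m ≡ suc n ⊎ n ≡ suc m
 m1 zero(suc zero)eq = inj₂ P.refl
 m1(suc zero)zero eq = inj₁ P.refl
 m1(suc m)(suc n)eq with m1 m n eq
 ... | inj₁ P.refl = inj₁ P.refl
 ... | inj₂ P.refl = inj₂ P.refl
 mm : ∀{m n}→ 1 N.< ∣ m - n ∣ → m ≢ n
 mm{m}1< P.refl with ∣ m - m ∣ | N.∣n-n∣≡0 m
 mm()P.refl | _ | P.refl
 mb : ∀{m n}→ ∣ m - n ∣ ≡ 1 → m ≢ n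
 mb{m}eq P.refl with()← P.trans(P.sym eq)(N.∣n-n∣≡0 m)
 record FR(R : CommutativeRing 0ℓ 0ℓ)(S : Set): Set₁ where
  open CommutativeRing R
  field
   Known :(S → Carrier)→ Set
   kr : ∀{f h}→(∀ s → f s ≈ h s)→ Known f → Known h
   kn : ∀ c → Known(λ _ → c)
   k2 : ∀{f h}→ Known f → Known h → Known(λ s → f s + h s)
   ko : ∀{f h}→ Known f → Known h → Known(λ s → f s * h s)
 record FF(R : CommutativeRing 0ℓ 0ℓ)(S : Set): Set₁ where
  open CommutativeRing R
  field
   functionRing : FR R S
  open FR functionRing public
  field
   kj : ∀{f h}→(∀ s → f s * h s ≈ 1#)→ Known f → Known h
 VL : ℕ → ℕ → Set
 VL d k = 1 N.≤ k × k N.< d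
 vm : ∀{d β ae}→ Move β ae → All(VL d)β → All(VL d)ae
 vm trivalent(i ∷ _ ∷ ks)= i ∷ ks
 vm(4-valent _)(i ∷ j ∷ ks)= j ∷ i ∷ ks
 vm(6-valent _)(i ∷ j ∷ _ ∷ ks)= j ∷ i ∷ j ∷ ks
 vm(skip m)(k ∷ ks)= k ∷ vm m ks
 module Closure(R : CommutativeRing 0ℓ 0ℓ){S : Set}(aO : FR R S)where
  open CommutativeRing R
  open RingProperties ring
  open EA R
  open FR aO
  kG : ∀{f}→ Known f → Known(λ s → - f s)
  kG kf = kr(λ s → -1*x≈-x _)(ko(kn(- 1#))kf)
  Kn : ∀{n}→(S → Et n)→ Set
  Kn u = ∀ T → Known(λ s → u s T)
  kB : ∀{n}{u : S → Et n}→ Kn u → Kn(bh ∘ u)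
  kB ku [] = ku []
  kB ku(inside ∷ T)= kG(kB(ku ∘(inside ∷_))T)
  kB ku(outside ∷ T)= kB(ku ∘(outside ∷_))T
  kC : ∀{n}{u v : S → Et n}→ Kn u → Kn v → Kn(λ s → u s aI v s)
  kC ku kv [] = ko(ku [])(kv [])
  kC ku kv(inside ∷ T)= k2(kC(ku ∘(inside ∷_))(kv ∘(outside ∷_))T)
   (kC(kB(ku ∘(outside ∷_)))(kv ∘(inside ∷_))T)
  kC ku kv(outside ∷ T)= kC(ku ∘(outside ∷_))(kv ∘(outside ∷_))T
  Ka : ∀{n}→(S → Fin n → Carrier)→ Set
  Ka x = ∀ c → Known(λ s → x s c)
  k9 : ∀{n}{x : S → Fin n → Carrier}→ Ka x → Kn(vf ∘ x)
  k9 kx [] = kn 0#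
  k9 kx(inside ∷ T)= ko(kx Fin.zero)(kn(un T))
  k9 kx(outside ∷ T)= k9(kx ∘ Fin.suc)T
  kp : ∀{n}{u : S → Et n}{x}→ Kn u → Ka x → Kn(λ s → u s af x s)
  kp ku kx = kC ku(k9 kx)
  ki : ∀{n}i{u : S → Et n}→ Kn u → Kn(λ s → ct i(u s))
  ki Fin.zero ku(inside ∷ T)= kn 0#
  ki Fin.zero ku(outside ∷ T)= kB(ku ∘(inside ∷_))T
  ki(Fin.suc i)ku(inside ∷ T)= ki i(ku ∘(inside ∷_))T
  ki(Fin.suc i)ku(outside ∷ T)= ki i(ku ∘(outside ∷_))T
 module Po(R : CommutativeRing 0ℓ 0ℓ)(d : ℕ){S : Set}(aO : FF R S)where
  open CommutativeRing R
  open RingProperties ring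
  open EA R
  open Fm R d
  open FF aO
  open Closure R functionRing public
  Kw :(S → Fe)→ Set
  Kw g = ∀ i → Ka(λ s → g s i)
  kH : ∀{g}→ Kw g → ∀ k → Kn(λ s → we(g s)k)
  kH kg zero T = kn(un T)
  kH kg(suc k)= kp(kH kg k)(kg(suc k))
  kP : ∀{g}{u}→ Kw g → Kn u → ∀ k m → Kn(λ s → tail(g s)k m(u s))
  kP kg ku k zero = ku
  kP kg ku k(suc m)= kP kg(kp ku(kg(suc k)))(suc k)m
  Ko :(S → Fl)→ Set
  Ko U = ∀ k → k N.≤ d → Kn(λ s → U s k)
  record FO(U : S → Fl): Set where
   field
    frame : S → Fe
    d1 : ∀ s → de(frame s)≈ 1#
    rp : ∀ s → Re(frame s)(U s)
    km : Kw frame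
  open FO
  record CF(k : ℕ)(t : S → Carrier)(U W : S → Fl): Set where
   field
    crossing : ∀ s → Cr k(U s)(W s)(t s)
    ta : S → Carrier
    t1 : ∀ s → t s * ta s ≈ 1#
  open CF
  kJ : ∀{a b : S → Carrier}{x y : S → Ve}→ Known a → Known b → Ka x → Ka y →
   Ka(λ s c → a s * x s c + b s * y s c)
  kJ ka kb kx ky c = k2(ko ka(kx c))(ko kb(ky c))
  Kq : ∀ k{z t ta : S → Carrier}{g}→ Known z → Known t → Known ta → Kw g →
   Kw(λ s → t' k(z s)(t s)(ta s)(g s))
  Kq k kz kt KU kg i with i N.≡ᵇ k
  ... | true = kJ kz kt(kg k)(kg(suc k))
  ... | false with i N.≡ᵇ suc k
  ... | true = λ c → ko(kG KU)(kg k c)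
  ... | false = kg i
  nF : ∀{k t U W}→ VL d k → FO U → CF k t U W → Known t → Ko W → FO W
  nF{suc k}(_ , kh)F C kt kW = record
   {frame = λ s → T.turned s(t1 C s)
   ;d1 = λ s → T.tT s(t1 C s)
   ;rp = λ s → T.tu s(t1 C s)
   ;km = Kq(suc k)(kP(km F)(kW(suc k)(N.<⇒≤ kh))(suc k)(d ∸ suc k)full)
    kt(kj(t1 C)kt)(km F)
   }
   where module T s = Tu(d1 F s)kh(rp F s)(crossing C s)
  k? : ∀{k t U W}→ VL d k → CF k t U W → ∀ i → i N.≤ d → i ≢ k →
   Kn(λ s → W s i)→ Kn(λ s → U s i)
  k? _ C i iJ ix kW T = kr(λ s → sym(proj₁(crossing C s)i iJ ix T))(kW T)
  k$ : ∀{k t U W}→ VL d k → CF k t U W → ∀ i → i N.≤ d → i ≢ k →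
   Kn(λ s → U s i)→ Kn(λ s → W s i)
  k$ _ C i iJ ix kU T = kr(λ s → proj₁(crossing C s)i iJ ix T)(kU T)
  kX : ∀{k t U W}→ VL d k → CF k t U W → Ko U →
   Kn(λ s → W s k)→ Ko W
  kX{k}v C kU g~ i iJ with i N.≟ k
  ... | yes P.refl = g~
  ... | no ix = k$ v C i iJ ix(kU i iJ)
  k~ : ∀{t ta : S → Carrier}{u w : S → Et d}→(∀ s → t s * ta s ≈ 1#)→ Known t →
   (∀ s → t s aX u s ap w s)→ Kn w → Kn u
  k~{t}{ta}{u}{w}inverse kt t^ kw T = kr
   (λ s → trans(*-congˡ(sym(t^ s T)))(trans(sym(*-assoc _ _ _))
    (trans(*-congʳ(trans(*-comm _ _)(inverse s)))(*-identityˡ _))))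
   (ko(kj inverse kt)(kw T))
  Kx : ∀{u : S → Et d}→ Kn u → Kn(λ s → ⊝ u s)
  Kx ku T = kG(ku T)
  k5 : ∀{p q tU tP t* U Na Nb W}→ ∣ p - q ∣ ≡ 1 → VL d p → VL d q →
   FO U → Ko U → Ko W → Known tU → Known tP →
   CF p tU U Na → CF q tP Na Nb → CF p t* Nb W →
   Ko Na × Ko Nb
  k5{p}{q}{tU}{tP}{t*}{U}{Na}{Nb}{W}AE vp vq F kU kW K9 KX UN NN NW =
   KY , K'
   where
   pq = mb AE
   Kp : ∀{p q}→ p ≡ suc q ⊎ q ≡ suc p → VL d p → VL d q →
    CF p tU U Na → CF q tP Na Nb → CF p t* Nb W → Kn(λ s → Na s p)
   Kp{suc(suc q)}(inj₁ P.refl)(_ , Pj)(_ , qC)UN NN NW =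
    k~(t1 NN)KX
     (λ s → He.join(d1 F s)(rp F s){q = q}(N.<⇒≤ Pj)(crossing UN s)(crossing NN s)(crossing NW s))
     (Kx(kp(kW(suc q)(N.<⇒≤ qC))(km F(suc q))))
   Kp{suc zero}(inj₁ P.refl)vp((), _)UN NN NW
   Kp{suc p}(inj₂ P.refl)(_ , Pj)(_ , qC)UN NN NW T = kr
    (λ s → sym(Tu.nl(d1 F s)Pj(rp F s)(crossing UN s)T))
    (kp(kH(km F)p)(kJ kz K9(km F(suc p))(km F(suc(suc p))))T)
    where
    m = d ∸ suc(suc(suc p))
    kz : Known(λ s → e9(suc p)(frame F s)(Na s))
    kz = kr
     (λ s → trans(*-congˡ(sym(He.m%(d1 F s)(rp F s)qC(crossing UN s)(crossing NN s)(crossing NW s))))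
      (trans(sym(*-assoc _ _ _))(trans(*-congʳ(trans(*-comm _ _)(t1 NN s)))(*-identityˡ _))))
     (ko(kj(t1 NN)KX)
      (kG(kP(km F)(kp(kW(suc(suc p))(N.<⇒≤ qC))(km F(suc(suc p))))(suc(suc(suc p)))m full)))
   K2 = Kp(m1 p q AE)vp vq UN NN NW
   KY = kX vp UN kU K2
   K' = kX vq NN KY(k? vp NW q(N.<⇒≤(proj₂ vq))(pq ∘ P.sym)(kW q(N.<⇒≤(proj₂ vq))))
  k^ : ∀{p q tU tP U N W}→ p ≢ q → VL d p → VL d q → Ko U → Ko W →
   CF p tU U N → CF q tP N W → Ko N
  k^{p}pq vp vq kU kW UN NW =
   kX vp UN kU(k? vq NW p(N.<⇒≤(proj₂ vp))pq(kW p(N.<⇒≤(proj₂ vp))))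
  Ke : ∀{k a b c U M W}→ VL d k → FO U → Ko U → Ko W →
   Known a → Known b → Known c →
   CF k a U M → CF k c M W → CF k b U W → Ko M
  Ke{suc k}{a}{b}{c}{U}{M}{W}v@(_ , kh)F kU kW ka kb kc UM MW UW =
   kX v UM kU(k~(t1 UW)kb
    (λ s → tK(d1 F s)kh(rp F s)(crossing UM s)(crossing MW s)(crossing UW s))
    λ T → k2(ko kc(kU(suc k)(N.<⇒≤ kh)T))(ko ka(kW(suc k)(N.<⇒≤ kh)T)))
module KW where
 open IS
 open Ex
 open FB
 open Sl
 open KF
 module WP(R : CommutativeRing 0ℓ 0ℓ)(d : ℕ){S : Set}(aO : FF R S)
  {N : ℕ}(c ca : S → Fin N → CommutativeRing.Carrier R)
  (c1 : ∀ s γ → CommutativeRing._≈_ R(CommutativeRing._*_ R(c s γ)(ca s γ))(CommutativeRing.1# R))where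
  open CommutativeRing R
  open RingProperties ring
  open EA R
  open Fm R d
  open FF aO
  open Po R d aO
  open FO
  open CF
  open RawSemiringDefs(Semiring.rawSemiring semiring)using(product;_^_)
  open SemiringExp semiring using(^-congˡ;^-cong)
  open CommutativeSemiringExp commutativeSemiring using(^-distrib-*)
  module g' = CommutativeMonoidSum *-commutativeMonoid
  value :(ℕ → ℕ)→ S → Carrier
  value a s = product λ γ → c s γ ^ a(toℕ γ)
  pc : ∀{n}{f h : Fin n → Carrier}→(∀ i → f i ≈ h i)→ product f ≈ product h
  pc{zero}fw = refl
  pc{suc n}fw = *-cong(fw Fin.zero)(pc{n}(fw ∘ Fin.suc))
  pz : ∀{n}(f h : Fin n → Carrier)→ product(λ i → f i * h i)≈ product f * product h
  pz{n}f h = g'.∑-distrib-+{n}f h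
  pd : ∀ n → product{n}(λ _ → 1#)≈ 1#
  pd n = g'.sum-replicate-zero n
  nH : ∀ n → 1# ^ n ≈ 1#
  nH zero = refl
  nH(suc n)= trans(*-identityˡ _)(nH n)
  vl : ∀ a s → value a s *(product λ γ → ca s γ ^ a(toℕ γ))≈ 1#
  vl a s = trans(sym(pz(λ γ → c s γ ^ a(toℕ γ))(λ γ → ca s γ ^ a(toℕ γ))))(trans(pc{N}λ γ →
   trans(sym(^-distrib-* _ _(a(toℕ γ))))(trans(^-congˡ(a(toℕ γ))(c1 s γ))(nH(a(toℕ γ)))))(pd N))
  Kf : ∀{f}n → Known f → Known(λ s → f s ^ n)
  Kf zero kf = kn 1#
  Kf(suc n)kf = ko kf(Kf n kf)
  kF : ∀{n}{f : S → Fin n → Carrier}→(∀ i → Known(λ s → f s i))→ Known(λ s → product(f s))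
  kF{zero}kf = kn 1#
  kF{suc n}kf = ko(kf Fin.zero)(kF{n}(kf ∘ Fin.suc))
  kY : ∀{v}a →(∀ γ → toℕ γ N.< v → Known(λ s → c s γ))→ Be v a → Known(value a)
  kY{v}a kc bA = kF{N}{λ s γ → c s γ ^ a(toℕ γ)}fL
   where
   fL : ∀ γ → Known(λ s → c s γ ^ a(toℕ γ))
   fL γ with toℕ γ N.<? v
   ... | yes vt = Kf(a(toℕ γ))(kc γ vt)
   ... | no vT = kr(λ s → reflexive(P.cong(c s γ ^_)(P.sym(bA(toℕ γ)(N.≮⇒≥ vT)))))(kn 1#)
  pk : ∀{n}{f fc : Fin n → Carrier}i x → f i ≈ x * fc i →(∀ j → j ≢ i → f j ≈ fc j)→
   product f ≈ x * product fc
  pk{suc n}Fin.zero x Aw oi =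
   trans(*-cong Aw(pc{n}λ j → oi(Fin.suc j)λ()))(*-assoc _ _ _)
  pk{suc n}(Fin.suc i)x Aw oi = trans
   (*-cong(oi Fin.zero λ())(pk{n}i x Aw λ j ji → oi(Fin.suc j)λ{P.refl → ji P.refl}))
   (trans(sym(*-assoc _ _ _))(trans(*-congʳ(*-comm _ _))(*-assoc _ _ _)))
  Cs : ℕ →(ℕ → ℕ)→(S → Fl)→(S → Fl)→ Set
  Cs k a U W = CF k(value a)U W
  open La Cs
  KL : ∀{β}→ Ll(S → Fl)β → Set
  KL [] = ⊤
  KL(W ∷ Gs)= Ko W × KL Gs
  um : ∀{β ae}(m : Move β ae)v(γs : Weights β){U}Gs nw → All(VL d)β →
   (∀ a → Known(value a))→ FO U → Ko U →
   Slice γs U Gs → Slice(moveWeights m v γs)U(rb m nw Gs)→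
   KL(rb m nw Gs)→ KL Gs
  um trivalent v(a ∷ e ∷ γs)(M ∷ W ∷ Gs)nw(vi ∷ _)kv F kU(UM , MW , _)(UW , _)(kW , Ku)=
   Ke vi F kU kW(kv a)(kv(trivalentOut v a e))(kv e)UM MW UW , kW , Ku
  um(4-valent fv)v(a ∷ e ∷ γs)(M ∷ W ∷ Gs)N(vi ∷ vj ∷ _)kv F kU(UM , MW , _)_(_ , kW , Ku)=
   k^(mm fv)vi vj kU kW UM MW , kW , Ku
  um(6-valent nd)v(a ∷ f ∷ e ∷ γs)(M₁ ∷ M₂ ∷ W ∷ Gs)N(vi ∷ vj ∷ _)kv F kU
   (UM , MM , MW , _)_(_ , _ , kW , Ku)=
   proj₁ kM , proj₂ kM , kW , Ku
   where kM = k5 nd vi vj F kU kW(kv a)(kv f)UM MM MW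
  um(skip m)v(a ∷ γs)(W ∷ Gs)nw(vk ∷ vs)kv F kU(UW , s)(_ , S4)(kW , Ku)=
   kW , um m v γs Gs nw vs kv(nF vk F UW(kv a)kW)kW s S4 Ku
  uA : ∀{β ae}(w : Weave β ae){v γs U Gs}→ All(VL d)β →(∀ a → Known(value a))→
   FO U → Ko U →(l : Lb w v γs U Gs)→ KL(bL w l)→ KL Gs
  uA [] vs kv F kU l Ku = Ku
  uA(m ∷ w){v}{γs}{U}{Gs}vs kv F kU(s , nw , rt)kb =
   um m v γs Gs nw vs kv F kU s(tS w rt)(uA w(vm m vs)kv F kU rt kb)
  kA : ∀{k t U W}→ VL d k → FO U → Ko W → CF k t U W → Known t
  kA{suc k}{t}{U}{W}(_ , kh)F kW UW = kr v1
   (kG(kP(km F)(kp(kW(suc k)(N.<⇒≤ kh))(km F(suc k)))(suc(suc k))(d ∸ suc(suc k))full))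
   where
   open SetoidReasoning setoid
   open In R
   v1 : ∀ s → - top(tail(frame F s)(suc(suc k))(d ∸ suc(suc k))(W s(suc k)af frame F s(suc k)))≈ t s
   v1 s = trans(-‿cong(trans(tc g(suc(suc k))m mL _)(td g(suc(suc k))m _ _ _)))(trans(-‿cong(*-congˡ(trans(tw g(suc
    (suc k))kh)(d1 F s))))(trans(-‿cong(*-identityʳ _))(-‿involutive _)))
    where
    g = frame F s
    m = d ∸ suc(suc k)
    x = g(suc k)
    y = g(suc(suc k))
    module T = Tu(d1 F s)kh(rp F s)(crossing UW s)
    mL : W s(suc k)af x ap(- t s)aX we g(suc(suc k))
    mL T = trans(cg T.nl(λ c → sym(trans(+-cong(*-identityˡ _)(zeroˡ _))(+-identityʳ _)))T)(trans(pP(we g k)T.z(t s)1# 0# x y T)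
     (*-congʳ(trans(+-cong(zeroʳ _)(-‿cong(*-identityʳ _)))(+-identityˡ _))))
  KB : ℕ → Set
  KB v = ∀ γ → toℕ γ N.< v → Known(λ s → c s γ)
  dw : ∀{β ae}(m : Move β ae)v(γs : Weights β){U}Gs nw → All(VL d)β →
   KB v → AW(Be v)γs → FO U → Ko U →
   Slice γs U Gs → Slice(moveWeights m v γs)U(rb m nw Gs)→
   KL Gs → v N.+ moveTrivalents m N.≤ N →
   KL(rb m nw Gs)× KB(v N.+ moveTrivalents m)
  dw trivalent v(a ∷ e ∷ γs){U}(M ∷ W ∷ Gs)nw(vi ∷ _)kc(ba ∷ be ∷ _)F kU(UM , MW , _)(UW , _)(_ , kW , Ku)v& =
   (kW , Ku), Kr
   where
   b = trivalentOut v a e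
   bd : ℕ → ℕ
   bd γ = a γ N.⊓ e γ
   bU : Be v bd
   bU γ vA = P.cong(N._⊓ e γ)(ba γ vA)
   vN : v N.< N
   vN = P.subst(N._≤ N)(N.+-comm v 1)v&
   i = Fin.fromℕ< vN
   tX : toℕ i ≡ v
   tX = O.toℕ-fromℕ< vN
   sJ : ∀ s → value b s ≈ c s i * value bd s
   sJ s = pk{N}{λ γ → c s γ ^ b(toℕ γ)}{λ γ → c s γ ^ bd(toℕ γ)}i(c s i)
    (trans(^-cong refl(P.trans(P.cong b tX)(ti v a e)))
     (*-congˡ(reflexive(P.cong(c s i ^_)(P.sym(P.trans(P.cong bd tX)(bU v N.≤-refl)))))))
    (λ j ji → ^-cong refl(tO v a e λ jv → ⊥-elim(ji(O.toℕ-injective(P.trans jv(P.sym tX))))))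
   Ks : Known(λ s → c s i)
   Ks = kr
    (λ s → trans(*-congʳ(sJ s))(trans(*-assoc _ _ _)(trans(*-congˡ(vl bd s))(*-identityʳ _))))
    (ko(kA vi F kW UW)(kj(vl bd)(kY bd kc bU)))
   Kr : KB(v N.+ 1)
   Kr γ v~ with toℕ γ N.<? v
   ... | yes vt = kc γ vt
   ... | no vT = P.subst(λ j → Known(λ s → c s j))(O.toℕ-injective(P.trans tX
    (N.≤-antisym(N.≮⇒≥ vT)(N.s≤s⁻¹(P.subst(toℕ γ N.<_)(N.+-comm v 1)v~)))))Ks
  dw(4-valent fv)v(a ∷ e ∷ γs)(M ∷ W ∷ Gs)Nc(vi ∷ vj ∷ _)kc bs F kU _(UN , NW , _)(_ , kW , Ku)_ =
   (k^(mm fv ∘ P.sym)vj vi kU kW UN NW , kW , Ku),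
   P.subst KB(P.sym(N.+-identityʳ v))kc
  dw(6-valent{i}{j}nd)v(a ∷ f ∷ e ∷ γs)(M₁ ∷ M₂ ∷ W ∷ Gs)_(vi ∷ vj ∷ _)kc bs F kU
   _(UN , NN , NW , _)(_ , _ , kW , Ku)_
   with bb ∷ bc ∷ _ ← P.subst(λ vb → AW(Be vb)(moveWeights(6-valent{i}{j}nd)v(a ∷ f ∷ e ∷ γs)))
    (N.+-identityʳ v)(bm(6-valent{i}{j}nd)v(a ∷ f ∷ e ∷ γs)bs)=
   (proj₁ kN , proj₂ kN , kW , Ku), P.subst KB(P.sym(N.+-identityʳ v))kc
   where
   kN = k5(P.trans(N.∣-∣-comm j i)nd)vj vi F kU kW(kY _ kc bb)(kY _ kc bc)UN NN NW
  dw(skip m)v(a ∷ γs)(W ∷ Gs)nw(vk ∷ vs)kc(ba ∷ bs)F kU(UW , s)(_ , S4)(kW , Ku)vJ =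
   (kW , proj₁ rt), proj₂ rt
   where rt = dw m v γs Gs nw vs kc bs(nF vk F UW(kY a kc ba)kW)kW s S4 Ku vJ
  d6 : ∀{β ae}(w : Weave β ae){v γs U Gs}→ All(VL d)β → KB v → AW(Be v)γs →
   FO U → Ko U → Lb w v γs U Gs → KL Gs → v N.+ trivalents w N.≤ N →
   KB(v N.+ trivalents w)
  d6 []{v}vs kc bs F kU l Ku vJ = P.subst KB(P.sym(N.+-identityʳ v))kc
  d6(m ∷ w){v}{γs}{U}{Gs}vs kc bs F kU(s , nw , rt)Ku vJ =
   P.subst KB(N.+-assoc v(moveTrivalents m)(trivalents w))
    (d6 w(vm m vs)(proj₂ bA)(bm m v γs bs)F kU rt(proj₁ bA)vU)
   where
   vU : v N.+ moveTrivalents m N.+ trivalents w N.≤ N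
   vU = P.subst(N._≤ N)(P.sym(N.+-assoc v(moveTrivalents m)(trivalents w)))vJ
   bA = dw m v γs Gs nw vs kc bs F kU s(tS w rt)Ku(N.m+n≤o⇒m≤o _ vU)
module Wo where
 open Sl
 open KF
 open import Relation.Binary.PropositionalEquality.Core using(refl;sym;trans;cong;cong₂;subst)
 open import Data.Bool.Base using(T)
 open import Data.Nat.Base using(_<_)
 fa : ∀{m n}→ m ≢ n →(m N.≡ᵇ n)≡ false
 fa{m}{n}m' with m N.≡ᵇ n in eq
 ... | false = refl
 ... | true = ⊥-elim(m'(N.≡ᵇ⇒≡ m n(subst T(sym eq)tt)))
 rl : ∀ n →(n N.≡ᵇ n)≡ true
 rl zero = refl
 rl(suc n)= rl n
 tF : ∀ k → transposition k k ≡ suc k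
 tF k rewrite rl k = refl
 tb : ∀ k → transposition k(suc k)≡ k
 tb k rewrite fa(N.1+n≢n{k})| rl k = refl
 tf : ∀{k x}→ x ≢ k → x ≢ suc k → transposition k x ≡ x
 tf xg xk rewrite fa xg | fa xk = refl
 data TV(k : ℕ): ℕ → Set where
  at : TV k k
  aH : TV k(suc k)
  oa : ∀{x}→ x ≢ k → x ≢ suc k → TV k x
 tV : ∀ k x → TV k x
 tV k x with x N.≟ k
 ... | yes refl = at
 ... | no xg with x N.≟ suc k
 ... | yes refl = aH
 ... | no xk = oa xg xk
 tv : ∀ k x → transposition k(transposition k x)≡ x
 tv k x with tV k x
 ... | at = trans(cong(transposition k)(tF k))(tb k)
 ... | aH = trans(cong(transposition k)(tb k))(tF k)
 ... | oa xg xk = trans(cong(transposition k)(tf xg xk))(tf xg xk)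
 tY : ∀ k{x y}→ transposition k x ≡ transposition k y → x ≡ y
 tY k{x}{y}eq = trans(sym(tv k x))(trans(cong(transposition k)eq)(tv k y))
 pm : ∀ β{x y}→ permutation β x ≡ permutation β y → x ≡ y
 pm [] eq = eq
 pm(k ∷ β)eq = pm β(tY k eq)
 pb : ∀ A B x → permutation(A ++ B)x ≡ permutation A(permutation B x)
 pb [] B x = refl
 pb(k ∷ A)B x = cong(transposition k)(pb A B x)
 tm : ∀ k{x y}→ x < y → ¬(x ≡ k × y ≡ suc k)→ transposition k x < transposition k y
 tm k{x}{y}xf ot with tV k x | tV k y
 ... | at | at = ⊥-elim(N.<-irrefl refl xf)
 ... | at | aH = ⊥-elim(ot(refl , refl))
 ... | at | oa ye yk rewrite tF k | tf ye yk = N.≤∧≢⇒< xf(yk ∘ sym)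
 ... | aH | at = ⊥-elim(N.<-asym xf N.≤-refl)
 ... | aH | aH = ⊥-elim(N.<-irrefl refl xf)
 ... | aH | oa ye yk rewrite tb k | tf ye yk = N.<-trans N.≤-refl xf
 ... | oa xg xk | at rewrite tF k | tf xg xk = N.<-trans xf N.≤-refl
 ... | oa xg xk | aH rewrite tb k | tf xg xk = N.≤∧≢⇒<(N.s≤s⁻¹ xf)xg
 ... | oa xg xk | oa ye yk rewrite tf xg xk | tf ye yk = xf
 exchange : ∀{d}A → All(VL d)A → ∀ k → permutation A(suc k)< permutation A k →
  ∃ λ Ab → All(VL d)Ab × suc(length Ab)≡ length A
   ×(∀ x → permutation Ab x ≡ permutation A(transposition k x))
 exchange [] _ k K3 = ⊥-elim(N.<-asym K3 N.≤-refl)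
 exchange(j ∷ Ak)(vj ∷ v)k d' with N.<-cmp(permutation Ak(suc k))(permutation Ak k)
 ... | tri< lt _ _ with exchange Ak v k lt
 ... | Ab , vb , Lr , eq = j ∷ Ab , vj ∷ vb , cong suc Lr , cong(transposition j)∘ eq
 exchange(j ∷ Ak)(vj ∷ v)k d' | tri≈ _ same _ = ⊥-elim(N.1+n≢n(pm Ak same))
 exchange(j ∷ Ak)(vj ∷ v)k d' | tri> _ _ gt
  with permutation Ak k N.≟ j | permutation Ak(suc k)N.≟ suc j
 ... | no ne | _ = ⊥-elim(N.<-asym d'(tm j gt(ne ∘ proj₁)))
 ... | yes _ | no ne = ⊥-elim(N.<-asym d'(tm j gt(ne ∘ proj₂)))
 ... | yes Ai | yes Az = Ak , v , refl , same
  where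
  same : ∀ x → permutation Ak x ≡ transposition j(permutation Ak(transposition k x))
  same x with tV k x
  ... | at rewrite tF k | Ai | Az = sym(tb j)
  ... | aH rewrite tb k | Ai | Az = sym(tF j)
  ... | oa xg xk rewrite tf xg xk = sym(tf
   (λ eq → xg(pm Ak(trans eq(sym Ai))))
   (λ eq → xk(pm Ak(trans eq(sym Az)))))
 Ac :(ℕ → ℕ)→ Word → Set
 Ac w [] = ⊤
 Ac w(k ∷ β)= w k < w(suc k)× Ac(w ∘ transposition k)β
 aP : ∀ β{w wb}→(∀ x → w x ≡ wb x)→ Ac w β → Ac wb β
 aP [] eq _ = tt
 aP(k ∷ β)eq(lt , r)= N.≤-trans(N.≤-reflexive(cong suc(sym(eq k))))(N.≤-trans lt(N.≤-reflexive(eq(suc k))))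
  , aP β(eq ∘ transposition k)r
 rk : ∀{d}β → All(VL d)β → ReducedWord d β → Ac id β
 rk{d}β v/ RB = go [] β refl
  where
  go : ∀ A B → A ++ B ≡ β → Ac(permutation A)B
  go A [] _ = tt
  go A(k ∷ B)refl with N.<-cmp(permutation A k)(permutation A(suc k))
  ... | tri< lt _ _ = lt , aP B(pb A(k ∷ []))
   (go(A ++ k ∷ [])B(List.++-assoc A(k ∷ [])B))
  ... | tri≈ _ same _ = ⊥-elim(N.1+n≢n(sym(pm A same)))
  ... | tri> _ _ gt with exchange A(All.++⁻ˡ A v/)k gt
  ... | Ab , v? , Lr , eq = ⊥-elim(N.<⇒≱ e'(RB(Ab ++ B)(All.++⁺ v?(All.tail(All.++⁻ʳ A v/)))same))
   where
   same : ∀ x → permutation(Ab ++ B)x ≡ permutation(A ++ k ∷ B)x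
   same x = trans(pb Ab B x)(trans(eq(permutation B x))(sym(pb A(k ∷ B)x)))
   e' : length(Ab ++ B)< length(A ++ k ∷ B)
   e' rewrite List.length-++ Ab{B}| List.length-++ A{k ∷ B}| sym Lr =
    N.≤-trans(N.n≤1+n _)(N.≤-reflexive(cong suc(sym(N.+-suc(length Ab)(length B)))))
 opaque
  sx : ℕ →(ℕ → ℕ)→ ℕ → ℕ
  sx k w i = if i N.≡ᵇ k then w k ⊔ w(suc k)else if i N.≡ᵇ suc k then w k ⊓ w(suc k)else w i
  sb : ∀ k w → sx k w k ≡ w k ⊔ w(suc k)
  sb k w rewrite rl k = refl
  sa : ∀ k w → sx k w(suc k)≡ w k ⊓ w(suc k)
  sa k w rewrite fa(N.1+n≢n{k})| rl k = refl
  sr : ∀{k i}w → i ≢ k → i ≢ suc k → sx k w i ≡ w i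
  sr w ix ik rewrite fa ix | fa ik = refl
 S% : ∀ k{w wb}→(∀ i → w i ≡ wb i)→ ∀ i → sx k w i ≡ sx k wb i
 S% k{w}{wb}eq i with tV k i
 ... | at = trans(sb k w)(trans(cong₂ _⊔_(eq k)(eq(suc k)))(sym(sb k wb)))
 ... | aH = trans(sa k w)(trans(cong₂ _⊓_(eq k)(eq(suc k)))(sym(sa k wb)))
 ... | oa p q = trans(sr w p q)(trans(eq i)(sym(sr wb p q)))
 sW : Word →(ℕ → ℕ)→ ℕ → ℕ
 sW [] w = w
 sW(k ∷ β)w = sW β(sx k w)
 sK : ∀ β{w wb}→(∀ i → w i ≡ wb i)→ ∀ i → sW β w i ≡ sW β wb i
 sK [] eq = eq
 sK(k ∷ β)eq = sK β(S% k eq)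
 sR : ∀ A B w → sW(A ++ B)w ≡ sW B(sW A w)
 sR [] B w = refl
 sR(k ∷ A)B w = sR A B(sx k w)
 infix 4 _eU_
 _eU_ : Word → Word → Set
 β eU ae = ∀ w i → sW β w i ≡ sW ae w i
 b< : ∀ k{β ae}→ β eU ae → k ∷ β eU k ∷ ae
 b< k p w = p(sx k w)
 pf : ∀ A Ab B → A eU Ab → A ++ B eU Ab ++ B
 pf A Ab B p w i = trans(cong(λ f → f i)(sR A B w))
  (trans(sK B(p w)i)(sym(cong(λ f → f i)(sR Ab B w))))
 s' : ∀ k → k ∷ k ∷ [] eU k ∷ []
 s' k w i with tV k i
 ... | at = trans(sb k _)(trans(cong₂ _⊔_(sb k w)(sa k w))
  (trans(N.m≥n⇒m⊔n≡m(N.m⊓n≤m⊔n(w k)(w(suc k))))(sym(sb k w))))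
 ... | aH = trans(sa k _)(trans(cong₂ _⊓_(sb k w)(sa k w))
  (trans(N.m≥n⇒m⊓n≡n(N.m⊓n≤m⊔n(w k)(w(suc k))))(sym(sa k w))))
 ... | oa p q = sr(sx k w)p q
 fi : ∀{i j}→ 1 < N.∣ i - j ∣ → i ≢ j × i ≢ suc j × suc i ≢ j
 fi{i}{j}fv = mm fv
  ,(λ{refl → N.<-irrefl(sym(one j))fv})
  ,(λ{refl → N.<-irrefl(sym(trans(N.∣-∣-comm i(suc i))(one i)))fv})
  where
  one : ∀ j → N.∣ suc j - j ∣ ≡ 1
  one zero = refl
  one(suc j)= one j
 Sg : ∀{i j}→ 1 < N.∣ i - j ∣ → i ∷ j ∷ [] eU j ∷ i ∷ []
 Sg{i}{j}fv w x with fi{i}{j}fv | tV i x | tV j x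
 ... | iT , iB , iC | at | at = ⊥-elim(iT refl)
 ... | iT , iB , iC | at | aH = ⊥-elim(iB refl)
 ... | iT , iB , iC | at | oa p q = trans(sr(sx i w)p q)(trans(sb i w)
  (sym(trans(sb i(sx j w))(cong₂ _⊔_(sr w p q)(sr w iC(iT ∘ N.suc-injective))))))
 ... | iT , iB , iC | aH | at = ⊥-elim(iC refl)
 ... | iT , iB , iC | aH | aH = ⊥-elim(iT refl)
 ... | iT , iB , iC | aH | oa p q = trans(sr(sx i w)p q)(trans(sa i w)
  (sym(trans(sa i(sx j w))(cong₂ _⊓_(sr w iT iB)(sr w p q)))))
 ... | iT , iB , iC | oa p q | at = trans(sb j(sx i w))(trans
  (cong₂ _⊔_(sr w p q)(sr w(iB ∘ sym)(iT ∘ sym ∘ N.suc-injective)))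
  (sym(trans(sr(sx j w)p q)(sb j w))))
 ... | iT , iB , iC | oa p q | aH = trans(sa j(sx i w))(trans
  (cong₂ _⊓_(sr w(iT ∘ sym)(iC ∘ sym))(sr w p q))
  (sym(trans(sr(sx j w)p q)(sa j w))))
 ... | iT , iB , iC | oa p q | oa p′ qa = trans(sr(sx i w)p′ qa)(trans(sr w p q)
  (sym(trans(sr(sx j w)p q)(sr w p′ qa))))
 SP : ∀ k → k ∷ suc k ∷ k ∷ [] eU suc k ∷ k ∷ suc k ∷ []
 SP k w = go
  where
  a = w k
  b = w(suc k)
  c = w(suc(suc k))
  w₁ = sx k w
  w₂ = sx(suc k)w₁
  vQ = sx(suc k)w
  v2 = sx k vQ
  kl : ∀{k}→ k ≢ suc(suc k)
  kl{suc k}eq = kl(N.suc-injective eq)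
  wQ : w₂ k ≡ a ⊔ b
  wQ = trans(sr w₁(N.1+n≢n ∘ sym)kl)(sb k w)
  wG : w₂(suc k)≡(a ⊓ b)⊔ c
  wG = trans(sb(suc k)w₁)(cong₂ _⊔_(sa k w)(sr w(kl ∘ sym)N.1+n≢n))
  wD : w₂(suc(suc k))≡(a ⊓ b)⊓ c
  wD = trans(sa(suc k)w₁)(cong₂ _⊓_(sa k w)(sr w(kl ∘ sym)N.1+n≢n))
  v8 : v2 k ≡ a ⊔(b ⊔ c)
  v8 = trans(sb k vQ)(cong₂ _⊔_(sr w(N.1+n≢n ∘ sym)kl)(sb(suc k)w))
  vS : v2(suc k)≡ a ⊓(b ⊔ c)
  vS = trans(sa k vQ)(cong₂ _⊓_(sr w(N.1+n≢n ∘ sym)kl)(sb(suc k)w))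
  vC : v2(suc(suc k))≡ b ⊓ c
  vC = trans(sr vQ(kl ∘ sym)N.1+n≢n)(sa(suc k)w)
  m8 :(a ⊔ b)⊔((a ⊓ b)⊔ c)≡ a ⊔(b ⊔ c)
  m8 = trans(sym(N.⊔-assoc(a ⊔ b)(a ⊓ b)c))
   (trans(cong(_⊔ c)(N.m≥n⇒m⊔n≡m(N.m⊓n≤m⊔n a b)))(N.⊔-assoc a b c))
  m9 :(a ⊓ b)⊓ c ≡(a ⊓(b ⊔ c))⊓(b ⊓ c)
  m9 = trans(N.⊓-assoc a b c)(sym(trans(N.⊓-assoc a(b ⊔ c)(b ⊓ c))
   (cong(a ⊓_)(N.m≥n⇒m⊓n≡n(N.m⊓n≤m⊔n b c)))))
  m+ :(a ⊔ b)⊓((a ⊓ b)⊔ c)≡(a ⊓(b ⊔ c))⊔(b ⊓ c)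
  m+ = trans(N.⊓-distribˡ-⊔(a ⊔ b)(a ⊓ b)c)
   (trans(cong₂ _⊔_(N.m≥n⇒m⊓n≡n(N.m⊓n≤m⊔n a b))(N.⊓-distribʳ-⊔ c a b))
   (trans(sym(N.⊔-assoc(a ⊓ b)(a ⊓ c)(b ⊓ c)))(cong(_⊔(b ⊓ c))(sym(N.⊓-distribˡ-⊔ a b c)))))
  go : ∀ i → sx k w₂ i ≡ sx(suc k)v2 i
  go i with tV k i
  ... | at = trans(sb k w₂)(trans(cong₂ _⊔_ wQ wG)(trans m8
   (sym(trans(sr v2(N.1+n≢n ∘ sym)kl)v8))))
  ... | aH = trans(sa k w₂)(trans(cong₂ _⊓_ wQ wG)(trans m+
   (sym(trans(sb(suc k)v2)(cong₂ _⊔_ vS vC)))))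
  ... | oa ix ik with i N.≟ suc(suc k)
  ... | yes refl = trans(sr w₂ ix ik)(trans wD(trans m9
   (sym(trans(sa(suc k)v2)(cong₂ _⊓_ vS vC)))))
  ... | no i8 = trans(sr w₂ ix ik)(trans(sr w₁ ik i8)(trans(sr w ix ik)
   (sym(trans(sr v2 ik i8)(trans(sr vQ ix ik)(sr w ik i8))))))
module BP where
 open Sl
 open KF
 open Wo
 open import Relation.Binary.PropositionalEquality.Core using(refl;sym;trans;cong;subst)
 open import Data.Nat.Base using(_≤_;_<_)
 kI : ℕ → ℕ → Word → Word
 kI zero k β = k ∷ β
 kI(suc _)k β = β
 ze : ∀{β}→ Weights β → ℕ → Word
 ze [] γ = []
 ze(_∷_{x = k}a γs)γ = kI(a γ)k(ze γs γ)
 k6 : ∀{n}k β → 0 < n → kI n k β ≡ β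
 k6 k β(s≤s _)= refl
 Kk : ∀ n k{β ae}→ β eU ae → kI n k β eU kI n k ae
 Kk zero k{β}{ae}p = b< k{β}{ae}p
 Kk(suc _)k p = p
 Bg : ∀{i j}→ N.∣ i - j ∣ ≡ 1 → i ∷ j ∷ i ∷ [] eU j ∷ i ∷ j ∷ []
 Bg{i}{j}nd with m1 i j nd
 ... | inj₁ refl = λ w x → sym(SP j w x)
 ... | inj₂ refl = SP i
 b* : ∀{β ae}→ β ≡ ae → β eU ae
 b* refl w i = refl
 zr : ∀{i j}→ N.∣ i - j ∣ ≡ 1 → ∀ x y z ρ →
  kI x i(kI y j(kI z i ρ))
  eU kI(y N.+ z ∸(x ⊓ z))j(kI(x ⊓ z)i(kI(x N.+ y ∸(x ⊓ z))j ρ))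
 zr{i}{j}nd zero zero zero ρ = pf(i ∷ j ∷ i ∷ [])(j ∷ i ∷ j ∷ [])ρ(Bg nd)
 zr nd zero zero(suc z)ρ = λ w x → refl
 zr{i}nd zero(suc y)zero ρ = pf(i ∷ i ∷ [])(i ∷ [])ρ(s' i)
 zr nd zero(suc y)(suc z)ρ = λ w x → refl
 zr nd(suc x)zero zero ρ = λ w x → refl
 zr nd(suc x)(suc y)zero ρ = λ w x → refl
 zr{i}{j}nd(suc x)zero(suc z)ρ with N.≤-total x z
 ... | inj₁ xN rewrite N.m≤n⇒m⊓n≡m xN | N.+-identityʳ x | N.n∸n≡0 x with z ∸ x
 ... | zero = λ w y → sym(pf(j ∷ j ∷ [])(j ∷ [])ρ(s' j)w y)
 ... | suc _ = λ w y → refl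
 zr{i}{j}nd(suc x)zero(suc z)ρ | inj₂ zQ
  rewrite N.m≥n⇒m⊓n≡n zQ | N.+-identityʳ x | N.n∸n≡0 z with x ∸ z
 ... | zero = λ w y → sym(pf(j ∷ j ∷ [])(j ∷ [])ρ(s' j)w y)
 ... | suc _ = λ w y → refl
 zr{i}{j}nd(suc x)(suc y)(suc z)ρ = b*(sym(trans
  (k6 j _(N.m<n⇒0<n∸m(N.<-≤-trans(s≤s(N.m⊓n≤n x z))(N.m≤n+m(suc z)y))))
  (k6 j ρ(N.m<n⇒0<n∸m(N.≤-<-trans(N.m⊓n≤m x z)(N.m<m+n x(s≤s z≤n)))))))
 zm : ∀{β ae}(m : Move β ae){v}γs{γ}→ γ < v → ze γs γ eU ze(moveWeights m v γs)γ
 zm(trivalent{i}){v}(a ∷ c ∷ γs){γ}vt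
  rewrite tO v a c(λ v^ → ⊥-elim(N.<⇒≢ vt v^))with a γ | c γ
 ... | zero | zero = pf(i ∷ i ∷ [])(i ∷ [])(ze γs γ)(s' i)
 ... | zero | suc _ = λ w x → refl
 ... | suc _ | zero = λ w x → refl
 ... | suc _ | suc _ = λ w x → refl
 zm(4-valent{i}{j}fv)(a ∷ c ∷ γs){γ}vt with a γ | c γ
 ... | zero | zero = pf(i ∷ j ∷ [])(j ∷ i ∷ [])(ze γs γ)(Sg{i}{j}fv)
 ... | zero | suc _ = λ w x → refl
 ... | suc _ | zero = λ w x → refl
 ... | suc _ | suc _ = λ w x → refl
 zm(6-valent nd)(a ∷ f ∷ e ∷ γs){γ}vt = zr nd(a γ)(f γ)(e γ)(ze γs γ)
 zm(skip{i}m)(a ∷ γs){γ}vt = Kk(a γ)i{ze γs γ}{ze(moveWeights m _ γs)γ}(zm m γs vt)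
 zv : ∀{β ae}(w : Weave β ae){v}γs{γ}→ γ < v → ze γs γ eU ze(bottomWeights w v γs)γ
 zv [] γs vt w x = refl
 zv(m ∷ w){v}γs vt u x = trans(zm m γs vt u x)
  (zv w(moveWeights m v γs)(N.<-≤-trans vt(N.m≤m+n v(moveTrivalents m)))u x)
 md : ∀{m d}→ m < d ∸ 1 → suc m < d
 md{d = suc d}p = s≤s p
 module Aa(d : ℕ)where
  record Ar(w : ℕ → ℕ): Set where
   field
    position : ℕ → ℕ
    wo : ∀ x → w(position x)≡ x
    pw : ∀ i → position(w i)≡ i
    f0 : w 0 ≡ 0
    fe : ∀ i → d < i → w i ≡ i
   injective : ∀{i j}→ w i ≡ w j → i ≡ j
   injective{i}{j}eq = trans(sym(pw i))(trans(cong position eq)(pw j))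
   l1 : ∀{i}→ 1 ≤ i → 1 ≤ w i
   l1{i}i~ with w i in eq
   ... | suc _ = s≤s z≤n
   ... | zero = ⊥-elim(N.<⇒≢ i~(injective(trans f0(sym eq))))
   ld : ∀{i}→ i ≤ d → w i ≤ d
   ld{i}iJ with w i N.≤? d
   ... | yes p = p
   ... | no Pg = ⊥-elim(Pg(subst(_≤ d)(sym(injective(fe(w i)(N.≰⇒> Pg))))iJ))
  open Ar
  a3 : ∀{w wb}→(∀ i → w i ≡ wb i)→ Ar w → Ar wb
  a3 eq a = record
   {position = position a
   ;wo = λ x → trans(sym(eq _))(wo a x)
   ;pw = λ i → trans(cong(position a)(sym(eq i)))(pw a i)
   ;f0 = trans(sym(eq 0))(f0 a)
   ;fe = λ i DH → trans(sym(eq i))(fe a i DH)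
   }
  ai : Ar id
  ai = record
   {position = id ;wo = λ _ → refl ;pw = λ _ → refl ;f0 = refl ;fe = λ _ _ → refl}
  ar : ∀{k w}→ VL d k → Ar w → Ar(w ∘ transposition k)
  ar{k}{w}(kk , kh)a = record
   {position = transposition k ∘ position a
   ;wo = λ x → trans(cong w(tv k(position a x)))(wo a x)
   ;pw = λ i → trans(cong(transposition k)(pw a _))(tv k i)
   ;f0 = trans(cong w(tf(N.<⇒≢ kk)λ()))(f0 a)
   ;fe = λ i DH → trans(cong w(tf(N.>⇒≢(N.<-trans kh DH))(N.>⇒≢(N.≤-<-trans kh DH))))(fe a i DH)
   }
  sV : ∀{k}w → w k ≤ w(suc k)→ ∀ i → sx k w i ≡ w(transposition k i)
  sV{k}w le i with tV k i
  ... | at rewrite tF k = trans(sb k w)(N.m≤n⇒m⊔n≡n le)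
  ... | aH rewrite tb k = trans(sa k w)(N.m≤n⇒m⊓n≡m le)
  ... | oa p q rewrite tf p q = sr w p q
  sG : ∀{k}w → w(suc k)≤ w k → ∀ i → sx k w i ≡ w i
  sG{k}w le i with tV k i
  ... | at = trans(sb k w)(N.m≥n⇒m⊔n≡m le)
  ... | aH = trans(sa k w)(N.m≥n⇒m⊓n≡n le)
  ... | oa p q = sr w p q
  an : ∀{k w}→ VL d k → Ar w → Ar(sx k w)
  an{k}{w}v a with N.≤-total(w k)(w(suc k))
  ... | inj₁ le = a3(λ i → sym(sV w le i))(ar v a)
  ... | inj₂ le = a3(λ i → sym(sG w le i))a
  Se : ℕ → ℕ →(ℕ → ℕ)→ Set
  Se A B w = ∀ j → 1 ≤ j → j ≤ d → j ≤ A ⊎ d < j N.+ B → w j ≡ suc d ∸ j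
  ms : ∀{A B w}→ Ar w → Se A B w → ∀{j}→ 1 ≤ j → j ≤ d →
   suc d ∸ w j ≤ A ⊎ d <(suc d ∸ w j)N.+ B → suc d ∸ w j ≡ j
  ms{w = w}a se{j}jj jd SQ =
   injective a(trans(se(suc d ∸ w j)(N.m<n⇒0<n∸m(s≤s(ld a jd)))mk SQ)
    (N.m∸[m∸n]≡n(N.m≤n⇒m≤1+n(ld a jd))))
   where
   mk : suc d ∸ w j ≤ d
   mk with w j | l1 a jj
   ... | suc u | _ = N.m∸n≤m d u
  s8 : ∀{A B k w}→ VL d k → Ar w → Se A B w →
   k ≤ A ⊎ d < suc k N.+ B → w(suc k)≤ w k
  s8{A}{B}{k}{w}(kk , kh)a se SQ with N.≤-total(w(suc k))(w k)
  ... | inj₁ le = le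
  ... | inj₂ le with SQ
  ... | inj₁ KZ = ⊥-elim(N.<⇒≢ jb(ms a se(s≤s z≤n)kh(inj₁(N.≤-trans(N.s≤s⁻¹ jb)KZ))))
   where
   jb : suc d ∸ w(suc k)< suc k
   jb = s≤s(N.≤-trans(N.∸-monoʳ-≤(suc d)le)(N.≤-reflexive
    (trans(cong(suc d ∸_)(se k kk(N.<⇒≤ kh)(inj₁ KZ)))(N.m∸[m∸n]≡n(N.m≤n⇒m≤1+n(N.<⇒≤ kh))))))
  ... | inj₂ K$ = ⊥-elim(N.>⇒≢ K?(ms a se kk(N.<⇒≤ kh)(inj₂(N.<-≤-trans K$(N.+-monoˡ-≤ B K?)))))
   where
   K? : k < suc d ∸ w k
   K? = N.≤-trans(N.≤-reflexive(sym
    (trans(cong(suc d ∸_)(se(suc k)(s≤s z≤n)kh(inj₂ K$)))(N.m∸[m∸n]≡n(N.m≤n⇒m≤1+n kh)))))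
    (N.∸-monoʳ-≤(suc d)le)
  SY : ∀{A B k w}→ VL d k → Ar w → Se A B w → Se A B(sx k w)
  SY{A}{B}{k}{w}v a se j jj jd SQ with tV k j
  ... | at = trans(sG w(s8 v a se(wJ SQ))k)(se k jj jd SQ)
   where
   wJ : k ≤ A ⊎ d < k N.+ B → k ≤ A ⊎ d < suc k N.+ B
   wJ(inj₁ p)= inj₁ p
   wJ(inj₂ p)= inj₂(N.m<n⇒m<1+n p)
  ... | aH = trans(sG w(s8 v a se(wJ SQ))(suc k))(se(suc k)jj jd SQ)
   where
   wJ : suc k ≤ A ⊎ d < suc k N.+ B → k ≤ A ⊎ d < suc k N.+ B
   wJ(inj₁ p)= inj₁(N.<⇒≤ p)
   wJ(inj₂ p)= inj₂ p
  ... | oa p q = trans(sr w p q)(se j jj jd SQ)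
  record Sa(A B : ℕ)(w : ℕ → ℕ): Set where
   constructor _,_
   field
    aD : Ar w
    se : Se A B w
  open Sa
  Sh : ∀{A B k w}→ VL d k → Sa A B w → Sa A B(sx k w)
  Sh v(a , s)= an v a , SY v a s
  sB : ∀{A B w}β → All(VL d)β → Sa A B w → Sa A B(sW β w)
  sB [] [] s = s
  sB(k ∷ β)(v ∷ vs)s = sB β vs(Sh v s)
  data Up : Word → ℕ → Set where
   [] : ∀{k}→ d ≤ k → Up [] k
   _∷_ : ∀{β}k → Up β(suc k)→ Up(k ∷ β)k
  data Dw : Word → ℕ → Set where
   [] : Dw [] 0
   _∷_ : ∀{β}k → Dw β k → Dw(suc k ∷ β)(suc k)
  uP : ∀{A B β k w}→ Up β k → All(VL d)β → Sa A B w →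
   ∀ q → w q ≡ suc B → k ≤ q → q N.+ B ≤ d → 1 ≤ k → Sa A(suc B)(sW β w)
  uP{A}{B}{β}{k}{w}up vs st q wq KI qj kk with q N.+ B N.≟ d
  ... | yes qo = sB β vs(aD st , sO)
   where
   sO : Se A(suc B)w
   sO j jj jd(inj₁ jl)= se st j jj jd(inj₁ jl)
   sO j jj jd(inj₂ d<)with j N.≟ q
   ... | yes refl = trans wq(sym(trans(cong(_∸ q)(sym(trans(N.+-suc q B)(cong suc qo))))(N.m+n∸m≡n q(suc B))))
   ... | no jq = se st j jj jd(inj₂(N.≤∧≢⇒<(N.s≤s⁻¹(subst(d <_)(N.+-suc j B)d<))
    λ Dy → jq(N.+-cancelʳ-≡ B j q(trans(sym Dy)(sym qo)))))
  uP{A}{B}{[]}{k}([] d~)vs st q wq KI qj kk | no qB =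
   ⊥-elim(qB(N.≤-antisym qj(N.≤-trans(N.≤-trans d~ KI)(N.m≤m+n q B))))
  uP{A}{B}{k ∷ β}{k}{w}(k ∷ up)((_ , kh)∷ vs)st q wq KI qj kk | no qB = go(tV k q)
   where
   v =(kk , kh)
   a = aD st
   qw : suc q N.+ B ≤ d
   qw = N.≤∧≢⇒< qj qB
   least : ∀{j}→ 1 ≤ j → j N.+ B ≤ d → j ≢ q → suc B ≤ w j
   least{j}jj jm jq with suc B N.≤? w j
   ... | yes p = p
   ... | no Pg = ⊥-elim(N.<-irrefl{d}refl(N.<-≤-trans d4(N.≤-trans(N.≤-reflexive(cong(N._+ B)mr))jm)))
    where
    jd = N.m+n≤o⇒m≤o j jm
    wS = N.s≤s⁻¹(N.≰⇒> Pg)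
    d4 : d <(suc d ∸ w j)N.+ B
    d4 = N.≤-trans(N.≤-reflexive(sym(N.m∸n+n≡m(N.m≤n⇒m≤1+n(ld a jd)))))(N.+-monoʳ-≤(suc d ∸ w j)wS)
    mr = ms a(se st)jj jd(inj₂ d4)
   nx : ∀ qa → sx k w qa ≡ suc B → suc k ≤ qa → qa N.+ B ≤ d → Sa A(suc B)(sW β(sx k w))
   nx qa eq K4 qg = uP up vs(Sh v st)qa eq K4 qg(N.m≤n⇒m≤1+n kk)
   go : TV k q → Sa A(suc B)(sW β(sx k w))
   go at = nx(suc k)(trans(sa k w)(trans(N.m≤n⇒m⊓n≡m
    (N.≤-trans(N.≤-reflexive wq)(least(s≤s z≤n)qw N.1+n≢n)))wq))N.≤-refl qw
   go aH = nx(suc k)(trans(sa k w)(trans(N.m≥n⇒m⊓n≡n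
    (N.≤-trans(N.≤-reflexive wq)(least kk(N.≤-trans(N.n≤1+n _)qj)(N.1+n≢n ∘ sym))))wq))N.≤-refl qj
   go(oa qt qk)= nx q(trans(sr w qt qk)wq)(N.≤∧≢⇒< KI(qt ∘ sym))qj
  dT : ∀{A B β k w}→ Dw β k → All(VL d)β → Sa A B w → A < d →
   ∀ q → w q ≡ d ∸ A → q ≤ suc k → A < q → q ≤ d → Sa(suc A)B(sW β w)
  dT{A}{B}{β}{k}{w}Dz vs st AQ q wq qh AX qd with q N.≟ suc A
  ... | yes qx = sB β vs(aD st , sO)
   where
   sO : Se(suc A)B w
   sO j jj jd(inj₂ d<)= se st j jj jd(inj₂ d<)
   sO j jj jd(inj₁ jc)with j N.≟ suc A
   ... | yes jA = trans(cong w(trans jA(sym qx)))(trans wq(cong(suc d ∸_)(sym jA)))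
   ... | no je = se st j jj jd(inj₁(N.s≤s⁻¹(N.≤∧≢⇒< jc je)))
  dT{A}{B}{[]}{zero}[] vs st AQ q wq qF AX qd | no qA =
   ⊥-elim(qA(N.≤-antisym(N.≤-trans qF(s≤s z≤n))AX))
  dT{A}{B}{suc k ∷ β}{suc k}{w}(k ∷ Dz)((kk , kh)∷ vs)st AQ q wq qh AX qd | no qA = go(tV(suc k)q)
   where
   v =(kk , kh)
   a = aD st
   AG : suc A < q
   AG = N.≤∧≢⇒< AX(qA ∘ sym)
   gI : ∀{j}→ A < j → j ≤ d → j ≢ q → w j ≤ d ∸ A
   gI{j}A7 jd jq with w j N.≤? d ∸ A
   ... | yes p = p
   ... | no Pg = ⊥-elim(N.<⇒≱ A7(N.≤-trans(N.≤-reflexive(sym mr))mU))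
    where
    jj = N.≤-trans(s≤s z≤n)A7
    mU : suc d ∸ w j ≤ A
    mU = N.≤-trans(N.∸-monoʳ-≤(suc d)(N.≰⇒> Pg))(N.≤-reflexive(N.m∸[m∸n]≡n(N.<⇒≤ AQ)))
    mr = ms a(se st)jj jd(inj₁ mU)
   nx : ∀ qa → sx(suc k)w qa ≡ d ∸ A → qa ≤ suc k → A < qa → qa ≤ d → Sa(suc A)B(sW β(sx(suc k)w))
   nx qa eq qg AY qy = dT Dz vs(Sh v st)AQ qa eq qg AY qy
   go : TV(suc k)q → Sa(suc A)B(sW β(sx(suc k)w))
   go at = nx(suc k)(trans(sb(suc k)w)(trans(N.m≥n⇒m⊔n≡m
    (N.≤-trans(gI(N.m<n⇒m<1+n AX)kh N.1+n≢n)(N.≤-reflexive(sym wq))))wq))N.≤-refl AX qd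
   go aH = nx(suc k)(trans(sb(suc k)w)(trans(N.m≤n⇒m⊔n≡n
    (N.≤-trans(gI(N.s≤s⁻¹ AG)(N.<⇒≤ kh)(N.1+n≢n ∘ sym))(N.≤-reflexive(sym wq))))wq))
    N.≤-refl(N.s≤s⁻¹ AG)(N.<⇒≤ kh)
   go(oa qt qk)= nx q(trans(sr w qt qk)wq)(N.s≤s⁻¹(N.≤∧≢⇒< qh qk))AX qd
  Pr : ℕ →(ℕ → ℕ)→ Set
  Pr s w = ∃ λ A → ∃ λ B → Sa A B w × s ⊓(d ∸ 1)≤ A N.+ B
  p9 : ∀{s w}β → All(VL d)β → Pr s w → Pr s(sW β w)
  p9 β vs(A , B , st , le)= A , B , sB β vs st , le
  pF : ∀{w}(a : Ar w){x}→ 1 ≤ x → x ≤ d → 1 ≤ position a x × position a x ≤ d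
  pF{w}a{x}xb xe = l$ , uF
   where
   l$ : 1 ≤ position a x
   l$ with position a x in eq
   ... | suc _ = s≤s z≤n
   ... | zero = ⊥-elim(N.<⇒≢ xb(trans(sym(f0 a))(trans(cong w(sym eq))(wo a x))))
   uF : position a x ≤ d
   uF with position a x N.≤? d
   ... | yes p = p
   ... | no Pg = ⊥-elim(Pg(subst(_≤ d)(trans(sym(wo a x))(fe a _(N.≰⇒> Pg)))xe))
  us : ∀{A B w}(st : Sa A B w)→ A < d → ∀{x}→ 1 ≤ x → x ≤ d → B < x → x ≤ d ∸ A →
   let q = position(aD st)x in A < q × q N.+ B ≤ d
  us{A}{B}{w}st AQ{x}xb xe By xB = N.≰⇒> nQ , N.≮⇒≥ nL
   where
   a = aD st
   q = position a x
   rj = pF a xb xe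
   xm : q ≤ A ⊎ d < q N.+ B → x ≡ suc d ∸ q
   xm SQ = trans(sym(wo a x))(se st q(proj₁ rj)(proj₂ rj)SQ)
   nQ : ¬(q ≤ A)
   nQ qD = N.<⇒≱(subst(d ∸ A <_)(sym(xm(inj₁ qD)))
    (N.≤-trans(N.≤-reflexive(sym(N.+-∸-assoc 1(N.<⇒≤ AQ))))(N.∸-monoʳ-≤(suc d)qD)))xB
   nL : ¬(d < q N.+ B)
   nL DB = N.<⇒≱ By(N.≤-trans(N.≤-reflexive(xm(inj₂ DB)))
    (N.m≤n+o⇒m∸n≤o(suc d)q DB))
  S$ : ∀{s m n}→ s ⊓ n ≤ m → m < n → suc s ⊓ n ≤ suc m
  S${s}{m}{n}le Md with N.≤-total s n
  ... | inj₁ gQ = N.≤-trans(N.m⊓n≤m(suc s)n)(s≤s(N.≤-trans(N.≤-reflexive(sym(N.m≤n⇒m⊓n≡m gQ)))le))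
  ... | inj₂ n9 = ⊥-elim(N.<⇒≱ Md(N.≤-trans(N.≤-reflexive(sym(N.m≥n⇒m⊓n≡n n9)))le))
  p% : ∀{s β w}→ Up β 1 → All(VL d)β → Pr s w → Pr(suc s)(sW β w)
  p%{s}{β}{w}up vs(A , B , st , le)with A N.+ B N.<? d ∸ 1
  ... | no Pg = A , B , sB β vs st , N.≤-trans(N.m⊓n≤n(suc s)(d ∸ 1))(N.≮⇒≥ Pg)
  ... | yes p = A , suc B
   , uP up vs st _(wo(aD st)(suc B))(N.≤-trans(s≤s z≤n)(proj₁ rj))(proj₂ rj)N.≤-refl
   , N.≤-trans(S${s}le p)(N.≤-reflexive(sym(N.+-suc A B)))
   where
   A1 : suc(A N.+ B)< d
   A1 = md p
   Bz = N.≤-trans(s≤s(N.m≤n+m B A))(N.<⇒≤ A1)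
   rj = us st(N.≤-trans(s≤s(N.m≤m+n A B))(N.<⇒≤ A1))(s≤s z≤n)Bz N.≤-refl
    (N.m+n≤o⇒m≤o∸n(suc B)(N.≤-trans(s≤s(N.≤-reflexive(N.+-comm B A)))(N.<⇒≤ A1)))
  p' : ∀{s β w}→ Dw β(d ∸ 1)→ All(VL d)β → Pr s w → Pr(suc s)(sW β w)
  p'{s}{β}{w}Dz vs(A , B , st , le)with A N.+ B N.<? d ∸ 1
  ... | no Pg = A , B , sB β vs st , N.≤-trans(N.m⊓n≤n(suc s)(d ∸ 1))(N.≮⇒≥ Pg)
  ... | yes p = suc A , B
   , dT Dz vs st AQ _(wo(aD st)(d ∸ A))
    (N.≤-trans(proj₂(pF(aD st)xb(N.m∸n≤m d A)))(N.m≤n+m∸n d 1))(proj₁ rj)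
    (proj₂(pF(aD st)xb(N.m∸n≤m d A)))
   , S${s}le p
   where
   A1 : suc(A N.+ B)< d
   A1 = md p
   AQ = N.≤-trans(s≤s(N.m≤m+n A B))(N.<⇒≤ A1)
   xb = N.m<n⇒0<n∸m AQ
   rj = us st AQ xb(N.m∸n≤m d A)
    (N.m+n≤o⇒m≤o∸n(suc B)(N.≤-trans(s≤s(N.≤-reflexive(N.+-comm B A)))(N.<⇒≤ A1)))N.≤-refl
  Rv :(ℕ → ℕ)→ Set
  Rv w = ∀ j → 1 ≤ j → j ≤ d → w j ≡ suc d ∸ j
  pX : ∀{s w}→ d ∸ 1 ≤ s → Pr s w → Rv w
  pX{s}{w}DA(A , B , st , le)j jj jd = trans(sym(N.m∸[m∸n]≡n(N.m≤n⇒m≤1+n(ld a jd))))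
   (cong(suc d ∸_)mr)
   where
   a = aD st
   jo = suc d ∸ w j
   d% : d ∸ 1 ≤ A N.+ B
   d% = N.≤-trans(N.≤-reflexive(sym(N.m≥n⇒m⊓n≡n DA)))le
   d& : d ≤ suc(A N.+ B)
   d& = N.≤-trans(N.m≤n+m∸n d 1)(s≤s d%)
   e/ : ∀ i →(i ≤ A ⊎ d < i N.+ B)⊎ i ≡ suc A
   e/ i with i N.≤? A
   ... | yes p = inj₁(inj₁ p)
   ... | no Pg with i N.≟ suc A
   ... | yes q = inj₂ q
   ... | no qL = inj₁(inj₂(N.≤-trans(s≤s d&)(N.+-monoˡ-≤ B(N.≤∧≢⇒<(N.≰⇒> Pg)(qL ∘ sym)))))
   mr : jo ≡ j
   mr with e/ jo | e/ j
   ... | inj₁ SQ | _ = ms a(se st)jj jd SQ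
   ... | inj₂ _ | inj₁ SQ = trans(cong(suc d ∸_)(se st j jj jd SQ))(N.m∸[m∸n]≡n(N.m≤n⇒m≤1+n jd))
   ... | inj₂ p | inj₂ q = trans p(sym q)
module Ie where
 open Sl
 open KF
 open Wo
 open BP
 open import Relation.Binary.PropositionalEquality.Core using(refl;sym;trans;cong;cong₂;subst)
 open import Data.Bool.Base using(T)
 open import Data.Nat.Base using(_≤_;_<_)
 module NS = Data.Nat.Solver.+-*-Solver
 sP : ℕ →(ℕ → ℕ)→ ℕ
 sP zero f = 0
 sP(suc n)f = sP n f N.+ f n
 sg : ∀ n{f h}→(∀ i → i < n → f i ≡ h i)→ sP n f ≡ sP n h
 sg zero eq = refl
 sg(suc n)eq = cong₂ N._+_(sg n λ i IA → eq i(N.m<n⇒m<1+n IA))(eq n N.≤-refl)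
 sH : ∀ n{f h}i → i < n → h i ≡ suc(f i)→(∀ j → j < n → j ≢ i → h j ≡ f j)→ sP n h ≡ suc(sP n f)
 sH(suc n){f}{h}i Iq Aw oi with i N.≟ n
 ... | yes refl = trans(cong₂ N._+_(sg n λ j jn → oi j(N.m<n⇒m<1+n jn)(N.<⇒≢ jn))Aw)(N.+-suc _ _)
 ... | no Io = cong₂ N._+_(sH n i(N.≤∧≢⇒<(N.s≤s⁻¹ Iq)Io)Aw λ j jn → oi j(N.m<n⇒m<1+n jn))
  (oi n N.≤-refl(Io ∘ sym))
 ii : ℕ → ℕ → ℕ
 ii m n = if m N.<ᵇ n then 1 else 0
 iS : ∀{m n}→ m < n → ii m n ≡ 1
 iS{m}{n}Md with m N.<ᵇ n | N.<⇒<ᵇ Md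
 ... | true | _ = refl
 iz : ∀{m n}→ ¬(m < n)→ ii m n ≡ 0
 iz{m}{n}m& with m N.<ᵇ n in eq
 ... | false = refl
 ... | true = ⊥-elim(m&(N.<ᵇ⇒< m n(subst T(sym eq)tt)))
 iU : ℕ →(ℕ → ℕ)→ ℕ
 iU n p = sP(suc n)λ y → sP y λ x → ii(p y)(p x)
 i5 : ∀ n{p q}→(∀ x → x ≤ n → p x ≡ q x)→ iU n p ≡ iU n q
 i5 n eq = sg(suc n)λ y y1 → sg y λ x xf →
  cong₂ ii(eq y(N.s≤s⁻¹ y1))(eq x(N.≤-trans(N.<⇒≤ xf)(N.s≤s⁻¹ y1)))
 iV : ∀ d{p}→ p 0 ≡ 0 →(∀ x → 1 ≤ x → x ≤ d → p x ≡ suc d ∸ x)→ 2 N.* iU d p ≡ d N.*(d ∸ 1)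
 iV d{p}p0 px = trans(cong(2 N.*_)(sg(suc d)λ y yh → r7 y(N.s≤s⁻¹ yh)))(gN d)
  where
  r7 : ∀ y → y ≤ d → sP y(λ x → ii(p y)(p x))≡ y ∸ 1
  r7 y yd = pa y N.≤-refl
   where
   pa : ∀ m → m ≤ y → sP m(λ x → ii(p y)(p x))≡ m ∸ 1
   pa zero _ = refl
   pa(suc zero)_ = trans(cong(ii(p y))p0)(iz{p y}{0}λ())
   pa(suc(suc m))m2 = trans(cong₂ N._+_(pa(suc m)(N.<⇒≤ m2))(iS e*))(N.+-comm m 1)
    where
    e* : p y < p(suc m)
    e* rewrite px y(N.≤-trans(s≤s z≤n)m2)yd | px(suc m)(s≤s z≤n)(N.≤-trans(N.<⇒≤ m2)yd)=
     N.∸-monoʳ-< m2(N.m≤n⇒m≤1+n yd)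
  gN : ∀ d → 2 N.* sP(suc d)(_∸ 1)≡ d N.*(d ∸ 1)
  gN zero = refl
  gN(suc zero)= refl
  gN(suc(suc d))= trans(N.*-distribˡ-+ 2(sP(suc(suc d))(_∸ 1))(suc d))(trans(cong(N._+ 2 N.* suc d)(gN(suc d)))
   (NS.solve 1(λ d →((con 1 :+ d):* d :+ con 2 :*(con 1 :+ d)):=(con 2 :+ d):*(con 1 :+ d))refl d))
   where open NS
 mE : ∀{β ae}→ Move β ae → β eU ae
 mE(trivalent{i}{β})= pf(i ∷ i ∷ [])(i ∷ [])β(s' i)
 mE(4-valent{i}{j}{β}fv)= pf(i ∷ j ∷ [])(j ∷ i ∷ [])β(Sg{i}{j}fv)
 mE(6-valent{i}{j}{β}nd)= pf(i ∷ j ∷ i ∷ [])(j ∷ i ∷ j ∷ [])β(Bg nd)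
 mE(skip{i}{β}{ae}m)= b< i{β}{ae}(mE m)
 wa : ∀{β ae}→ Weave β ae → β eU ae
 wa [] w i = refl
 wa(m ∷ u)w i = trans(mE m w i)(wa u w i)
 sd : ∀ β w → Ac w β → ∀ i → sW β w i ≡ w(permutation β i)
 sd [] w _ i = refl
 sd(k ∷ β)w(lt , as)i = trans(sK β(Aa.sV 0 w(N.<⇒≤ lt))i)
  (sd β(w ∘ transposition k)as i)
 lz : ∀{β}(γs : Weights β)γ → length(ze γs γ)≤ length β
 lz [] γ = z≤n
 lz(a ∷ γs)γ with a γ
 ... | zero = s≤s(lz γs γ)
 ... | suc _ = N.m≤n⇒m≤1+n(lz γs γ)
 Aj : ∀{β}(γs : Weights β)γ → length β ≤ length(ze γs γ)→ AW(λ a → a γ ≡ 0)γs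
 Aj [] γ _ = []
 Aj(a ∷ γs)γ le with a γ in eq
 ... | zero = eq ∷ Aj γs γ(N.s≤s⁻¹ le)
 ... | suc _ = ⊥-elim(N.<⇒≱ le(lz γs γ))
 vz : ∀{d β}(γs : Weights β)γ → All(VL d)β → All(VL d)(ze γs γ)
 vz [] γ [] = []
 vz(a ∷ γs)γ(v ∷ vs)with a γ
 ... | zero = v ∷ vz γs γ vs
 ... | suc _ = vz γs γ vs
 module Cu(d : ℕ)where
  open Aa d
  open Ar
  inv : ∀{w}→ Ar w → ℕ
  inv a = iU d(position a)
  p7 : ∀{w wb}(a : Ar w)(a′ : Ar wb)→(∀ i → w i ≡ wb i)→ ∀ x → position a x ≡ position a′ x
  p7 a a′ eq x = injective a(trans(wo a x)(trans(sym(wo a′ x))(sym(eq _))))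
  i9 : ∀{w wb}(a : Ar w)(a′ : Ar wb)→(∀ i → w i ≡ wb i)→ inv a ≡ inv a′
  i9 a a′ eq = i5 d λ x _ → p7 a a′ eq x
  i? : ∀{k w}(v : VL d k)(a : Ar w)→ w k < w(suc k)→ inv(ar v a)≡ suc(inv a)
  i?{k}{w}v@(kk , kh)a lt = sH(suc d)yf(s≤s(ld a kh))
   (sH yf xh lt nw λ x xJ xC → ow xJ λ{(eq , _)→ xC eq})
   λ y yh yy → sg y λ x xf → ow xf λ{(_ , eq)→ yy eq}
   where
   xh = w k
   yf = w(suc k)
   p = position a
   p′ = transposition k ∘ p
   nw : ii(p′ yf)(p′ xh)≡ suc(ii(p yf)(p xh))
   nw rewrite pw a k | pw a(suc k)| tF k | tb k =
    trans(iS{k}{suc k}N.≤-refl)(cong suc(sym(iz{suc k}{k}(N.<-asym N.≤-refl))))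
   ow : ∀{x y}→ x < y → ¬(x ≡ xh × y ≡ yf)→ ii(p′ y)(p′ x)≡ ii(p y)(p x)
   ow{x}{y}xf ot with N.<-cmp(p x)(p y)
   ... | tri< p/ _ _ = trans(iz(N.<-asym(tm k p/ λ(ex , ey)→
    ot(trans(sym(wo a x))(cong w ex), trans(sym(wo a y))(cong w ey)))))
    (sym(iz(N.<-asym p/)))
   ... | tri≈ _ same _ = ⊥-elim(N.<⇒≢ xf(trans(sym(wo a x))(trans(cong w same)(wo a y))))
   ... | tri> _ _ Pn = trans(iS(tm k Pn λ(ey , ex)→
    N.<-asym lt(N.≤-trans(N.≤-reflexive(cong suc(trans(cong w(sym ex))(wo a x))))
     (N.≤-trans xf(N.≤-reflexive(trans(sym(wo a y))(cong w ey)))))))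
    (sym(iS Pn))
  aB : ∀{w}β → All(VL d)β → Ar w → Ar(sW β w)
  aB [] [] a = a
  aB(k ∷ β)(v ∷ vs)a = aB β vs(an v a)
  iW : ∀{w}β(vs : All(VL d)β)(a : Ar w)→ inv(aB β vs a)≤ inv a N.+ length β
  iW [] [] a = N.≤-reflexive(sym(N.+-identityʳ _))
  iW{w}(k ∷ β)(v ∷ vs)a = N.≤-trans(iW β vs(an v a))
   (N.≤-trans(N.+-monoˡ-≤(length β)step)(N.≤-reflexive(sym(N.+-suc(inv a)(length β)))))
   where
   step : inv(an v a)≤ suc(inv a)
   step with N.<-cmp(w k)(w(suc k))
   ... | tri< lt _ _ = N.≤-reflexive(trans
    (i9(an v a)(ar v a)(sV w(N.<⇒≤ lt)))(i? v a lt))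
   ... | tri≈ _ same _ = N.m≤n⇒m≤1+n(N.≤-reflexive(i9(an v a)a(sG w(N.≤-reflexive(sym same)))))
   ... | tri> _ _ gt = N.m≤n⇒m≤1+n(N.≤-reflexive(i9(an v a)a(sG w(N.<⇒≤ gt))))
  iX : ∀{w}β(vs : All(VL d)β)(a : Ar w)→ Ac w β → inv(aB β vs a)≡ inv a N.+ length β
  iX [] [] a _ = sym(N.+-identityʳ _)
  iX{w}(k ∷ β)(v ∷ vs)a(lt , as)= trans
   (iX β vs(an v a)(aP β(λ i → sym(sV w(N.<⇒≤ lt)i))as))
   (trans(cong(N._+ length β)(trans(i9(an v a)(ar v a)(sV w(N.<⇒≤ lt)))(i? v a lt)))
    (sym(N.+-suc(inv a)(length β))))
  Ic : inv ai ≡ 0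
  Ic = trans(sg(suc d)λ y _ → r7 y y N.≤-refl)(zk(suc d))
   where
   zk : ∀ n → sP n(λ _ → 0)≡ 0
   zk zero = refl
   zk(suc n)= trans(N.+-identityʳ _)(zk n)
   r7 : ∀ y m → m ≤ y → sP m(λ x → ii y x)≡ 0
   r7 y zero _ = refl
   r7 y(suc m)Mj = trans(cong₂ N._+_(r7 y m(N.<⇒≤ Mj))(iz(N.<-asym Mj)))refl
  rM : ∀{w}(a : Ar w)→ Rv w → ∀ x → 1 ≤ x → x ≤ d → position a x ≡ suc d ∸ x
  rM{w}a Rh x xb xe = injective a(trans(wo a x)(sym(trans
   (Rh(suc d ∸ x)(N.m<n⇒0<n∸m(s≤s xe))(mk xb))(N.m∸[m∸n]≡n(N.m≤n⇒m≤1+n xe)))))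
   where
   mk : ∀{x}→ 1 ≤ x → suc d ∸ x ≤ d
   mk{suc x}_ = N.m∸n≤m d x
  rR : ∀{w}(a : Ar w)→ Rv w → 2 N.* inv a ≡ d N.*(d ∸ 1)
  rR a Rh = iV d(injective a(trans(wo a 0)(sym(f0 a))))(rM a Rh)
  lu : ∀{β}→ All(VL d)β → Ac id β → Rv(sW β id)→ 2 N.* length β ≡ d N.*(d ∸ 1)
  lu{β}vs as Rh = trans(cong(2 N.*_)(sym(trans(iX β vs ai as)(cong(N._+ length β)Ic))))
   (rR(aB β vs ai)Rh)
  lX : ∀{β}→ All(VL d)β → Rv(sW β id)→ d N.*(d ∸ 1)≤ 2 N.* length β
  lX{β}vs Rh = N.≤-trans(N.≤-reflexive(sym(rR(aB β vs ai)Rh)))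
   (N.*-monoʳ-≤ 2(N.≤-trans(iW β vs ai)(N.≤-reflexive(cong(N._+ length β)Ic))))
  vy : ∀{β ae}(w : Weave β ae)v(γs : Weights β)γ → γ < v → All(VL d)β → All(VL d)ae →
   Ac id ae → Rv(sW β id)→ Rv(sW(ze γs γ)id)→
   AW(λ a → a γ ≡ 0)(bottomWeights w v γs)
  vy{β}{ae}w v γs γ vt v/ v9 as Rh RO = Aj(bottomWeights w v γs)γ(N.*-cancelˡ-≤ 2(N.≤-trans
   (N.≤-reflexive(lu v9 as λ j p q → trans(sym(wa w id j))(Rh j p q)))
   (lX(vz(bottomWeights w v γs)γ v9)λ j p q → trans(sym(zv w γs vt id j))(RO j p q))))
module To where
 open Sl
 open KF
 open Wo
 open BP
 open Ie
 open import Relation.Binary.PropositionalEquality.Core using(refl;sym;trans;cong;cong₂;subst)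
 open import Data.Nat.Base using(_≤_)
 open import Defs using(sign)
 cO : ℕ → List ℕ → ℕ
 cO iH [] = 0
 cO iH(i ∷ is)with i N.≟ iH
 ... | yes _ = cO iH is
 ... | no _ = suc(cO iH is)
 cI : ∀ iH f n →(∀ j → f j ≢ iH)→ cO iH(applyUpTo f n)≡ n
 cI iH f zero i$ = refl
 cI iH f(suc n)i$ with f 0 N.≟ iH
 ... | yes p = ⊥-elim(i$ 0 p)
 ... | no _ = cong suc(cI iH(f ∘ suc)n(i$ ∘ suc))
 cJ : ∀ iH f n →(∀{i j}→ f i ≡ f j → i ≡ j)→ n ∸ 1 ≤ cO iH(applyUpTo f n)
 cJ iH f zero Ix = z≤n
 cJ iH f(suc n)Ix with f 0 N.≟ iH
 ... | yes refl = N.≤-reflexive(sym(cI iH(f ∘ suc)n λ j eq → N.1+n≢0(Ix{suc j}{0}eq)))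
 ... | no _ = N.≤-trans(N.m≤n+m∸n n 1)(s≤s(cJ iH(f ∘ suc)n λ{i}{j}eq → N.suc-injective(Ix{suc i}{suc j}eq)))
 module TW{d n : ℕ}{σ : Signature n}(am : Admissible d σ)where
  open Aa d
  pW :(L : ℕ × ℕ → ℕ)(f : ℕ × ℕ → ℕ → ℕ)(xs : List(ℕ × ℕ))→ Weights(map L xs)
  pW L f xs = All.map⁺{f = L}(universal f xs)
  pZ :(L : ℕ × ℕ → ℕ)(f : ℕ × ℕ → ℕ → ℕ)(γ : ℕ)→ List(ℕ × ℕ)→ Word
  pZ L f γ [] = []
  pZ L f γ(x ∷ xs)= kI(f x γ)(L x)(pZ L f γ xs)
  zp : ∀ L f γ xs → ze(pW L f xs)γ ≡ pZ L f γ xs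
  zp L f γ [] = refl
  zp L f γ(x ∷ xs)= cong(kI(f x γ)(L x))(zp L f γ xs)
  pG : ∀ L f γ xs ys → pZ L f γ(xs ++ ys)≡ pZ L f γ xs ++ pZ L f γ ys
  pG L f γ [] ys = refl
  pG L f γ(x ∷ xs)ys with f x γ
  ... | zero = cong(L x ∷_)(pG L f γ xs ys)
  ... | suc _ = pG L f γ xs ys
  pN : ∀ L f γ i ks →(∀ k → f(i , k)γ ≡ 0)→ pZ L f γ(map(i ,_)ks)≡ map(λ k → L(i , k))ks
  pN L f γ i [] fq = refl
  pN L f γ i(k ∷ ks)fq rewrite fq k = cong(L(i , k)∷_)(pN L f γ i ks fq)
  lI : List ℕ
  lI = map suc(upTo(d ∸ 1))
  lv : All(VL d)lI
  lv = All.map⁺(All.applyUpTo⁺₁ id(d ∸ 1)λ Is → s≤s z≤n , md Is)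
  lc : ∀{j}k → sign σ j ≡ Sign.+ → letter am j k ≡ k
  lc{j}k eq with sign σ j
  lc k refl | .Sign.+ = refl
  lw : ∀{j}k → sign σ j ≡ Sign.- → letter am j k ≡ d ∸ k
  lw{j}k eq with sign σ j
  lw k refl | .Sign.- = refl
  lm : ∀ j{k}→ VL d k → VL d(letter am j k)
  lm j{k}(kk , kh)with sign σ j
  ... | Sign.+ = kk , kh
  ... | Sign.- = N.m<n⇒0<n∸m kh , N.∸-monoʳ-< kk(N.<⇒≤ kh)
  p2 : ∀ p is → All(VL d)(map(topLetter am p)(cartesianProduct is lI))
  p2 p [] = []
  p2 p(i ∷ is)= subst(All(VL d))(sym(List.map-++(topLetter am p)(map(i ,_)lI)_))
   (All.++⁺(All.map⁺(All.map⁺(All.map(lm(p I.+ + i))lv)))(p2 p is))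
  tW : ∀ p l → All(VL d)(topWord am p l)
  tW p l = p2 p(upTo l)
  ue : ∀ g h m k →(∀ i → g(suc(h i))≡ k N.+ i)→ d ≤ k N.+ m → Up(map g(map suc(applyUpTo h m)))k
  ue g h zero k eq d~ = [](subst(d ≤_)(N.+-identityʳ k)d~)
  ue g h(suc m)k eq DN = subst(λ x → Up(x ∷ map g(map suc(applyUpTo(h ∘ suc)m)))k)
   (sym(trans(eq 0)(N.+-identityʳ k)))
   (k ∷ ue g(h ∘ suc)m(suc k)(λ i → trans(eq(suc i))(N.+-suc k i))(subst(d ≤_)(N.+-suc k m)DN))
  dK : ∀ g h m →(∀ i → g(suc(h i))≡ m ∸ i)→ Dw(map g(map suc(applyUpTo h m)))m
  dK g h zero eq = []
  dK g h(suc m)eq = subst(λ x → Dw(x ∷ map g(map suc(applyUpTo(h ∘ suc)m)))(suc m))(sym(eq 0))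
   (m ∷ dK g(h ∘ suc)m(eq ∘ suc))
  fo : ∀ j{s w}→ Pr s w → Pr(suc s)(sW(map(letter am j)lI)w)
  fo j = bq(sign σ j)refl
   where
   vK = All.map⁺(All.map(lm j)lv)
   bq : ∀ ε → sign σ j ≡ ε → ∀{s w}→ Pr s w → Pr(suc s)(sW(map(letter am j)lI)w)
   bq Sign.+ eq = p%(ue(letter am j)id(d ∸ 1)1(λ i → lc(suc i)eq)(N.m≤n+m∸n d 1))vK
   bq Sign.- eq = p'(dK(letter am j)id(d ∸ 1)λ i → trans(lw(suc i)eq)(sym(N.∸-+-assoc d 1 i)))vK
  pj : ∀ L f γ xs → All(VL d)(map L xs)→ All(VL d)(pZ L f γ xs)
  pj L f γ [] [] = []
  pj L f γ(x ∷ xs)(v ∷ vs)with f x γ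
  ... | zero = v ∷ pj L f γ xs vs
  ... | suc _ = pj L f γ xs vs
  py : ∀ p f γ iH is{s w}→(∀ i k → i ≢ iH → f(i , k)γ ≡ 0)→ Pr s w →
   Pr(s N.+ cO iH is)(sW(pZ(topLetter am p)f γ(cartesianProduct is lI))w)
  py p f γ iH []{s}fq pr = subst(λ s → Pr s _)(sym(N.+-identityʳ s))pr
  py p f γ iH(i ∷ is){s}{w}fq pr = subst(Pr _)(sym sJ)rt
   where
   L = topLetter am p
   Z = pZ L f γ(map(i ,_)lI)
   sJ : sW(pZ L f γ(cartesianProduct(i ∷ is)lI))w
    ≡ sW(pZ L f γ(cartesianProduct is lI))(sW Z w)
   sJ = trans(cong(λ β → sW β w)(pG L f γ(map(i ,_)lI)(cartesianProduct is lI)))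
    (sR Z(pZ L f γ(cartesianProduct is lI))w)
   rt : Pr(s N.+ cO iH(i ∷ is))(sW(pZ L f γ(cartesianProduct is lI))(sW Z w))
   rt with i N.≟ iH
   ... | yes _ = py p f γ iH is fq(p9 Z(pj L f γ(map(i ,_)lI)
    (All.map⁺(All.map⁺(All.map(lm(p I.+ + i))lv))))pr)
   ... | no Ih = subst(λ s → Pr s(sW(pZ L f γ(cartesianProduct is lI))(sW Z w)))(sym(N.+-suc s(cO iH is)))
    (py p f γ iH is fq(subst(λ β → Pr(suc s)(sW β w))
     (sym(pN L f γ i lI(λ k → fq i k Ih)))(fo(p I.+ + i)pr)))
  start : Pr 0 id
  start = 0 , 0 ,(ai , λ{j jj jd(inj₁ j0)→ ⊥-elim(N.<⇒≱ jj j0)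
   ;j jj jd(inj₂ DR)→ ⊥-elim(N.<⇒≱ DR(N.≤-trans(N.≤-reflexive(N.+-identityʳ j))jd))}), z≤n
  tz : ∀ p l f γ iH → d ≤ l →(∀ i k → i ≢ iH → f(i , k)γ ≡ 0)→
   Rv(sW(ze(pW(topLetter am p)f(positions am l))γ)id)
  tz p l f γ iH d8 fq =
   subst(λ β → Rv(sW β id))(sym(zp(topLetter am p)f γ(positions am l)))(pX(N.≤-trans(N.∸-monoˡ-≤ 1 d8)(cJ iH id l λ eq → eq))(py p f γ iH(upTo l)fq start))
  pH : ∀ L xs → pZ L(λ _ _ → 0)0 xs ≡ map L xs
  pH L [] = refl
  pH L(x ∷ xs)= cong(L x ∷_)(pH L xs)
  tp : ∀ p l → d ≤ l → Rv(sW(topWord am p l)id)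
  tp p l d8 = subst(λ β → Rv(sW β id))
   (trans(zp(topLetter am p)(λ _ _ → 0)0(positions am l))(pH(topLetter am p)(positions am l)))
   (tz p l(λ _ _ → 0)0 0 d8 λ _ _ _ → refl)
  tx : ∀ p l → length(topWord am p l)≡ l N.*(d ∸ 1)
  tx p l = trans(List.length-map(topLetter am p)(positions am l))(trans(lx(upTo l))
   (cong₂ N._*_(List.length-upTo l)(trans(List.length-map suc(upTo(d ∸ 1)))(List.length-upTo(d ∸ 1)))))
   where
   lx : ∀ is → length(cartesianProduct is lI)≡ length is N.* length lI
   lx [] = refl
   lx(i ∷ is)= trans(List.length-++(map(i ,_)lI))
    (cong₂ N._+_(List.length-map(i ,_)lI)(lx is))
 tl : ∀{β ae}(w : Weave β ae)→ trivalents w N.+ length ae ≡ length β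
 tl [] = refl
 tl(m ∷ w)= trans(N.+-assoc(moveTrivalents m)(trivalents w)_)
  (trans(cong(moveTrivalents m N.+_)(tl w))(one m))
  where
  one : ∀{β ae}(m : Move β ae)→ moveTrivalents m N.+ length ae ≡ length β
  one trivalent = refl
  one(4-valent _)= refl
  one(6-valent _)= refl
  one(skip m)= trans(N.+-suc(moveTrivalents m)_)(cong suc(one m))
module Gd where
 open IS
 open Sl
 open KF
 open Wo
 open import Relation.Binary.PropositionalEquality.Core using(refl;sym;trans;cong;cong₂;subst)
 open import Data.Nat.Base using(_≤_;_<_;∣_-_∣)
 module so = In I.+-*-commutativeRing
 module a9 = CommutativeMonoidSum I.+-0-commutativeMonoid
 module g2 = SemiringSum(CommutativeSemiring.semiring I.+-*-commutativeSemiring)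
 su : ∀{n}→(Fin n → ℤ)→ ℤ
 su = a9.sum
 sm : ∀{n}{f h : Fin n → ℤ}→(∀ i → f i ≡ h i)→ su f ≡ su h
 sm = a9.sum-cong-≗
 wi :(N : ℕ)→(ℕ → ℤ)→(ℕ → ℕ)→ ℤ
 wi N dg a = su{N}λ γ → + a(toℕ γ)I.* dg(toℕ γ)
 wn : ∀ N{dg db a a′}→(∀ γ → γ < N → + a γ I.* dg γ ≡ + a′ γ I.* db γ)→ wi N dg a ≡ wi N db a′
 wn N eq = sm λ γ → eq(toℕ γ)(O.toℕ<n γ)
 wA : ∀ N dg a b → wi N dg(λ γ → a γ N.+ b γ)≡ wi N dg a I.+ wi N dg b
 wA N dg a b = trans(sm{N}λ γ → trans(cong(I._* dg(toℕ γ))(I.pos-+(a(toℕ γ))(b(toℕ γ))))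
  (I.*-distribʳ-+(dg(toℕ γ))(+ a(toℕ γ))(+ b(toℕ γ))))(a9.∑-distrib-+{N}_ _)
 wl : ∀ N{v dg db a}→ Be v a →(∀ γ → γ < v → dg γ ≡ db γ)→ wi N dg a ≡ wi N db a
 wl N{v}{dg}{db}{a}bA eq = wn N{dg}{db}{a}{a}a1
  where
  a1 : ∀ γ → γ < N → + a γ I.* dg γ ≡ + a γ I.* db γ
  a1 γ _ with γ N.<? v
  ... | yes vt = cong(+ a γ I.*_)(eq γ vt)
  ... | no vT rewrite bA γ(N.≮⇒≥ vT)= trans(I.*-zeroˡ(dg γ))(sym(I.*-zeroˡ(db γ)))
 sk : ∀{n}(i : Fin n)x{f h : Fin n → ℤ}→ f i ≡ x I.+ h i →(∀ j → j ≢ i → f j ≡ h j)→ su f ≡ x I.+ su h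
 sk{suc n}Fin.zero x Aw oi =
  trans(cong₂ I._+_ Aw(sm λ j → oi(Fin.suc j)λ()))(I.+-assoc x _ _)
 sk{suc n}(Fin.suc i)x{f}{h}Aw oi = trans
  (cong₂ I._+_(oi Fin.zero λ())(sk i x{f ∘ Fin.suc}{h ∘ Fin.suc}Aw λ j ji → oi(Fin.suc j)λ{refl → ji refl}))
  (so.solve 3(λ h x s → h :+(x :+ s):= x :+(h :+ s))refl(h Fin.zero)x _)
  where open so
 Level : Set → Set
 Level I = ℕ → I → ℤ
 rL : ∀{I : Set}→ ℕ →(I → ℤ)→ Level I → Level I
 rL k x U l = if l N.≡ᵇ k then x else U l
 rc : ∀{I : Set}k(x : I → ℤ)U → rL k x U k ≡ x
 rc k x U rewrite rl k = refl
 ro : ∀{I : Set}{k}(x : I → ℤ)U{l}→ l ≢ k → rL k x U l ≡ U l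
 ro x U lJ rewrite fa lJ = refl
 module Ga(I : Set)(N : ℕ)(dg : ℕ → I → ℤ)where
  record Gb(k : ℕ)(a : ℕ → ℕ)(U W : Level I): Set where
   field
    same : ∀ l → l ≢ k → ∀ i → U l i ≡ W l i
    ch : ∀ i → U k i I.+ W k i ≡ U(k ∸ 1)i I.+ U(suc k)i I.+ wi N(λ γ → dg γ i)a
  open La Gb public
 module Rg(I : Set)(N : ℕ)(dg db : ℕ → I → ℤ)(v : ℕ)(a1 : ∀ γ → γ < v → ∀ i → dg γ i ≡ db γ i)where
  module G = Ga I N dg
  module Gg = Ga I N db
  r* : ∀{β}(γs : Weights β){U Gs}→ AW(Be v)γs → G.Slice γs U Gs → Gg.Slice γs U Gs
  r* []{Gs = []}[] s = tt
  r*(_∷_{x = k}a γs){U}{W ∷ Gs}(b ∷ bs)(g , s)= record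
   {same = G.Gb.same g
   ;ch = λ i → trans(G.Gb.ch g i)(cong(λ y → U(k ∸ 1)i I.+ U(suc k)i I.+ y)(wl N b λ γ vt → a1 γ vt i))
   }, r* γs bs s
 k1 : ∀{k}→ 1 ≤ k → k ∸ 1 ≢ k
 k1{suc k}_ eq = N.1+n≢n(sym eq)
 record Ni(p q : ℕ): Set₁ where
  field
   p′ qa : ℕ
   p^ : p′ ≢ p
   p4 : p′ ≢ q
   qp : qa ≢ p
   qq : qa ≢ q
   a6 : ∀{I : Set}(V : Level I)i → V(p ∸ 1)i I.+ V(suc p)i ≡ V q i I.+ V p′ i
   a7 : ∀{I : Set}(V : Level I)i → V(q ∸ 1)i I.+ V(suc q)i ≡ V p i I.+ V qa i
 k/ : ∀ k → k ≢ suc(suc k)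
 k/(suc k)eq = k/ k(N.suc-injective eq)
 nk : ∀{p q}→ ∣ p - q ∣ ≡ 1 → 1 ≤ p → 1 ≤ q → Ni p q
 nk{p}{q}nd 1≤p qc with m1 p q nd
 nk{suc(suc q)}{suc q}nd 1≤p qc | inj₁ refl = record
  {p′ = suc(suc(suc q));qa = q
  ;p^ = N.1+n≢n ;p4 = k/(suc q)∘ sym ;qp = k/ q ;qq = N.1+n≢n ∘ sym
  ;a6 = λ V i → refl ;a7 = λ V i → I.+-comm(V q i)(V(suc(suc q))i)}
 nk{suc p}{suc(suc p)}nd 1≤p qc | inj₂ refl = record
  {p′ = p ;qa = suc(suc(suc p))
  ;p^ = N.1+n≢n ∘ sym ;p4 = k/ p ;qp = k/(suc p)∘ sym ;qq = N.1+n≢n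
  ;a6 = λ V i → I.+-comm(V p i)(V(suc(suc p))i);a7 = λ V i → refl}
 module Ee(I : Set)(d N : ℕ)where
  uD : ℕ →(I → ℤ)→(ℕ → I → ℤ)→ ℕ → I → ℤ
  uD v x dg γ = if γ N.≡ᵇ v then x else dg γ
  em : ∀{β ae}(m : Move β ae)v(γs : Weights β)dg{U}Gs → All(VL d)β → AW(Be v)γs →
   v N.+ moveTrivalents m ≤ N → Ga.Slice I N dg γs U Gs →
   ∃ λ db →(∀ γ → γ < v → ∀ i → dg γ i ≡ db γ i)
    × ∃ λ nw → Ga.Slice I N db(moveWeights m v γs)U(rb m nw Gs)
  em(trivalent{k})v(a ∷ c ∷ γs)dg{U}(M ∷ W ∷ Gs)(vk ∷ _)(ba ∷ bc ∷ bs)v&(UM , MW , s)=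
   db , a1 , tt , record{same = λ l lJ i → trans(same UM l lJ i)(same MW l lJ i);ch = CC}
   , Rg.r* I N dg db v a1 γs bs s
   where
   open Ga.Gb
   b = trivalentOut v a c
   x : I → ℤ
   x i = U k i I.+ W k i I.-(U(k ∸ 1)i I.+ U(suc k)i)I.- wi N(λ γ → dg γ i)(λ γ → a γ ⊓ c γ)
   db = uD v x dg
   d^ : db v ≡ x
   d^ rewrite rl v = refl
   d5 : ∀{γ}→ γ ≢ v → db γ ≡ dg γ
   d5 v3 rewrite fa v3 = refl
   a1 : ∀ γ → γ < v → ∀ i → dg γ i ≡ db γ i
   a1 γ vt i = cong(λ f → f i)(sym(d5(N.<⇒≢ vt)))
   vN : v < N
   vN = subst(_≤ N)(N.+-comm v 1)v&
   v< = Fin.fromℕ< vN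
   Bc : ∀ i → wi N(λ γ → db γ i)b ≡ x i I.+ wi N(λ γ → dg γ i)(λ γ → a γ ⊓ c γ)
   Bc i = sk v<(x i)
    (trans(cong(λ γ → + b γ I.* db γ i)(O.toℕ-fromℕ< vN))(trans(cong₂ I._*_(cong +_(ti v a c))(cong(λ f → f i)d^))
     (trans(I.*-identityˡ(x i))(sym(trans(cong(λ y → x i I.+ y)(trans
      (cong(λ y → + y I.* dg(toℕ v<)i)(trans(cong(λ γ → a γ ⊓ c γ)(O.toℕ-fromℕ< vN))(cong(_⊓ c v)(ba v N.≤-refl))))
      (I.*-zeroˡ(dg(toℕ v<)i))))(I.+-identityʳ(x i)))))))
    λ j jp → let v% = λ e → jp(O.toℕ-injective(trans e(sym(O.toℕ-fromℕ< vN))))in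
     cong₂ I._*_(cong +_(tO v a c λ e → ⊥-elim(v% e)))(cong(λ f → f i)(d5 v%))
   CC : ∀ i → U k i I.+ W k i ≡ U(k ∸ 1)i I.+ U(suc k)i I.+ wi N(λ γ → db γ i)b
   CC i = sym(trans(cong(λ y → U(k ∸ 1)i I.+ U(suc k)i I.+ y)(Bc i))
    (so.solve 3(λ s t w → t :+(s :+ :- t :+ :- w :+ w):= s)refl
     (U k i I.+ W k i)(U(k ∸ 1)i I.+ U(suc k)i)(wi N(λ γ → dg γ i)(λ γ → a γ ⊓ c γ))))
    where open so
  em(4-valent{p}{q}fv)v(a ∷ c ∷ γs)dg{U}(M ∷ W ∷ Gs)((1≤p , _)∷(qc , _)∷ _)bs _(UM , MW , s)=
   dg ,(λ _ _ _ → refl), Nc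
   , record{same = λ l lM i → cong(λ f → f i)(sym(ro(W q)U lM))
    ;ch = λ i → trans(cong₂ I._+_(same UM q(pq ∘ sym)i)(cong(λ f → f i)(rc q(W q)U)))
     (trans(ch MW i)(cong(I._+ wi N(λ γ → dg γ i)c)
      (sym(cong₂ I._+_(same UM(q ∸ 1)q1 i)(same UM(suc q)(qi)i)))))}
   , record{same = oj
    ;ch = λ i → trans(cong₂ I._+_(cong(λ f → f i)(ro(W q)U pq))(sym(same MW p pq i)))
     (trans(ch UM i)(cong(I._+ wi N(λ γ → dg γ i)a)
      (sym(cong₂ I._+_(cong(λ f → f i)(ro(W q)U Pb))(cong(λ f → f i)(ro(W q)U Pf))))))}
   , s
   where
   open Ga.Gb
   Nc = rL q(W q)U
   d> = fi{p}{q}fv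
   pq = proj₁ d>
   Pf = proj₂(proj₂ d>)
   qi = proj₁(proj₂ d>)∘ sym
   q1 : q ∸ 1 ≢ p
   q1 eq = Pf(trans(cong suc(sym eq))(N.m+[n∸m]≡n qc))
   Pb : p ∸ 1 ≢ q
   Pb eq = qi(trans(cong suc(sym eq))(N.m+[n∸m]≡n 1≤p))
   oj : ∀ l → l ≢ p → ∀ i → Nc l i ≡ W l i
   oj l l+ i with l N.≟ q
   ... | yes refl = cong(λ f → f i)(rc q(W q)U)
   ... | no lM = trans(cong(λ f → f i)(ro(W q)U lM))(trans(same UM l l+ i)(same MW l lM i))
  em(6-valent{p}{q}nd)v(a ∷ f ∷ e ∷ γs)dg{U}(M₁ ∷ M₂ ∷ W ∷ Gs)((1≤p , _)∷(qc , _)∷ _)bs _(UM , MM , MW , s)=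
   dg ,(λ _ _ _ → refl),(Na , Nb)
   , record{same = λ l lM i → cong(λ f → f i)(sym(ro n U lM))
    ;ch = λ i → trans(cong(λ y → U q i I.+ y)(cong(λ f → f i)(rc q n U)))
     (so.solve 2(λ u x → u :+(x :+ :- u):= x)refl(U q i)(U(q ∸ 1)i I.+ U(suc q)i I.+ wt i b))}
   , record{same = λ l l+ i → Ng l l+ i
    ;ch = λ i → trans(cong₂ I._+_(cong(λ f → f i)(ro n U pq))(cong(λ f → f i)(ro n W pq)))
     (CM i)}
   , record{same = λ l lM i → cong(λ f → f i)(ro n W lM)
    ;ch = λ i → trans(cong(I._+ W q i)(cong(λ f → f i)(rc q n W)))(CO i)}
   , s
   where
   open Ga.Gb
   open so
   open SixValent a f e
   pq = mb nd
   wt : I →(ℕ → ℕ)→ ℤ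
   wt i x = wi N(λ γ → dg γ i)x
   n : I → ℤ
   n i = U(q ∸ 1)i I.+ U(suc q)i I.+ wt i b I.- U q i
   Na = rL q n U
   Nb = rL q n W
   Uc : ∀ l → l ≢ p → l ≢ q → ∀ i → U l i ≡ W l i
   Uc l l+ lM i = trans(same UM l l+ i)(trans(same MM l lM i)(same MW l l+ i))
   Ng : ∀ l → l ≢ p → ∀ i → Na l i ≡ Nb l i
   Ng l l+ i with l N.≟ q
   ... | yes refl = trans(cong(λ f → f i)(rc q n U))(cong(λ f → f i)(sym(rc q n W)))
   ... | no lM = trans(cong(λ f → f i)(ro n U lM))(trans(Uc l l+ lM i)(cong(λ f → f i)(sym(ro n W lM))))
   Bw : ∀ i → wt i b I.+ wt i c ≡ wt i f I.+ wt i e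
   Bw i = trans(sym(wA N(λ γ → dg γ i)b c))(trans(wn N{λ γ → dg γ i}{λ γ → dg γ i}{a = λ γ → b γ N.+ c γ}{λ γ → f γ N.+ e γ}(λ γ _ → cong(λ x → + x I.* dg γ i)
    (N.m∸n+n≡m(N.≤-trans(N.m⊓n≤n(a γ)(e γ))(N.m≤n+m(e γ)(f γ))))))(wA N(λ γ → dg γ i)f e))
   DP : ∀ i → wt i(SixValent.d a f e)I.+ wt i c ≡ wt i a I.+ wt i f
   DP i = trans(sym(wA N(λ γ → dg γ i)(SixValent.d a f e)c))(trans(wn N{λ γ → dg γ i}{λ γ → dg γ i}{a = λ γ → SixValent.d a f e γ N.+ c γ}{λ γ → a γ N.+ f γ}
    (λ γ _ → cong(λ x → + x I.* dg γ i)(N.m∸n+n≡m(N.≤-trans(N.m⊓n≤m(a γ)(e γ))(N.m≤m+n(a γ)(f γ))))))(wA N(λ γ → dg γ i)a f))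
   open Ni(nk nd 1≤p qc)
   module _(i : I)where
    m = M₁ p i
    Up = U p i
    Uq = U q i
    Wp = W p i
    Wq = W q i
    X = U p′ i
    Y = U qa i
    e$ : wt i a ≡ Up I.+ m I.-(Uq I.+ X)
    e$ = m5(trans(ch UM i)(cong(I._+ wt i a)(a6 U i)))
     where
     m5 : ∀{s t w}→ s ≡ t I.+ w → w ≡ s I.- t
     m5{s}{t}{w}refl = solve 2(λ t w → w := t :+ w :+ :- t)refl t w
    Ea : wt i f ≡ Uq I.+ Wq I.-(m I.+ Y)
    Ea = m5(trans(trans(cong₂ I._+_(same UM q(pq ∘ sym)i)(sym(same MW q(pq ∘ sym)i)))(ch MM i))
     (cong(I._+ wt i f)(trans(a7 M₁ i)(cong(λ y → m I.+ y)(sym(same UM qa qp i))))))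
     where
     m5 : ∀{s t w}→ s ≡ t I.+ w → w ≡ s I.- t
     m5{s}{t}{w}refl = solve 2(λ t w → w := t :+ w :+ :- t)refl t w
    e& : wt i e ≡ m I.+ Wp I.-(Wq I.+ X)
    e& = m5(trans(trans(cong(I._+ Wp)(same MM p pq i))(ch MW i))(cong(I._+ wt i e)(trans(a6 M₂ i)
     (cong₂ I._+_(same MW q(pq ∘ sym)i)(sym(trans(same UM p′ p^ i)(same MM p′ p4 i)))))))
     where
     m5 : ∀{s t w}→ s ≡ t I.+ w → w ≡ s I.- t
     m5{s}{t}{w}refl = solve 2(λ t w → w := t :+ w :+ :- t)refl t w
    Eb : wt i b ≡ wt i f I.+ wt i e I.- wt i c
    Eb = trans(solve 2(λ b c → b := b :+ c :+ :- c)refl(wt i b)(wt i c))(cong(I._- wt i c)(Bw i))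
    Ec : wt i(SixValent.d a f e)≡ wt i a I.+ wt i f I.- wt i c
    Ec = trans(solve 2(λ b c → b := b :+ c :+ :- c)refl(wt i(SixValent.d a f e))(wt i c))(cong(I._- wt i c)(DP i))
    na : n i ≡ Up I.+ Y I.+(wt i f I.+ wt i e I.- wt i c)I.- Uq
    na = cong₂(λ s b → s I.+ b I.- Uq)(a7 U i)Eb
    CM : Up I.+ Wp ≡ Na(p ∸ 1)i I.+ Na(suc p)i I.+ wt i c
    CM = sym(trans(cong(I._+ wt i c)(trans(a6 Na i)(cong₂ I._+_(trans(cong(λ g → g i)(rc q n U))na)
     (cong(λ g → g i)(ro n U p4)))))
     (trans(cong₂(λ f e → Up I.+ Y I.+(f I.+ e I.- wt i c)I.- Uq I.+ X I.+ wt i c)Ea e&)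
      (solve 8(λ m Up Uq Wp Wq X Y c → Up :+ Y :+((Uq :+ Wq :+ :-(m :+ Y)):+(m :+ Wp :+ :-(Wq :+ X)):+ :- c):+ :- Uq :+ X :+ c := Up :+ Wp)
       refl m Up Uq Wp Wq X Y(wt i c))))
    CO : n i I.+ Wq ≡ Nb(q ∸ 1)i I.+ Nb(suc q)i I.+ wt i(SixValent.d a f e)
    CO = trans(cong(I._+ Wq)na)(trans(cong(λ e → Up I.+ Y I.+(wt i f I.+ e I.- wt i c)I.- Uq I.+ Wq)e&)
     (trans(solve 9(λ m Up Uq Wp Wq X Y c f → Up :+ Y :+(f :+(m :+ Wp :+ :-(Wq :+ X)):+ :- c):+ :- Uq :+ Wq
      := Wp :+ Y :+(Up :+ m :+ :-(Uq :+ X):+ f :+ :- c))refl m Up Uq Wp Wq X Y(wt i c)(wt i f))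
      (sym(cong₂ I._+_(trans(a7 Nb i)(cong₂ I._+_(cong(λ g → g i)(ro n W pq))
       (trans(cong(λ g → g i)(ro n W qq))(sym(Uc qa qp qq i)))))
       (trans Ec(cong(λ a → a I.+ wt i f I.- wt i c)e$))))))
  em(skip{k}m)v(a ∷ γs)dg{U}(W ∷ Gs)(_ ∷ vs)(ba ∷ bs)vJ(g , s)with em m v γs dg Gs vs bs vJ s
  ... | db , a1 , nw , S4 = db , a1 , nw , record
   {same = Ga.Gb.same g
   ;ch = λ i → trans(Ga.Gb.ch g i)(cong(λ y → U(k ∸ 1)i I.+ U(suc k)i I.+ y)(wl N ba λ γ vt → a1 γ vt i))}, S4
  extend : ∀{β ae}(w : Weave β ae)v(γs : Weights β)dg{U}Gs → All(VL d)β → AW(Be v)γs →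
   v N.+ trivalents w ≤ N → Ga.Slice I N dg γs U Gs →
   ∃ λ db →(∀ γ → γ < v → ∀ i → dg γ i ≡ db γ i)× Ga.Lb I N db w v γs U Gs
  extend [] v γs dg Gs vs bs vJ s = dg ,(λ _ _ _ → refl), s
  extend(m ∷ w)v γs dg{U}Gs vs bs vJ s
   with v+ ← N.≤-trans(N.+-monoʳ-≤ v(N.m≤m+n(moveTrivalents m)(trivalents w)))vJ
   with em m v γs dg Gs vs bs v+ s
  ... | DC , AM , nw , g7 with extend w(v N.+ moveTrivalents m)(moveWeights m v γs)DC(rb m nw Gs)
   (vm m vs)(bm m v γs bs)(subst(_≤ N)(sym(N.+-assoc v(moveTrivalents m)(trivalents w)))vJ)g7
  ... | Dp , AN , rt = Dp , a1 , Rg.r* I N dg Dp v a1 γs bs s , nw , rt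
   where
   a1 : ∀ γ → γ < v → ∀ i → dg γ i ≡ Dp γ i
   a1 γ vt i = trans(AM γ vt i)(AN γ(N.<-≤-trans vt(N.m≤m+n v _))i)
module Fx where
 open IS
 open Sl
 open KF
 open Wo
 open Gd
 open import Relation.Binary.PropositionalEquality.Core using(refl;sym;trans;cong;cong₂)
 open import Defs using(D)
 c2 : ∀{n}(f g h e : Fin n → ℤ)s t u →
  su(λ γ →(f γ I.* s I.+ g γ I.* t I.+ h γ I.* u)I.* e γ)
  ≡ s I.* su(λ γ → f γ I.* e γ)I.+ t I.* su(λ γ → g γ I.* e γ)I.+ u I.* su(λ γ → h γ I.* e γ)
 c2{zero}f g h e s t u = so.solve 3(λ s t u → con(+ 0):= s :* con(+ 0):+ t :* con(+ 0):+ u :* con(+ 0))refl s t u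
  where open so
 c2{suc n}f g h e s t u = trans(cong(λ y →(fY I.* s I.+ gP I.* t I.+ ha I.* u)I.* Ei I.+ y)
  (c2(f ∘ Fin.suc)(g ∘ Fin.suc)(h ∘ Fin.suc)(e ∘ Fin.suc)s t u))
  (so.solve 10(λ f g h e s t u F G H →(f :* s :+ g :* t :+ h :* u):* e :+(s :* F :+ t :* G :+ u :* H)
   := s :*(f :* e :+ F):+ t :*(g :* e :+ G):+ u :*(h :* e :+ H))refl fY gP ha Ei s t u _ _ _)
  where
  open so
  fY = f Fin.zero
  gP = g Fin.zero
  ha = h Fin.zero
  Ei = e Fin.zero
 Sw : ∀{n}(f g e : Fin n → ℤ)→ su(λ γ →(f γ I.+ g γ)I.* e γ)≡ su(λ γ → f γ I.* e γ)I.+ su(λ γ → g γ I.* e γ)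
 Sw{n}f g e = trans(sm{n}λ γ → I.*-distribʳ-+(e γ)(f γ)(g γ))(a9.∑-distrib-+{n}_ _)
 Dx : ∀ x y z xa ya za → D x y z xa ya za ≡ + x I.*(+ ya I.- + za)I.+ + y I.*(+ za I.- + xa)I.+ + z I.*(+ xa I.- + ya)
 Dx x y z xa ya za = solve 6(λ x y z xa ya za →
  ((y :* za):+ :-(z :* ya)):+ :-((x :* za):+ :-(z :* xa)):+((x :* ya):+ :-(y :* xa))
  := x :*(ya :+ :- za):+ y :*(za :+ :- xa):+ z :*(xa :+ :- ya))refl(+ x)(+ y)(+ z)(+ xa)(+ ya)(+ za)
  where open so
 mv : ∀{β ae}→ Move β ae →(v : ℕ)→ Weights β →(γ ad : ℕ)→ ℤ
 mv trivalent v(a ∷ c ∷ _)γ ad = D(a γ)(b γ)(c γ)(a ad)(b ad)(c ad)I.+ D(a γ)(b γ)(c γ)(a ad)(b ad)(c ad)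
  where b = trivalentOut v a c
 mv(4-valent _)v _ γ ad = + 0
 mv(6-valent _)v(a ∷ f ∷ e ∷ _)γ ad =
  D(a γ)(c γ)(e γ)(a ad)(c ad)(e ad)I.+ D(b γ)(d γ)(f γ)(b ad)(d ad)(f ad)
  where open SixValent a f e
 mv(skip m)v(_ ∷ γs)γ ad = mv m v γs γ ad
 mi : ∀{s t w}→ s ≡ t I.+ w → w ≡ s I.- t
 mi{s}{t}{w}refl = so.solve 2(λ t w → w := t :+ w :+ :- t)refl t w
  where open so
 module Te(I : Set)(d N : ℕ)(dg : ℕ → I → ℤ)(i : I)(ad : ℕ)where
  open Ga I N dg
  open Gb
  open so
  wt :(ℕ → ℕ)→ ℤ
  wt a = wi N(λ γ → dg γ i)a
  fl : ∀{β}→ Weights β → Level I → Ll(Level I)β → ℤ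
  fl [] U [] = + 0
  fl(_∷_{x = k}a γs)U(W ∷ Gs)= + a ad I.*(W k i I.- U k i)I.+ fl γs W Gs
  e+ : ∀(x y z : ℕ → ℕ)→ su{N}(λ γ → D(x(toℕ γ))(y(toℕ γ))(z(toℕ γ))(x ad)(y ad)(z ad)I.* dg(toℕ γ)i)
   ≡(+ y ad I.- + z ad)I.* wt x I.+(+ z ad I.- + x ad)I.* wt y I.+(+ x ad I.- + y ad)I.* wt z
  e+ x y z = trans(sm{N}λ γ → cong(I._* dg(toℕ γ)i)(Dx(x(toℕ γ))(y(toℕ γ))(z(toℕ γ))(x ad)(y ad)(z ad)))
   (c2{N}(λ γ → + x(toℕ γ))(λ γ → + y(toℕ γ))(λ γ → + z(toℕ γ))(λ γ → dg(toℕ γ)i)_ _ _)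
  cR : ∀{β ae}(m : Move β ae)v(γs : Weights β){U}Gs nw → All(VL d)β →
   Slice γs U Gs → Slice(moveWeights m v γs)U(rb m nw Gs)→
   su{N}(λ γ → mv m v γs(toℕ γ)ad I.* dg(toℕ γ)i)
   ≡ + 2 I.*(fl γs U Gs I.- fl(moveWeights m v γs)U(rb m nw Gs))
  cR(trivalent{k})v(a ∷ c ∷ γs){U}(M ∷ W ∷ Gs)nw((kk , _)∷ _)(UM , MW , _)(UW , _)= trans(Sw{N}DE DE(λ γ → dg(toℕ γ)i))(trans(cong(λ y → y I.+ y)(trans(e+ a b c)(cong₂ I._+_(cong₂(λ x y →(+ b ad I.- + c ad)
   I.* x I.+(+ c ad I.- + a ad)I.* y)(mi(ch UM i))(mi(ch UW i)))(cong((+ a ad I.- + b ad)I.*_)(mi(trans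
   (ch MW i)(cong(I._+ wt c)nb)))))))(solve 8(λ a b c u m w n φ →((b :+ :- c):*(u :+ m :+ :- n):+(c :+ :- a):*(u :+ w :+ :- n):+(a :+ :-
   b):*(m :+ w :+ :- n)):+((b :+ :- c):*(u :+ m :+ :- n):+(c :+ :- a):*(u :+ w :+ :- n):+(a :+ :- b):*(m :+ w :+ :- n)):= con(+ 2):*((a
   :*(m :+ :- u):+(c :*(w :+ :- m):+ φ)):+ :-(b :*(w :+ :- u):+ φ)))refl(+ a ad)(+ b ad)(+ c ad)u m w n(fl γs W Gs)))
   where
   open ≡-Reasoning
   b = trivalentOut v a c
   DE : Fin N → ℤ
   DE γ = D(a(toℕ γ))(b(toℕ γ))(c(toℕ γ))(a ad)(b ad)(c ad)
   u = U k i
   m = M k i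
   w = W k i
   n = U(k ∸ 1)i I.+ U(suc k)i
   S =(+ b ad I.- + c ad)I.*(u I.+ m I.- n)I.+(+ c ad I.- + a ad)I.*(u I.+ w I.- n)I.+(+ a ad I.- + b ad)I.*(m I.+ w I.- n)
   nb : M(k ∸ 1)i I.+ M(suc k)i ≡ n
   nb = cong₂ I._+_(sym(same UM(k ∸ 1)(k1 kk)i))(sym(same UM(suc k)N.1+n≢n i))
  cR(4-valent{p}{q}fv)v(a ∷ c ∷ γs){U}(M ∷ W ∷ Gs)Nc _(UM , MW , _)(UN , NW , _)= trans(trans(sm{N}λ γ → I.*-zeroˡ(dg(toℕ γ)i))(a9.sum-replicate-zero N))(trans(solve 7(λ a c up uq wp wq φ → con(+ 0):= con(+ 2)
   :*((a :*(wp :+ :- up):+(c :*(wq :+ :- uq):+ φ)):+ :-(c :*(wq :+ :- uq):+(a :*(wp :+ :- up):+ φ))))refl(+ a ad)(+ c ad)(U p i)(U q i)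
   (W p i)(W q i)φ)(cong₂(λ x y → + 2 I.*(x I.- y))(cong₂(λ mp mq → + a ad I.*(mp I.- U p i)I.+(+ c ad I.*(W q i I.- mq)I.+ φ))(sym(same MW
   p pq i))(same UM q(pq ∘ sym)i))(cong₂(λ nq np → + c ad I.*(nq I.- U q i)I.+(+ a ad I.*(W p i I.- np)I.+ φ))(sym(same NW q(pq ∘ sym)i))
   (same UN p pq i))))
   where
   open ≡-Reasoning
   φ = fl γs W Gs
   pq = mm fv
  cR(6-valent{p}{q}nd)v(a ∷ f ∷ e ∷ γs){U}(M₁ ∷ M₂ ∷ W ∷ Gs)(Na , Nb)((1≤p , _)∷(qc , _)∷ _)
   (UM , MM , MW , _)(UN , NN , NW , _)= trans(Sw{N}Db Dc(λ γ → dg(toℕ γ)i))(trans(cong₂ I._+_(e+ a c e)(e+ b dc f))(trans(cong₂ I._+_(trans(cong(λ x → S a′ cB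
    ed x(wt c)(wt e))e$)(cong₂(S a′ cB ed(Up I.+ m I.-(Uq I.+ X)))Ej e&))(trans(cong₂(λ y z → S y z fc(wt b)(wt dc)(wt f))eQ eR)
    (trans(cong(λ x → S(fc I.+ ed I.- cB)(a′ I.+ fc I.- cB)fc x(wt dc)(wt f))Eb)(cong₂(S(fc I.+ ed I.- cB)(a′ I.+ fc I.- cB)fc(Uq I.+ n I.-
    (Up I.+ Y)))Ec Ea))))(trans hA(cong₂(λ x y → + 2 I.*(x I.- y))t+ Bd))))
   where
   open ≡-Reasoning
   open SixValent a f e using(b;c)renaming(d to dc)
   open Ni(nk nd 1≤p qc)
   pq = mb nd
   qe = pq ∘ sym
   Db Dc : Fin N → ℤ
   Db γ = D(a(toℕ γ))(c(toℕ γ))(e(toℕ γ))(a ad)(c ad)(e ad)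
   Dc γ = D(b(toℕ γ))(dc(toℕ γ))(f(toℕ γ))(b ad)(dc ad)(f ad)
   S :(x y z wx wy wz : ℤ)→ ℤ
   S x y z wx wy wz =(y I.- z)I.* wx I.+(z I.- x)I.* wy I.+(x I.- y)I.* wz
   a′ = + a ad
   cB = + c ad
   ed = + e ad
   fc = + f ad
   Up = U p i
   Uq = U q i
   Wp = W p i
   Wq = W q i
   m = M₁ p i
   n = Na q i
   X = U p′ i
   Y = U qa i
   φ = fl γs W Gs
   eQ : + b ad ≡ fc I.+ ed I.- cB
   eQ = trans(mi{+ f ad I.+ + e ad}{+ c ad}(trans(sym(I.pos-+(f ad)(e ad)))
    (trans(cong +_(sym(N.m∸n+n≡m(N.≤-trans(N.m⊓n≤n(a ad)(e ad))(N.m≤n+m(e ad)(f ad))))))(trans(I.pos-+(b ad)(c ad))(I.+-comm(+ b ad)cB)))))refl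
   eR : + dc ad ≡ a′ I.+ fc I.- cB
   eR = trans(mi{+ a ad I.+ + f ad}{+ c ad}(trans(sym(I.pos-+(a ad)(f ad)))
    (trans(cong +_(sym(N.m∸n+n≡m(N.≤-trans(N.m⊓n≤m(a ad)(e ad))(N.m≤m+n(a ad)(f ad))))))(trans(I.pos-+(dc ad)(c ad))(I.+-comm(+ dc ad)cB)))))refl
   e$ : wt a ≡ Up I.+ m I.-(Uq I.+ X)
   e$ = mi(trans(ch UM i)(cong(I._+ wt a)(a6 U i)))
   Ea : wt f ≡ Uq I.+ Wq I.-(m I.+ Y)
   Ea = mi(trans(cong₂ I._+_(same UM q qe i)(sym(same MW q qe i)))(trans(ch MM i)
    (cong(I._+ wt f)(trans(a7 M₁ i)(cong(λ y → m I.+ y)(sym(same UM qa qp i)))))))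
   e& : wt e ≡ m I.+ Wp I.-(Wq I.+ X)
   e& = mi(trans(cong(I._+ Wp)(same MM p pq i))(trans(ch MW i)(cong(I._+ wt e)(trans(a6 M₂ i)
    (cong₂ I._+_(same MW q qe i)(sym(trans(same UM p′ p^ i)(same MM p′ p4 i))))))))
   Eb : wt b ≡ Uq I.+ n I.-(Up I.+ Y)
   Eb = mi(trans(ch UN i)(cong(I._+ wt b)(a7 U i)))
   Ej : wt c ≡ Up I.+ Wp I.-(n I.+ X)
   Ej = mi(trans(cong₂ I._+_(same UN p pq i)(sym(same NW p pq i)))(trans(ch NN i)
    (cong(I._+ wt c)(trans(a6 Na i)(cong(λ y → n I.+ y)(sym(same UN p′ p4 i)))))))
   Ec : wt dc ≡ n I.+ Wq I.-(Wp I.+ Y)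
   Ec = mi(trans(cong(I._+ Wq)(same NN q qe i))(trans(ch NW i)(cong(I._+ wt dc)(trans(a7 Nb i)
    (cong₂ I._+_(same NW p pq i)(sym(trans(same UN qa qq i)(same NN qa qp i))))))))
   t+ = cong₂(λ x y → a′ I.*(m I.- Up)I.+(x I.+(y I.+ φ)))
    (cong₂(λ x y → fc I.*(x I.- y))(sym(same MW q qe i))(same UM q qe i))(cong(λ x → ed I.*(Wp I.- x))(same MM p pq i))
   Bd = trans(cong₂(λ x y → x I.*(n I.- Uq)I.+(cB I.*(Wp I.- Up)I.+(y I.*(Wq I.- n)I.+ φ)))(sym eQ)(sym eR))
    (cong₂(λ x y → + b ad I.*(n I.- Uq)I.+(x I.+(y I.+ φ)))
     (cong₂(λ x y → cB I.*(x I.- y))(sym(same NW p pq i))(same UN p pq i))(cong(λ x → + dc ad I.*(Wq I.- x))(same NN q qe i)))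
   hA = solve 13(λ a c e f Up Uq Wp Wq m n X Y φ →
    ((c :+ :- e):*(Up :+ m :+ :-(Uq :+ X)):+(e :+ :- a):*(Up :+ Wp :+ :-(n :+ X)):+(a :+ :- c):*(m :+ Wp :+ :-(Wq :+ X)))
    :+(((a :+ f :+ :- c):+ :- f):*(Uq :+ n :+ :-(Up :+ Y)):+(f :+ :-(f :+ e :+ :- c)):*(n :+ Wq :+ :-(Wp :+ Y))
     :+((f :+ e :+ :- c):+ :-(a :+ f :+ :- c)):*(Uq :+ Wq :+ :-(m :+ Y)))
    := con(+ 2):*((a :*(m :+ :- Up):+(f :*(Wq :+ :- Uq):+(e :*(Wp :+ :- m):+ φ)))
     :+ :-((f :+ e :+ :- c):*(n :+ :- Uq):+(c :*(Wp :+ :- Up):+((a :+ f :+ :- c):*(Wq :+ :- n):+ φ)))))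
    refl a′ cB ed fc Up Uq Wp Wq m n X Y φ
  cR(skip{k}m)v(a ∷ γs){U}(W ∷ Gs)nw(_ ∷ vs)(_ , s)(_ , S4)= trans(cR m v γs Gs nw vs s S4)
   (cong(+ 2 I.*_)(solve 3(λ x y z → y :+ :- z :=(x :+ y):+ :-(x :+ z))refl(+ a ad I.*(W k i I.- U k i))(fl γs W Gs)(fl(moveWeights m v γs)W(rb m nw Gs))))
module Bl where
 open IS
 open Sl
 open KF
 open Wo
 open Gd
 open Fx
 open import Relation.Binary.PropositionalEquality.Core using(refl;sym;trans;cong;cong₂)
 open import Defs using(D)
 ι : ℤ → ℚ
 ι z = z Q./ 1
 b> : ∀ a b → ι(a I.+ b)≡ ι a Q.+ ι b
 b> a b = Q.toℚᵘ-injective(ℚᵘ.≃-trans(Q.toℚᵘ-fromℚᵘ(ℚᵘ.mkℚᵘ(a I.+ b)0))(ℚᵘ.≃-sym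
  (ℚᵘ.≃-trans(Q.toℚᵘ-homo-+(ι a)(ι b))(ℚᵘ.≃-trans(ℚᵘ.+-cong(Q.toℚᵘ-fromℚᵘ(ℚᵘ.mkℚᵘ a 0))(Q.toℚᵘ-fromℚᵘ(ℚᵘ.mkℚᵘ b 0)))
   (ℚᵘ.*≡*(solve 2(λ a b →(a :* con(+ 1):+ b :* con(+ 1)):* con(+ 1):=(a :+ b):* con(+ 1))refl a b))))))
  where open so
 f1 : ∀ a b → ι(a I.* b)≡ ι a Q.* ι b
 f1 a b = Q.toℚᵘ-injective(ℚᵘ.≃-trans(Q.toℚᵘ-fromℚᵘ(ℚᵘ.mkℚᵘ(a I.* b)0))(ℚᵘ.≃-sym
  (ℚᵘ.≃-trans(Q.toℚᵘ-homo-*(ι a)(ι b))(ℚᵘ.*-cong(Q.toℚᵘ-fromℚᵘ(ℚᵘ.mkℚᵘ a 0))(Q.toℚᵘ-fromℚᵘ(ℚᵘ.mkℚᵘ b 0))))))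
 nD : ∀ a → ι(I.- a)≡ Q.- ι a
 nD a = Q.toℚᵘ-injective(ℚᵘ.≃-trans(Q.toℚᵘ-fromℚᵘ(ℚᵘ.mkℚᵘ(I.- a)0))(ℚᵘ.≃-sym
  (ℚᵘ.≃-trans(Q.toℚᵘ-homo‿-(ι a))(ℚᵘ.-‿cong(Q.toℚᵘ-fromℚᵘ(ℚᵘ.mkℚᵘ a 0))))))
 iL : ∀{a b}→ ι a ≡ ι b → a ≡ b
 iL{a}{b}eq with ℚᵘ.≃-trans(ℚᵘ.≃-sym(Q.toℚᵘ-fromℚᵘ(ℚᵘ.mkℚᵘ a 0)))
  (ℚᵘ.≃-trans(ℚᵘ.≃-reflexive(cong Q.toℚᵘ eq))(Q.toℚᵘ-fromℚᵘ(ℚᵘ.mkℚᵘ b 0)))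
 ... | ℚᵘ.*≡* Ek = trans(sym(I.*-identityʳ a))(trans Ek(I.*-identityʳ b))
 hI : ∀ z → z Q./ 2 ≡ ½ Q.* ι z
 hI z = Q.toℚᵘ-injective(ℚᵘ.≃-trans(Q.toℚᵘ-fromℚᵘ(ℚᵘ.mkℚᵘ z 1))(ℚᵘ.≃-sym
  (ℚᵘ.≃-trans(Q.toℚᵘ-homo-* ½(ι z))(ℚᵘ.≃-trans(ℚᵘ.*-cong(ℚᵘ.≃-refl{Q.toℚᵘ ½})(Q.toℚᵘ-fromℚᵘ(ℚᵘ.mkℚᵘ z 0)))
   (ℚᵘ.*≡*(solve 1(λ z → con(+ 1):* z :* con(+ 2):= z :* con(+ 2))refl z))))))
  where open so
 hl : ∀ z → ½ Q.* ι(+ 2 I.* z)≡ ι z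
 hl z = trans(cong(½ Q.*_)(f1(+ 2)z))(trans(sym(Q.*-assoc ½(ι(+ 2))(ι z)))(Q.*-identityˡ(ι z)))
 hE : ∀ z → ½ Q.* ι(z I.+ z)≡ ι z
 hE z = trans(cong(λ y → ½ Q.* ι y)(solve 1(λ z → z :+ z := con(+ 2):* z)refl z))(hl z)
  where open so
 mP : ∀{β ae}(m : Move β ae)v(γs : Weights β)γ ad → movePairing m v γs γ ad ≡ ½ Q.* ι(mv m v γs γ ad)
 mP trivalent v(a ∷ c ∷ _)γ ad = sym(hE(D(a γ)(trivalentOut v a c γ)(c γ)(a ad)(trivalentOut v a c ad)(c ad)))
 mP(4-valent _)v _ γ ad = sym(Q.*-zeroʳ ½)
 mP(6-valent _)v(a ∷ f ∷ e ∷ _)γ ad = hI(D(a γ)(S.c γ)(e γ)(a ad)(S.c ad)(e ad)I.+ D(S.b γ)(S.d γ)(f γ)(S.b ad)(S.d ad)(f ad))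
  where module S = SixValent a f e
 mP(skip m)v(_ ∷ γs)γ ad = mP m v γs γ ad
 sc : ∀{n}{f h : Fin n → ℚ}→(∀ i → f i ≡ h i)→ sumℚ f ≡ sumℚ h
 sc{zero}eq = refl
 sc{suc n}eq = cong₂ Q._+_(eq Fin.zero)(sc{n}(eq ∘ Fin.suc))
 module f2 = CommutativeMonoidSum Q.+-0-commutativeMonoid
 s6 : ∀{n}(f h : Fin n → ℚ)→ sumℚ(λ i → f i Q.+ h i)≡ sumℚ f Q.+ sumℚ h
 s6{n}f h = f2.∑-distrib-+{n}f h
 sX : ∀{n}c(f : Fin n → ℚ)→ sumℚ(λ i → c Q.* f i)≡ c Q.* sumℚ f
 sX{zero}c f = sym(Q.*-zeroʳ c)
 sX{suc n}c f = trans(cong(c Q.* f Fin.zero Q.+_)(sX{n}c(f ∘ Fin.suc)))(sym(Q.*-distribˡ-+ c(f Fin.zero)(sumℚ(f ∘ Fin.suc))))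
 sz : ∀{n}{f : Fin n → ℚ}→(∀ i → f i ≡ 0ℚ)→ sumℚ f ≡ 0ℚ
 sz{zero}eq = refl
 sz{suc n}eq = trans(cong₂ Q._+_(eq Fin.zero)(sz{n}(eq ∘ Fin.suc)))(Q.+-identityˡ 0ℚ)
 S5 : ∀{n}(f : Fin n → ℤ)→ sumℚ(ι ∘ f)≡ ι(su f)
 S5{zero}f = refl
 S5{suc n}f = trans(cong(ι(f Fin.zero)Q.+_)(S5{n}(f ∘ Fin.suc)))(sym(b>(f Fin.zero)(su(f ∘ Fin.suc))))
 module Bn(I : Set)(d N : ℕ)(dg : ℕ → I → ℤ)(i : I)(ad : ℕ)where
  open Ga I N dg
  open Te I d N dg i ad
  mV : ∀{β ae}(m : Move β ae)v(γs : Weights β){U}Gs nw → All(VL d)β →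
   Slice γs U Gs → Slice(moveWeights m v γs)U(rb m nw Gs)→
   sumℚ{N}(λ γ → movePairing m v γs(toℕ γ)ad Q.* ι(dg(toℕ γ)i))
   ≡ ι(fl γs U Gs I.- fl(moveWeights m v γs)U(rb m nw Gs))
  mV m v γs{U}Gs nw vs s S4 = trans(sc{N}(λ γ → trans(cong(Q._* ι(dg(toℕ γ)i))(mP m v γs(toℕ γ)ad))(trans(Q.*-assoc ½(ι(mv m v γs(toℕ γ)
   ad))(ι(dg(toℕ γ)i)))(cong(½ Q.*_)(sym(f1(mv m v γs(toℕ γ)ad)(dg(toℕ γ)i)))))))(trans(sX{N}½(λ γ → ι(mv m v γs
   (toℕ γ)ad I.* dg(toℕ γ)i)))(trans(cong(½ Q.*_)(trans(S5{N}(λ γ → mv m v γs(toℕ γ)ad I.* dg(toℕ γ)i))(cong ι(cR m v γs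
   Gs nw vs s S4))))(hl(fl γs U Gs I.- fl(moveWeights m v γs)U(rb m nw Gs)))))
   where open ≡-Reasoning
  b2 : ∀{β ae}(w : Weave β ae)v(γs : Weights β){U}Gs → All(VL d)β →(l : Lb w v γs U Gs)→
   sumℚ{N}(λ γ → pairing w v γs(toℕ γ)ad Q.* ι(dg(toℕ γ)i))
   ≡ ι(fl γs U Gs I.- fl(bottomWeights w v γs)U(bL w l))
  b2 [] v γs{U}Gs vs l = trans(sz{N}λ γ → Q.*-zeroˡ(ι(dg(toℕ γ)i)))(cong ι(sym(I.+-inverseʳ(fl γs U Gs))))
  b2(m ∷ w)v γs{U}Gs vs(s , nw , rt)= trans(sc{N}(λ γ → Q.*-distribʳ-+(ι(dg(toℕ γ)i))(movePairing m v γs(toℕ γ)ad)(pairing w vQ S~(toℕ γ)ad)))(trans(s6{N}(λ γ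
   → movePairing m v γs(toℕ γ)ad Q.* ι(dg(toℕ γ)i))(λ γ → pairing w vQ S~(toℕ γ)ad Q.* ι(dg(toℕ γ)i)))(trans(cong₂ Q._+_(mV m v
   γs Gs nw vs s(tS w rt))(b2 w vQ S~(rb m nw Gs)(vm m vs)rt))(trans(sym(b>(f+ I.- f3)(f3 I.- f~)))(cong ι
   (solve 3(λ x y z →(x :+ :- y):+(y :+ :- z):= x :+ :- z)refl f+ f3 f~)))))
   where
   open ≡-Reasoning
   open so
   vQ = v N.+ moveTrivalents m
   S~ = moveWeights m v γs
   f+ = fl γs U Gs
   f3 = fl S~ U(rb m nw Gs)
   f~ = fl(bottomWeights w vQ S~)U(bL w rt)
module SZ where
 open IS
 open Ex
 open FB using(module Fm)
 open Sl
 open KF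
 open KW
 open Wo
 open BP
 module e~(R : CommutativeRing 0ℓ 0ℓ)(d : ℕ)(t ta :(ℕ → ℕ)→ CommutativeRing.Carrier R)
  (t1 : ∀ a → CommutativeRing._≈_ R(CommutativeRing._*_ R(t a)(ta a))(CommutativeRing.1# R))where
  open CommutativeRing R
  open RingProperties ring
  open In R
  open EA R
  open Fm R d
  open Aa d
  open Ar
  open SetoidReasoning setoid
  sF :(ℕ → ℕ)→(ℕ → Carrier)→ Fe → Fe
  sF w f b i c = f(w i)* b(w i)c
  rS : ℕ → ℕ → Carrier → Carrier →(ℕ → Carrier)→ ℕ → Carrier
  rS x y τ aj f z = if z N.≡ᵇ x then - aj * f x else if z N.≡ᵇ y then τ * f y else f z
  module _{x y : ℕ}{τ aj : Carrier}{f : ℕ → Carrier}(xc : x ≢ y)where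
   rO : rS x y τ aj f x ≡ - aj * f x
   rO rewrite rl x = P.refl
   rP : rS x y τ aj f y ≡ τ * f y
   rP rewrite fa(xc ∘ P.sym)| rl y = P.refl
   rz : ∀{z}→ z ≢ x → z ≢ y → rS x y τ aj f z ≡ f z
   rz zx zy rewrite fa zx | fa zy = P.refl
  Iv :(f f⁻¹ : ℕ → Carrier)→ Set
  Iv f f⁻¹ = ∀ z → f z * f⁻¹ z ≈ 1#
  rH : ∀{x y τ aj f f⁻¹}→ x ≢ y → τ * aj ≈ 1# → Iv f f⁻¹ →
   Iv(rS x y τ aj f)(rS x y aj τ f⁻¹)
  rH{x}{y}{τ}{aj}{f}{f⁻¹}xc b+ fb z with z N.≟ x
  ... | yes P.refl = trans(*-cong(reflexive(rO{f = f}xc))(reflexive(rO{f = f⁻¹}xc)))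
   (trans(solve 4(λ a b f g →(:- b :* f):*(:- a :* g):=(a :* b):*(f :* g))refl τ aj(f x)(f⁻¹ x))
    (trans(*-cong b+(fb x))(*-identityˡ 1#)))
  ... | no zx with z N.≟ y
  ... | yes P.refl = trans(*-cong(reflexive(rP{f = f}xc))(reflexive(rP{f = f⁻¹}xc)))
   (trans(solve 4(λ a b f g →(a :* f):*(b :* g):=(a :* b):*(f :* g))refl τ aj(f y)(f⁻¹ y))
    (trans(*-cong b+(fb y))(*-identityˡ 1#)))
  ... | no zy = trans(*-cong(reflexive(rz{f = f}xc zx zy))(reflexive(rz{f = f⁻¹}xc zx zy)))(fb z)
  wf : ∀{g h : Fe}→(∀ i c → g i c ≈ h i c)→ ∀ k → we g k ap we h k
  wf p zero = ra
  wf p(suc k)= cg(wf p k)(p(suc k))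
  _g8_ : ∀{v w}→ Ar v → Ar w → Set
  v g8 w = ∀{x y}→ x N.< y → position v y N.< position v x → position w y N.< position w x
  SF : ∀{w}→ Ar w → Fe → Fe → Set
  SF a bd b = ∀{v}(av : Ar v)→ av g8 a → ∀ f f⁻¹ → Iv f f⁻¹ →
   ∀ k → we(sF v f bd)k ap we(sF v f b)k
  AC : ∀{β}→ Fe →(ℕ → ℕ)→(ℕ → Carrier)→ Weights β → Fl → Ll Fl β → Set
  AC b w f [] U [] = Re(sF w f b)U
  AC b w f(_∷_{x = k}a γs)U(W ∷ Gs)= Re(sF w f b)U ×
   AC b(w ∘ transposition k)(rS(w k)(w(suc k))(t a)(ta a)f)γs W Gs
  Ce : ℕ →(ℕ → ℕ)→ Fl → Fl → Set
  Ce k a U W = Cr k U W(t a)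
  open La Ce using(Slice)
  S& : ℕ → ℕ → Carrier → Fe → Fe
  S& x y μ b z = if z N.≡ᵇ y then(λ c → b y c + μ * b x c)else b z
  b! : ∀ x y μ b → S& x y μ b y ≡ λ c → b y c + μ * b x c
  b! x y μ b rewrite rl y = P.refl
  s! : ∀ x y μ b{z}→ z ≢ y → S& x y μ b z ≡ b z
  s! x y μ b zy rewrite fa zy = P.refl
  eB : ∀ g m k → m N.< k → we g k af g(suc m)ap aN
  eB g m k Mc = vr g(g(suc m))Mc(sq(we g m)(g(suc m)))
  s+ : ∀{v}(av : Ar v){x y}→ 1 N.≤ x → position av x N.< position av y → ∀ μ b f f⁻¹ → Iv f f⁻¹ →
   ∀ k → we(sF v f(S& x y μ b))k ap we(sF v f b)k
  s+ av xb p/ μ b f f⁻¹ fb zero = ra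
  s+{v}av{x}{y}xb p/ μ b f f⁻¹ fb(suc k)with v(suc k)N.≟ y
  ... | no yj = cg(s+ av xb p/ μ b f f⁻¹ fb k)(λ c → *-congˡ(reflexive(P.cong(λ x → x c)(s! x y μ b yj))))
  ... | yes yi = λ S → trans(cg(s+ av xb p/ μ b f f⁻¹ fb k)(λ c → trans(*-congˡ(reflexive(P.trans(P.cong(λ z → S& x y μ b z c)yi)(P.trans
   (P.cong(λ x → x c)(b! x y μ b))(P.cong(λ z → b z c + μ * b x c)(P.sym yi))))))(eK c))S)(trans(cu(we g k)1# _(g(suc
   k))(g(suc m))S)(trans(+-cong(*-identityˡ _)(trans(*-congˡ(eB g m k Mc S))(zeroʳ _)))(+-identityʳ _)))
   where
   g = sF v f b
   Pd : ∃ λ m → position av x ≡ suc m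
   Pd with position av x in eq
   ... | suc m = m , P.refl
   ... | zero = ⊥-elim(N.<⇒≢ xb(P.trans(P.sym(f0 av))(P.trans(P.cong v(P.sym eq))(wo av x))))
   m = proj₁ Pd
   v$ : v(suc m)≡ x
   v$ = P.trans(P.cong v(P.sym(proj₂ Pd)))(wo av x)
   Mc : m N.< k
   Mc = N.s≤s⁻¹(P.subst₂ N._<_(proj₂ Pd)(P.trans(P.cong(position av)(P.sym yi))(pw av(suc k)))p/)
   eK : ∀ c → f(v(suc k))*(b(v(suc k))c + μ * b x c)≈ 1# * g(suc k)c +(f(v(suc k))* μ * f⁻¹ x)* g(suc m)c
   eK c = trans(distribˡ _ _ _)(trans(+-cong(sym(*-identityˡ _))(trans(sym(*-identityʳ _))(*-congˡ(sym(fb x)))))(trans(+-congˡ(solve 5(λ f μ b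
    fx gx → f :*(μ :* b):*(fx :* gx):= f :* μ :* gx :*(fx :* b))refl _ μ(b x c)(f x)(f⁻¹ x)))(+-congˡ(*-congˡ(reflexive(P.cong(λ z → f z * b
    z c)(P.sym v$)))))))
  t9 : ∀ k z τ aj g → t' k z τ aj g k ≡ λ c → z * g k c + τ * g(suc k)c
  t9 k z τ aj g rewrite rl k = P.refl
  t4 : ∀ k z τ aj g → t' k z τ aj g(suc k)≡ λ c → - aj * g k c
  t4 k z τ aj g rewrite fa(N.1+n≢n{k})| rl k = P.refl
  t7 : ∀ k z τ aj g{i}→ i ≢ k → i ≢ suc k → t' k z τ aj g i ≡ g i
  t7 k z τ aj g ix ik rewrite fa ix | fa ik = P.refl
  module g9{k w f f⁻¹ b U W τ aj}(a : Ar w)(v : VL d(suc k))(xf : w(suc k)N.< w(suc(suc k)))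
   (aU : τ * aj ≈ 1#)(fb : Iv f f⁻¹)(det : de(sF w f b)≈ 1#)
   (r+ : Re(sF w f b)U)(cr : Cr(suc k)U W τ)where
   x = w(suc k)
   y = w(suc(suc k))
   xc = N.<⇒≢ xf
   a₁ = ar v a
   w₁ = w ∘ transposition(suc k)
   fO = rS x y τ aj f
   fZ = rS x y aj τ f⁻¹
   g = sF w f b
   module T = Tu det(proj₂ v)r+ cr
   μ = T.z * f x *(aj * f⁻¹ y)
   b₁ = S& x y μ b
   ts : ∀ i c → T.turned aU i c ≈ sF w₁ fO b₁ i c
   ts i c with tV(suc k)i
   ... | at = trans(reflexive(P.cong(λ v → v c)(t9(suc k)T.z τ aj g)))(trans(+-congʳ(trans(sym(*-identityʳ _))(*-congˡ(sym(trans(*-cong aU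
    (fb y))(*-identityˡ 1#))))))(trans(solve 9(λ z fx bx τ aj fy gy by one → z :*(fx :* bx):*(τ :* aj :*(fy :* gy)):+ τ :*(fy :* by):= τ :*
    fy :*(by :+ z :* fx :*(aj :* gy):* bx))refl T.z(f x)(b x c)τ aj(f y)(f⁻¹ y)(b y c)1#)(trans(sym(reflexive(P.cong₂ _*_(rP{f =
    f}xc)(P.cong(λ v → v c)(b! x y μ b)))))(sym(reflexive(P.cong(λ j → fO(w j)* b₁(w j)c)(tF(suc k))))))))
   ... | aH = trans(reflexive(P.cong(λ v → v c)(t4(suc k)T.z τ aj g)))(trans(sym(*-assoc _ _ _))(trans(sym(reflexive(P.cong₂ _*_(rO{f =
    f}xc)(P.cong(λ v → v c)(s! x y μ b xc)))))(sym(reflexive(P.cong(λ j → fO(w j)* b₁(w j)c)(tb(suc k)))))))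
   ... | oa ix ik = begin
    T.turned aU i c
     ≡⟨ P.cong(λ v → v c)(t7(suc k)T.z τ aj g ix ik)⟩
    f(w i)* b(w i)c
     ≡⟨ P.cong₂ _*_(rz{f = f}xc(ix ∘ injective a)(ik ∘ injective a))
      (P.cong(λ v → v c)(s! x y μ b(ik ∘ injective a)))⟨
    fO(w i)* b₁(w i)c
     ≡⟨ P.cong(λ j → fO(w j)* b₁(w j)c)(tf ix ik)⟨
    sF w₁ fO b₁ i c ∎
   Ds : de(sF w₁ fO b₁)≈ 1#
   Ds = trans(sym(wf ts d _))(T.tT aU)
   Rw : Re(sF w₁ fO b₁)W
   Rw i iJ = tr(T.tu aU i iJ)(wf ts i)
   xp : position a x N.< position a y
   xp = P.subst₂ N._<_(P.sym(pw a(suc k)))(P.sym(pw a(suc(suc k))))N.≤-refl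
   S/ : SF a b₁ b
   S/{u}au uH h hD hB = s+ au(l1 a(proj₁ v))Bh μ b h hD hB
    where
    Bh : position au x N.< position au y
    Bh with N.<-cmp(position au x)(position au y)
    ... | tri< lt _ _ = lt
    ... | tri≈ _ same _ = ⊥-elim(xc(P.trans(P.sym(wo au x))(P.trans(P.cong u same)(wo au y))))
    ... | tri> _ _ gt = ⊥-elim(N.<-asym xp(uH xf gt))
   eW : a g8 a₁
   eW{p}{q}PD iY = tm(suc k)iY λ(Ed , El)→ N.<-asym PD
    (P.subst₂ N._<_(P.trans(P.cong w(P.sym Ed))(wo a q))(P.trans(P.cong w(P.sym El))(wo a p))xf)
  cE : ∀{β}(γs : Weights β){w f f⁻¹ b U}Gs(a : Ar w)→ All(VL d)β → Ac w β →
   Iv f f⁻¹ → de(sF w f b)≈ 1# → Re(sF w f b)U →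
   Slice γs U Gs → ∃ λ bd → SF a bd b × AC bd w f γs U Gs
  cE []{b = b}[] a [] _ fb det r+ _ = b ,(λ _ _ _ _ _ _ → ra), r+
  cE(_∷_{x = suc k}wt γs){w}{f}{f⁻¹}{b}{U}(W ∷ Gs)a(v ∷ vs)(xf , as)fb det r+(cr , s)=
   proj₁ nx , same ,(λ i iJ → tr(r+ i iJ)(sy(same a(λ _ p → p)f f⁻¹ fb i))), proj₂(proj₂ nx)
   where
   module σ = g9{b = b}a v xf(t1 wt)fb det r+ cr
   nx = cE γs{f⁻¹ = σ.fZ}{b = σ.b₁}Gs σ.a₁ vs as(rH σ.xc(t1 wt)fb)σ.Ds σ.Rw s
   same : SF a(proj₁ nx)b
   same{u}au uH h hD hB j = tr
    (proj₁(proj₂ nx)au(λ PD iY → σ.eW PD(uH PD iY))h hD hB j)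
    (σ.S/ au uH h hD hB j)
module ES where
 open IS
 open Ex
 open FB using(module Fm)
 open Sl
 open KF
 open Wo
 open BP
 open SZ
 sp : ℕ → ℕ → ℕ →(ℕ → ℕ)→ ℕ → ℕ
 sp κ x y a with x N.≤? κ | κ N.<? y
 ... | yes _ | yes _ = a
 ... | _ | _ = λ _ → 0
 aq : ∀{β}→ ℕ →(ℕ → ℕ)→ Weights β → ℕ → ℕ
 aq κ w [] γ = 0
 aq κ w(_∷_{x = k}a γs)γ = sp κ(w k)(w(suc k))a γ N.+ aq κ(w ∘ transposition k)γs γ
 module e0(R : CommutativeRing 0ℓ 0ℓ)(d : ℕ)(t ta :(ℕ → ℕ)→ CommutativeRing.Carrier R)
  (t1 : ∀ a → CommutativeRing._≈_ R(CommutativeRing._*_ R(t a)(ta a))(CommutativeRing.1# R))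
  (t> : CommutativeRing._≈_ R(t λ _ → 0)(CommutativeRing.1# R))
  (t! : ∀ a b → CommutativeRing._≈_ R(t λ γ → a γ N.+ b γ)(CommutativeRing._*_ R(t a)(t b)))where
  open CommutativeRing R
  open RingProperties ring
  open In R
  open EA R
  open Fm R d
  open Aa d
  open Ar
  open e~ R d t ta t1
  open SetoidReasoning setoid
  ef : ∀{β}→(ℕ → ℕ)→(ℕ → Carrier)→ Weights β → ℕ → Carrier
  ef w f [] = f
  ef w f(_∷_{x = k}a γs)= ef(w ∘ transposition k)(rS(w k)(w(suc k))(t a)(ta a)f)γs
  es : ∀{β}(γs : Weights β){w f b U}Gs → AC b w f γs U Gs →
   Re(sF(w ∘ permutation β)(ef w f γs)b)(lL U Gs)
  es [] [] r+ = r+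
  es(a ∷ γs)(W ∷ Gs)(_ , rt)= es γs Gs rt
  aK : ℕ → Carrier
  aK zero = 1#
  aK(suc n)= - aK n
  tN : ∀ x k n(u : Et d)y → tail x k n u af y ap aK n aX tail x k n(u af y)
  tN x k zero u y S = sym(*-identityˡ _)
  tN x k(suc n)u y S = trans(tN x(suc k)n(u af x(suc k))y S)(trans(*-congˡ(tc x(suc k)n(tr(az u(x(suc k))y)(bO _))S))(trans
   (*-congˡ(trans(td x(suc k)n(- 1#)_ S)(-1*x≈-x _)))(solve 2(λ e a → e :* :- a := :- e :* a)refl ε _)))
   where ε = aK n
  rv : ℕ → Carrier
  rv zero = 1#
  rv(suc n)= aK n * rv n
  a8 : ∀ n → aK n * aK n ≈ 1#
  a8 zero = *-identityˡ 1#
  a8(suc n)= trans(solve 1(λ e → :- e :* :- e := e :* e)refl(aK n))(a8 n)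
  ut : ∀{x y}→ x * x ≈ 1# → y * y ≈ 1# →(x * y)*(x * y)≈ 1#
  ut{x}{y}p q = trans(solve 2(λ e f →(f :* e):*(f :* e):=(f :* f):*(e :* e))refl y x)(trans(*-cong p q)(*-identityˡ 1#))
  rT : ∀ n → rv n * rv n ≈ 1#
  rT zero = *-identityˡ 1#
  rT(suc n)= ut(a8 n)(rT n)
  mr : Fe → Fe
  mr x j = x(suc d ∸ j)
  mB : ∀{n k}→ k N.+ suc n ≡ d → suc d ∸ suc n ≡ suc k
  mB{n}{k}eq = P.trans(P.cong(_∸ n)(P.trans(P.sym eq)(N.+-suc k n)))(N.m+n∸n≡m(suc k)n)
  rJ : ∀ x n k → k N.+ n ≡ d → ∀ u → u aI we(mr x)n ap rv n aX tail x k n u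
  rJ x zero k _ u S = trans(ie u S)(sym(*-identityˡ _))
  rJ x(suc n)k eq u S = trans(sym(aA u(we(mr x)n)_ S))(trans(cg(rJ x n(suc k)(P.trans(P.sym(N.+-suc k n))eq)u)(λ c → reflexive
   (P.cong(λ j → x j c)(mB eq)))S)(trans(ak(rv n)_ _ S)(trans(*-congˡ(tN x(suc k)n u(x(suc k))S))(solve 3(λ e f a
   → e :*(f :* a):= f :* e :* a)refl(rv n)(aK n)_))))
  rj : ℕ → ℕ →(ℕ → Carrier)→ Carrier
  rj κ zero f = 1#
  rj κ(suc n)f = f(suc κ)* rj(suc κ)n f
  rU : ∀ κ n{f g}→(∀ z → f z ≈ g z)→ rj κ n f ≈ rj κ n g
  rU κ zero p = refl
  rU κ(suc n)p = *-cong(p(suc κ))(rU(suc κ)n p)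
  s? : ℕ → Carrier →(ℕ → Carrier)→ ℕ → Carrier
  s? x μ f z = if z N.≡ᵇ x then μ * f z else f z
  sA : ∀{x μ f z}→ z ≢ x → s? x μ f z ≡ f z
  sA zx rewrite fa zx = P.refl
  Si : ∀ x{μ f}→ s? x μ f x ≡ μ * f x
  Si x rewrite rl x = P.refl
  rh : ∀{x μ f}κ n →(∀ z → κ N.< z → z N.≤ κ N.+ n → z ≢ x)→ rj κ n(s? x μ f)≈ rj κ n f
  rh κ zero os = refl
  rh{f = f}κ(suc n)os = *-cong(reflexive(sA{f = f}(os(suc κ)N.≤-refl(N.m<m+n κ(N.s≤s N.z≤n)))))
   (rh(suc κ)n λ z zD zT → os z(N.<⇒≤ zD)(P.subst(z N.≤_)(P.sym(N.+-suc κ n))zT))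
  rx : ∀{x μ f}κ n → κ N.< x → x N.≤ κ N.+ n → rj κ n(s? x μ f)≈ μ * rj κ n f
  rx{x}κ zero xK xL = ⊥-elim(N.<⇒≱ xK(P.subst(x N.≤_)(N.+-identityʳ κ)xL))
  rx{x}{μ}{f}κ(suc n)xK xL with x N.≟ suc κ
  ... | yes P.refl = trans(*-cong(reflexive(Si x{f = f}))(rh(suc κ)n λ z xP _ → N.>⇒≢ xP))(*-assoc _ _ _)
  ... | no xG = trans(*-cong(reflexive(sA{f = f}(xG ∘ P.sym)))
   (rx{f = f}(suc κ)n(N.≤∧≢⇒< xK(xG ∘ P.sym))(P.subst(x N.≤_)(N.+-suc κ n)xL)))
   (solve 3(λ a m b → a :*(m :* b):= m :*(a :* b))refl _ _ _)
  fS : ℕ → ℕ → Carrier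
  fS κ x with x N.≤? κ
  ... | yes _ = 1#
  ... | no _ = - 1#
  fM : ∀ κ x → fS κ x * fS κ x ≈ 1#
  fM κ x with x N.≤? κ
  ... | yes _ = *-identityˡ 1#
  ... | no _ = a8 1
  r8 : ∀ κ{x y a f}→ κ N.≤ d → x N.< y → y N.≤ d →
   rj κ(d ∸ κ)(rS x y(t a)(ta a)f)≈ fS κ x * t(sp κ x y a)* rj κ(d ∸ κ)f
  r8 κ{x}{y}{a}{f}da xf yd = trans(rU κ(d ∸ κ)bE)sJ
   where
   τ = t a
   aj = ta a
   xc = N.<⇒≢ xf
   i> = s? y τ f
   bE : ∀ z → rS x y τ aj f z ≈ s? x(- aj)i> z
   bE z with z N.≟ x
   ... | yes P.refl = reflexive(P.trans(rO{f = f}xc)(P.trans(P.cong(- aj *_)(P.sym(sA{f = f}xc)))(P.sym(Si x{f = i>}))))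
   ... | no zx with z N.≟ y
   ... | yes P.refl = reflexive(P.trans(rP{f = f}xc)(P.trans(P.sym(Si y{f = f}))(P.sym(sA{f = i>}zx))))
   ... | no zy = reflexive(P.trans(rz{f = f}xc zx zy)(P.trans(P.sym(sA{f = f}zy))(P.sym(sA{f = i>}zx))))
   end : κ N.+(d ∸ κ)≡ d
   end = N.m+[n∸m]≡n da
   i^ : ∀{z}→ z N.≤ d → z N.≤ κ N.+(d ∸ κ)
   i^{z}zR = P.subst(z N.≤_)(P.sym end)zR
   r = rj κ(d ∸ κ)f
   sJ : rj κ(d ∸ κ)(s? x(- aj)i>)≈ fS κ x * t(sp κ x y a)* r
   sJ with x N.≤? κ | κ N.<? y
   ... | yes xd | yes yc = trans(rh{f = i>}κ(d ∸ κ)λ z zD _ → N.>⇒≢(N.≤-<-trans xd zD))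
    (trans(rx{f = f}κ(d ∸ κ)yc(i^ yd))(*-congʳ(sym(*-identityˡ _))))
   ... | yes xd | no yb = trans(rh{f = i>}κ(d ∸ κ)λ z zD _ → N.>⇒≢(N.≤-<-trans xd zD))
    (trans(rh{f = f}κ(d ∸ κ)λ z zD _ → N.>⇒≢(N.≤-<-trans(N.≮⇒≥ yb)zD))
     (trans(sym(*-identityˡ _))(*-congʳ(trans(sym(*-identityˡ _))(*-congˡ(sym t>))))))
   ... | no xi | yes yc = trans(rx{f = i>}κ(d ∸ κ)(N.≰⇒> xi)(i^(N.≤-trans(N.<⇒≤ xf)yd)))
    (trans(*-congˡ(rx{f = f}κ(d ∸ κ)yc(i^ yd)))
    (trans(solve 3(λ b a r → :- b :*(a :* r):= :-(a :* b):* r)refl aj τ r)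
    (*-congʳ(trans(-‿cong(t1 a))(trans(sym(*-identityʳ _))(*-congˡ(sym t>)))))))
   ... | no xi | no yb = ⊥-elim(yb(N.<-trans(N.≰⇒> xi)xf))
  sh : ℕ →(ℕ → ℕ)→ Word → Carrier
  sh κ w [] = 1#
  sh κ w(k ∷ β)= sh κ(w ∘ transposition k)β * fS κ(w k)
  s9 : ∀ κ w β → sh κ w β * sh κ w β ≈ 1#
  s9 κ w [] = *-identityˡ 1#
  s9 κ w(k ∷ β)= ut(s9 κ(w ∘ transposition k)β)(fM κ(w k))
  r2 : ∀ κ → κ N.≤ d → ∀{β}(γs : Weights β){w f}→ Ar w → All(VL d)β → Ac w β →
   rj κ(d ∸ κ)(ef w f γs)≈ sh κ w β * t(aq κ w γs)* rj κ(d ∸ κ)f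
  r2 κ da []{w}{f}a [] _ = trans(sym(*-identityˡ _))(*-congʳ(trans(sym(*-identityˡ _))(*-congˡ(sym t>))))
  r2 κ da(_∷_{x = k}{xs = β}wt γs){w}{f}a(v ∷ vs)(xf , as)=
   trans(r2 κ da γs(ar v a)vs as)(trans(*-congˡ(r8 κ{f = f}da xf(ld a(proj₂ v))))
    (trans(solve 5(λ s t p q r → s :* t :*(p :* q :* r):=(s :* p):*(q :* t):* r)refl
     (sh κ(w ∘ transposition k)β)_(fS κ(w k))_ _)
     (*-congʳ(*-congˡ(sym(t!(sp κ(w k)(w(suc k))wt)_))))))
  r3 : ∀ κ n → rj κ n(λ _ → 1#)≈ 1#
  r3 κ zero = refl
  r3 κ(suc n)= trans(*-identityˡ _)(r3(suc κ)n)
  wc : ∀{g h : Fe}n →(∀ i → 1 N.≤ i → i N.≤ n → ∀ c → g i c ≈ h i c)→ we g n ap we h n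
  wc zero p = ra
  wc(suc n)p = cg(wc n λ i i~ Ii → p i i~(N.m≤n⇒m≤1+n Ii))(p(suc n)(N.s≤s N.z≤n)N.≤-refl)
  s4 : ∀ F b n κ → κ N.+ n ≡ d → we(mr(λ z c → F z * b z c))n ap rj κ n F aX we(mr b)n
  s4 F b zero κ eq S = sym(*-identityˡ _)
  s4 F b(suc n)κ eq S = trans(aE _(F z₀)(b z₀)S)(trans(*-congˡ(trans(cn(s4 F b n(suc κ)(P.trans(P.sym(N.+-suc κ n))eq))S)(ak(rj(suc
   κ)n F)_ _ S)))(trans(sym(*-assoc _ _ _))(reflexive(P.cong(λ z → F z * rj(suc κ)n F * we(mr b)(suc n)S)(mB eq)))))
   where z₀ = suc d ∸ suc n
  eH : ℕ → Word → Carrier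
  eH κ β = sh κ id β * rv(d ∸ κ)
  eL : ∀ κ β → eH κ β * eH κ β ≈ 1#
  eL κ β = ut(s9 κ id β)(rT(d ∸ κ))
  module Es{β}(γs : Weights β){b U}(Gs : Ll Fl β)(vs : All(VL d)β)(as : Ac id β)
   (Rh : Rv(permutation β))(det : de b ≈ 1#)
   (cd : AC b id(λ _ → 1#)γs U Gs)where
   V : Fl
   V = lL U Gs
   F : ℕ → Carrier
   F = ef id(λ _ → 1#)γs
   s/ : Re(sF id(λ _ → 1#)b)U
   s/ = hC γs Gs cd
    where
    hC : ∀{β}(γs : Weights β){w f U}Gs → AC b w f γs U Gs → Re(sF w f b)U
    hC [] [] r+ = r+
    hC(_ ∷ _)(_ ∷ _)(r+ , _)= r+
   l% : ∀ k → k N.≤ d → U k ap we b k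
   l% k kd = tr(s/ k kd)(wf(λ i c → *-identityˡ _)k)
   r4 : ∀ n → n N.≤ d → V n ap we(mr(λ z c → F z * b z c))n
   r4 n n3 = tr(es γs Gs cd n n3)
    (wc n λ i i~ Ii c → reflexive(P.cong(λ z → F z * b z c)(Rh i i~(N.≤-trans Ii n3))))
   h : ℕ → Carrier
   h κ = top(U κ aI V(d ∸ κ))
   hv : ∀ κ → κ N.≤ d → h κ ≈ eH κ β * t(aq κ id γs)
   hv κ da = trans(co(l% κ da)(tr(r4 n(N.m∸n≤m d κ))(s4 F b n κ n5))full)(trans(ay(rj κ n F)(we b κ)(we
    (mr b)n)full)(trans(*-cong(trans(r2 κ da γs ai vs as)(trans(*-congˡ(r3 κ n))(*-identityʳ _)))(trans
    (rJ b n κ n5(we b κ)full)(*-congˡ(trans(tw b κ da)det))))(trans(*-congˡ(*-identityʳ _))(solve 3(λ a b c → a :*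
    b :* c := a :* c :* b)refl(sh κ id β)(t(aq κ id γs))(rv n)))))
    where
    n = d ∸ κ
    n5 : κ N.+ n ≡ d
    n5 = N.m+[n∸m]≡n da
   E : ℕ → Fin d → Carrier
   E k i = top(U k aI ct i(V(suc(d ∸ k))))
   Ev : ∀ k i → 1 N.≤ k → k N.≤ d → E k i ≈ F k * b k i * h k
   Ev(suc k)i _ kh = trans(co(ra{u = U(suc k)})(cp i Vs)full)(trans(co(ra{u = U(suc k)})(cancel(ct i(V n af y))
    (ct i(V n)af y))full)(trans(trans(ds(U(suc k))(ct i(V n af y)⊕ ct i(V n)af y)(⊝(ct i(V n)af y))
    full)(+-cong(co(ra{u = U(suc k)})(ce i(V n)y)full)(a2(U(suc k))(ct i(V n)af y)full)))(trans(+-cong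
    (ay(y i)(U(suc k))(V n)full)(trans(-‿cong(vn(ct i(V n))full))-0#≈0#))(+-identityʳ _))))
    where
    n = d ∸ suc k
    cancel : ∀(u v : Et d)→ u ap(u ⊕ v)⊕ ⊝ v
    cancel u v S = solve 2(λ a b → a :=(a :+ b):+ :- b)refl(u S)(v S)
    y : Ve
    y c = F(suc k)* b(suc k)c
    K% : suc k N.+ n ≡ d
    K% = N.m+[n∸m]≡n kh
    nN : suc n N.≤ d
    nN = P.subst(suc n N.≤_)K%(N.s≤s(N.m≤n+m n k))
    Vs : V(suc n)ap V n af y
    Vs = tr(r4(suc n)nN)(cg(sy(r4 n(N.<⇒≤ nN)))
     λ c → reflexive(P.cong(λ z → F z * b z c)(mB{n}{k}(P.trans(N.+-suc k n)K%))))
    AF : U(suc k)af y ap aN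
    AF S = trans(aE(U(suc k))(F(suc k))(b(suc k))S)(trans(*-congˡ(trans(cn(l%(suc k)kh)S)
     (sq(we b k)(b(suc k))S)))(zeroʳ _))
    vn : ∀ Y → U(suc k)aI(Y af y)ap aN
    vn Y S = begin
     (U(suc k)aI(Y af y))S
      ≈⟨ co(ra{u = U(suc k)})(λ T → begin
       (Y af y)T ≈⟨ co(sy(bi Y))ra T ⟩
       (bh(bh Y)aI vf y)T ≈⟨ vF y(bh Y)T ⟨
       (vf y aI bh Y)T ∎)S ⟩
     (U(suc k)aI(vf y aI bh Y))S
      ≈⟨ aA(U(suc k))(vf y)(bh Y)S ⟨
     (U(suc k)af y aI bh Y)S
      ≈⟨ co AF(ra{u = bh Y})S ⟩
     (aN aI bh Y)S
      ≈⟨ zb(bh Y)S ⟩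
     0# ∎
module Bt where
 open IS
 open Ex
 open FB using(module Fm)
 open Sl
 open KF
 open KW
 open Wo
 open BP
 open SZ
 open ES
 module Bo(R : CommutativeRing 0ℓ 0ℓ)
  (stable : ∀ z w → ¬ ¬ CommutativeRing._≈_ R z w → CommutativeRing._≈_ R z w)
  (d : ℕ){S : Set}(aO : FF R S)
  {N : ℕ}(c ca : S → Fin N → CommutativeRing.Carrier R)
  (c1 : ∀ s γ → CommutativeRing._≈_ R(CommutativeRing._*_ R(c s γ)(ca s γ))(CommutativeRing.1# R))where
  open CommutativeRing R
  open RingProperties ring
  open In R
  open EA R
  open Fm R d
  open FF aO
  open Po R d aO
  open Aa d
  open Ar
  open WP R d aO c ca c1
  open RawSemiringDefs(Semiring.rawSemiring semiring)using(product;_^_)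
  open SemiringExp semiring using(^-homo-*)
  vu :(ℕ → ℕ)→ S → Carrier
  vu a s = product λ γ → ca s γ ^ a(toℕ γ)
  v5 : ∀ s → value(λ _ → 0)s ≈ 1#
  v5 s = pd N
  v6 : ∀ s a b → value(λ γ → a γ N.+ b γ)s ≈ value a s * value b s
  v6 s a b = trans(pc{N}λ γ → ^-homo-*(c s γ)(a(toℕ γ))(b(toℕ γ)))
   (pz{N}(λ γ → c s γ ^ a(toℕ γ))(λ γ → c s γ ^ b(toℕ γ)))
  private
   module St s = e~ R d(λ a → value a s)(λ a → vu a s)(λ a → vl a s)
   module En s = e0 R d(λ a → value a s)(λ a → vu a s)(λ a → vl a s)(v5 s)(v6 s)
  open La Cs
  ea : ∀{β}→ S → Ll(S → Fl)β → Ll Fl β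
  ea s [] = []
  ea s(W ∷ Gs)= W s ∷ ea s Gs
  ly : ∀{β}s{U}(Gs : Ll(S → Fl)β)→ lL(U s)(ea s Gs)≡ lL U Gs s
  ly s [] = P.refl
  ly s{U}(W ∷ Gs)= ly s{W}Gs
  S0 : ∀{β}s(γs : Weights β){U}Gs → Slice γs U Gs → La.Slice(St.Ce s)γs(U s)(ea s Gs)
  S0 s [] [] _ = tt
  S0 s(a ∷ γs)(W ∷ Gs)(UW , r)= CF.crossing UW s , S0 s γs Gs r
  Kb : ∀{β U}(Gs : Ll(S → Fl)β)→ Ko U → KL Gs → Ko(lL U Gs)
  Kb [] kU _ = kU
  Kb(W ∷ Gs)kU(kW , Ku)= Kb Gs kW Ku
  kD :(∀ a → Known(value a))→ ∀ a → Known(vu a)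
  kD kv a = kj(vl a)(kv a)
  k7 : ∀{x y : ℕ}{τ aj : S → Carrier}{f : S → ℕ → Carrier}→ Known τ → Known aj →(∀ z → Known(λ s → f s z))→
   ∀ z → Known(λ s → St.rS s x y(τ s)(aj s)(f s)z)
  k7{x}{y}g^ KQ kf z with z N.≡ᵇ x
  ... | true = ko(kG KQ)(kf x)
  ... | false with z N.≡ᵇ y
  ... | true = ko g^(kf y)
  ... | false = kf z
  module _(kv : ∀ a → Known(value a))where
   kK : ∀{β}(γs : Weights β){w}{f : S → ℕ → Carrier}→(∀ z → Known(λ s → f s z))→
    ∀ z → Known(λ s → En.ef s w(f s)γs z)
   kK [] kf z = kf z
   kK(a ∷ γs)kf z = kK γs(k7(kv a)(kD kv a)kf)z
   k3 : ∀{β}(γs : Weights β){b : S → Fe}{w}{f : S → ℕ → Carrier}{U}Gs → Kw b →(∀ z → Known(λ s → f s z))→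
    (∀ s → St.AC s(b s)w(f s)γs(U s)(ea s Gs))→ Ko U × KL Gs
   k3 []{b}{w}{f}[] kb kf cs =
    (λ k kd T → kr(λ s → sym(cs s k kd T))(kH{λ s → St.sF s w(f s)(b s)}(λ i c → ko(kf(w i))(kb(w i)c))k T)), tt
   k3(a ∷ γs){b}{w}{f}(W ∷ Gs)kb kf cs =
    (λ k kd T → kr(λ s → sym(proj₁(cs s)k kd T))(kH{λ s → St.sF s w(f s)(b s)}(λ i c → ko(kf(w i))(kb(w i)c))k T)),
    k3 γs Gs kb(k7(kv a)(kD kv a)kf)λ s → proj₂(cs s)
  en : ∀{β}→ S →(ℕ → ℕ)→(ℕ → Carrier)→ Weights β → ℕ → Carrier
  en s w f [] = f
  en s w f(_∷_{x = k}a γs)=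
   en s(w ∘ transposition k)(St.rS s(w k)(w(suc k))(vu a s)(value a s)f)γs
  eS : ∀{β}s(γs : Weights β){w f f⁻¹}→ Ar w → All(VL d)β → Ac w β → St.Iv s f f⁻¹ →
   St.Iv s(En.ef s w f γs)(en s w f⁻¹ γs)
  eS s [] a [] as fb = fb
  eS s(wt ∷ γs){f = f}{f⁻¹}a(v ∷ vs)(xf , as)fb = eS s γs(ar v a)vs as
   (St.rH s{f = f}{f⁻¹}(N.<⇒≢ xf)(vl wt s)fb)
  Ao : ∀{β}s(γs : Weights β){b bd w f U}Gs → Ar w → All(VL d)β →
   (∀ k → 1 N.≤ k → k N.≤ d → ∀ i → bd k i ≈ b k i)→
   St.AC s b w f γs U Gs → St.AC s bd w f γs U Gs
  rI : ∀ s{b bd w f U}→ Ar w →(∀ k → 1 N.≤ k → k N.≤ d → ∀ i → bd k i ≈ b k i)→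
   Re(St.sF s w f b)U → Re(St.sF s w f bd)U
  rI s{b}{bd}{w}{f}a eq r+ k kd = tr(r+ k kd)(En.wc s{St.sF s w f b}{St.sF s w f bd}k λ i i~ Iu c →
   *-congˡ(sym(eq _(l1 a i~)(ld a(N.≤-trans Iu kd))c)))
  Ao s []{f = f}{U}[] a [] eq r+ = rI s{f = f}{U}a eq r+
  Ao s(_ ∷ γs){f = f}{U}(_ ∷ Gs)a(v ∷ vs)eq(r+ , r)=
   rI s{f = f}{U}a eq r+ , Ao s γs Gs(ar v a)vs eq r
  rB : ∀{b U}→ ¬ ¬ Re b U → Re b U
  rB RC k kd T = stable _ _(¬¬-map(λ r+ → r+ k kd T)RC)
  Al : ∀{β}s(γs : Weights β){b w f U}Gs → ¬ ¬ St.AC s b w f γs U Gs → St.AC s b w f γs U Gs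
  Al s []{b}{w}{f}{U}[] p = rB{St.sF s w f b}{U}p
  Al s(_ ∷ γs){b}{w}{f}{U}(_ ∷ Gs)p =
   rB{St.sF s w f b}{U}(¬¬-map proj₁ p), Al s γs Gs(¬¬-map proj₂ p)
  r~ : ℕ → Carrier → Carrier
  r~ k x with 1 N.≤? k | k N.≤? d
  ... | yes _ | yes _ = x
  ... | _ | _ = 0#
  r1 : ∀{k x}→ 1 N.≤ k → k N.≤ d → r~ k x ≡ x
  r1{k}kk kd with 1 N.≤? k | k N.≤? d
  ... | yes _ | yes _ = P.refl
  ... | yes _ | no K* = ⊥-elim(K* kd)
  ... | no K+ | _ = ⊥-elim(K+ kk)
  k% : ∀ k{f}→(1 N.≤ k → k N.≤ d → Known f)→ Known(λ s → r~ k(f s))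
  k% k kf with 1 N.≤? k | k N.≤? d
  ... | yes kk | yes kd = kf kk kd
  ... | yes _ | no _ = kn 0#
  ... | no _ | _ = kn 0#
  module AR{β}(γs : Weights β){U : S → Fl}(Gs : Ll(S → Fl)β)(vs : All(VL d)β)
   (as : Ac id β)(Rh : Rv(permutation β))(gR : Slice γs U Gs)
   (fE : ∀ s → ¬ ¬ ∃ λ g → de g ≈ 1# × Re g(U s))where
   V : S → Fl
   V = lL U Gs
   h : ℕ → S → Carrier
   h κ s = top(U s κ aI V s(d ∸ κ))
   E : ℕ → Fin d → S → Carrier
   E k i s = top(U s k aI ct i(V s(suc(d ∸ k))))
   F Fc : ℕ → S → Carrier
   F k s = En.ef s id(λ _ → 1#)γs k
   Fc k s = en s id(λ _ → 1#)γs k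
   Fd : ∀ k s → F k s * Fc k s ≈ 1#
   Fd k s = eS s γs{f = λ _ → 1#}{λ _ → 1#}ai vs as(λ z → *-identityˡ 1#)k
   e1 : ℕ → S → Carrier
   e1 k = value(aq k id γs)
   sign : ℕ → S → Carrier
   sign k s = En.eH s k β
   S^ : ∀ k s → sign k s * sign k s ≈ 1#
   S^ k s = En.eL s k β
   b : S → Fe
   b s k i = r~ k(Fc k s *(sign k s * vu(aq k id γs)s)* E k i s)
   module _(s : S)where
    module Nc{g}(AS : St.AC s g id(λ _ → 1#)γs(U s)(ea s Gs))(det : de g ≈ 1#)=
     En.Es s γs{b = g}{U = U s}(ea s Gs)vs as Rh det AS
    a5 : ¬ ¬ ∃ λ g → de g ≈ 1# × St.AC s g id(λ _ → 1#)γs(U s)(ea s Gs)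
    a5 = ¬¬-map(λ(g , det , r+)→
     let
      i! : ∀ k → we(St.sF s id(λ _ → 1#)g)k ap we g k
      i! = St.wf s λ i c → *-identityˡ _
      bd , same , cd = St.cE s γs{w = id}{f = λ _ → 1#}{f⁻¹ = λ _ → 1#}{b = g}(ea s Gs)ai vs as
       (λ z → *-identityˡ 1#)(trans(i! d _)det)(λ k kd → tr(r+ k kd)(sy(i! k)))(S0 s γs Gs gR)
     in bd , trans(trans(St.wf s(λ i c → sym(*-identityˡ _))d full)
      (same ai(λ _ p → p)(λ _ → 1#)(λ _ → 1#)(λ z → *-identityˡ 1#)d full))(trans(i! d full)det)
      , cd)(fE s)
    hv : ∀ κ → κ N.≤ d → h κ s ≈ sign κ s * e1 κ s
    hv κ da = stable _ _(¬¬-map(λ(g , det , cd)→ trans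
     (reflexive(P.cong(λ W → top(U s κ aI W(d ∸ κ)))(P.sym(ly s{U}Gs))))
     (Nc.hv{g}cd det κ da))a5)
    b4 : ∀{g}→ de g ≈ 1# → St.AC s g id(λ _ → 1#)γs(U s)(ea s Gs)→
     ∀ k → 1 N.≤ k → k N.≤ d → ∀ i → b s k i ≈ g k i
    b4{g}det cd k kk kd i = trans(reflexive(r1 kk kd))(trans(*-congˡ(trans
     (reflexive(P.cong(λ W → top(U s k aI ct i(W(suc(d ∸ k)))))(P.sym(ly s{U}Gs))))
     (trans(Nc.Ev{g}cd det k i kk kd)(*-congˡ(Nc.hv{g}cd det k kd)))))
     (trans(solve 7(λ f⁻¹ e v' f g ed v → f⁻¹ :*(e :* v'):*(f :* g :*(ed :* v)):=(f :* f⁻¹):*(e :* ed):*(v :* v'):* g)refl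
      (Fc k s)(sign k s)(vu(aq k id γs)s)(F k s)(g k i)(sign k s)(e1 k s))
      (trans(*-congʳ(trans(*-cong(trans(*-cong(Fd k s)(En.eL s k β))(*-identityˡ 1#))(vl(aq k id γs)s))(*-identityˡ 1#)))(*-identityˡ _))))
    Bi : de(b s)≈ 1#
    Bi = stable _ _(¬¬-map(λ(g , det , cd)→ trans(En.wc s d(λ i i~ iJ c → b4 det cd i i~ iJ c)full)det)a5)
    bX : St.AC s(b s)id(λ _ → 1#)γs(U s)(ea s Gs)
    bX = Al s γs(ea s Gs)(¬¬-map(λ(g , det , cd)→
     Ao s γs(ea s Gs)ai vs(b4 det cd)cd)a5)
   Kc : ∀ k → Known(sign k)
   Kc k = ko(fU k id β)(r5(d ∸ k))
    where
    fU : ∀ k w β → Known(λ s → En.sh s k w β)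
    fU k w [] = kn 1#
    fU k w(l ∷ β)= ko(fU k(w ∘ transposition l)β)Ff
     where
     Ff : Known(λ s → En.fS s k(w l))
     Ff with w l N.≤? k
     ... | yes _ = kn 1#
     ... | no _ = kn(- 1#)
    Af : ∀ n → Known(λ s → En.aK s n)
    Af zero = kn 1#
    Af(suc n)= kG(Af n)
    r5 : ∀ n → Known(λ s → En.rv s n)
    r5 zero = kn 1#
    r5(suc n)= ko(Af n)(r5 n)
   k< :(∀ a → Known(value a))→ ∀ k → Known(λ s → Fc k s *(sign k s * vu(aq k id γs)s))
   k< kv k = ko(kj(Fd k)(kK kv γs{id}{λ _ _ → 1#}(λ _ → kn 1#)k))
    (ko(Kc k)(kD kv(aq k id γs)))
   module _(kv : ∀ a → Known(value a))(kb : Kw b)where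
    kq : Ko U × KL Gs
    kq = k3 kv γs Gs kb(λ _ → kn 1#)bX
    fW : FO U
    fW = record
     {frame = b
     ;d1 = Bi
     ;rp = λ s k kd → tr(hC γs{U}Gs s{b s}{id}{λ _ → 1#}(bX s)k kd)(St.wf s(λ i c → *-identityˡ _)k)
     ;km = kb
     }
     where
     hC : ∀{β}(γs : Weights β){U}Gs s{b w f}→ St.AC s b w f γs(U s)(ea s Gs)→ Re(St.sF s w f b)(U s)
     hC [] [] s r+ = r+
     hC(_ ∷ _)(_ ∷ _)s(r+ , _)= r+
module SS where
 open IS
 open Sl
 open KF
 open Wo hiding(at;aH;oa)
 open BP
 open Ie
 open To
 open Gd
 open ES using(sp;aq)
 open import Relation.Binary.PropositionalEquality.Core using(refl;sym;trans;cong;cong₂;subst)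
 open import Data.Nat.Base using(_≤_;_<_)
 sU : ℕ →(ℕ → ℤ)→ ℤ
 sU zero f = I.0ℤ
 sU(suc n)f = sU n f I.+ f n
 sT : ∀ n{f g}→(∀ j → j < n → f j ≡ g j)→ sU n f ≡ sU n g
 sT zero eq = refl
 sT(suc n)eq = cong₂ I._+_(sT n λ j jn → eq j(N.m<n⇒m<1+n jn))(eq n N.≤-refl)
 s0 : ∀ n{f g}k x → suc k < n →(∀ j → j < n → j ≢ k → j ≢ suc k → f j ≡ g j)→
  f k I.+ f(suc k)≡ g k I.+ g(suc k)I.+ x → sU n f ≡ sU n g I.+ x
 s0(suc n){f}{g}k x g< oa eq with suc k N.≟ n
 ... | yes refl = trans(cong(λ s → s I.+ f k I.+ f(suc k))(sT k λ j jg → oa j(N.m<n⇒m<1+n(N.m<n⇒m<1+n jg))(N.<⇒≢ jg)(N.<⇒≢(N.m<n⇒m<1+n jg))))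
  (trans(I.+-assoc(sU k g)(f k)(f(suc k)))(trans(cong(λ y → sU k g I.+ y)eq)
   (so.solve 4(λ s a b x → s :+(a :+ b :+ x):= s :+ a :+ b :+ x)refl(sU k g)(g k)(g(suc k))x)))
  where open so
 ... | no n' = trans(cong₂ I._+_(s0 n k x K0(λ j jn → oa j(N.m<n⇒m<1+n jn))eq)
  (oa n N.≤-refl(λ e → N.<⇒≢(N.<-trans N.≤-refl K0)(sym e))(n' ∘ sym)))
  (so.solve 3(λ s x a → s :+ x :+ a := s :+ a :+ x)refl(sU n g)x(g n))
  where
  open so
  K0 = N.≤∧≢⇒<(N.s≤s⁻¹ g<)n'
 aJ : ℕ → ℕ → ℤ → ℤ
 aJ κ y x = if κ N.<ᵇ y then x else I.0ℤ
 aR : ∀{κ y}x → κ < y → aJ κ y x ≡ x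
 aR{κ}{y}x yc with κ N.<ᵇ y | N.<⇒<ᵇ yc
 ... | true | _ = refl
 aZ : ∀{κ y}x → ¬ κ < y → aJ κ y x ≡ I.0ℤ
 aZ{κ}{y}x yb with κ N.<ᵇ y in eq
 ... | false = refl
 ... | true = ⊥-elim(yb(N.<ᵇ⇒< κ y(subst Data.Bool.Base.T(sym eq)tt)))
  where import Data.Bool.Base
 tL : ∀(U : ℕ → ℤ)n → sU n(λ j → U(suc j)I.- U j)≡ U n I.- U 0
 tL U zero = sym(I.+-inverseʳ(U 0))
 tL U(suc n)= trans(cong(I._+(U(suc n)I.- U n))(tL U n))
  (so.solve 3(λ a b c →(a :+ :- b):+(c :+ :- a):= c :+ :- b)refl(U n)(U 0)(U(suc n)))
  where open so
 module SG(I : Set)(d N : ℕ)(dg : ℕ → I → ℤ)where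
  open Ga I N dg
  open Gb
  open Aa d
  open Ar
  sv : ℕ →(ℕ → ℕ)→ Level I → I → ℤ
  sv κ w U i = sU d λ j → aJ κ(w(suc j))(U(suc j)i I.- U j i)
  Sx : ∀ κ{k w a U W}i → VL d k → w k < w(suc k)→ Gb k a U W →
   sv κ(w ∘ transposition k)W i ≡ sv κ w U i I.+ wi N(λ γ → dg γ i)(sp κ(w k)(w(suc k))a)
  Sx κ{suc k}{w}{a}{U}{W}i(_ , kh)xf g = s0 d k _ kh ux Ai
   where
   x = w(suc k)
   y = w(suc(suc k))
   ux : ∀ j → j < d → j ≢ k → j ≢ suc k → aJ κ(w(transposition(suc k)(suc j)))(W(suc j)i I.- W j i)≡ aJ κ(w(suc j))(U(suc j)i I.- U j i)
   ux j _ jk j1 = cong₂(aJ κ)(cong w(tf(jk ∘ N.suc-injective)(j1 ∘ N.suc-injective)))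
    (cong₂ I._-_(sym(same g(suc j)(jk ∘ N.suc-injective)i))(sym(same g j j1 i)))
   A = U(suc k)i ;B = W(suc k)i ;L = U k i ;H = U(suc(suc k))i
   wt = wi N(λ γ → dg γ i)
   l$ : W k i ≡ L
   l$ = sym(same g k(N.1+n≢n ∘ sym)i)
   uF : W(suc(suc k))i ≡ H
   uF = sym(same g(suc(suc k))N.1+n≢n i)
   open so
   zo : wt(λ _ → 0)≡ I.0ℤ
   zo = trans(sm{N}λ γ → I.*-zeroˡ(dg(toℕ γ)i))(a9.sum-replicate-zero N)
   Ai : aJ κ(w(transposition(suc k)(suc k)))(B I.- W k i)I.+ aJ κ(w(transposition(suc k)(suc(suc k))))(W(suc(suc k))i I.- B)
    ≡ aJ κ x(A I.- L)I.+ aJ κ y(H I.- A)I.+ wt(sp κ x y a)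
   Ai = trans(cong₂ I._+_(cong₂(aJ κ)(cong w(tF(suc k)))(cong(λ z → B I.- z)l$))
    (cong₂(aJ κ)(cong w(tb(suc k)))(cong(I._- B)uF)))CX
    where
    CX : aJ κ y(B I.- L)I.+ aJ κ x(H I.- B)≡ aJ κ x(A I.- L)I.+ aJ κ y(H I.- A)I.+ wt(sp κ x y a)
    CX with x N.≤? κ | κ N.<? y
    ... | yes xd | yes yc = trans(cong₂ I._+_(aR _ yc)(aZ _(N.≤⇒≯ xd)))
     (trans(solve 5(λ A B L H w →(B :+ :- L):+ con(+ 0):= con(+ 0):+(H :+ :- A):+(A :+ B :+ :-(L :+ H)))refl A B L H I.0ℤ)
      (cong₂ I._+_(cong₂ I._+_(sym(aZ _(N.≤⇒≯ xd)))(sym(aR _ yc)))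
       (trans(cong(I._-(L I.+ H))(ch g i))(solve 3(λ l h w → l :+ h :+ w :+ :-(l :+ h):= w)refl L H(wt a)))))
    ... | yes xd | no yb = trans(cong₂ I._+_(aZ _ yb)(aZ _(N.≤⇒≯ xd)))
     (sym(trans(cong₂ I._+_(cong₂ I._+_(aZ _(N.≤⇒≯ xd))(aZ _ yb))zo)refl))
    ... | no xi | yes yc = trans(cong₂ I._+_(aR _ yc)(aR _(N.≰⇒> xi)))
     (trans(solve 4(λ A B L H →(B :+ :- L):+(H :+ :- B):=(A :+ :- L):+(H :+ :- A):+ con(+ 0))refl A B L H)
      (cong₂ I._+_(cong₂ I._+_(sym(aR _(N.≰⇒> xi)))(sym(aR _ yc)))(sym zo)))
    ... | no xi | no yb = ⊥-elim(yb(N.<-trans(N.≰⇒> xi)xf))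
  sM : ∀ κ{β}(γs : Weights β){w U}Gs i → All(VL d)β → Ac w β → Slice γs U Gs →
   sv κ(w ∘ permutation β)(lL U Gs)i ≡ sv κ w U i I.+ wi N(λ γ → dg γ i)(aq κ w γs)
  sM κ []{w}{U}[] i [] _ _ = sym(trans(cong(λ y → sv κ w U i I.+ y)
   (trans(sm{N}λ γ → I.*-zeroˡ(dg(toℕ γ)i))(a9.sum-replicate-zero N)))(I.+-identityʳ _))
  sM κ(_∷_{x = k}a γs){w}{U}(W ∷ Gs)i(v ∷ vs)(xf , as)(g , s)=
   trans(sM κ γs Gs i vs as s)(trans(cong(I._+ wt rt)(Sx κ{k}{w}i v xf g))
    (trans(I.+-assoc(sv κ w U i)(wt n4)(wt rt))(cong(λ y → sv κ w U i I.+ y)(sym(wA N(λ γ → dg γ i)n4 rt)))))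
   where
   wt = wi N(λ γ → dg γ i)
   n4 = sp κ(w k)(w(suc k))a
   rt = aq κ(w ∘ transposition k)γs
  S1 : ∀ κ U i → κ ≤ d → sv κ id U i ≡ U d i I.- U κ i
  S1 κ U i da = pa d da
   where
   open so
   pa : ∀ n → κ ≤ n → sU n(λ j → aJ κ(suc j)(U(suc j)i I.- U j i))≡ U n i I.- U κ i
   pa n nU with κ N.≟ n
   ... | yes refl = trans(trans(sT κ λ j js → aZ _(N.<⇒≱ js ∘ N.s≤s⁻¹))(zk κ))(sym(I.+-inverseʳ(U κ i)))
    where
    zk : ∀ n → sU n(λ _ → I.0ℤ)≡ I.0ℤ
    zk zero = refl
    zk(suc n)= trans(I.+-identityʳ _)(zk n)
   pa zero z≤n | no ny = ⊥-elim(ny refl)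
   pa(suc n)nU | no ny = trans(cong₂ I._+_(pa n(N.s≤s⁻¹(N.≤∧≢⇒< nU ny)))(aR{κ}{suc n}_(N.≤∧≢⇒< nU ny)))
    (solve 3(λ a b c →(a :+ :- b):+(c :+ :- a):= c :+ :- b)refl(U n i)(U κ i)(U(suc n)i))
  s~ : ∀ κ{w}V i → κ ≤ d → Rv w → sv κ w V i ≡ V(d ∸ κ)i I.- V 0 i
  s~ κ{w}V i da Rh = trans(sT d λ j jr → cong(λ y → aJ κ y(V(suc j)i I.- V j i))(Rh(suc j)(s≤s z≤n)jr))
   (trans(pa d N.≤-refl)(cong(λ l → V l i I.- V 0 i)(N.m≥n⇒m⊓n≡n(N.m∸n≤m d κ))))
   where
   open so
   th : ℕ → ℤ
   th j = aJ κ(d ∸ j)(V(suc j)i I.- V j i)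
   pa : ∀ n → n ≤ d → sU n th ≡ V(n ⊓(d ∸ κ))i I.- V 0 i
   pa zero _ = sym(I.+-inverseʳ(V 0 i))
   pa(suc n)n> with n N.<? d ∸ κ
   ... | yes nW = trans(cong₂ I._+_(trans(pa n(N.<⇒≤ n>))(cong(λ l → V l i I.- V 0 i)(N.m≤n⇒m⊓n≡m(N.<⇒≤ nW))))
    (aR _(subst(_< d ∸ n)(N.m∸[m∸n]≡n da)(N.∸-monoʳ-< nW(N.m∸n≤m d κ)))))
    (trans(solve 3(λ a b c →(a :+ :- b):+(c :+ :- a):= c :+ :- b)refl(V n i)(V 0 i)(V(suc n)i))
     (cong(λ l → V l i I.- V 0 i)(sym(N.m≤n⇒m⊓n≡m nW))))
   ... | no n6 = trans(cong₂ I._+_(trans(pa n(N.<⇒≤ n>))(cong(λ l → V l i I.- V 0 i)(N.m≥n⇒m⊓n≡n(N.≮⇒≥ n6))))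
    (aZ _(N.≤⇒≯(subst(d ∸ n ≤_)(N.m∸[m∸n]≡n da)(N.∸-monoʳ-≤ d(N.≮⇒≥ n6))))))
    (trans(I.+-identityʳ _)(cong(λ l → V l i I.- V 0 i)(sym(N.m≥n⇒m⊓n≡n(N.m≤n⇒m≤1+n(N.≮⇒≥ n6))))))
  a/ : ∀ κ{β}(γs : Weights β){U}Gs i → κ ≤ d → All(VL d)β → Ac id β → Rv(permutation β)→
   Slice γs U Gs →(∀ i → U d i ≡ I.0ℤ)→(∀ i → lL U Gs 0 i ≡ I.0ℤ)→
   wi N(λ γ → dg γ i)(aq κ id γs)≡ U κ i I.+ lL U Gs(d ∸ κ)i
  a/ κ γs{U}Gs i da vs as Rh s Ud V0 = sY(trans(sym(s~ κ V i da Rh))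
   (trans(sM κ γs Gs i vs as s)(cong(I._+ wt)(S1 κ U i da))))
   where
   open so
   V = lL U Gs
   wt = wi N(λ γ → dg γ i)(aq κ id γs)
   sY : V(d ∸ κ)i I.- V 0 i ≡ U d i I.- U κ i I.+ wt → wt ≡ U κ i I.+ V(d ∸ κ)i
   sY eq = trans(trans(solve 2(λ u w → w := u :+(con(+ 0):+ :- u :+ w))refl(U κ i)wt)
    (cong(λ z → U κ i I.+(z I.- U κ i I.+ wt))(sym(Ud i))))(cong(λ z → U κ i I.+ z)(trans(sym eq)
     (trans(cong(λ z → V(d ∸ κ)i I.- z)(V0 i))(I.+-identityʳ _))))
 module PS{d n : ℕ}{σ : Signature n}(am : Admissible d σ)(dd : 2 ≤ d)where
  open TW am using(pW;lI)
  pL : ∀{X : Set}(L : ℕ × ℕ → ℕ)(g : ℕ × ℕ → X)(xs : List(ℕ × ℕ))→ Ll X(map L xs)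
  pL L g xs = All.map⁺{f = L}(universal g xs)
  lq : ∀{X : Set}→ X →(ℕ × ℕ → X)→ ℕ → ℕ → X
  lq U g i(suc(suc k))= g(i , suc k)
  lq U g(suc i)(suc zero)= g(i , d ∸ 1)
  lq U g i k = U
  l7 : ∀{X : Set}(U : X)g i → lq U g i(suc(d ∸ 1))≡ lq U g(suc i)1
  l7{X}U g i = go d dd(d ∸ 1)refl
   where
   go : ∀ dc → 2 ≤ dc → ∀ e → e ≡ dc ∸ 1 → lq U g i(suc e)≡ g(i , e)
   go(suc(suc dc))_(suc e)eq = refl
   go(suc(suc dc))_ zero()
   go(suc zero)(s≤s())e eq
  module _{X : Set}(P : ℕ →(ℕ → ℕ)→ X → X → Set)(L : ℕ × ℕ → ℕ)(f : ℕ × ℕ → ℕ → ℕ)(g : ℕ × ℕ → X)(Ua : X)where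
   open La P
   Pa : X → List(ℕ × ℕ)→ Set
   Pa U xs = Slice(pW L f xs)U(pL L g xs)
   At : ℕ → ℕ → Set
   At i k = P(L(i , k))(f(i , k))(lq Ua g i k)(g(i , k))
   pQ : ∀ l →(∀ i k → i < l → 1 ≤ k → k < d → At i k)→ Pa Ua(positions am l)
   pQ l at = rV id l 0(λ j → refl)λ j k jt → at j k jt
    where
    r7 : ∀ rt i h m k →(∀ j → h j ≡ k N.+ j)→ k N.+ m ≡ d ∸ 1 →(∀ k → 1 ≤ k → k < d → At i k)→
     Pa(lq Ua g(suc i)1)rt → Pa(lq Ua g i(suc k))(map(i ,_)(map suc(applyUpTo h m))++ rt)
    r7 rt i h zero k eq kQ at s = subst(λ U → Pa U rt)
     (sym(trans(cong(lq Ua g i ∘ suc)(trans(sym(N.+-identityʳ k))kQ))(l7 Ua g i)))s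
    r7 rt i h(suc m)k eq kQ at s rewrite eq 0 | N.+-identityʳ k =
     at(suc k)(s≤s z≤n)kh , r7 rt i(h ∘ suc)m(suc k)(λ j → trans(eq(suc j))(N.+-suc k j))(trans(sym(N.+-suc k m))kQ)at s
     where
     kh : suc k < d
     kh = md(subst(k <_)kQ(N.m<m+n k(s≤s z≤n)))
    rV : ∀ h m i →(∀ j → h j ≡ i N.+ j)→(∀ j k → j < i N.+ m → 1 ≤ k → k < d → At j k)→
     Pa(lq Ua g i 1)(cartesianProduct(applyUpTo h m)lI)
    rV h zero i eq at = tt
    rV h(suc m)i eq at rewrite eq 0 | N.+-identityʳ i =
     r7 _ i id(d ∸ 1)0(λ j → refl)refl(λ k → at i k(N.m<m+n i(s≤s z≤n)))
      (rV(h ∘ suc)m(suc i)(λ j → trans(eq(suc j))(N.+-suc i j))λ j k j< → at j k(subst(j <_)(sym(N.+-suc i m))j<))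
   pA : ∀ l → Pa Ua(positions am l)→ ∀ i k → i < l → 1 ≤ k → k < d → At i k
   pA l s i k i7 kk kh = rV id l 0(λ j → refl)s i k z≤n i7 kk kh
    where
    r7 : ∀ rt i h m k →(∀ j → h j ≡ k N.+ j)→ k N.+ m ≡ d ∸ 1 →
     Pa(lq Ua g i(suc k))(map(i ,_)(map suc(applyUpTo h m))++ rt)→
     (∀ l → suc k ≤ l → l < d → At i l)× Pa(lq Ua g(suc i)1)rt
    r7 rt i h zero k eq kQ s =(λ l K~ Ls → ⊥-elim(N.<⇒≱(s≤s K~)(N.≤-trans Ls(N.≤-trans(N.m≤n+m∸n d 1)
     (s≤s(N.≤-reflexive(trans(sym kQ)(N.+-identityʳ k))))))))
     , subst(λ U → Pa U rt)(trans(cong(lq Ua g i ∘ suc)(trans(sym(N.+-identityʳ k))kQ))(l7 Ua g i))s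
    r7 rt i h(suc m)k eq kQ s rewrite eq 0 | N.+-identityʳ k = fk , proj₂ Lc
     where
     Lc = r7 rt i(h ∘ suc)m(suc k)(λ j → trans(eq(suc j))(N.+-suc k j))(trans(sym(N.+-suc k m))kQ)(proj₂ s)
     fk : ∀ l → suc k ≤ l → l < d → At i l
     fk l K~ Ls with l N.≟ suc k
     ... | yes refl = proj₁ s
     ... | no Ld = proj₁ Lc l(N.≤∧≢⇒< K~(Ld ∘ sym))Ls
    rV : ∀ h m i →(∀ j → h j ≡ i N.+ j)→ Pa(lq Ua g i 1)(cartesianProduct(applyUpTo h m)lI)→
     ∀ j k → i ≤ j → j < i N.+ m → 1 ≤ k → k < d → At j k
    rV h zero i eq s j k Ij j< = ⊥-elim(N.<⇒≱ j<(subst(_≤ j)(sym(N.+-identityʳ i))Ij))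
    rV h(suc m)i eq s j k Ij j< kk kh rewrite eq 0 | N.+-identityʳ i with j N.≟ i
    ... | yes refl = proj₁(r7 _ i id(d ∸ 1)0(λ j → refl)refl s)k kk kh
    ... | no ji = rV(h ∘ suc)m(suc i)(λ j → trans(eq(suc j))(N.+-suc i j))
     (proj₂(r7 _ i id(d ∸ 1)0(λ j → refl)refl s))j k(N.≤∧≢⇒< Ij(ji ∘ sym))(subst(j <_)(N.+-suc i m)j<)kk kh
  pI : ∀{X : Set}(L : ℕ × ℕ → ℕ)(g : ℕ × ℕ → X)(Ua : X)l →
   lL Ua(pL L g(positions am l))≡ lq Ua g l 1
  pI{X}L g Ua l = rV id l 0(λ j → refl)
   where
   l8 : X → List(ℕ × ℕ)→ X
   l8 U xs = lL U(pL L g xs)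
   r7 : ∀ rt i h m k →(∀ j → h j ≡ k N.+ j)→ k N.+ m ≡ d ∸ 1 →
    l8(lq Ua g i(suc k))(map(i ,_)(map suc(applyUpTo h m))++ rt)≡ l8(lq Ua g(suc i)1)rt
   r7 rt i h zero k eq kQ = cong(λ U → l8 U rt)(trans(cong(lq Ua g i ∘ suc)(trans(sym(N.+-identityʳ k))kQ))(l7 Ua g i))
   r7 rt i h(suc m)k eq kQ rewrite eq 0 | N.+-identityʳ k =
    r7 rt i(h ∘ suc)m(suc k)(λ j → trans(eq(suc j))(N.+-suc k j))(trans(sym(N.+-suc k m))kQ)
   rV : ∀ h m i →(∀ j → h j ≡ i N.+ j)→ l8(lq Ua g i 1)(cartesianProduct(applyUpTo h m)lI)≡ lq Ua g(i N.+ m)1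
   rV h zero i eq = cong(λ i → lq Ua g i 1)(sym(N.+-identityʳ i))
   rV h(suc m)i eq rewrite eq 0 | N.+-identityʳ i = trans(r7 _ i id(d ∸ 1)0(λ j → refl)refl)
    (trans(rV(h ∘ suc)m(suc i)λ j → trans(eq(suc j))(N.+-suc i j))(cong(λ i → lq Ua g i 1)(sym(N.+-suc i m))))
  pB : ∀ l → All(λ(i , k)→ i < l)(positions am l)
  pB l = go(upTo l)(All.applyUpTo⁺₁ id l λ i7 → i7)
   where
   go : ∀ is → All(_< l)is → All(λ(i , k)→ i < l)(cartesianProduct is lI)
   go [] [] = []
   go(i ∷ is)(i7 ∷ ps)= All.++⁺(All.map⁺(universal(λ _ → i7)lI))(go is ps)
  pK : ∀{Q :(ℕ → ℕ)→ Set}L f{B : ℕ × ℕ → Set}xs → All B xs →(∀ x → B x → Q(f x))→ AW Q(pW L f xs)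
  pK L f [] [] q = []
  pK L f(x ∷ xs)(b ∷ bs)q = q x b ∷ pK L f xs bs q
module Du where
 open IS
 open Sl
 open KF
 open Wo hiding(at;aH;oa)
 open BP
 open Ie
 open To
 open Gd
 open ES using(sp;aq)
 open SS
 open import Relation.Binary.PropositionalEquality.Core using(refl;sym;trans;cong;cong₂;subst)
 open import Data.Nat.Base using(_≤_;_<_)
 open import Defs using(sign)
 module Rn(vI vo : ℕ)where
  S2 :(ℕ → ℕ)→(ℕ → ℕ)→ Set
  S2 a a′ = ∀ τ → a(vI N.+ τ)≡ a′(vo N.+ τ)
  Ma : ∀{β}→ Weights β → Weights β → Set
  Ma [] [] = ⊤
  Ma(a ∷ γs)(a′ ∷ sf)= S2 a a′ × Ma γs sf
  mt : ∀{β ae}(m : Move β ae)s(γs sf : Weights β)→ Ma γs sf →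
   Ma(moveWeights m(vI N.+ s)γs)(moveWeights m(vo N.+ s)sf)
  mt trivalent s(a ∷ c ∷ γs)(a′ ∷ cB ∷ sf)(aa , cc , r)= os , r
   where
   os : S2(trivalentOut(vI N.+ s)a c)(trivalentOut(vo N.+ s)a′ cB)
   os τ with τ N.≟ s
   ... | yes refl = trans(ti(vI N.+ τ)a c)(sym(ti(vo N.+ τ)a′ cB))
   ... | no f4 = trans(tO(vI N.+ s)a c λ e → ⊥-elim(f4(N.+-cancelˡ-≡ vI τ s e)))
    (trans(cong₂ _⊓_(aa τ)(cc τ))(sym(tO(vo N.+ s)a′ cB λ e → ⊥-elim(f4(N.+-cancelˡ-≡ vo τ s e)))))
  mt(4-valent _)s(a ∷ c ∷ γs)(a′ ∷ cB ∷ sf)(aa , cc , r)= cc , aa , r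
  mt(6-valent _)s(a ∷ f ∷ e ∷ γs)(a′ ∷ fc ∷ ed ∷ sf)(aa , ff , ee , r)=
   (λ τ → cong₂ _∸_(cong₂ N._+_(ff τ)(ee τ))(cong₂ _⊓_(aa τ)(ee τ))),(λ τ → cong₂ _⊓_(aa τ)(ee τ)),
   (λ τ → cong₂ _∸_(cong₂ N._+_(aa τ)(ff τ))(cong₂ _⊓_(aa τ)(ee τ))), r
  mt(skip m)s(a ∷ γs)(a′ ∷ sf)(aa , r)= aa , mt m s γs sf r
  mw : ∀{β ae}(w : Weave β ae)s(γs sf : Weights β)→ Ma γs sf →
   Ma(bottomWeights w(vI N.+ s)γs)(bottomWeights w(vo N.+ s)sf)
  mw [] s γs sf r = r
  mw(m ∷ w)s γs sf r rewrite N.+-assoc vI s(moveTrivalents m)| N.+-assoc vo s(moveTrivalents m)=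
   mw w(s N.+ moveTrivalents m)_ _(mt m s γs sf r)
  mz : ∀{β}{γs sf : Weights β}→ AW(Be vI)γs → AW(Be vo)sf → Ma γs sf
  mz{γs = []}{[]}[] [] = tt
  mz{γs = _ ∷ _}{_ ∷ _}(b ∷ bs)(bd ∷ Bu)=
   (λ τ → trans(b(vI N.+ τ)(N.m≤m+n vI τ))(sym(bd(vo N.+ τ)(N.m≤m+n vo τ)))), mz bs Bu
  aW : ∀{β}κ w(γs sf : Weights β)→ Ma γs sf → S2(aq κ w γs)(aq κ w sf)
  aW κ w [] [] _ τ = refl
  aW κ w(_∷_{x = k}a γs)(a′ ∷ sf)(aa , r)τ = cong₂ N._+_ n4(aW κ(w ∘ transposition k)γs sf r τ)
   where
   n4 : sp κ(w k)(w(suc k))a(vI N.+ τ)≡ sp κ(w k)(w(suc k))a′(vo N.+ τ)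
   n4 with w k N.≤? κ | κ N.<? w(suc k)
   ... | yes _ | yes _ = aa τ
   ... | yes _ | no _ = refl
   ... | no _ | _ = refl
 aQ : ∀{β}κ w(γs : Weights β)γ → AW(λ a → a γ ≡ 0)γs → aq κ w γs γ ≡ 0
 aQ κ w [] γ [] = refl
 aQ κ w(_∷_{x = k}a γs)γ(z ∷ zs)= cong₂ N._+_ n4(aQ κ(w ∘ transposition k)γs γ zs)
  where
  n4 : sp κ(w k)(w(suc k))a γ ≡ 0
  n4 with w k N.≤? κ | κ N.<? w(suc k)
  ... | yes _ | yes _ = z
  ... | yes _ | no _ = refl
  ... | no _ | _ = refl
 s7 : ∀ m n(f : ℕ → ℤ)→(∀ γ → γ < m → f γ ≡ I.0ℤ)→ su{m N.+ n}(f ∘ toℕ)≡ su{n}(λ τ → f(m N.+ toℕ τ))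
 s7 zero n f z = refl
 s7(suc m)n f z = trans(cong(I._+ su{m N.+ n}(f ∘ suc ∘ toℕ))(z 0(s≤s z≤n)))
  (trans(I.+-identityˡ _)(s7 m n(f ∘ suc)λ γ Me → z(suc γ)(s≤s Me)))
 module DD{d n : ℕ}{σ : Signature n}(am : Admissible d σ)(dd : 2 ≤ d)(p : ℤ)(l : ℕ)(Dr : d < l)
  {ae}(w : Weave(topWord am p l)ae)(ve : All(VL d)ae)(aG : Ac id ae)where
  open TW am
  open PS am dd
  open Aa d
  open Cu d
  private instance
   DI : N.NonZero d
   DI = N.>-nonZero(N.≤-trans(s≤s z≤n)dd)
  L = topLetter am p
  xs = positions am l
  vK = tW p l
  vb = l N.* d
  T = trivalents w
  ic : ℕ × ℕ → ℕ → ℕ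
  ic(i , k)γ = if(i N.≡ᵇ γ N./ d)∧(k N.≡ᵇ γ N.% d)then 1 else 0
  Cl : ℕ → ℕ → ℕ
  Cl i k = k N.+ i N.* d
  CE : ∀ i{k}→ k < d → Cl i k N./ d ≡ i
  CE i{k}kh = trans(N.+-distrib-/ k(i N.* d)f^)(trans(cong₂ N._+_(N.m<n⇒m/n≡0 kh)(N.m*n/n≡m i d))refl)
   where
   f^ : k N.% d N.+(i N.* d)N.% d < d
   f^ = subst(_< d)(sym(trans(cong₂ N._+_(N.m<n⇒m%n≡m kh)(N.m*n%n≡0 i d))(N.+-identityʳ k)))kh
  CG : ∀ i{k}→ k < d → Cl i k N.% d ≡ k
  CG i{k}kh = trans(N.[m+kn]%n≡m%n k i d)(N.m<n⇒m%n≡m kh)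
  i' : ∀ i{k}→ k < d → ic(i , k)(Cl i k)≡ 1
  i' i{k}kh rewrite CE i kh | CG i kh | rl i | rl k = refl
  i6 : ∀ i k{γ}→ γ ≢ Cl i k → ic(i , k)γ ≡ 0
  i6 i k{γ}f5 with i N.≟ γ N./ d
  ... | no Ia rewrite fa Ia = refl
  ... | yes refl with k N.≟ γ N.% d
  ... | no Kv rewrite fa Kv | ∧-zeroʳ(γ N./ d N.≡ᵇ γ N./ d)= refl
  ... | yes refl = ⊥-elim(f5(N.m≡m%n+[m/n]*n γ d))
  i1 : ∀ γ i k → i ≢ γ N./ d → ic(i , k)γ ≡ 0
  i1 γ i k Ia rewrite fa Ia = refl
  wk : ∀ N dg i k → k < d → Cl i k < N → wi N dg(ic(i , k))≡ dg(Cl i k)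
  wk N dg i k kh C0 = trans(sk{N}(Fin.fromℕ< C0)(dg(Cl i k)){h = λ _ → I.0ℤ}AI oo)
   (trans(cong(λ y → dg(Cl i k)I.+ y)(a9.sum-replicate-zero N))(I.+-identityʳ _))
   where
   AI : + ic(i , k)(toℕ(Fin.fromℕ< C0))I.* dg(toℕ(Fin.fromℕ< C0))≡ dg(Cl i k)I.+ I.0ℤ
   AI rewrite O.toℕ-fromℕ< C0 | i' i kh = trans(I.*-identityˡ _)(sym(I.+-identityʳ _))
   oo : ∀ j → j ≢ Fin.fromℕ< C0 → + ic(i , k)(toℕ j)I.* dg(toℕ j)≡ I.0ℤ
   oo j ja = trans(cong(λ x → + x I.* dg(toℕ j))(i6 i k λ e → ja(O.toℕ-injective(trans e(sym(O.toℕ-fromℕ< C0))))))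
    (I.*-zeroˡ(dg(toℕ j)))
  bz : AW(Be vb)(pW L ic xs)
  bz = pK L ic xs(pB l)λ(i , k)i7 γ vR →
   i1 γ i k λ Iy → N.<⇒≱ i7(subst(l ≤_)(sym Iy)(subst(_≤ γ N./ d)(N.m*n/n≡m l d)(N./-monoˡ-≤ d vR)))
  bt : AW(Be l)(topWeights am p l)
  bt = pK L(λ(i , k)γ → if(k N.≡ᵇ d ∸ 1)∧(γ N.≡ᵇ i)then 1 else 0)xs(pB l)λ(i , k)i7 γ Lf → bA i k γ(N.>⇒≢(N.<-≤-trans i7 Lf))
   where
   bA : ∀ i k γ → γ ≢ i →(if(k N.≡ᵇ d ∸ 1)∧(γ N.≡ᵇ i)then 1 else 0)≡ 0
   bA i k γ i% rewrite fa i% | ∧-zeroʳ(k N.≡ᵇ d ∸ 1)= refl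
  rr : Rv(permutation ae)
  rr j jj jd = trans(sym(sd ae id aG j))
   (trans(sym(wa w id j))(tp p l(N.<⇒≤ Dr)j jj jd))
  mR : ∀ γ → γ < l → AW(λ a → a γ ≡ 0)(bottomWeights w l(topWeights am p l))
  mR γ l/ = vy w l(topWeights am p l)γ l/ vK ve aG(tp p l(N.<⇒≤ Dr))
   (tz p l(λ(i , k)γ → if(k N.≡ᵇ d ∸ 1)∧(γ N.≡ᵇ i)then 1 else 0)γ γ(N.<⇒≤ Dr)λ i k Ip → r7 i k(Ip ∘ sym))
   where
   r7 : ∀ i k → γ ≢ i →(if(k N.≡ᵇ d ∸ 1)∧(γ N.≡ᵇ i)then 1 else 0)≡ 0
   r7 i k i% rewrite fa i% | ∧-zeroʳ(k N.≡ᵇ d ∸ 1)= refl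
  lY : ∀ γ → γ < vb → AW(λ a → a γ ≡ 0)(bottomWeights w vb(pW L ic xs))
  lY γ vY = vy w vb(pW L ic xs)γ vY vK ve aG(tp p l(N.<⇒≤ Dr))
   (tz p l ic γ(γ N./ d)(N.<⇒≤ Dr)λ i k → i1 γ i k)
  bottom = bottomWeights w l(topWeights am p l)
  bD = bottomWeights w vb(pW L ic xs)
  ci : ℕ → ℕ → ℕ
  ci κ = aq κ id bottom
  cF : ∀ κ γ → γ < l → ci κ γ ≡ 0
  cF κ γ l/ = aQ κ id bottom γ(mR γ l/)
  Sy : ∀ κ τ → ci κ(l N.+ τ)≡ aq κ id bD(vb N.+ τ)
  Sy κ = aW κ id bottom bD
   (S8(mw w 0 _ _(mz bt bz)))
   where
   open Rn l vb
   S8 : Ma(bottomWeights w(l N.+ 0)(topWeights am p l))(bottomWeights w(vb N.+ 0)(pW L ic xs))→ Ma bottom bD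
   S8 m rewrite N.+-identityʳ l | N.+-identityʳ vb = m
  module _(ag : ℕ)(vg : VL d ag)where
   k! : ℕ
   k! = letter am p ag
   l~ : letter am p k! ≡ ag
   l~ = bq(sign σ p)refl
    where
    bq : ∀ ε → sign σ p ≡ ε → letter am p k! ≡ ag
    bq Sign.+ eq = trans(lc k! eq)(lc ag eq)
    bq Sign.- eq = trans(lw k! eq)(trans(cong(d ∸_)(lw ag eq))(N.m∸[m∸n]≡n(N.<⇒≤(proj₂ vg))))
   l9 : ∀{k}→ VL d k → letter am p k ≡ ag → k ≡ k!
   l9{k}(_ , kh)= bq(sign σ p)refl
    where
    bq : ∀ ε → sign σ p ≡ ε → letter am p k ≡ ag → k ≡ k!
    bq Sign.+ eq e = trans(sym(lc k eq))(trans e(sym(lc ag eq)))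
    bq Sign.- eq e = trans(sym(N.m∸[m∸n]≡n(N.<⇒≤ kh)))(trans(cong(d ∸_)(trans(sym(lw k eq))e))(sym(lw ag eq)))
   ul : Level ⊤
   ul = rL ag(λ _ → + 1)λ _ _ → I.0ℤ
   zl : Level ⊤
   zl _ _ = I.0ℤ
   rn : ℕ × ℕ → Level ⊤
   rn(zero , k)= if k N.<ᵇ k! then ul else zl
   rn(suc i , k)= zl
   rN : ∀{k}→ k < k! → rn(0 , k)≡ ul
   rN{k}Kl with k N.<ᵇ k! | N.<⇒<ᵇ Kl
   ... | true | _ = refl
   rC : ∀{k}→ ¬ k < k! → rn(0 , k)≡ zl
   rC{k}KR with k N.<ᵇ k! in eq
   ... | false = refl
   ... | true = ⊥-elim(KR(N.<ᵇ⇒< k k!(subst Data.Bool.Base.T(sym eq)tt)))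
    where import Data.Bool.Base
   lT : ℕ → ℕ → Level ⊤
   lT = lq ul rn
   Nc = vb N.+ T
   lD : ℕ → ⊤ → ℤ
   lD γ i = U Lh i I.+ W Lh i I.-(U(Lh ∸ 1)i I.+ U(suc Lh)i)
    where
    U = lT(γ N./ d)(γ N.% d)
    W = rn(γ N./ d , γ N.% d)
    Lh = L(γ N./ d , γ N.% d)
   Kd : VL d k!
   Kd = lm p vg
   lE : ∀ k → 1 ≤ k → k ≤ k! → lT 0 k ≡ ul
   lE(suc zero)_ _ = refl
   lE(suc(suc k))_ KS = rN KS
   lU : ∀ k → k! < k → lT 0 k ≡ zl
   lU(suc zero)K5 = ⊥-elim(N.<⇒≱ K5(proj₁ Kd))
   lU(suc(suc k))KA = rC λ Kl → N.<⇒≱ KA Kl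
   lO : ∀ i k → 1 ≤ k → lT(suc i)k ≡ zl
   lO zero(suc zero)_ = rC λ Dt → N.<⇒≱(proj₂ Kd)(N.≤-trans(N.m≤n+m∸n d 1)Dt)
   lO(suc i)(suc zero)_ = refl
   lO i(suc(suc k))_ = refl
   Sz : ∀ i k → i < l → VL d k → ∀ m → m ≢ L(i , k)→ ∀ x → lT i k m x ≡ rn(i , k)m x
   Sz(suc i)k _(kk , _)m m/ x = cong(λ U → U m x)(lO i k kk)
   Sz zero k _(kk , kh)m m/ x with N.<-cmp k k!
   ... | tri< Kl _ _ = cong(λ U → U m x)(trans(lE k kk(N.<⇒≤ Kl))(sym(rN Kl)))
   ... | tri> _ _ KA = cong(λ U → U m x)(trans(lU k KA)(sym(rC(N.<-asym KA))))
   ... | tri≈ _ refl _ = trans(cong(λ U → U m x)(lE k kk N.≤-refl))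
    (trans(cong(λ y → y x)(ro(λ _ → + 1)(λ _ _ → I.0ℤ)mZ))(cong(λ U → U m x)(sym(rC(N.<-irrefl refl)))))
    where
    mZ : m ≢ ag
    mZ e = m/(trans e(sym(trans(cong(λ j → letter am j k!)(I.+-identityʳ p))l~)))
   ty : Ga.Slice ⊤ Nc lD(pW L ic xs)ul(pL L rn xs)
   ty = pQ(Gf)L ic rn ul l λ i k i7 kk kh → record
    {same = Sz i k i7(kk , kh)
    ;ch = λ x → sY(trans(wk Nc(λ γ → lD γ x)i k kh(N.≤-trans(CY i k i7 kh)(N.m≤m+n vb T)))
     (cong₂(λ i k → lT i k(L(i , k))x I.+ rn(i , k)(L(i , k))x I.-(lT i k(L(i , k)∸ 1)x I.+ lT i k(suc(L(i , k)))x))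
      (CE i kh)(CG i kh)))
    }
    where
    Gf = Ga.Gb ⊤ Nc lD
    CY : ∀ i k → i < l → k < d → Cl i k < vb
    CY i k i7 kh = N.≤-trans(N.+-monoˡ-<(i N.* d)kh)(N.*-monoˡ-≤ d i7)
    sY : ∀{w s t}→ w ≡ s I.- t → s ≡ t I.+ w
    sY{w}{s}{t}refl = so.solve 2(λ s t → s := t :+(s :+ :- t))refl s t
     where open so
   l' : ∀ l → 1 ≤ l → ∀ m x → lL ul(pL L rn(positions am l))m x ≡ I.0ℤ
   l'(suc l)_ m x = cong(λ V → V m x)(trans(pI L rn ul(suc l))(lO l 1(s≤s z≤n)))
   private et = Ee.extend ⊤ d Nc w vb(pW L ic xs)lD(pL L rn xs)vK bz N.≤-refl ty
   dD : ℕ → ℤ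
   dD γ = proj₁ et(vb N.+(γ ∸ l))tt
   d2 : ∀ κ → VL d κ → wi(l N.+ T)dD(ci κ)≡ ul κ tt
   d2 κ(f6 , Dl)= trans(s7 l T(λ γ → + ci κ γ I.* dD γ)(λ γ l/ → trans(cong(λ x → + x I.* dD γ)(cF κ γ l/))(I.*-zeroˡ(dD γ))))
    (trans(sm{T}λ τ → cong₂(λ x y → + x I.* proj₁ et(vb N.+ y)tt)(Sy κ(toℕ τ))(N.m+n∸m≡n l(toℕ τ)))
    (trans(sym(s7 vb T(λ γ → + aq κ id bD γ I.* proj₁ et γ tt)λ γ vY →
     trans(cong(λ x → + x I.* proj₁ et γ tt)(aQ κ id bD γ(lY γ vY)))(I.*-zeroˡ(proj₁ et γ tt))))
    (trans(SG.a/ ⊤ d Nc(proj₁ et)κ bD(G.bL w lg)tt(N.<⇒≤ Dl)ve aG rr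
     (G.bS w lg)(λ _ → cong(λ y → y tt)(ro(λ _ → + 1)(λ _ _ → I.0ℤ)(N.>⇒≢(proj₂ vg))))
     (λ x → trans(cong(λ V → V 0 x)(G.ll w lg))(l' l(N.≤-trans(s≤s z≤n)Dr)0 x)))
     (trans(cong(λ y → ul κ tt I.+ y)(trans(cong(λ V → V(d ∸ κ)tt)(G.ll w lg))(l' l(N.≤-trans(s≤s z≤n)Dr)(d ∸ κ)tt)))
      (I.+-identityʳ _)))))
    where
    lg = proj₂(proj₂ et)
    module G = Ga ⊤ Nc(proj₁ et)
module Ln where
 open IS
 open KF
 module Pl(R : CommutativeRing 0ℓ 0ℓ)where
  open CommutativeRing R
  open RingProperties ring
  open In R
  open SetoidReasoning setoid
  Py : Set
  Py = List Carrier
  ev : Py → Carrier → Carrier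
  ev [] s = 0#
  ev(a ∷ p)s = a + s * ev p s
  cf c₁ : Py → Carrier
  cf [] = 0#
  cf(a ∷ _)= a
  c₁ [] = 0#
  c₁(_ ∷ p)= cf p
  infixl 6 _e^_
  infixl 7 _bV_
  _e^_ : Py → Py → Py
  [] e^ q = q
  (a ∷ p)e^ [] = a ∷ p
  (a ∷ p)e^(b ∷ q)= a + b ∷ p e^ q
  SA : Carrier → Py → Py
  SA a = map(a *_)
  _bV_ : Py → Py → Py
  [] bV q = []
  (a ∷ p)bV q = SA a q e^(0# ∷ p bV q)
  eE : ∀ p q s → ev(p e^ q)s ≈ ev p s + ev q s
  eE [] q s = sym(+-identityˡ _)
  eE(a ∷ p)[] s = sym(+-identityʳ _)
  eE(a ∷ p)(b ∷ q)s = trans(+-congˡ(*-congˡ(eE p q s)))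
   (solve 5(λ a b s x y → a :+ b :+ s :*(x :+ y):=(a :+ s :* x):+(b :+ s :* y))refl a b s(ev p s)(ev q s))
  eF : ∀ a p s → ev(SA a p)s ≈ a * ev p s
  eF a [] s = sym(zeroʳ a)
  eF a(b ∷ p)s = trans(+-congˡ(*-congˡ(eF a p s)))
   (solve 4(λ a b s x → a :* b :+ s :*(a :* x):= a :*(b :+ s :* x))refl a b s(ev p s))
  ej : ∀ p q s → ev(p bV q)s ≈ ev p s * ev q s
  ej [] q s = sym(zeroˡ _)
  ej(a ∷ p)q s = trans(eE(SA a q)(0# ∷ p bV q)s)(trans(+-cong(eF a q s)(trans(+-identityˡ _)(*-congˡ(ej p q s))))(solve 4(λ a q s p → a :* q :+
   s :*(p :* q):=(a :+ s :* p):* q)refl a(ev q s)s(ev p s)))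
  Ef : ∀ p → ev p 0# ≈ cf p
  Ef [] = refl
  Ef(a ∷ p)= trans(+-congˡ(zeroˡ _))(+-identityʳ a)
  cP : ∀ p q → cf(p e^ q)≈ cf p + cf q
  cP [] q = sym(+-identityˡ _)
  cP(a ∷ p)[] = sym(+-identityʳ _)
  cP(a ∷ p)(b ∷ q)= refl
  cT : ∀ p q → c₁(p e^ q)≈ c₁ p + c₁ q
  cT [] q = sym(+-identityˡ _)
  cT(a ∷ p)[] = sym(+-identityʳ _)
  cT(a ∷ p)(b ∷ q)= cP p q
  cU : ∀ a p → cf(SA a p)≈ a * cf p
  cU a [] = sym(zeroʳ a)
  cU a(b ∷ p)= refl
  c6 : ∀ a p → c₁(SA a p)≈ a * c₁ p
  c6 a [] = sym(zeroʳ a)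
  c6 a(b ∷ p)= cU a p
  cj : ∀ p q → cf(p bV q)≈ cf p * cf q
  cj [] q = sym(zeroˡ _)
  cj(a ∷ p)q = trans(cP(SA a q)(0# ∷ p bV q))(trans(+-identityʳ _)(cU a q))
  cH : ∀ p q → c₁(p bV q)≈ c₁ p * cf q + cf p * c₁ q
  cH [] q = sym(trans(+-cong(zeroˡ _)(zeroˡ _))(+-identityˡ _))
  cH(a ∷ p)q = trans(cT(SA a q)(0# ∷ p bV q))(trans(+-cong(c6 a q)(cj p q))(+-comm _ _))
  Ze : Py → Set
  Ze = All(_≈ 0#)
  eI : ∀{p}→ Ze p → ∀ s → ev p s ≈ 0#
  eI [] s = refl
  eI(z ∷ zs)s = trans(+-cong z(trans(*-congˡ(eI zs s))(zeroʳ s)))(+-identityˡ 0#)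
  cV : ∀{p}→ Ze p → cf p ≈ 0#
  cV [] = refl
  cV(z ∷ _)= z
  c> : ∀{p}→ Ze p → c₁ p ≈ 0#
  c> [] = refl
  c>(_ ∷ zs)= cV zs
  quotient : Carrier → Py → Py
  quotient x [] = []
  quotient x(a ∷ [])= []
  quotient x(a ∷ b ∷ p)= ev(b ∷ p)x ∷ quotient x(b ∷ p)
  eu : ∀ x p s → ev p s ≈ ev p x +(s + - x)* ev(quotient x p)s
  eu x [] s = sym(trans(+-identityˡ _)(zeroʳ _))
  eu x(a ∷ [])s = solve 3(λ a s x → a :+ s :* con I.0ℤ := a :+ x :* con I.0ℤ :+(s :+ :- x):* con I.0ℤ)refl a s x
   where import Data.Integer.Base as I
  eu x(a ∷ b ∷ p)s = trans(+-congˡ(*-congˡ(eu x(b ∷ p)s)))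
   (solve 5(λ a s x P Q → a :+ s :*(P :+(s :+ :- x):* Q):=(a :+ x :* P):+(s :+ :- x):*(P :+ s :* Q))refl a s x(ev(b ∷ p)x)(ev(quotient x(b ∷ p))s))
  qz : ∀ x p → Ze(quotient x p)→ ev p x ≈ 0# → Ze p
  qz x [] _ _ = []
  qz x(a ∷ [])_ px = trans(sym(trans(+-congˡ(zeroʳ x))(+-identityʳ a)))px ∷ []
  qz x(a ∷ b ∷ p)(z ∷ zs)px = trans(sym(trans(+-congˡ(trans(*-congˡ z)(zeroʳ x)))(+-identityʳ a)))px ∷ qz x(b ∷ p)zs z
  module _(nj : ℕ → Carrier)(AA : ∀ i j → i ≢ j → ∃ λ w →(nj i + - nj j)* w ≈ 1#)where
   identity : ∀ p →(∀ s → ev p s ≈ 0#)→ Ze p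
   identity p vn = go(length p)p 0 N.≤-refl λ i _ → vn(nj i)
    where
    ql : ∀ x a p → length(quotient x(a ∷ p))≡ length p
    ql x a [] = P.refl
    ql x a(b ∷ p)= P.cong suc(ql x b p)
    go : ∀ n p k → length p N.≤ n →(∀ i → k N.≤ i → ev p(nj i)≈ 0#)→ Ze p
    go n [] k _ _ = []
    go(suc n)(a ∷ p)k le vn = qz(nj k)(a ∷ p)
     (go n Q(suc k)(N.≤-trans(N.≤-reflexive(ql(nj k)a p))(N.s≤s⁻¹ le))zE)(vn k N.≤-refl)
     where
     Q = quotient(nj k)(a ∷ p)
     zE : ∀ i → k N.< i → ev Q(nj i)≈ 0#
     zE i KT = trans(trans(sym(*-identityˡ _))(*-congʳ(sym(proj₂ w))))(trans(solve 4(λ D w q p → D :* w :* q := w :*(p :+ D :* q):+ :-(w :* p))refl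
      (nj i + - nj k)(proj₁ w)(ev Q(nj i))(ev(a ∷ p)(nj k)))(trans(+-cong(*-congˡ(trans(sym(eu(nj k)(a ∷ p)(nj i)))
      (vn i(N.<⇒≤ KT))))(-‿cong(*-congˡ(vn k N.≤-refl))))(-‿inverseʳ _)))
      where w = AA i k(N.>⇒≢ KT)
  cQ : ∀{a b w}→ b * w ≈ 1# → a * b ≈ 0# → a ≈ 0#
  cQ{a}{b}{w}bw ab = trans(sym(*-identityʳ a))(trans(*-congˡ(sym bw))(trans(sym(*-assoc a b w))(trans(*-congʳ ab)(zeroˡ w))))
  zd : ∀ p q → Ze p → Ze(p e^ q)→ Ze q
  zd [] q _ zq = zq
  zd(a ∷ p)[] _ _ = []
  zd(a ∷ p)(b ∷ q)(z ∷ zs)(y ∷ ys)= trans(sym(trans(+-congʳ z)(+-identityˡ b)))y ∷ zd p q zs ys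
  zh : ∀{a}p → a ≈ 0# → Ze(SA a p)
  zh [] Ax = []
  zh(b ∷ p)Ax = trans(*-congʳ Ax)(zeroˡ b)∷ zh p Ax
  zc : ∀ p h{w}→ cf h * w ≈ 1# → Ze(p bV h)→ Ze p
  zc [] h hw zs = []
  zc(a ∷ p)h hw zs = Ax ∷ zc p h hw(t5(zd(SA a h)(0# ∷ p bV h)(zh h Ax)zs))
   where
   Ax : a ≈ 0#
   Ax = cQ hw(trans(sym(cj(a ∷ p)h))(cV zs))
   t5 : ∀{b q}→ Ze(b ∷ q)→ Ze q
   t5(_ ∷ z)= z
 module Gm(R : CommutativeRing 0ℓ 0ℓ)
  (stable : ∀ z w → ¬ ¬ CommutativeRing._≈_ R z w → CommutativeRing._≈_ R z w)
  (uB : ∀ z → ¬ CommutativeRing._≈_ R z(CommutativeRing.0# R)→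
   ¬ ¬ ∃ λ w → CommutativeRing._≈_ R(CommutativeRing._*_ R z w)(CommutativeRing.1# R))
  (nj : ℕ → CommutativeRing.Carrier R)
  (AA : ∀ i j → i ≢ j → ∃ λ w → CommutativeRing._≈_ R
   (CommutativeRing._*_ R(CommutativeRing._+_ R(nj i)(CommutativeRing.-_ R(nj j)))w)(CommutativeRing.1# R))where
  open CommutativeRing R
  open RingProperties ring
  open In R
  open SetoidReasoning setoid
  open Pl R
  Unit : Carrier → Set
  Unit z = ∃ λ w → z * w ≈ 1#
  ui : ∀{a b}→ Unit a → Unit b → Unit(a * b)
  ui{a}{b}(v , av)(w , bw)= v * w , trans(solve 4(λ a b v w → a :* b :*(v :* w):=(a :* v):*(b :* w))refl a b v w)
   (trans(*-cong av bw)(*-identityˡ 1#))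
  ur : ∀{a b}→ a ≈ b → Unit a → Unit b
  ur A2(w , aw)= w , trans(*-congʳ(sym A2))aw
  p< : ∀ p h →(∀ s → Unit(ev h s)→ ev p s ≈ 0#)→ ∀ s → ev(p bV h)s ≈ 0#
  p< p h vn s = trans(ej p h s)(stable _ _ λ Ph →
   uB(ev h s)(λ hH → Ph(trans(*-congˡ hH)(zeroʳ _)))λ u → Ph(trans(*-congʳ(vn s u))(zeroˡ _)))
  vW : ∀ p h → Unit(cf h)→(∀ s → Unit(ev h s)→ ev p s ≈ 0#)→ Ze p
  vW p h(w , hw)vn = zc p h hw(identity nj AA(p bV h)(p< p h vn))
  module _(h : Py)(ha : Unit(cf h))where
   Dm : Set
   Dm = ∃ λ s → Unit(ev h s)
   or : Dm
   or = 0# , ur(sym(Ef h))ha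
   record Fraction(f : Dm → Carrier): Set where
    field
     num den : Py
     dm : Unit(cf den)
     rA : ∀ s → f s * ev den(proj₁ s)≈ ev num(proj₁ s)
   open Fraction
   Gw : Carrier → ∀{f}→ Fraction f → Set
   Gw r F = c₁(num F)* cf(den F)+ -(cf(num F)* c₁(den F))≈ r *(cf(num F)* cf(den F))
   Gr : Carrier →(Dm → Carrier)→ Set
   Gr r f = ∃ λ(F : Fraction f)→ Gw r F
   gs : ∀{r f g}→(∀ s → f s ≈ g s)→ Gr r f → Gr r g
   gs Fh(F , e)= record{num = num F ;den = den F ;dm = dm F ;rA = λ s → trans(*-congʳ(sym(Fh s)))(rA F s)}, e
   gr : ∀{r rK f}→ r ≈ rK → Gr r f → Gr rK f
   gr Rx(F , e)= F , trans e(*-congʳ Rx)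
   gc : ∀ c → Gr 0#(λ _ → c)
   gc c = record{num = c ∷ [] ;den = 1# ∷ [] ;dm = 1# , *-identityˡ 1#
    ;rA = λ s → trans(*-congˡ(trans(+-congˡ(zeroʳ _))(+-identityʳ 1#)))(trans(*-identityʳ c)(sym(trans(+-congˡ(zeroʳ _))(+-identityʳ c))))}
    , trans(+-cong(zeroˡ _)(trans(-‿cong(zeroʳ _))-0#≈0#))(trans(+-identityˡ 0#)(sym(zeroˡ _)))
   gz : ∀{r rK f g}→ Gr r f → Gr rK g → Gr(r + rK)(λ s → f s * g s)
   gz{r}{rK}{f}{g}(F , e)(G , ed)= record
    {num = num F bV num G ;den = den F bV den G ;dm = ur(sym(cj(den F)(den G)))(ui(dm F)(dm G))
    ;rA = λ s → trans(*-congˡ(ej(den F)(den G)_))(trans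
     (solve 4(λ f g a b → f :* g :*(a :* b):=(f :* a):*(g :* b))refl(f s)(g s)_ _)
     (trans(*-cong(rA F s)(rA G s))(sym(ej(num F)(num G)_))))}
    ,(trans(+-cong(*-cong(cH(num F)(num G))(cj(den F)(den G)))(-‿cong(*-cong(cj(num F)(num G))(cH(den F)(den G)))))(trans(solve 8
     (λ n na m mM a a′ b bd →(na :* m :+ n :* mM):*(a :* b):+ :-(n :* m :*(a′ :* b :+ a :* bd)):=(na :* a :+ :-(n :* a′)):*(m :* b):+(mM :* b
     :+ :-(m :* bd)):*(n :* a))refl n na m mM a a′ b bd)(trans(+-cong(*-congʳ e)(*-congʳ ed))(trans(solve 6(λ r rK n a m b → r :*(n :* a):*(m
     :* b):+ rK :*(m :* b):*(n :* a):=(r :+ rK):*(n :* m :*(a :* b)))refl r rK n a m b)(sym(*-congˡ(*-cong(cj(num F)(num G))(cj(den F)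
     (den G)))))))))
    where
    n = cf(num F);na = c₁(num F);a = cf(den F);a′ = c₁(den F)
    m = cf(num G);mM = c₁(num G);b = cf(den G);bd = c₁(den G)
   gL : ∀{r f g}→ Gr r f → Gr r g → Gr r(λ s → f s + g s)
   gL{r}{f}{g}(F , e)(G , ed)= record
    {num = num F bV den G e^ num G bV den F ;den = den F bV den G ;dm = ur(sym(cj(den F)(den G)))(ui(dm F)(dm G))
    ;rA = λ s → trans(*-congˡ(ej(den F)(den G)_))(trans
     (solve 4(λ f g a b →(f :+ g):*(a :* b):=(f :* a):* b :+(g :* b):* a)refl(f s)(g s)_ _)
     (trans(+-cong(*-congʳ(rA F s))(*-congʳ(rA G s)))
      (sym(trans(eE(num F bV den G)(num G bV den F)_)(+-cong(ej(num F)(den G)_)(ej(num G)(den F)_))))))}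
    ,(trans(+-cong(*-cong(trans(cT(num F bV den G)(num G bV den F))(+-cong(cH(num F)(den G))(cH(num G)(den F))))(cj(den F)(den G)))
     (-‿cong(*-cong Cn(cH(den F)(den G)))))(trans(solve 8(λ n na m mM a a′ b bd →((na :* b :+ n :* bd):+(mM :* a :+ m :* a′)):*(a :* b):+
     :-((n :* b :+ m :* a):*(a′ :* b :+ a :* bd)):=(na :* a :+ :-(n :* a′)):*(b :* b):+(mM :* b :+ :-(m :* bd)):*(a :* a))refl n na m mM a a′
     b bd)(trans(+-cong(*-congʳ e)(*-congʳ ed))(trans(solve 5(λ r n a m b → r :*(n :* a):*(b :* b):+ r :*(m :* b):*(a :* a):= r :*((n :* b
     :+ m :* a):*(a :* b)))refl r n a m b)(sym(*-congˡ(*-cong Cn(cj(den F)(den G)))))))))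
    where
    n = cf(num F);na = c₁(num F);a = cf(den F);a′ = c₁(den F)
    m = cf(num G);mM = c₁(num G);b = cf(den G);bd = c₁(den G)
    Cn : cf(num F bV den G e^ num G bV den F)≈ n * b + m * a
    Cn = trans(cP(num F bV den G)(num G bV den F))(+-cong(cj(num F)(den G))(cj(num G)(den F)))
   Ap : ∀{f}(F : Fraction f)→ f or * cf(den F)≈ cf(num F)
   Ap F = trans(*-congˡ(sym(Ef(den F))))(trans(rA F or)(Ef(num F)))
   gA : ∀{r f g}→(∀ s → f s * g s ≈ 1#)→ Gr r f → Gr(- r)g
   gA{r}{f}{g}fg(F , e)= record
    {num = den F ;den = num F ;dm = ur(Ap F)(ui(g or , fg or)(dm F))
    ;rA = λ s → trans(*-congˡ(sym(rA F s)))(trans(solve 3(λ f g a → g :*(f :* a):=(f :* g):* a)refl(f s)(g s)_)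
     (trans(*-congʳ(fg s))(*-identityˡ _)))}
    , trans(solve 4(λ a a′ n na → a′ :* n :+ :-(a :* na):= :-(na :* a :+ :-(n :* a′)))refl(cf(den F))(c₁(den F))(cf(num F))(c₁(num F)))
     (trans(-‿cong e)(solve 3(λ r n a → :-(r :*(n :* a)):= :- r :*(a :* n))refl r(cf(num F))(cf(den F))))
   s5 : ∀{f}(F G : Fraction f)→(cf(num F)* cf(den G)≈ cf(num G)* cf(den F))×
    (c₁(num F)* cf(den G)+ cf(num F)* c₁(den G)≈ c₁(num G)* cf(den F)+ cf(num G)* c₁(den F))
   s5{f}F G = Eg(trans(sym(c7 p q))(cV ze))CR CH , Eg(trans(sym(c8 p q))(c> ze))CS CI
    where
    p = num F bV den G
    q = num G bV den F
    dn : Py → Py → Py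
    dn p q = p e^ SA(- 1#)q
    c7 : ∀ p q → cf(dn p q)≈ cf p + - cf q
    c7 p q = trans(cP p _)(+-congˡ(trans(cU(- 1#)q)(-1*x≈-x _)))
    c8 : ∀ p q → c₁(dn p q)≈ c₁ p + - c₁ q
    c8 p q = trans(cT p _)(+-congˡ(trans(c6(- 1#)q)(-1*x≈-x _)))
    ze : Ze(dn p q)
    ze = vW(dn p q)h ha λ s u → trans(eE p _ s)(trans(+-cong(ej(num F)(den G)s)(trans(eF(- 1#)q s)(trans(-1*x≈-x _)(-‿cong(ej(num G)(den F)s)))))
     (trans(+-cong(*-congʳ(sym(rA F(s , u))))(-‿cong(*-congʳ(sym(rA G(s , u))))))
      (solve 3(λ f a b → f :* a :* b :+ :-(f :* b :* a):= con I.0ℤ)refl(f(s , u))(ev(den F)s)(ev(den G)s))))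
     where import Data.Integer.Base as I
    Eg : ∀{a b a′ bd}→ a + - b ≈ 0# → a ≈ a′ → b ≈ bd → a′ ≈ bd
    Eg{a}{b}e A5 Bv = trans(sym A5)(trans(trans(solve 2(λ a b → a :=(a :+ :- b):+ b)refl a b)(trans(+-congʳ e)(+-identityˡ b)))Bv)
    CR = cj(num F)(den G)
    CH = cj(num G)(den F)
    CS = cH(num F)(den G)
    CI = cH(num G)(den F)
   gu : ∀{r rK f}→ Unit(f or)→ Gr r f → Gr rK f → r ≈ rK
   gu{r}{rK}{f}fY(F , e)(G , ed)= trans(solve 2(λ r s → r :=(r :+ :- s):+ s)refl r rK)(trans(+-congʳ(cQ(proj₂ un)dn))(+-identityˡ rK))
    where
    n = cf(num F);na = c₁(num F);a = cf(den F);a′ = c₁(den F)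
    m = cf(num G);mM = c₁(num G);b = cf(den G);bd = c₁(den G)
    un : Unit(n * a *(b * b))
    un = ui(ui(ur(Ap F)(ui fY(dm F)))(dm F))(ui(dm G)(dm G))
    Eh = proj₁(s5 F G)
    Ed = proj₂(s5 F G)
    dn :(r + - rK)*(n * a *(b * b))≈ 0#
    dn = trans(solve 5(λ r s n a b →(r :+ :- s):*(n :* a :*(b :* b)):= r :*(n :* a):*(b :* b):+ :-(s :*(n :* b):*(a :* b)))refl r rK n a b)
     (trans(+-cong(*-congʳ(sym e))(-‿cong(*-congʳ(*-congˡ Eh))))(trans(solve 9(λ n na a a′ b bd m r x →(na :* a :+ :-(n :* a′)):*(b :* b):+
     :-(r :*(m :* a):*(a :* b)):=(na :* b :+ n :* bd):*(a :* b):+ :-((n :* b):*(a′ :* b :+ a :* bd)):+ :-(a :* a :*(r :*(m :* b))))refl n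
     na a a′ b bd m rK 0#)(trans(+-cong(+-cong(*-congʳ Ed)(-‿cong(*-congʳ Eh)))(-‿cong(*-congˡ(sym ed))))(solve 6(λ m mM a a′ b bd →(mM :* a
     :+ m :* a′):*(a :* b):+ :-((m :* a):*(a′ :* b :+ a :* bd)):+ :-(a :* a :*(mM :* b :+ :-(m :* bd))):= con I.0ℤ)refl m mM a a′ b bd))))
     where import Data.Integer.Base as I
   l^ : ∀{x y f}→(∀ s → f s ≈ x + proj₁ s * y)→ Gr 0# f → y ≈ 0#
   l^{x}{y}{f}f?(F , e)= cQ(proj₂(ui(dm F)(dm F)))(trans(solve 4(λ x y a a′ → y :*(a :* a):=(y :* a :+ x :* a′):* a :+ :-(x :* a :* a′))refl x y a a′)(trans(+-cong(*-congʳ(trans(proj₂ same)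
    (trans(+-cong(*-identityʳ _)(zeroʳ _))(+-identityʳ _))))(-‿cong(*-congʳ(trans(proj₁ same)(*-identityʳ _)))))(trans e(zeroˡ _))))
    where
    n = cf(num F);na = c₁(num F);a = cf(den F);a′ = c₁(den F)
    li : Fraction f
    li = record{num = x ∷ y ∷ [] ;den = 1# ∷ [] ;dm = 1# , *-identityˡ 1#
     ;rA = λ s → trans(*-congˡ(trans(+-congˡ(zeroʳ _))(+-identityʳ 1#)))(trans(*-identityʳ _)(trans(f? s)(+-congˡ(*-congˡ(sym(trans(+-congˡ(zeroʳ _))(+-identityʳ y)))))))}
    same = s5 li F
   gF : FF R Dm
   gF = record
    {functionRing = record
     {Known = Gr 0# ;kr = gs ;kn = gc ;k2 = gL
     ;ko = λ k K& → gr(+-identityˡ 0#)(gz k K&)}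
    ;kj = λ fg k → gr -0#≈0#(gA fg k)}
module CL where
 open IS
 open RN
 open CN
 open Bl using(ι;b>;nD;iL)
 open Ln
 open import Defs using(_:+_;_:*_)
 opaque
  unfolding _≈ℝ_
  fN : ∀ a b → fromℚ(a Q.+ b)≈ℝ fromℚ a +ℝ fromℚ b
  fN a b = pi(fromℚ(a Q.+ b))(fromℚ a +ℝ fromℚ b)λ _ → P.refl
  fG : ∀ a → fromℚ(Q.- a)≈ℝ -ℝ fromℚ a
  fG a = pi(fromℚ(Q.- a))(-ℝ fromℚ a)λ _ → P.refl
  i& : ∀ a b → a Q.* b ≡ 1ℚ → fromℚ a *ℝ fromℚ b +ℝ -ℝ(fromℚ 0ℚ *ℝ fromℚ 0ℚ)≈ℝ fromℚ 1ℚ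
  i& a b ab = pi(fromℚ a *ℝ fromℚ b +ℝ -ℝ(fromℚ 0ℚ *ℝ fromℚ 0ℚ))(fromℚ 1ℚ)λ _ → P.trans(P.cong(Q._+ 0ℚ)ab)P.refl
  i/ : ∀ a b → fromℚ a *ℝ fromℚ 0ℚ +ℝ fromℚ 0ℚ *ℝ fromℚ b ≈ℝ fromℚ 0ℚ
  i/ a b = pi(fromℚ a *ℝ fromℚ 0ℚ +ℝ fromℚ 0ℚ *ℝ fromℚ b)(fromℚ 0ℚ)
   λ _ → P.trans(P.cong₂ Q._+_(Q.*-zeroʳ a)(Q.*-zeroˡ b))P.refl
  zF : fromℚ 0ℚ ≈ℝ fromℚ 0ℚ +ℝ fromℚ 0ℚ
  zF = pi(fromℚ 0ℚ)(fromℚ 0ℚ +ℝ fromℚ 0ℚ)λ _ → P.refl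
  zC : fromℚ 0ℚ ≈ℝ -ℝ fromℚ 0ℚ
  zC = pi(fromℚ 0ℚ)(-ℝ fromℚ 0ℚ)λ _ → P.refl
  b~ : ¬(fromℚ 1ℚ ≈ℝ fromℚ 0ℚ)
  b~ eq with eq 1ℚ(Q.positive⁻¹ 1ℚ)
  ... | N , bound = Q.<-irrefl P.refl(bound N N.≤-refl)
 open CommutativeRing ri
 open RingProperties ring
 open In ri using(⟦_ah;+-homo;nh;solve;_:=_)renaming(_:+_ to _al_;_:*_ to _ac_;:-_ to aC_)
 f7 : ¬(1# ≈ 0#)
 f7(re , _)= b~ re
 rw : ℚ → ℂ
 rw r = fromℚ r +i fromℚ 0ℚ
 r/ : ∀ a b → rw(a Q.+ b)≈ rw a + rw b
 r/ a b = fN a b , zF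
 r^ : ∀ a → rw(Q.- a)≈ - rw a
 r^ a = fG a , zC
 iG : ∀ z → ⟦ z ah ≈ rw(ι z)
 iG(+ n)= nI n
  where
  nI : ∀ n → ⟦ + n ah ≈ rw(ι(+ n))
  nI zero = refl
  nI(suc n)= trans(+-congˡ(nI n))(trans(sym(r/ 1ℚ(ι(+ n))))(reflexive(P.cong rw(P.sym(b>(+ 1)(+ n))))))
 iG -[1+ n ] = trans(-‿cong(iG(+ suc n)))(trans(sym(r^(ι(+ suc n))))(reflexive(P.cong rw(P.sym(nD(+ suc n))))))
 iM : ∀{z}→ z ≢ I.0ℤ → ∃ λ w → ⟦ z ah * w ≈ 1#
 iM{z}zK = rw qm , trans(*-congʳ(iG z))
  (i&(ι z)qm(Q.*-inverseʳ(ι z)), i/(ι z)qm)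
  where
  instance
   qG : Q.NonZero(ι z)
   qG = Q.≢-nonZero λ eq → zK(iL{z}{I.0ℤ}eq)
  qm = Q.1/ ι z
 nZ : ℕ → ℂ
 nZ i = ⟦ + i ah
 nA : ∀ i j → i ≢ j → ∃ λ w →(nZ i + - nZ j)* w ≈ 1#
 nA i j iT = proj₁ u , trans(*-congʳ(trans(+-congˡ(sym(nh(+ j))))(sym(+-homo(+ i)(I.- + j)))))(proj₂ u)
  where u = iM{+ i I.- + j}λ eq → iT(I.+-injective(I.i-j≡0⇒i≡j(+ i)(+ j)eq))
 open Pl ri
 module Ge = Gm ri Co.stable Co.iv nZ nA
 open Ge using(Unit;ui;ur)public
 nt : ∀{z}→ Unit z → ¬(z ≈ 0#)
 nt(w , zw)zM = f7(trans(sym zw)(trans(*-congʳ zM)(zeroˡ w)))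
 module _{d n : ℕ}where
  Av : Point d n → Point d n → ℂ → Point d n
  Av u ξ s i c = u i c + s * ξ i c
  li : Polynomial d n → Point d n → Point d n → Py
  li(const a)u ξ = a ∷ []
  li(var i c)u ξ = u i c ∷ ξ i c ∷ []
  li(f :+ g)u ξ = li f u ξ e^ li g u ξ
  li(f :* g)u ξ = li f u ξ bV li g u ξ
  ei : ∀ f u ξ s → ev(li f u ξ)s ≈ eval f(Av u ξ s)
  ei(const a)u ξ s = trans(+-congˡ(zeroʳ s))(+-identityʳ a)
  ei(var i c)u ξ s = +-congˡ(*-congˡ(trans(+-congˡ(zeroʳ s))(+-identityʳ(ξ i c))))
  ei(f :+ g)u ξ s = trans(eE(li f u ξ)(li g u ξ)s)(+-cong(ei f u ξ s)(ei g u ξ s))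
  ei(f :* g)u ξ s = trans(ej(li f u ξ)(li g u ξ)s)(*-cong(ei f u ξ s)(ei g u ξ s))
  cl : ∀ f u ξ → cf(li f u ξ)≈ eval f u
  cl(const a)u ξ = refl
  cl(var i c)u ξ = refl
  cl(f :+ g)u ξ = trans(cP(li f u ξ)(li g u ξ))(+-cong(cl f u ξ)(cl g u ξ))
  cl(f :* g)u ξ = trans(cj(li f u ξ)(li g u ξ))(*-cong(cl f u ξ)(cl g u ξ))
  ec : ∀ f{u v : Point d n}→(∀ i c → u i c ≈ v i c)→ eval f u ≈ eval f v
  ec(const a)eq = refl
  ec(var i c)eq = eq i c
  ec(f :+ g)eq = +-cong(ec f eq)(ec g eq)
  ec(f :* g)eq = *-cong(ec f eq)(ec g eq)
  cancel : ∀(q h : Polynomial d n)→ Nonvanishing h →(∀ u → eval q u * eval h u ≈ 0#)→ ∀ u → eval q u ≈ 0#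
  cancel q h(ua , ha)vn u = trans(sym(ec q end))(trans(sym(ei q ua ξ 1#))(eI ze 1#))
   where
   ξ : Point d n
   ξ i c = u i c + - ua i c
   end : ∀ i c → Av ua ξ 1# i c ≈ u i c
   end i c = trans(+-congˡ(*-identityˡ _))(trans(+-comm _ _)(trans(+-assoc _ _ _)(trans(+-congˡ(-‿inverseˡ _))(+-identityʳ _))))
   ze : Ze(li q ua ξ)
   ze = zc(li q ua ξ)(li h ua ξ){proj₁ ha}(trans(*-congʳ(cl h ua ξ))(proj₂ ha))
    (identity nZ nA(li q ua ξ bV li h ua ξ)λ s → trans(ej(li q ua ξ)(li h ua ξ)s)
     (trans(*-cong(ei q ua ξ s)(ei h ua ξ s))(vn(Av ua ξ s))))
  c* : ∀(q h : Polynomial d n)→ Nonvanishing h →(∀ u → Unit(eval h u)→ eval q u ≈ 0#)→ ∀ u → eval q u ≈ 0#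
  c* q h h0 vn = cancel q h h0 λ u → Co.stable _ _ λ q0 →
   Co.iv(eval h u)(λ hH → q0(trans(*-congˡ hH)(zeroʳ _)))λ un → q0(trans(*-congʳ(vn u un))(zeroˡ _))
  gn : ∀(f g h : Polynomial d n)→ Nonvanishing h →(∀ u → Unit(eval h u)→ eval f u ≈ eval g u)→ ∀ u → eval f u ≈ eval g u
  gn f g h h0 eq u = trans(solve 2(λ f g → f :=(f al aC g)al g)refl(eval f u)(eval g u))
   (trans(+-congʳ(trans(+-congˡ(sym(-1*x≈-x _)))(c*(f :+(const(- 1#):* g))h h0
    (λ u un → trans(+-cong(eq u un)(-1*x≈-x _))(-‿inverseʳ _))u)))(+-identityˡ _))
  nn : ∀(f g : Polynomial d n)→ Nonvanishing f → Nonvanishing g → ¬ ¬ Nonvanishing(f :* g)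
  nn f g(ua , fY)g0 nf = nt fY(cancel f g g0(λ u → Co.stable _ _ λ f% →
   Co.iv(eval(f :* g)u)f% λ un → nf(u , un))ua)
 module KG where
  Fu : ℕ → Set
  Fu m =(Fin m → ℂ)→ ℂ
  record Li{m}(L : Fu m): Set where
   field
    resp : ∀{v w}→(∀ j → v j ≈ w j)→ L v ≈ L w
    add : ∀ v w → L(λ j → v j + w j)≈ L v + L w
    tG : ∀ c v → L(λ j → c * v j)≈ c * L v
  open Li
  infixr 5 _eV_
  _eV_ : ∀{m}→ ℂ →(Fin m → ℂ)→ Fin(suc m)→ ℂ
  (x eV v)Fin.zero = x
  (x eV v)(Fin.suc j)= v j
  zn : ∀{m}→ Fin m → ℂ
  zn _ = 0#
  Dd : ∀ M(x : Fin M → ℂ)→ ¬ ¬((∀ r → x r ≈ 0#)⊎ ∃ λ r → Unit(x r))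
  Dd zero x k = k(inj₁ λ())
  Dd(suc M)x k = Dd M(x ∘ Fin.suc)λ
   {(inj₂(r , u))→ k(inj₂(Fin.suc r , u))
   ;(inj₁ zs)→ Co.iv(x Fin.zero)(λ z → k(inj₁ λ{Fin.zero → z ;(Fin.suc r)→ zs r}))λ u → k(inj₂(Fin.zero , u))}
  KH : ∀ m M → M N.< m →(L : Fin M → Fu m)→(∀ r → Li(L r))→
   ¬ ¬ ∃ λ v →(∀ r → L r v ≈ 0#)× ¬(∀ j → v j ≈ 0#)
  KH(suc m)M(N.s≤s Mm)L l& k = Dd M(λ r → L r(1# eV zn))λ
   {(inj₁ zs)→ k(1# eV zn , zs , λ vs → f7(vs Fin.zero))
   ;(inj₂(r , u))→ eP M Mm L l& r u k}
   where
   eP : ∀ M → M N.≤ m →(L : Fin M → Fu(suc m))→(∀ r → Li(L r))→ ∀ r → Unit(L r(1# eV zn))→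
    ¬ ¬ ∃ λ v →(∀ r → L r v ≈ 0#)× ¬(∀ j → v j ≈ 0#)
   eP(suc M)Mk L l& r(w , uw)k = KH m M Mk(λ q v → L(punchIn r q)(l? v))(λ q → Lm(l&(punchIn r q)))λ
    (v , zs , v*)→ k(l? v , S< v zs , λ z → v*(z ∘ Fin.suc))
    where
    x :(Fin m → ℂ)→ ℂ
    x v = -(w * L r(0# eV v))
    l? :(Fin m → ℂ)→ Fin(suc m)→ ℂ
    l? v = x v eV v
    c$ : ∀{a b}{v vb : Fin m → ℂ}→ a ≈ b →(∀ j → v j ≈ vb j)→ ∀ j →(a eV v)j ≈(b eV vb)j
    c$ p q Fin.zero = p
    c$ p q(Fin.suc j)= q j
    xD : ∀{v vb}→(∀ j → v j ≈ vb j)→ x v ≈ x vb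
    xD eq = -‿cong(*-congˡ(resp(l& r)(c$ refl eq)))
    xI : ∀ v vb → x(λ j → v j + vb j)≈ x v + x vb
    xI v vb = trans(-‿cong(*-congˡ(trans(resp(l& r)λ{Fin.zero → sym(+-identityˡ 0#);(Fin.suc j)→ refl})(add(l& r)(0# eV v)(0# eV vb)))))
     (solve 3(λ w a b → aC(w ac(a al b)):= aC(w ac a)al aC(w ac b))refl w _ _)
    xv : ∀ c v → x(λ j → c * v j)≈ c * x v
    xv c v = trans(-‿cong(*-congˡ(trans(resp(l& r)λ{Fin.zero → sym(zeroʳ c);(Fin.suc j)→ refl})(tG(l& r)c(0# eV v)))))
     (solve 3(λ w c a → aC(w ac(c ac a)):= c ac aC(w ac a))refl w c _)
    Lm : ∀{F}→ Li F → Li(F ∘ l?)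
    Lm F = record
     {resp = λ eq → resp F(c$(xD eq)eq)
     ;add = λ v vb → trans(resp F λ{Fin.zero → xI v vb ;(Fin.suc j)→ refl})(add F(l? v)(l? vb))
     ;tG = λ c v → trans(resp F λ{Fin.zero → xv c v ;(Fin.suc j)→ refl})(tG F c(l? v))}
    Pq : ∀ v → L r(l? v)≈ 0#
    Pq v = trans(resp(l& r)sJ)(trans(add(l& r)_ _)(trans(+-congʳ(tG(l& r)(x v)(1# eV zn)))
     (trans(+-congˡ(trans(sym(*-identityˡ _))(*-congʳ(sym uw))))
      (trans(solve 3(λ w a b → aC(w ac b)ac a al a ac w ac b := b ac(a ac w al aC(a ac w)))refl w(L r(1# eV zn))(L r(0# eV v)))
       (trans(*-congˡ(-‿inverseʳ _))(zeroʳ _))))))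
     where
     sJ : ∀ j → l? v j ≈ x v *(1# eV zn)j +(0# eV v)j
     sJ Fin.zero = sym(trans(+-identityʳ _)(*-identityʳ _))
     sJ(Fin.suc j)= sym(trans(+-congʳ(zeroʳ _))(+-identityˡ _))
    S< : ∀ v →(∀ q → L(punchIn r q)(l? v)≈ 0#)→ ∀ q → L q(l? v)≈ 0#
    S< v zs q with r O.≟ q
    ... | yes P.refl = Pq v
    ... | no RD = P.subst(λ q → L q(l? v)≈ 0#)(O.punchIn-punchOut RD)(zs(Fin.punchOut RD))
module De where
 open IS
 open CN
 open Ex
 open FB using(module Fm)
 open Sl
 open KF
 open KW
 open Bt
 open CL
 open import Defs using(one)
 open CommutativeRing ri
 open RingProperties ring
 open EA ri
 open SemiringExp semiring using(_^_;^-homo-*)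
 ss : ∀{d}{f g : Subset d → ℂ}→(∀ A → f A ≈ g A)→ sumSubsets f ≈ sumSubsets g
 ss{zero}eq = eq []
 ss{suc d}eq = +-cong(ss{d}(eq ∘(inside ∷_)))(ss{d}(eq ∘(outside ∷_)))
 sj : ∀ d → sumSubsets{d}(λ _ → 0#)≈ 0#
 sj zero = refl
 sj(suc d)= trans(+-cong(sj d)(sj d))(+-identityˡ 0#)
 bv : ∀{d}(u : Et d)A → bh u A ≈(- 1#)^ card A * u A
 bv u [] = sym(*-identityˡ _)
 bv u(inside ∷ A)= trans(-‿cong(bv(u ∘(inside ∷_))A))(trans(sym(-1*x≈-x _))(sym(*-assoc _ _ _)))
 bv u(outside ∷ A)= bv(u ∘(outside ∷_))A
 aL : ∀{d}(u v : Λ d)→ u Defs.∧ v ap u aI v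
 aL u v [] = *-identityˡ _
 aL{suc d}u v(outside ∷ T)= trans(+-congʳ(sj d))(trans(+-identityˡ _)(aL(u ∘(outside ∷_))(v ∘(outside ∷_))T))
 aL u v(inside ∷ T)= +-cong(aL(u ∘(inside ∷_))(v ∘(outside ∷_))T)
  (trans(ss λ A → th A)(aL(bh(u ∘(outside ∷_)))(v ∘(inside ∷_))T))
  where
  th : ∀ A →(if does(A ⊆? T)then(- 1#)^(card A N.+ inversions A(T ─ A))*(u(outside ∷ A)* v(inside ∷(T ─ A)))else 0#)
   ≈(if does(A ⊆? T)then sgn A(T ─ A)*(bh(u ∘(outside ∷_))A * v(inside ∷(T ─ A)))else 0#)
  th A with does(A ⊆? T)
  ... | false = refl
  ... | true = trans(*-congʳ(^-homo-*(- 1#)(card A)(inversions A(T ─ A))))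
   (trans(*-congʳ(*-comm _ _))(trans(*-assoc _ _ _)(*-congˡ(trans(sym(*-assoc _ _ _))(*-congʳ(sym(bv(u ∘(outside ∷_))A)))))))
 oe : ∀{d}→ one{d}ap un
 oe [] = refl
 oe(inside ∷ S)= refl
 oe(outside ∷ S)= oe S
 s* : ∀{n}(f : Fin n → ℂ)→(∀ i → f i ≈ 0#)→ Defs.sum f ≈ 0#
 s*{zero}f z = refl
 s*{suc n}f z = trans(+-cong(z Fin.zero)(s*(f ∘ Fin.suc)(z ∘ Fin.suc)))(+-identityˡ 0#)
 vv : ∀{d}(x : Fin d → ℂ)→ vector x ap vf x
 vv x [] = refl
 vv x(inside ∷ S)= trans(+-cong(*-congˡ(oe S))(s*(λ i → x(Fin.suc i)* 0#)λ i → zeroʳ _))(+-identityʳ _)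
 vv x(outside ∷ S)= trans(+-congʳ(zeroʳ _))(trans(+-identityˡ _)(vv(x ∘ Fin.suc)S))
 vH : ∀{d}(u : Λ d)x → u Defs.∧ vector x ap u af x
 vH u x = tr(aL u(vector x))(co(ra{u = u})(vv x))
 Dg : ∀{d}→ ℕ → ℕ → Et d → Set
 Dg e p u = ∀ S → e N.+ card S ≢ p → u S ≈ 0#
 dx : ∀{d e f p q}{u v : Et d}→ Dg e p u → Dg f q v → Dg(e N.+ f)(p N.+ q)(u aI v)
 dx{e = e}{f}{p}{q}{u}{v}du dv [] Pc with e N.≟ p
 ... | no Em = trans(*-congʳ(du [] λ eq → Em(P.trans(P.sym(N.+-identityʳ e))eq)))(zeroˡ _)
 ... | yes P.refl = trans(*-congˡ(dv [] λ eq → Pc(P.trans(N.+-identityʳ(e N.+ f))(P.cong(e N.+_)(P.trans(P.sym(N.+-identityʳ f))eq)))))(zeroʳ _)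
 dx{e = e}{f}{p}{q}{u}{v}du dv(outside ∷ S)Pc = dx{e = e}{f}(du ∘(outside ∷_))(dv ∘(outside ∷_))S Pc
 dx{e = e}{f}{p}{q}{u}{v}du dv(inside ∷ S)Pc = trans(+-cong
  (dx{e = suc e}{f}{p}{q}(λ A Pv → du(inside ∷ A)(Pv ∘ P.trans(P.sym(N.+-suc e(card A)))))(dv ∘(outside ∷_))S
   (Pc ∘ P.trans(N.+-suc(e N.+ f)(card S))))
  (dx{e = e}{suc f}{p}{q}(λ A Pv → trans(bv(u ∘(outside ∷_))A)(trans(*-congˡ(du(outside ∷ A)Pv))(zeroʳ _)))
   (λ A qJ → dv(inside ∷ A)(qJ ∘ P.trans(P.sym(N.+-suc f(card A)))))S
   (Pc ∘ P.trans(P.trans(N.+-suc(e N.+ f)(card S))(P.cong(N._+ card S)(P.sym(N.+-suc e f)))))))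
  (+-identityˡ 0#)
 dz : ∀{d}→ Dg{d}0 0 un
 dz [] gS = ⊥-elim(gS P.refl)
 dz(inside ∷ S)_ = refl
 dz(outside ∷ S)≢ = dz S ≢
 uy : ∀ d → un{d}empty ≈ 1#
 uy zero = refl
 uy(suc d)= uy d
 dL : ∀{d}(x : Fin d → ℂ)→ Dg 0 1(vf x)
 dL x [] _ = refl
 dL x(inside ∷ S)≢ = trans(*-congˡ(dz S(≢ ∘ P.cong suc)))(zeroʳ _)
 dL x(outside ∷ S)≢ = dL(x ∘ Fin.suc)S ≢
 dU : ∀{d}{u : Et d}→ Dg 0 1 u → u ap vf(λ i → u ⁅ i ⁆)
 dU{u = u}du [] = du [] λ()
 dU{suc d}{u = u}du(inside ∷ S)= hC S
  where
  hC : ∀ S → u(inside ∷ S)≈ u(inside ∷ empty)* un S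
  hC S with S f& empty
   where
   open import Data.Vec.Properties using(≡-dec)
   open import Data.Bool.Properties using(_≟_)
   _f&_ = ≡-dec _≟_
  ... | yes P.refl = sym(trans(*-congˡ(uy d))(*-identityʳ(u(inside ∷ empty))))
  ... | no gT = trans(du(inside ∷ S)(λ eq → gT(ek S(N.suc-injective eq))))(sym(trans(*-congˡ(dz S(gT ∘ ek S)))(zeroʳ _)))
   where
   ek : ∀{d}(S : Subset d)→ card S ≡ 0 → S ≡ empty
   ek [] _ = P.refl
   ek(outside ∷ S)eq = P.cong(outside ∷_)(ek S eq)
 dU{u = u}du(outside ∷ S)= dU{u = u ∘(outside ∷_)}(du ∘(outside ∷_))S
 vM : ∀{d}(S : Subset d)→ card S ≢ d → vol S ≈ 0#
 vM [] ≢ = ⊥-elim(≢ P.refl)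
 vM(inside ∷ S)≢ = vM S(≢ ∘ P.cong suc)
 vM(outside ∷ S)≢ = refl
 vO : ∀ d → vol{d}full ≡ 1#
 vO zero = P.refl
 vO(suc d)= vO d
 t6 : ∀{d}{u : Et d}→ Dg 0 d u → top u ≈ 1# → u ap vol
 t6{d}{u}du t~ S with card S N.≟ d
 ... | no DJ = trans(du S DJ)(sym(vM S DJ))
 ... | yes DO = P.subst(λ S → u S ≈ vol S)(P.sym(∣p∣≡n⇒p≡⊤ DO))(trans t~(reflexive(P.sym(vO d))))
 uV : ∀{d}→ Fin d → Fin d → ℂ
 uV Fin.zero Fin.zero = 1#
 uV Fin.zero(Fin.suc j)= 0#
 uV(Fin.suc i)Fin.zero = 0#
 uV(Fin.suc i)(Fin.suc j)= uV i j
 vG : ∀ d → vf{d}(λ _ → 0#)ap aN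
 vG d [] = refl
 vG d(inside ∷ S)= zeroˡ _
 vG(suc d)(outside ∷ S)= vG d S
 tA : ∀{d}(S : Subset d)→ suc(card S)≡ d → ∃ λ i → ∃ λ ε → ε * ε ≈ 1# × ∀ u → top(u af uV i)≈ ε * u S
 tA(outside ∷ S)eq = Fin.zero ,(- 1#)^ card S , Sj(card S), λ u → P.subst
  (λ T → top(u af uV Fin.zero)≈(- 1#)^ card T * u(outside ∷ T))(P.sym(∣p∣≡n⇒p≡⊤(N.suc-injective eq)))(
  trans(+-cong(trans(co(ra{u = u ∘(inside ∷_)})(vG _)full)(zg(u ∘(inside ∷_))full))
   (trans(co(ra{u = bh(u ∘(outside ∷_))})(λ S → *-identityˡ(un S))full)(ie(bh(u ∘(outside ∷_)))full)))
   (trans(+-identityˡ _)(bv(u ∘(outside ∷_))full)))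
  where
  Sj : ∀ n →(- 1#)^ n *(- 1#)^ n ≈ 1#
  Sj zero = *-identityˡ 1#
  Sj(suc n)= trans(sl.solve 2(λ a x → a :* x :*(a :* x):=(a :* a):*(x :* x))refl(- 1#)((- 1#)^ n))
   (trans(*-cong(trans(-1*x≈-x(- 1#))(-‿involutive 1#))(Sj n))(*-identityˡ 1#))
   where
   module sl = In ri
   open sl
 tA(inside ∷ S)eq with i , ε , f/ , RI ← tA S(N.suc-injective eq)= Fin.suc i , ε , f/ , λ u →
  trans(+-cong(RI(u ∘(inside ∷_)))(trans(co(ra{u = bh(u ∘(outside ∷_))})(λ S → zeroˡ(un S))full)(zg(bh(u ∘(outside ∷_)))full)))
   (+-identityʳ _)
 module Fg(d : ℕ)(dd : 2 N.≤ d)where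
  open Fm ri d
  crossing : ∀{k U W c}→ RelativePosition k U W → CrossingValue k U W c → Cr k U W c
  crossing{k}{U}{W}(same , _)(y , nw , value)= same , y , tr nw(vH(U(k ∸ 1))y), tr(sy(vH(U k)y))value
  fj : ∀{G}→ IsDecoratedFlag G → ¬ ¬ ∃ λ g → de g ≈ 1# × Re g G
  fj{G}fR = ¬¬-map(λ(y , Gv)→ g y , proj₁(Cp y Gv), proj₂(Cp y Gv))l8
   where
   open IsDecoratedFlag fR renaming(top to f8)
   Sk : ∀ k → Dec(suc k N.< d)→ 1 N.≤ k →(Fin d → ℂ)→ Fin d → ℂ
   Sk k(yes kh)kk y = proj₁(step k kk kh)
   Sk k(no _)kk y = y
   g :(Fin d → ℂ)→ Fe
   g y zero = y
   g y(suc zero)i = G 1 ⁅ i ⁆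
   g y(suc(suc k))= Sk(suc k)(suc(suc k)N.<? d)(N.s≤s N.z≤n)y
   b? : ∀ y k → suc(suc k)N.< d →(K/ : Dec(suc(suc k)N.< d))→ G(suc k)ap we(g y)(suc k)→
    G(suc(suc k))ap we(g y)(suc k)af Sk(suc k)K/(N.s≤s N.z≤n)y
   b? y k kh(no Kt)_ = ⊥-elim(Kt kh)
   b? y k _(yes kh)l< = tr(proj₂(step(suc k)(N.s≤s N.z≤n)kh))(tr(vH(G(suc k))_)(cn l<))
   l* : ∀ y k → k N.< d → G k ap we(g y)k
   l* y zero _ = tr bottom oe
   l* y(suc zero)DK = tr(dU{u = G 1}(degree 1 N.≤-refl DK))(sy(iy _))
   l* y(suc(suc k))kh = b? y k kh(suc(suc k)N.<? d)(l* y(suc k)(N.<⇒≤ kh))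
   Df = d ∸ 1
   d/ : suc Df ≡ d
   d/ = N.m+[n∸m]≡n(N.≤-trans(N.s≤s N.z≤n)dd)
   d9 : Df N.< d
   d9 = N.≤-reflexive d/
   dN : 1 N.≤ Df
   dN = N.∸-monoˡ-≤ 1 dd
   l8 : ¬ ¬ ∃ λ y → G Df af y ap vol
   l8 k = nonzero Df dN d9 λ S → Co.stable _ _ λ G0 → gU S G0
    where
    gU : ∀ S → ¬ ¬(G Df S ≈ 0#)
    gU S G0 with card S N.≟ Df
    ... | no ≢ = G0(degree Df dN d9 S ≢)
    ... | yes cS with i , ε , f/ , RI ← tA S(P.trans(P.cong suc cS)d/)= Co.iv(G Df S)G0 λ(w , Gh)→
     k((λ c → ε * w * uV i c), t6(λ T ≢ → dx{e = 0}{0}{Df}{1}(degree Df dN d9)(dL(λ c → ε * w * uV i c))T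
      (≢ ∘ λ eq → P.trans eq(P.trans(N.+-comm Df 1)d/)))
      (trans(aE(G Df)(ε * w)(uV i)full)(trans(*-congˡ(RI(G Df)))
       (trans(sl.solve 4(λ e w f g → e sl.:* w sl.:*(f sl.:* g)sl.:=(e sl.:* f)sl.:*(g sl.:* w))refl ε w ε(G Df S))
        (trans(*-cong f/ Gh)(*-identityˡ 1#))))))
     where module sl = In ri
   Cp : ∀ y → G Df af y ap vol → de(g y)≈ 1# × Re(g y)G
   Cp y Gv = trans(sym(proj₂ wI full))(reflexive(vO d)), rp
    where
    l> : g y(suc Df)≡ y
    l> = go Df dN(N.≤⇒≯(N.≤-reflexive(P.sym d/)))
     where
     go : ∀ k → 1 N.≤ k → ¬ suc k N.< d → g y(suc k)≡ y
     go(suc k)_ Kt with suc(suc k)N.<? d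
     ... | yes kh = ⊥-elim(Kt kh)
     ... | no _ = P.refl
    wI :(G d ap vol)×(vol ap we(g y)d)
    wI = f8 , tr(sy Gv)(tr(cg(l* y Df d9)(λ c → reflexive(P.cong(λ v → v c)(P.sym l>))))
     (λ S → reflexive(P.cong(λ k → we(g y)k S)d/)))
    rp : Re(g y)G
    rp k kd with k N.≟ d
    ... | yes P.refl = tr(proj₁ wI)(proj₂ wI)
    ... | no KD = l* y k(N.≤∧≢⇒< kd KD)
 module Fi(d : ℕ)(dd : 2 N.≤ d){S : Set}(aO : FF ri S){N : ℕ}(c ca : S → Fin N → ℂ)(c1 : ∀ s γ → c s γ * ca s γ ≈ 1#)where
  open Fg d dd
  open WP ri d aO c ca c1
  open Bo ri Co.stable d aO c ca c1 using(vu;ea)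
  open Fm ri d
  open La Cs
  fs : ∀{β}(γs : Weights β)(U : S → Fl)Gs →(∀ s → SliceDecoration(c s)γs(U s)(ea s Gs))→ Slice γs U Gs
  fs [] U [] dec = tt
  fs(a ∷ γs)U(W ∷ Gs)dec = record
   {crossing = λ s → crossing{U = U s}{W = W s}(proj₁(proj₂(dec s)))(proj₁(proj₂(proj₂(dec s))))
   ;ta = vu a ;t1 = vl a}, fs γs W Gs λ s → proj₂(proj₂(proj₂(dec s)))
  fn : ∀{β ae}(m : Move β ae)→(S → NewFlags d m)→ NL(S → Fl)m
  fn trivalent nw = tt
  fn(4-valent _)nw = nw
  fn(6-valent _)nw = proj₁ ∘ nw , proj₂ ∘ nw
  fn(skip m)nw = fn m nw
  rE : ∀{β ae}(m : Move β ae)(nw : S → NewFlags d m)(Gs : Ll(S → Fl)β)s →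
   moveRegions m(nw s)(ea s Gs)≡ ea s(rb m(fn m nw)Gs)
  rE trivalent nw(_ ∷ _ ∷ Gs)s = P.refl
  rE(4-valent _)nw(_ ∷ _ ∷ Gs)s = P.refl
  rE(6-valent _)nw(_ ∷ _ ∷ _ ∷ Gs)s = P.refl
  rE(skip m)nw(W ∷ Gs)s = P.cong(W s ∷_)(rE m nw Gs s)
  family : ∀{β ae}(w : Weave β ae)v(γs : Weights β)(U : S → Fl)Gs →(∀ s → Decoration(c s)w v γs(U s)(ea s Gs))→ Lb w v γs U Gs
  family [] v γs U Gs dec = fs γs U Gs dec
  family(m ∷ w)v γs U Gs dec = fs γs U Gs(proj₁ ∘ dec), fn m nw ,
   family w(v N.+ moveTrivalents m)(moveWeights m v γs)U(rb m(fn m nw)Gs)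
    λ s → P.subst(Decoration(c s)w(v N.+ moveTrivalents m)(moveWeights m v γs)(U s))(rE m nw Gs s)(proj₂(proj₂(dec s)))
   where
   nw : S → NewFlags d m
   nw s = proj₁(proj₂(dec s))
  Sm : ∀{β}{Δ : Fin N → ℂ}(γs : Weights β){U}Gs → SliceDecoration{d}Δ γs U Gs → IsDecoratedFlag U
  Sm [] [] s = s
  Sm(_ ∷ _)(_ ∷ _)(f , _)= f
  fm : ∀{β}(γs : Weights β)(U : S → Fl)Gs →(∀ s → SliceDecoration(c s)γs(U s)(ea s Gs))→
   La.Slice(λ k a U W → ∀ s → IsDecoratedFlag(U s))γs U Gs
  fm [] U [] dec = tt
  fm(a ∷ γs)U(W ∷ Gs)dec = proj₁ ∘ dec , fm γs W Gs λ s → proj₂(proj₂(proj₂(dec s)))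
  te : ∀{β ae}(w : Weave β ae){Δ : Fin N → ℂ}{v γs U Gs}→ Decoration Δ w v γs U Gs → SliceDecoration{d}Δ γs U Gs
  te [] s = s
  te(m ∷ w)(s , _)= s
module RF where
 open IS
 open CN
 open Ex
 open KF
 open Gd using(Level;module a9)
 open CL
 open De
 open import Defs using(sign;_:+_;_:*_;one;least)
 open CommutativeRing ri
 open RingProperties ring
 open EA ri
 open SemiringExp semiring using(_^_;^-homo-*)
 module e< = CommutativeMonoidSum *-commutativeMonoid
 pR : ∀ d n → FR ri(Point d n)
 pR d n = record
  {Known = λ f → ∃ λ(P : Polynomial d n)→ ∀ u → eval P u ≈ f u
  ;kr = λ fw(P , eq)→ P , λ u → trans(eq u)(fw u)
  ;kn = λ c → const c , λ u → refl
  ;k2 = λ(P , p)(Q , q)→ P :+ Q , λ u → +-cong(p u)(q u)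
  ;ko = λ(P , p)(Q , q)→ P :* Q , λ u → *-cong(p u)(q u)
  }
 module EC{S : Set}(aO : FR ri S)where
  open FR aO
  open Closure ri aO using(Kn;Ka)
  kS : ∀{d}{f : S → Subset d → ℂ}→(∀ A → Known(λ s → f s A))→ Known(λ s → sumSubsets(f s))
  kS{zero}kf = kf []
  kS{suc d}kf = k2(kS{d}(kf ∘(inside ∷_)))(kS{d}(kf ∘(outside ∷_)))
   where import Data.Vec.Base
  Kg : ∀ b{f : S → ℂ}→ Known f → Known(λ s → if b then f s else 0#)
  Kg true kf = kf
  Kg false kf = kn 0#
  Km : ∀{d}{u v : S → Λ d}→ Kn u → Kn v → Kn(λ s → u s Defs.∧ v s)
  Km ku kv T = kS λ A → Kg(does(A ⊆? T))(ko(kn(sgn A(T ─ A)))(ko(ku A)(kv(T ─ A))))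
  Ky : ∀{d}q{u v : S → Λ d}→ Kn u → Kn v → Kn(λ s → cap q(u s)(v s))
  Ky{d}q ku kv T = kS λ A → Kg(does((A ⊆? ∁ T)×-dec(card A N.+ q N.≟ d)))
   (ko(kn(sgn A T))(ko(ku(A ∪ T))(Km(λ S → kn(basis A S))kv full)))
  k' : ∀{n}{f : S → Fin n → ℂ}→(∀ i → Known(λ s → f s i))→ Known(λ s → Defs.sum(f s))
  k'{zero}kf = kn 0#
  k'{suc n}kf = k2(kf Fin.zero)(k'{n}(kf ∘ Fin.suc))
  Kh : ∀{d}{x : S → Fin d → ℂ}→ Ka x → Kn(vector ∘ x)
  Kh kx T = k' λ i → ko(kx i)(kn(basis ⁅ i ⁆ T))
  k& : ∀{d}{x : S → Fin d → ℂ}→ Ka x → Kn(covector ∘ x)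
  k& kx T = k' λ i → ko(kx i)(kn(sgn ⁅ i ⁆(∁ ⁅ i ⁆)* basis(∁ ⁅ i ⁆)T))
  KE : ∀{d}→(S → ℕ × Λ d)→ Set
  KE e = ∃ λ p →(∀ s → proj₁(e s)≡ p)× Kn(proj₂ ∘ e)
  Kz : ∀{d}{e f : S → ℕ × Λ d}→ KE e → KE f → KE(λ s → e s ⋎ f s)
  Kz{d}{e}{f}(p , pe , ke)(q , qf , kf)= bY(p N.+ q N.≤? d)
   where
   degree : ∀ s → proj₁(e s)N.+ proj₁(f s)≡ p N.+ q
   degree s = P.cong₂ N._+_(pe s)(qf s)
   bA : p N.+ q N.≤ d → ∀ s → e s ⋎ f s ≡(proj₁(e s)N.+ proj₁(f s), proj₂(e s)Defs.∧ proj₂(f s))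
   bA le s = P.cong(λ b → if b then(proj₁(e s)N.+ proj₁(f s), proj₂(e s)Defs.∧ proj₂(f s))else(proj₁(e s)N.+ proj₁(f s)∸ d , cap(proj₁(f s))(proj₂(e s))(proj₂(f s))))
    (dec-true(proj₁(e s)N.+ proj₁(f s)N.≤? d)(P.subst(N._≤ d)(P.sym(degree s))le))
   aJ : ¬ p N.+ q N.≤ d → ∀ s → e s ⋎ f s ≡(proj₁(e s)N.+ proj₁(f s)∸ d , cap(proj₁(f s))(proj₂(e s))(proj₂(f s)))
   aJ n! s = P.cong(λ b → if b then(proj₁(e s)N.+ proj₁(f s), proj₂(e s)Defs.∧ proj₂(f s))else(proj₁(e s)N.+ proj₁(f s)∸ d , cap(proj₁(f s))(proj₂(e s))(proj₂(f s))))
    (dec-false(proj₁(e s)N.+ proj₁(f s)N.≤? d)(n! ∘ P.subst(N._≤ d)(degree s)))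
   bY : Dec(p N.+ q N.≤ d)→ KE(λ s → e s ⋎ f s)
   bY(yes le)= p N.+ q ,(λ s → P.trans(P.cong proj₁(bA le s))(degree s)),
    λ T → kr(λ s → reflexive(P.cong(λ x → proj₂ x T)(P.sym(bA le s))))(Km ke kf T)
   bY(no n!)= p N.+ q ∸ d ,(λ s → P.trans(P.cong proj₁(aJ n! s))(P.cong(_∸ d)(degree s))),
    λ T → kr(λ s → reflexive(P.trans(P.cong(λ q → cap q(proj₂(e s))(proj₂(f s))T)(P.sym(qf s)))(P.cong(λ x → proj₂ x T)(P.sym(aJ n! s)))))
     (Ky q ke kf T)
 module _{d n : ℕ}{σ : Signature n}(am : Admissible d σ)where
  private instance
   n≢0 : N.NonZero n
   n≢0 = N.>-nonZero(N.≤-trans(N.s≤s N.z≤n)(size σ))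
  rd : ℤ → Fin n
  rd j = fromℕ<(I.n%ℕd<d j n)
  eb : ∀{u j}→ sign σ j ≡ Sign.+ → element am u j ≡(1 , vector(component am u j))
  eb{u}{j}eq with sign σ j
  eb P.refl | .Sign.+ = P.refl
  el : ∀{u j}→ sign σ j ≡ Sign.- → element am u j ≡(d ∸ 1 , covector(component am u j))
  el{u}{j}eq with sign σ j
  el P.refl | .Sign.- = P.refl
  cW : ∀ j → sign σ j ≡ Sign.+ ⊎ sign σ j ≡ Sign.-
  cW j with sign σ j
  ... | Sign.+ = inj₁ P.refl
  ... | Sign.- = inj₂ P.refl
  lV : ∀{u j k}(kh : suc k N.< d)→ 𝓕 am u j(suc k)≡ proj₂(mixedProduct am u j(firstHit am j(suc k)kh))
  lV{u}{j}{k}kh with suc k N.<? d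
  ... | yes K6 = P.cong(λ p → proj₂(mixedProduct am u j(firstHit am j(suc k)p)))(N.<-irrelevant K6 kh)
  ... | no Kt = ⊥-elim(Kt kh)
  tH : ∀{u j k}→ 1 N.≤ k → d N.≤ k → 𝓕 am u j k ≡ vol
  tH{u}{j}{suc k}_ d~ with suc k N.<? d
  ... | yes kh = ⊥-elim(N.<⇒≱ kh d~)
  ... | no _ = P.refl
  module _ where
   open FR(pR d n)
   open Closure ri(pR d n)using(Kn)
   open EC(pR d n)
   pE : ∀ j → KE(λ u → element am u j)
   pE j with cW j
   ... | inj₁ bl = 1 ,(λ u → P.cong proj₁(eb{u}{j}bl)), λ T → kr
    (λ u → reflexive(P.cong(λ e → proj₂ e T)(P.sym(eb{u}{j}bl))))(Kh{x = λ u → component am u j}(λ c → var(rd j)c , λ u → refl)T)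
   ... | inj₂ wh = d ∸ 1 ,(λ u → P.cong proj₁(el{u}{j}wh)), λ T → kr
    (λ u → reflexive(P.cong(λ e → proj₂ e T)(P.sym(el{u}{j}wh))))(k&{x = λ u → component am u j}(λ c → var(rd j)c , λ u → refl)T)
   pl : ∀ j m → KE(λ u → mixedProduct am u j m)
   pl j zero = pE j
   pl j(suc m)= Kz(pE j)(pl(j I.+ + 1)m)
   pC : ∀ j k → Kn(λ u → 𝓕 am u j k)
   pC j zero T = kn(one T)
   pC j(suc k)T = b5(suc k N.<? d)
    where
    b5 : Dec(suc k N.< d)→ Known(λ u → 𝓕 am u j(suc k)T)
    b5(yes kh)= kr(λ u → reflexive(P.cong(λ x → x T)(P.sym(lV{u}{j}{k}kh))))
     (proj₂(proj₂(pl j(firstHit am j(suc k)kh)))T)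
    b5(no Kt)= kr(λ u → reflexive(P.cong(λ x → x T)(P.sym(tH{u}{j}{suc k}(N.s≤s N.z≤n)(N.≮⇒≥ Kt)))))(kn(vol T))
  ib : ∀{u j k i}→ sign σ j ≡ Sign.+ → k N.≤ i → intermediate am u j k i ≡ 𝓕 am u j i
  ib{u}{j}{k}{i}eq KJ with sign σ j
  ib{u}{j}{k}{i}P.refl KJ | .Sign.+ rewrite dec-true(k N.≤? i)KJ = P.refl
  ir : ∀{u j k i}→ sign σ j ≡ Sign.+ → ¬ k N.≤ i → intermediate am u j k i ≡ 𝓕 am u(j I.+ + 1)i
  ir{u}{j}{k}{i}eq KK with sign σ j
  ir{u}{j}{k}{i}P.refl KK | .Sign.+ rewrite dec-false(k N.≤? i)KK = P.refl
  iw : ∀{u j k i}→ sign σ j ≡ Sign.- → i N.≤ d ∸ k → intermediate am u j k i ≡ 𝓕 am u j i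
  iw{u}{j}{k}{i}eq Ib with sign σ j
  iw{u}{j}{k}{i}P.refl Ib | .Sign.- rewrite dec-true(i N.≤? d ∸ k)Ib = P.refl
  ia : ∀{u j k i}→ sign σ j ≡ Sign.- → ¬ i N.≤ d ∸ k → intermediate am u j k i ≡ 𝓕 am u(j I.+ + 1)i
  ia{u}{j}{k}{i}eq If with sign σ j
  ia{u}{j}{k}{i}P.refl If | .Sign.- rewrite dec-false(i N.≤? d ∸ k)If = P.refl
  iq : ∀ j k i →(∀ u → intermediate am u j k i ≡ 𝓕 am u j i)⊎(∀ u → intermediate am u j k i ≡ 𝓕 am u(j I.+ + 1)i)
  iq j k i with cW j
  ... | inj₁ bl with k N.≤? i
  ... | yes KJ = inj₁ λ u → ib{u}bl KJ
  ... | no KK = inj₂ λ u → ir{u}bl KK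
  iq j k i | inj₂ wh with i N.≤? d ∸ k
  ... | yes Ib = inj₁ λ u → iw{u}{k = k}wh Ib
  ... | no If = inj₂ λ u → ia{u}{k = k}wh If
  ig : 1 N.≤ d → ∀ u j i → intermediate am u j 1 i ≡ 𝓕 am u j i
  ig df u j i with cW j
  ig df u j zero | inj₁ bl = ir{u}{k = 1}bl λ()
  ig df u j(suc i)| inj₁ bl = ib{u}{k = 1}bl(N.s≤s N.z≤n)
  ... | inj₂ wh with i N.≤? d ∸ 1
  ... | yes Ib = iw{u}{k = 1}wh Ib
  ... | no If = P.trans(ia{u}{k = 1}wh If)
   (P.trans(tH{u}{j I.+ + 1}(N.≤-trans df dV)dV)(P.sym(tH{u}{j}(N.≤-trans df dV)dV)))
   where
   dV : d N.≤ i
   dV = N.≤-trans(N.m≤n+m∸n d 1)(N.≰⇒> If)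
  iA : 1 N.≤ d → ∀ u j i → intermediate am u j d i ≡ 𝓕 am u(j I.+ + 1)i
  iA df u j i with cW j
  ... | inj₁ bl with d N.≤? i
  ... | yes dV = P.trans(ib{u}bl dV)(P.trans(tH{u}{j}(N.≤-trans df dV)dV)(P.sym(tH{u}{j I.+ + 1}(N.≤-trans df dV)dV)))
  ... | no DL = ir{u}bl DL
  iA df u j zero | inj₂ wh = iw{u}{k = d}wh N.z≤n
  iA df u j(suc i)| inj₂ wh = ia{u}{k = d}wh λ Ib → N.<⇒≱(N.s≤s(N.z≤n{i}))(P.subst(suc i N.≤_)(N.n∸n≡0 d)Ib)
  lC : ∀{P : ℕ → Set}(P? : ∀ m → Dec(P m))b → P 0 → least P? b ≡ 0
  lC P? zero p = P.refl
  lC P?(suc b)p rewrite dec-true(P? 0)p = P.refl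
  lA : ∀{P Q : ℕ → Set}(P? : ∀ m → Dec(P m))(Q? : ∀ m → Dec(Q m))b c →(∀{m}→ P m → Q m)→(∀{m}→ Q m → P m)→ P b → Q c → least P? b ≡ least Q? c
  lA P? Q? zero c to fP p q = P.sym(lC Q? c(to p))
  lA P? Q?(suc b)zero to fP p q = lC P?(suc b)(fP q)
  lA P? Q?(suc b)(suc c)to fP p q with P? 0 | Q? 0
  ... | yes _ | yes _ = P.refl
  ... | yes PE | no qE = ⊥-elim(qE(to PE))
  ... | no Pw | yes qK = ⊥-elim(Pw(fP qK))
  ... | no _ | no _ = P.cong suc(lA(P? ∘ suc)(Q? ∘ suc)b c to fP p q)
  b6 : 1 N.< d → ∀{u j}→ sign σ j ≡ Sign.+ → 𝓕 am u j 1 ≡ vector(component am u j)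
  b6 DK{u}{j}bl = P.trans(lV{u}{j}DK)(P.trans(P.cong(λ m → proj₂(mixedProduct am u j m))hJ)(P.cong proj₂(eb{u}bl)))
   where
   hJ : firstHit am j 1 DK ≡ 0
   hJ = lC _(proj₁(hits am j 1 DK))(P.subst(λ s → d N.∣ I.∣(s ◃ 1)I.- + 1 ∣)(P.sym bl)(d N.∣0))
  wK : ∀{k}→ suc(suc k)≡ d → ∀{u j}→ sign σ j ≡ Sign.- → 𝓕 am u j(suc k)≡ covector(component am u j)
  wK{k}P.refl{u}{j}wh = P.trans(lV{u}{j}N.≤-refl)(P.trans(P.cong(λ m → proj₂(mixedProduct am u j m))hJ)(P.cong proj₂(el{u}wh)))
   where
   hJ : firstHit am j(suc k)N.≤-refl ≡ 0
   hJ = lC _(proj₁(hits am j(suc k)N.≤-refl))(P.subst(λ s → d N.∣ I.∣(s ◃ 1)I.- + suc k ∣)(P.sym wh)N.∣-refl)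
  ru : ∀ a → rd(+ a I.+ + n)≡ rd(+ a)
  ru a = O.fromℕ<-cong _ _(N.[m+n]%n≡m%n a n)_ _
  b% : ∀ j a b → j I.+ a I.+ b ≡ j I.+ b I.+ a
  b% j a b = P.trans(I.+-assoc j a b)(P.trans(P.cong(λ c → j I.+ c)(I.+-comm a b))(P.sym(I.+-assoc j b a)))
  pS : ∀ j m → partialSum σ(j I.+ + n)m ≡ partialSum σ j m
  pS j zero = P.cong(_◃ 1)(periodic σ j)
  pS j(suc m)= P.cong₂ I._+_(pS j m)
   (P.cong(_◃ 1)(P.trans(P.cong(sign σ)(b% j(+ n)(+ suc m)))(periodic σ(j I.+ + suc m))))
  eo : ∀ u a → element am u(+ a I.+ + n)≡ element am u(+ a)
  eo u a with cW(+ a)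
  ... | inj₁ bl = P.trans(eb{u}(P.trans(periodic σ(+ a))bl))(P.trans(P.cong(λ i → 1 , vector(u i))(ru a))(P.sym(eb{u}bl)))
  ... | inj₂ wh = P.trans(el{u}(P.trans(periodic σ(+ a))wh))(P.trans(P.cong(λ i → d ∸ 1 , covector(u i))(ru a))(P.sym(el{u}wh)))
  mx : ∀ u a m → mixedProduct am u(+ a I.+ + n)m ≡ mixedProduct am u(+ a)m
  mx u a zero = eo u a
  mx u a(suc m)= P.cong₂ _⋎_(eo u a)
   (P.trans(P.cong(λ j → mixedProduct am u j m)(b%(+ a)(+ n)(+ 1)))(mx u(a N.+ 1)m))
  fH : ∀ j k kh → firstHit am(j I.+ + n)k kh ≡ firstHit am j k kh
  fH j k kh = lA _ _(proj₁(hits am(j I.+ + n)k kh))(proj₁(hits am j k kh))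
   (λ{m}→ P.subst(λ s → d N.∣ I.∣ s I.- + k ∣)(pS j m))(λ{m}→ P.subst(λ s → d N.∣ I.∣ s I.- + k ∣)(P.sym(pS j m)))
   (proj₂(hits am(j I.+ + n)k kh))(proj₂(hits am j k kh))
  pO : ∀ u a k → 𝓕 am u(+ a I.+ + n)k ≡ 𝓕 am u(+ a)k
  pO u a zero = P.refl
  pO u a(suc k)with suc k N.<? d
  ... | yes kh = P.trans(P.cong(λ m → proj₂(mixedProduct am u(+ a I.+ + n)m))(fH(+ a)(suc k)kh))(P.cong proj₂(mx u a(firstHit am(+ a)(suc k)kh)))
  ... | no _ = P.refl
module Tr where
 open IS
 open CN
 open Ex
 open To using(module TW)
 open Gd using(Level)
 open CL
 open De
 open RF
 open import Defs using(sign;_:+_;_:*_;det;value;inverse;product)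
 open CommutativeRing ri
 open RingProperties ring
 open EA ri
 open SemiringExp semiring using(_^_;^-homo-*;^-congˡ)
 open In ri using(solve;_:=_)renaming(_:+_ to _al_;_:*_ to _ac_;:-_ to aC_)
 sZ : ∀{d}c(f : Subset d → ℂ)→ sumSubsets(λ A → c * f A)≈ c * sumSubsets f
 sZ{zero}c f = refl
 sZ{suc d}c f = trans(+-cong(sZ{d}c(f ∘(inside ∷_)))(sZ{d}c(f ∘(outside ∷_))))(sym(distribˡ c _ _))
  where open import Data.Vec.Base using(_∷_)
 SR : ∀{d}a b{u v uc vb : Λ d}→ uc ap a aX u → vb ap b aX v → uc Defs.∧ vb ap(a * b)aX(u Defs.∧ v)
 SR{d}a b{u}{v}{uc}{vb}pu pv T = trans(aL uc vb T)(trans(co pu pv T)(trans(ak a u(b aX v)T)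
  (trans(*-congˡ(trans(ay b u v T)(*-congˡ(sym(aL u v T)))))(sym(*-assoc _ _ _)))))
 S6 : ∀ e c{x y}→ x ≈ c * y →(if e then x else 0#)≈ c *(if e then y else 0#)
 S6 true c eq = eq
 S6 false c eq = sym(zeroʳ c)
 Cq : ∀{d}q a b{u v uc vb : Λ d}→ uc ap a aX u → vb ap b aX v → cap q uc vb ap(a * b)aX cap q u v
 Cq{d}q a b{u}{v}{uc}{vb}pu pv T = trans(ss th)
  (sZ(a * b)(λ A → if does((A ⊆? ∁ T)×-dec(card A N.+ q N.≟ d))then sgn A T *(u(A ∪ T)* det(basis A Defs.∧ v))else 0#))
  where
  th : ∀ A →(if does((A ⊆? ∁ T)×-dec(card A N.+ q N.≟ d))then sgn A T *(uc(A ∪ T)* det(basis A Defs.∧ vb))else 0#)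
   ≈(a * b)*(if does((A ⊆? ∁ T)×-dec(card A N.+ q N.≟ d))then sgn A T *(u(A ∪ T)* det(basis A Defs.∧ v))else 0#)
  th A = S6(does((A ⊆? ∁ T)×-dec(card A N.+ q N.≟ d)))(a * b)(trans(*-congˡ{sgn A T}(*-cong(pu(A ∪ T))(trans(SR 1# b{basis A}{v}{basis A}{vb}(λ S → sym(*-identityˡ(basis A S)))pv full)(*-congʳ{det(basis A Defs.∧ v)}(*-identityˡ b)))))
   (solve 5(λ s a x b y → s ac(a ac x ac(b ac y)):= a ac b ac(s ac(x ac y)))refl(sgn A T)a(u(A ∪ T))b(det(basis A Defs.∧ v))))
 Sc : ∀{d}→ ℂ → ℕ × Λ d → ℕ × Λ d → Set
 Sc c e ed = proj₁ ed ≡ proj₁ e × proj₂ ed ap c aX proj₂ e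
 S> : ∀{d}a b{e f ed fc : ℕ × Λ d}→ Sc a e ed → Sc b f fc → Sc(a * b)(e ⋎ f)(ed ⋎ fc)
 S>{d}a b{p , u}{q , v}{p , uc}{q , vb}(P.refl , pu)(P.refl , pv)= e2(does(p N.+ q N.≤? d))
  {p N.+ q , u Defs.∧ v}{p N.+ q ∸ d , cap q u v}{p N.+ q , uc Defs.∧ vb}{p N.+ q ∸ d , cap q uc vb}
  (P.refl , SR a b{u}{v}{uc}{vb}pu pv)(P.refl , Cq q a b{u}{v}{uc}{vb}pu pv)
  where
  e2 : ∀ e{x y xa ya : ℕ × Λ d}→ Sc(a * b)x xa → Sc(a * b)y ya → Sc(a * b)(if e then x else y)(if e then xa else ya)
  e2 true s _ = s
  e2 false _ s = s
 ST : ∀{d}{c}{e f ed fc : ℕ × Λ d}→ e ≡ f → ed ≡ fc → Sc c f fc → Sc c e ed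
 ST P.refl P.refl s = s
 s1 : ∀{n}c(f g : Fin n → ℂ)→(∀ i → f i ≈ c * g i)→ Defs.sum f ≈ c * Defs.sum g
 s1{zero}c f g eq = sym(zeroʳ c)
 s1{suc n}c f g eq = trans(+-cong(eq Fin.zero)(s1{n}c(f ∘ Fin.suc)(g ∘ Fin.suc)(eq ∘ Fin.suc)))(sym(distribˡ c _ _))
 vL : ∀{d}c{x xa : Fin d → ℂ}→(∀ i → xa i ≈ c * x i)→ vector xa ap c aX vector x
 vL c eq S = s1 c _ _ λ i → trans(*-congʳ(eq i))(*-assoc _ _ _)
 c9 : ∀{d}c{x xa : Fin d → ℂ}→(∀ i → xa i ≈ c * x i)→ covector xa ap c aX covector x
 c9 c eq S = s1 c _ _ λ i → trans(*-congʳ(eq i))(*-assoc _ _ _)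
 n* : ∀ n → 1# ^ n ≈ 1#
 n* zero = refl
 n*(suc n)= trans(*-identityˡ _)(n* n)
 bH : ∀(t : ℂˣ)m n → t ^ᶻ(m ⊖ n)≈ value t ^ m * inverse t ^ n
 bH t m zero = sym(*-identityʳ _)
 bH t zero(suc n)= sym(*-identityˡ _)
 bH t(suc m)(suc n)= trans(reflexive(P.cong(t ^ᶻ_)(I.[1+m]⊖[1+n]≡m⊖n m n)))(trans(bH t m n)(trans(sym(*-identityˡ _))
  (trans(*-congʳ(sym(isInverse t)))(solve 4(λ v i a b → v ac i ac(a ac b):=(v ac a)ac(i ac b))refl(value t)(inverse t)(value t ^ m)(inverse t ^ n)))))
 bZ : ∀(t : ℂˣ)a b → t ^ᶻ(a I.+ b)≈ t ^ᶻ a * t ^ᶻ b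
 bZ t(+ m)(+ n)= ^-homo-*(value t)m n
 bZ t(+ m)-[1+ n ] = bH t m(suc n)
 bZ t -[1+ m ](+ n)= trans(bH t n(suc m))(*-comm _ _)
 bZ t -[1+ m ] -[1+ n ] = trans(reflexive(P.cong(inverse t ^_)(P.cong suc(P.sym(N.+-suc m n)))))(^-homo-*(inverse t)(suc m)(suc n))
 nR : ∀(t : ℂˣ)a → t ^ᶻ a * t ^ᶻ(I.- a)≈ 1#
 nR t a = trans(sym(bZ t a(I.- a)))(reflexive(P.cong(t ^ᶻ_)(I.+-inverseʳ a)))
 module Mo{n : ℕ}(t : Fin n → ℂˣ)where
  pc : ∀{n}{f g : Fin n → ℂ}→(∀ i → f i ≈ g i)→ product f ≈ product g
  pc{zero}eq = refl
  pc{suc n}eq = *-cong(eq Fin.zero)(pc{n}(eq ∘ Fin.suc))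
  pz : ∀{n}(f g : Fin n → ℂ)→ product(λ i → f i * g i)≈ product f * product g
  pz{n}f g = e<.∑-distrib-+{n}f g
  pd : ∀ n → product{n}(λ _ → 1#)≈ 1#
  pd n = e<.sum-replicate-zero n
  mo :(Fin n → ℤ)→ ℂ
  mo δ = product λ i → t i ^ᶻ δ i
  mc : ∀{δ ε}→(∀ i → δ i ≡ ε i)→ mo δ ≈ mo ε
  mc eq = pc λ i → reflexive(P.cong(t i ^ᶻ_)(eq i))
  ma : ∀ δ ε → mo(λ i → δ i I.+ ε i)≈ mo δ * mo ε
  ma δ ε = trans(pc λ i → bZ(t i)(δ i)(ε i))(pz(λ i → t i ^ᶻ δ i)(λ i → t i ^ᶻ ε i))
  m0 : mo(λ _ → I.0ℤ)≈ 1#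
  m0 = pd n
  mn : ∀ δ → mo δ * mo(λ i → I.- δ i)≈ 1#
  mn δ = trans(sym(ma δ(λ i → I.- δ i)))(trans(mc λ i → I.+-inverseʳ(δ i))m0)
 sn : ∀{n}→ Fin n → Fin n → ℤ
 sn i j = if does(i O.≟ j)then + 1 else I.0ℤ
 S! : ∀{n}(i j : Fin n)→ sn(Fin.suc i)(Fin.suc j)≡ sn i j
 S! i j with i O.≟ j
 ... | yes _ = P.refl
 ... | no _ = P.refl
 mg : ∀{n}(t : Fin n → ℂˣ)i → Mo.mo t(sn i)≈ value(t i)
 mg{suc n}t Fin.zero = trans(*-cong(*-identityʳ _)(Mo.m0(t ∘ Fin.suc)))(*-identityʳ _)
 mg{suc n}t(Fin.suc i)= trans(*-identityˡ _)
  (trans(Mo.mc(t ∘ Fin.suc)(S! i))(mg(t ∘ Fin.suc)i))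
 module FD{d n : ℕ}{σ : Signature n}(am : Admissible d σ)where
  pD : ℤ → ℕ → Fin n → ℤ
  pD j zero i = sn(rd am j)i
  pD j(suc m)i = sn(rd am j)i I.+ pD(j I.+ + 1)m i
  fD : ℤ → Level(Fin n)
  fD j zero i = I.0ℤ
  fD j(suc k)i with suc k N.<? d
  ... | yes kh = pD j(firstHit am j(suc k)kh)i
  ... | no _ = I.0ℤ
  ft : ∀ j{k}i → 1 N.≤ d → d N.≤ k → fD j k i ≡ I.0ℤ
  ft j{zero}i _ _ = P.refl
  ft j{suc k}i _ d~ with suc k N.<? d
  ... | yes kh = ⊥-elim(N.<⇒≱ kh d~)
  ... | no _ = P.refl
  pp : ∀ a m i → pD(+ a I.+ + n)m i ≡ pD(+ a)m i
  pp a zero i = P.cong(λ r → sn r i)(ru am a)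
  pp a(suc m)i = P.cong₂ I._+_(P.cong(λ r → sn r i)(ru am a))
   (P.trans(P.cong(λ j → pD j m i)(b% am(+ a)(+ n)(+ 1)))(pp(a N.+ 1)m i))
  fp : ∀ a k i → fD(+ a I.+ + n)k i ≡ fD(+ a)k i
  fp a zero i = P.refl
  fp a(suc k)i with suc k N.<? d
  ... | yes kh = P.trans(P.cong(λ m → pD(+ a I.+ + n)m i)(fH am(+ a)(suc k)kh))
   (pp a(firstHit am(+ a)(suc k)kh)i)
  ... | no _ = P.refl
  module _(t : Fin n → ℂˣ)(u : Point d n)where
   open Mo t
   ez : ∀ j → Sc(mo(sn(rd am j)))(element am u j)(element am(rescale t u)j)
   ez j = by(cW am j)
    where
    i = rd am j
    by : sign σ j ≡ Sign.+ ⊎ sign σ j ≡ Sign.- → Sc(mo(sn i))(element am u j)(element am(rescale t u)j)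
    by(inj₁ bl)= ST(eb am{u}bl)(eb am{rescale t u}bl)
     (P.refl , tr(vL(value(t i)){component am u j}{component am(rescale t u)j}λ c → refl)(λ S → *-congʳ{vector(component am u j)S}(sym(mg t i))))
    by(inj₂ wh)= ST(el am{u}wh)(el am{rescale t u}wh)
     (P.refl , tr(c9(value(t i)){component am u j}{component am(rescale t u)j}λ c → refl)(λ S → *-congʳ{covector(component am u j)S}(sym(mg t i))))
   pJ : ∀ j m → Sc(mo(pD j m))(mixedProduct am u j m)(mixedProduct am(rescale t u)j m)
   pJ j zero = ez j
   pJ j(suc m)= proj₁ bE , λ S → trans(proj₂ bE S)(*-congʳ(sym(ma(sn(rd am j))(pD(j I.+ + 1)m))))
    where bE = S>(mo(sn(rd am j)))(mo(pD(j I.+ + 1)m))(ez j)(pJ(j I.+ + 1)m)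
   s% : ∀ j k → 𝓕 am(rescale t u)j k ap mo(fD j k)aX 𝓕 am u j k
   s% j zero S = sym(trans(*-congʳ m0)(*-identityˡ _))
   s% j(suc k)S with suc k N.<? d
   ... | yes kh = proj₂(pJ j(firstHit am j(suc k)kh))S
   ... | no _ = sym(trans(*-congʳ m0)(*-identityˡ _))
  it : ℤ → ℕ → Level(Fin n)
  it j k l with iq am j k l
  ... | inj₁ _ = fD j l
  ... | inj₂ _ = fD(j I.+ + 1)l
  iI : ∀ t u j k l → intermediate am(rescale t u)j k l ap Mo.mo t(it j k l)aX intermediate am u j k l
  iI t u j k l with iq am j k l
  ... | inj₁ eq rewrite eq u | eq(rescale t u)= s% t u j l
  ... | inj₂ eq rewrite eq u | eq(rescale t u)= s% t u(j I.+ + 1)l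
  module _(df : 1 N.≤ d)where
   Aq : ∀{j l}i → d N.≤ l → fD(j I.+ + 1)l i ≡ fD j l i
   Aq{j}i d8 = P.trans(ft(j I.+ + 1)i df d8)(P.sym(ft j i df d8))
   Bj : ∀{l}→ ¬ l N.≤ d ∸ 1 → d N.≤ l
   Bj Lg = N.≤-trans(N.m≤n+m∸n d 1)(N.≰⇒> Lg)
   iD : ∀ j l i → it j 1 l i ≡ fD j l i
   iD j l i with cW am j
   iD j zero i | inj₁ bl = P.refl
   iD j(suc l)i | inj₁ bl = P.refl
   iD j l i | inj₂ wh with l N.≤? d ∸ 1
   ... | yes _ = P.refl
   ... | no Lg = Aq i(Bj Lg)
   il : ∀ j l i → it j d l i ≡ fD(j I.+ + 1)l i
   il j l i with cW am j
   ... | inj₁ bl with d N.≤? l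
   ... | yes d8 = P.sym(Aq i d8)
   ... | no _ = P.refl
   il j zero i | inj₂ wh with 0 N.≤? d ∸ d
   ... | no _ = P.refl
   ... | yes _ = P.refl
   il j(suc l)i | inj₂ wh with suc l N.≤? d ∸ d
   ... | no _ = P.refl
   ... | yes Lo with()← P.subst(suc l N.≤_)(N.n∸n≡0 d)Lo
   ip : ∀ j k l i → k N.< d → l ≢ Defs.letter am j k → it j k l i ≡ it j(suc k)l i
   ip j k l i kh Ld with cW am j
   ... | inj₁ bl with k N.≤? l | suc k N.≤? l
   ... | yes _ | yes _ = P.refl
   ... | no _ | no _ = P.refl
   ... | no K^ | yes K~ = ⊥-elim(K^(N.<⇒≤ K~))
   ... | yes KO | no K< = ⊥-elim(Ld(P.trans(N.≤-antisym(N.≮⇒≥ K<)KO)(P.sym(TW.lc am k bl))))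
   ip j k l i kh Ld | inj₂ wh with l N.≤? d ∸ k | l N.≤? d ∸ suc k
   ... | yes _ | yes _ = P.refl
   ... | no _ | no _ = P.refl
   ... | no Lg | yes Lo = ⊥-elim(Lg(N.≤-trans Lo(N.∸-monoʳ-≤ d(N.n≤1+n k))))
   ... | yes Lo | no Lg = ⊥-elim(Ld(P.trans(N.≤-antisym Lo(P.subst(N._≤ l)(P.sym(N.+-∸-assoc 1 kh))(N.≰⇒> Lg)))(P.sym(TW.lw am k wh))))
module TP where
 open IS
 open CN
 open Ex
 open FB using(module Fm;rl;fa)
 open Sl
 open KF
 open KW
 open Wo using(Ac)
 open To
 open Gd
 open Bt
 open SS
 open CL
 open De
 open RF
 open Tr
 open import Defs using(_:+_;_:*_;inverse)
 open CommutativeRing ri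
 open RingProperties ring
 open EA ri
 open SemiringExp semiring using(_^_;^-homo-*;^-cong;^-congˡ;^-assocʳ)
 open CommutativeSemiringExp commutativeSemiring using(^-distrib-*)
 open In ri using(solve;_:=_)renaming(_:+_ to _al_;_:*_ to _ac_;:-_ to aC_)
 module Zi{X Y Z : Set}{P : ℕ →(ℕ → ℕ)→ X → X → Set}{Q : ℕ →(ℕ → ℕ)→ Y → Y → Set}{R : ℕ →(ℕ → ℕ)→ Z → Z → Set}{d : ℕ}
  (f : X → Y → Z)(combine : ∀{k a U W A B}→ VL d k → P k a U W → Q k a A B → R k a(f U A)(f W B))where
  private
   module LP = La P
   module LQ = La Q
   module LR = La R
  zL : ∀{β}→ Ll X β → Ll Y β → Ll Z β
  zL [] [] = []
  zL(W ∷ Gs)(B ∷ As)= f W B ∷ zL Gs As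
  zN : ∀{β ae}(m : Move β ae)→ NL X m → NL Y m → NL Z m
  zN trivalent _ _ = tt
  zN(4-valent _)M A = f M A
  zN(6-valent _)(M , N)(A , B)= f M A , f N B
  zN(skip m)nw nB = zN m nw nB
  zi : ∀{β ae}(m : Move β ae)nw nB(Gs : Ll X β)As →
   zL(rb m nw Gs)(rb m nB As)≡ rb m(zN m nw nB)(zL Gs As)
  zi trivalent _ _(_ ∷ _ ∷ Gs)(_ ∷ _ ∷ As)= P.refl
  zi(4-valent _)_ _(_ ∷ _ ∷ Gs)(_ ∷ _ ∷ As)= P.refl
  zi(6-valent _)_ _(_ ∷ _ ∷ _ ∷ Gs)(_ ∷ _ ∷ _ ∷ As)= P.refl
  zi(skip m)n na(W ∷ Gs)(B ∷ As)= P.cong(f W B ∷_)(zi m n na Gs As)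
  zj : ∀{β}(γs : Weights β){U A}Gs As → All(VL d)β → LP.Slice γs U Gs → LQ.Slice γs A As → LR.Slice γs(f U A)(zL Gs As)
  zj [] [] [] [] _ _ = tt
  zj(a ∷ γs)(W ∷ Gs)(B ∷ As)(v ∷ vs)(p , s)(q , t)= combine v p q , zj γs Gs As vs s t
  zf : ∀{β ae}(w : Weave β ae){v γs U A}Gs As → All(VL d)β → LP.Lb w v γs U Gs → LQ.Lb w v γs A As →
   LR.Lb w v γs(f U A)(zL Gs As)
  zf []{γs = γs}Gs As vs s t = zj γs Gs As vs s t
  zf(m ∷ w){v}{γs}{U}{A}Gs As vs(s , nw , l)(t , nB , Lh)= zj γs Gs As vs s t , zN m nw nB ,
   P.subst(LR.Lb w(v N.+ moveTrivalents m)(moveWeights m v γs)(f U A))(zi m nw nB Gs As)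
    (zf w(rb m nw Gs)(rb m nB As)(vm m vs)l Lh)
 module Rs(d : ℕ)where
  open Fm ri d
  rQ : ∀{k}{U W Ub Wa : Fl}{c}(a a$ b : ℕ → ℂ)→ VL d k →(∀ l → a l * a$ l ≈ 1#)→(∀ l → l ≢ k → a l ≈ b l)→
   (∀ l → Ub l ap a l aX U l)→(∀ l → Wa l ap b l aX W l)→ Cr k U W c →
   Cr k Ub Wa(c *(a k * b k *(a$(k ∸ 1)* a$(suc k))))
  rQ{k}{U}{W}{Ub}{Wa}{c}a a$ b _ AJ same u w(l< , y , nw , value)=
   (λ i iJ ix S → trans(u i S)(trans(*-cong(same i ix)(l< i iJ ix S))(sym(w i S)))),
   (λ i → b k * a$(k ∸ 1)* y i),
   (λ S → sym(trans(aE(Ub(k ∸ 1))(b k * a$(k ∸ 1))y S)(trans(*-congˡ(trans(cn(u(k ∸ 1))S)(ak(a(k ∸ 1))(U(k ∸ 1))_ S)))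
    (trans(solve 4(λ b i a x → b ac i ac(a ac x):=(a ac i)ac(b ac x))refl(b k)(a$(k ∸ 1))(a(k ∸ 1))((U(k ∸ 1)af y)S))
     (trans(*-cong(AJ(k ∸ 1))(*-congˡ(sym(nw S))))(trans(*-identityˡ _)(sym(w k S)))))))),
   (λ S → trans(aE(Ub k)(b k * a$(k ∸ 1))y S)(trans(*-congˡ(trans(cn(u k)S)(trans(ak(a k)(U k)_ S)(*-congˡ(value S)))))
    (trans(sym(*-identityˡ _))(trans(*-congʳ(sym(AJ(suc k))))
     (trans(solve 7(λ A Ab b i a c x → A ac Ab ac(b ac i ac(a ac(c ac x))):= c ac(a ac b ac(i ac Ab))ac(A ac x))refl
      (a(suc k))(a$(suc k))(b k)(a$(k ∸ 1))(a k)c(U(suc k)S))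
      (*-congˡ(sym(u(suc k)S))))))))
  c4 : ∀{k}{U W : Fl}{c cB}→ c ≈ cB → Cr k U W c → Cr k U W cB
  c4 eq(l< , y , nw , value)= l< , y , nw , λ S → trans(value S)(*-congʳ eq)
 aS : FF ri Bool
 aS = record
  {functionRing = record
   {Known = λ f → f true ≈ f false
   ;kr = λ eq p → trans(sym(eq true))(trans p(eq false))
   ;kn = λ c → refl ;k2 = +-cong ;ko = *-cong}
  ;kj = λ{f}{h}fh p → trans(sym(*-identityˡ _))(trans(*-congʳ(sym(fh false)))(trans(*-congʳ(*-congʳ(sym p)))
   (trans(solve 3(λ a b c → a ac b ac c := a ac c ac b)refl(f true)(h false)(h true))(trans(*-congʳ(fh true))(*-identityˡ _)))))}
 module _{d n : ℕ}(t : Fin n → ℂˣ)where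
  rs : Polynomial d n → Polynomial d n
  rs(const a)= const a
  rs(var i c)= const(Defs.value(t i)):* var i c
  rs(f :+ g)= rs f :+ rs g
  rs(f :* g)= rs f :* rs g
  er : ∀ f u → eval(rs f)u ≈ eval f(rescale t u)
  er(const a)u = refl
  er(var i c)u = refl
  er(f :+ g)u = +-cong(er f u)(er g u)
  er(f :* g)u = *-cong(er f u)(er g u)
  nr : ∀ h → Nonvanishing h → Nonvanishing(rs h)
  nr h(u , hu)=(λ i c → inverse(t i)* u i c), ur(trans(ec h λ i c →
   trans(sym(*-identityˡ _))(trans(*-congʳ(sym(isInverse(t i))))(*-assoc _ _ _)))(sym(er h _)))hu
 module Pa{d n : ℕ}{σ : Signature n}(am : Admissible d σ)(dd : 2 N.≤ d)where
  open PS am dd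
  ep : ∀{S N}(aO : FF ri S)(c ca : S → Fin N → ℂ)(inv : ∀ s γ → c s γ * ca s γ ≈ 1#)L(g : ℕ × ℕ → S → Flag d)xs s →
   Bo.ea ri Co.stable d aO c ca inv s(pL L g xs)≡ pL L(λ x → g x s)xs
  ep aO c ca inv L g [] s = P.refl
  ep aO c ca inv L g(x ∷ xs)s = P.cong(g x s ∷_)(ep aO c ca inv L g xs s)
 oc : ℂˣ
 oc = record{value = 1# ;inverse = 1# ;isInverse = *-identityˡ 1#}
 od : ∀ z → oc ^ᶻ z ≈ 1#
 od(+ m)= n* m
 od -[1+ m ] = n*(suc m)
 module PO(R : CommutativeRing 0ℓ 0ℓ)where
  private module R = CommutativeRing R
  open In R using(⟦_ah;+-homo;nh;*-homo)
  open RingProperties R.ring using()renaming(-1*x≈-x to xH)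
  open SemiringExp R.semiring using()renaming(_^_ to _^′_)
  p5 :(∀ z → ⟦ z ah R.≈ R.0# → z ≡ I.0ℤ)→ ∀ x → x R.≈ ⟦ + 2 ah → ∀ m → x ^′ m R.≈ R.1# → m ≡ 0
  p5 injective x x2 m eq = go m(I.+-injective(I.i-j≡0⇒i≡j(+(2 N.^ m))(+ 1)(injective(+(2 N.^ m)I.- + 1)
   (R.trans(+-homo(+(2 N.^ m))(I.- + 1))(R.trans(R.+-cong(R.trans(Ig m)eq)(R.trans(nh(+ 1))(R.-‿cong(R.+-identityʳ R.1#))))(R.-‿inverseʳ R.1#))))))
   where
   Ig : ∀ m → ⟦ +(2 N.^ m)ah R.≈ x ^′ m
   Ig zero = R.+-identityʳ R.1#
   Ig(suc m)= R.trans(R.reflexive(P.cong ⟦_ah(I.pos-* 2(2 N.^ m))))(R.trans(*-homo(+ 2)(+(2 N.^ m)))(R.*-cong(R.sym x2)(Ig m)))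
   go : ∀ m → 2 N.^ m ≡ 1 → m ≡ 0
   go zero _ = P.refl
   go(suc m)eq with()← N.<⇒≢(N.≤-<-trans(N.≤-reflexive(P.sym(N.*-identityʳ 1)))(N.*-mono-≤{2}{2}N.≤-refl(N.m^n>0 2 m)))(P.sym eq)
 iO : ∀ z → In.⟦_ah ri z ≈ 0# → z ≡ I.0ℤ
 iO z zM with z I.≟ I.0ℤ
 ... | yes zS = zS
 ... | no zK = ⊥-elim(nt{In.⟦_ah ri z}(iM{z}zK)zM)
 i0 : ∀ x → x ≈ In.⟦_ah ri(+ 2)→ Unit x → ∃ λ(τ : ℂˣ)→ ∀ z → τ ^ᶻ z ≈ 1# → z ≡ I.0ℤ
 i0 x x2(y , xy)= τ , og
  where
  τ : ℂˣ
  τ = record{value = x ;inverse = y ;isInverse = xy}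
  og : ∀ z → τ ^ᶻ z ≈ 1# → z ≡ I.0ℤ
  og(+ m)eq = P.cong +_(PO.p5 ri iO x x2 m eq)
  og -[1+ m ] eq = ⊥-elim(N.1+n≢0(PO.p5 ri iO x x2(suc m)
   (trans(sym(*-identityʳ(x ^ suc m)))(trans(*-congˡ{x ^ suc m}(sym eq))(nR τ(+ suc m))))))
 opaque
  iZ : ∃ λ(τ : ℂˣ)→ ∀ z → τ ^ᶻ z ≈ 1# → z ≡ I.0ℤ
  iZ = i0(In.⟦_ah ri(+ 2))refl(iM{+ 2}λ())
 t< : ℂˣ
 t< = proj₁ iZ
 t2 : ∀ z → t< ^ᶻ z ≈ 1# → z ≡ I.0ℤ
 t2 = proj₂ iZ
 t3 : ∀{n}→ Fin n → Fin n → ℂˣ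
 t3 Fin.zero Fin.zero = t<
 t3 Fin.zero(Fin.suc j)= oc
 t3(Fin.suc i)Fin.zero = oc
 t3(Fin.suc i)(Fin.suc j)= t3 i j
 mA : ∀{n}(i : Fin n)δ → Mo.mo(t3 i)δ ≈ t< ^ᶻ δ i
 mA{suc n}Fin.zero δ = trans(*-congˡ(trans(Mo.pc(λ(_ : Fin n)→ oc){n}(λ j → od(δ(Fin.suc j))))(Mo.pd(λ(_ : Fin n)→ oc)n)))(*-identityʳ _)
 mA{suc n}(Fin.suc i)δ = trans(*-cong(od(δ Fin.zero))(mA i(δ ∘ Fin.suc)))(*-identityˡ _)
 ws : ∀ N dg a i → i N.< N → a i ≡ 1 →(∀ γ → γ ≢ i → a γ ≡ 0)→ wi N dg a ≡ dg i
 ws N dg a i Iz Aw oi = P.trans(sk{N}(Fin.fromℕ< Iz)(dg i){h = λ _ → I.0ℤ}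
  (P.trans(P.cong(λ j → + a j I.* dg j)(O.toℕ-fromℕ< Iz))(P.trans(P.cong(λ x → + x I.* dg i)Aw)(P.trans(I.*-identityˡ(dg i))(P.sym(I.+-identityʳ(dg i))))))
  (λ j ja → P.trans(P.cong(λ x → + x I.* dg(toℕ j))(oi(toℕ j)λ e → ja(O.toℕ-injective(P.trans e(P.sym(O.toℕ-fromℕ< Iz))))))(I.*-zeroˡ(dg(toℕ j)))))
  (P.trans(P.cong(λ y → dg i I.+ y)(a9.sum-replicate-zero N))(I.+-identityʳ(dg i)))
 module TG{d n : ℕ}{σ : Signature n}(am : Admissible d σ)(dd : 2 N.≤ d)(p : ℤ)where
  open PS am dd
  open FD am
  open TW am
  df : 1 N.≤ d
  df = N.≤-trans(N.s≤s N.z≤n)dd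
  L = topLetter am p
  tD : Level(Fin n)
  tD = it p 1
  rD : ℕ × ℕ → Level(Fin n)
  rD(i , k)= it(p I.+ + i)(suc k)
  lf : ℕ → ℕ → Level(Fin n)
  lf = lq tD rD
  lj : ∀ i k → 1 N.≤ k → ∀ l x → lf i k l x ≡ it(p I.+ + i)k l x
  lj i(suc(suc k))_ l x = P.refl
  lj zero(suc zero)_ l x = P.cong(λ j → it j 1 l x)(P.sym(I.+-identityʳ p))
  lj(suc i)(suc zero)_ l x = P.trans(P.cong(λ k → it(p I.+ + i)k l x)(N.m+[n∸m]≡n df))
   (P.trans(il df(p I.+ + i)l x)(P.trans(P.cong(λ j → fD j l x)(nx i))(P.sym(iD df(p I.+ + suc i)l x))))
   where
   nx : ∀ i → p I.+ + i I.+ + 1 ≡ p I.+ + suc i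
   nx i = P.trans(I.+-assoc p(+ i)(+ 1))(P.cong(λ j → p I.+ + j)(N.+-comm i 1))
  SB : ∀ i k → 1 N.≤ k → k N.< d → ∀ l → l ≢ L(i , k)→ ∀ x → lf i k l x ≡ rD(i , k)l x
  SB i k kk kh l Ld x = P.trans(lj i k kk l x)(ip df(p I.+ + i)k l x kh Ld)
  cD : ∀{I : Set}→ ℕ → Level I → Level I → I → ℤ
  cD k A B i = A k i I.+ B k i I.-(A(k ∸ 1)i I.+ A(suc k)i)
  lD : ℕ → ℕ → Fin n → ℤ
  lD i k = cD(L(i , k))(lf i k)(rD(i , k))
  mD : ℕ → Fin n → ℤ
  mD γ = lD γ(d ∸ 1)
  mH : ℕ × ℕ → ℕ → ℕ
  mH(i , k)γ = if(k N.≡ᵇ d ∸ 1)∧(γ N.≡ᵇ i)then 1 else 0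
  mO : ∀ i → mH(i , d ∸ 1)i ≡ 1
  mO i rewrite rl(d ∸ 1)| rl i = P.refl
  my : ∀ i k γ → γ ≢ i → mH(i , k)γ ≡ 0
  my i k γ i% rewrite fa i% | ∧-zeroʳ(k N.≡ᵇ d ∸ 1)= P.refl
  mC : ∀ i k γ → k ≢ d ∸ 1 → mH(i , k)γ ≡ 0
  mC i k γ Kv rewrite fa Kv = P.refl
 module Tw{d n : ℕ}{σ : Signature n}(am : Admissible d σ)(dd : 2 N.≤ d)(p : ℤ)(l : ℕ)
  {ae}(w : Weave(topWord am p l)ae)(Δ : Fin(l N.+ trivalents w)→ K d σ)(va : AreWeaveVariables am p l w Δ)
  (t : Fin n → ℂˣ)(u : Point d n)(ge : ∀ s → Unit(eval(proj₁ va)(if s then rescale t u else u)))where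
  open TW am
  open PS am dd
  open FD am
  open TG am dd p
  open Mo t hiding(pc;pz;pd)
  open Fm ri d
  N = l N.+ trivalents w
  xs = positions am l
  po : Bool → Point d n
  po s = if s then rescale t u else u
  dt = λ s → proj₂(proj₂ va)(po s)(ge s)
  c ca : Bool → Fin N → ℂ
  c s = proj₁(dt s)
  ca s γ = proj₁(proj₂(proj₁(proj₂(dt s))γ))
  cv : ∀ s γ → c s γ * ca s γ ≈ 1#
  cv s γ = proj₂(proj₂(proj₁(proj₂(dt s))γ))
  module C = WP ri d aS c ca cv
  module F = Fi d dd aS c ca cv
  U : Bool → Fl
  U s = intermediate am(po s)p 1
  rn : ℕ × ℕ → Bool → Fl
  rn(i , k)s = intermediate am(po s)(p I.+ + i)(suc k)
  dq : ∀ s → Decoration(c s)w l(topWeights am p l)(U s)(Bo.ea ri Co.stable d aS c ca cv s(pL L rn xs))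
  dq s = P.subst(Decoration(c s)w l(topWeights am p l)(U s))(P.sym(Pa.ep am dd aS c ca cv L rn xs s))(proj₂(proj₂(dt s)))
  lg : La.Lb C.Cs w l(topWeights am p l)U(pL L rn xs)
  lg = F.family w l(topWeights am p l)U(pL L rn xs)dq
  a4 :(Bool → Fl)→ Level(Fin n)→ Bool → Fl
  a4 G A true l = mo(λ i → I.- A l i)aX G true l
  a4 G A false l = G false l
  aV :(Bool → ℂ)→(Fin n → ℤ)→ Bool → ℂ
  aV v δ true = v true * mo(λ i → I.- δ i)
  aV v δ false = v false
  open Po ri d aS using(Ko;FO;CF)
  Ag : ∀{G Gg : Fl}(A : Level(Fin n))→(∀ l → Gg l ap mo(A l)aX G l)→ ∀ l →(mo(λ i → I.- A l i)aX Gg l)ap G l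
  Ag A eq l S = trans(*-congˡ(eq l S))(trans(sym(*-assoc _ _ _))(trans(*-congʳ(trans(*-comm _ _)(mn(A l))))(*-identityˡ _)))
  kE : Ko(a4 U tD)
  kE l _ S = Ag{U false}{U true}tD(iI t u p 1)l S
  kL : ∀ x → Ko(a4(rn x)(rD x))
  kL(i , k)l _ S = Ag{rn(i , k)false}{rn(i , k)true}(rD(i , k))(iI t u(p I.+ + i)(suc k))l S
  lR : ℕ → ℕ → Bool → Fl
  lR = lq U rn
  kR : ∀ i k → Ko(a4(lR i k)(lf i k))
  kR i(suc(suc k))= kL(i , suc k)
  kR(suc i)(suc zero)= kL(i , d ∸ 1)
  kR zero(suc zero)= kE
  kR zero zero = kE
  kR(suc i)zero = kE
  a> : ∀{G A}→ Defs.IsDecoratedFlag(G false)→ Ko(a4 G A)→ ¬ ¬ FO(a4 G A)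
  a>{G}{A}fR Kr = ¬¬-map(λ(g , det , r+)→ record
   {frame = λ _ → g ;d1 = λ _ → det
   ;rp = λ{true k kd → tr(Kr k kd)(r+ k kd);false → r+}
   ;km = λ i c → refl})(Fg.fj d dd fR)
  a0 : ∀{k v G H}(A B : Level(Fin n))→ VL d k →(∀ l → l ≢ k → ∀ i → A l i ≡ B l i)→ CF k v G H →
   CF k(aV v(cD k A B))(a4 G A)(a4 H B)
  a0{k}{v}{G}{H}A B vK same C = record
   {crossing = λ{true → c4(*-congˡ degree)(rQ(λ l → mo(λ i → I.- A l i))(λ l → mo(A l))(λ l → mo(λ i → I.- B l i))
    vK(λ l → trans(*-comm _ _)(mn(A l)))(λ l lJ → mc{λ i → I.- A l i}{λ i → I.- B l i}λ i → P.cong I.-_(same l lJ i))(λ l S → refl)(λ l S → refl)(CF.crossing C true))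
    ;false → CF.crossing C false}
   ;ta = λ{true → CF.ta C true * mo D ;false → CF.ta C false}
   ;t1 = λ{true → trans(solve 4(λ a b c e → a ac b ac(c ac e):=(a ac c)ac(e ac b))refl _ _ _ _)
    (trans(*-cong(CF.t1 C true)(mn D))(*-identityˡ 1#))
    ;false → CF.t1 C false} }
   where
   open Rs d
   D = cD k A B
   degree : mo(λ i → I.- A k i)* mo(λ i → I.- B k i)*(mo(A(k ∸ 1))* mo(A(suc k)))≈ mo(λ i → I.- D i)
   -A -B AO AP : Fin n → ℤ
   -A i = I.- A k i
   -B i = I.- B k i
   AO = A(k ∸ 1)
   AP = A(suc k)
   degree = trans(*-cong(sym(ma -A -B))(sym(ma AO AP)))(trans(sym(ma(λ i → -A i I.+ -B i)(λ i → AO i I.+ AP i)))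
    (mc{λ i → -A i I.+ -B i I.+(AO i I.+ AP i)}{λ i → I.- D i}λ i → d!(A k i)(B k i)(AO i)(AP i)))
    where
    open so using()renaming(solve to eX;_:=_ to _⟨=⟩_;_:+_ to _bR_;:-_ to g3_)
    d! : ∀ a b x y → I.- a I.+ I.- b I.+(x I.+ y)≡ I.-(a I.+ b I.-(x I.+ y))
    d! = eX 4(λ a b x y →(g3 a bR g3 b)bR(x bR y)⟨=⟩ g3(a bR b bR g3(x bR y)))P.refl
  private
   f9 : ∀ s → Defs.SliceDecoration(c s)(topWeights am p l)(U s)(Bo.ea ri Co.stable d aS c ca cv s(pL L rn xs))
   f9 s = F.te w(dq s)
   Fj = F.fm(topWeights am p l)U(pL L rn xs)f9
  fX : ∀ i k → i N.< l → 1 N.≤ k → k N.< d → Defs.IsDecoratedFlag(lR i k false)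
  fX i k i7 kk kh = pA(λ k a U W → ∀ s → Defs.IsDecoratedFlag(U s))L mH rn U l Fj i k i7 kk kh false
  Cc : ∀ i k → i N.< l → 1 N.≤ k → k N.< d → CF(L(i , k))(C.value(mH(i , k)))(lR i k)(rn(i , k))
  Cc = pA C.Cs L mH rn U l(La.tS C.Cs w lg)
  lF : ∀ i{k}→ 1 N.≤ k → k N.< d → VL d(L(i , k))
  lF i kk kh = lm(p I.+ + i)(kk , kh)
  cX : ∀ i k → i N.< l → 1 N.≤ k → k N.< d → aV(C.value(mH(i , k)))(lD i k)true ≈ C.value(mH(i , k))false
  cX i k i7 kk kh = Co.stable _ _(¬¬-map(λ frame →
   C.kA(lF i kk kh)frame(kL(i , k))
    (a0(lf i k)(rD(i , k))(lF i kk kh)(SB i k kk kh)(Cc i k i7 kk kh)))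
   (a>{lR i k}{lf i k}(fX i k i7 kk kh)(kR i k)))
  uk : ∀ i k → i N.< l → 1 N.≤ k → k N.< d → k ≢ d ∸ 1 → mo(lD i k)≈ 1#
  uk i k i7 kk kh Kv = trans(sym(*-identityʳ _))(trans(*-congˡ(sym nX))(mn(lD i k)))
   where
   ov : ∀ s → C.value(mH(i , k))s ≈ 1#
   ov s = trans(C.pc{N}λ γ → reflexive(P.cong(c s γ ^_)(mC i k(toℕ γ)Kv)))(C.pd N)
   nX : mo(λ x → I.- lD i k x)≈ 1#
   nX = trans(sym(*-identityˡ _))(trans(*-congʳ(sym(ov true)))(trans(cX i k i7 kk kh)(ov false)))
module WD where
 open IS
 open CN
 open Ex
 open FB using(module Fm;rl;fa)
 open Sl
 open KF
 open KW
 open Wo using(Ac)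
 open To
 open Gd
 open Bt
 open SS
 open CL
 open De
 open RF
 open Tr
 open TP
 open import Defs using(_:+_;_:*_;product;num;den)
 open CommutativeRing ri
 open RingProperties ring
 open EA ri
 open SemiringExp semiring using(_^_;^-homo-*;^-cong;^-congˡ)
 open CommutativeSemiringExp commutativeSemiring using(^-distrib-*)
 open In ri using(solve;_:=_)renaming(_:+_ to _al_;_:*_ to _ac_;:-_ to aC_)
 module GW{d n : ℕ}{σ : Signature n}(am : Admissible d σ)(dd : 2 N.≤ d)(p : ℤ)(l : ℕ)
  {ae}(w : Weave(topWord am p l)ae)(Δ : Fin(l N.+ trivalents w)→ K d σ)(va : AreWeaveVariables am p l w Δ)where
  open TW am
  open PS am dd
  open FD am
  open TG am dd p
  N = l N.+ trivalents w
  xs = positions am l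
  h = proj₁ va
  gG : ∀ t → ¬ ¬ ∃ λ u → ∀ s → Unit(eval h(if s then rescale t u else u))
  gG t = ¬¬-map(λ(u ,(z , uz))→ u ,
   λ{true → ur(er t h u)(eval h u * z , trans(solve 3(λ a b z → b ac(a ac z):= a ac b ac z)refl(eval h u)(eval(rs t h)u)z)uz)
    ;false → eval(rs t h)u * z , trans(sym(*-assoc _ _ _))uz})
   (nn h(rs t h)(proj₁(proj₂ va))(nr t h(proj₁(proj₂ va))))
  uf : ∀ i k → i N.< l → 1 N.≤ k → k N.< d → k ≢ d ∸ 1 → ∀ x → lD i k x ≡ I.0ℤ
  uf i k i7 kk kh Kv x = decidable-stable(lD i k x I.≟ I.0ℤ)(¬¬-map(λ(u , ge)→ t2(lD i k x)
   (trans(sym(mA x(lD i k)))(Tw.uk am dd p l w Δ va(t3 x)u ge i k i7 kk kh Kv)))(gG(t3 x)))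
  ty : Ga.Slice(Fin n)N mD(topWeights am p l)tD(pL L rD xs)
  ty = pQ(Ga.Gb(Fin n)N mD)L mH rD tD l λ i k i7 kk kh → record
   {same = SB i k kk kh ;ch = λ x → ch i k i7 kk kh x(k N.≟ d ∸ 1)}
   where
   open so renaming(solve to eX)
   ch : ∀ i k → i N.< l → 1 N.≤ k → k N.< d → ∀ x → Dec(k ≡ d ∸ 1)→ let A = lf i k ;B = rD(i , k);m = L(i , k)in
    A m x I.+ B m x ≡ A(m ∸ 1)x I.+ A(suc m)x I.+ wi N(λ γ → mD γ x)(mH(i , k))
   ch i k i7 kk kh x(yes P.refl)= P.trans(so.solve 2(λ s t → s so.:= t so.:+(s so.:+ so.:- t))P.refl
    (lf i k(L(i , k))x I.+ rD(i , k)(L(i , k))x)(lf i k(L(i , k)∸ 1)x I.+ lf i k(suc(L(i , k)))x))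
    (P.cong(λ y → lf i k(L(i , k)∸ 1)x I.+ lf i k(suc(L(i , k)))x I.+ y)
     (P.sym(ws N(λ γ → mD γ x)(mH(i , k))i(N.<-≤-trans i7(N.m≤m+n l _))(mO i)(my i k))))
   ch i k i7 kk kh x(no Kv)= P.trans(I.i-j≡0⇒i≡j _ _(uf i k i7 kk kh Kv x))
    (P.sym(P.trans(P.cong(λ y → lf i k(L(i , k)∸ 1)x I.+ lf i k(suc(L(i , k)))x I.+ y)zo)(I.+-identityʳ _)))
    where
    zo : wi N(λ γ → mD γ x)(mH(i , k))≡ I.0ℤ
    zo = P.trans(sm{N}λ γ → P.trans(P.cong(λ y → + y I.* mD(toℕ γ)x)(mC i k(toℕ γ)Kv))(I.*-zeroˡ(mD(toℕ γ)x)))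
     (a9.sum-replicate-zero N)
  bt : AW(Be l)(topWeights am p l)
  bt = pK L mH xs(pB l)λ(i , k)i7 γ Lf → my i k γ(N.>⇒≢(N.<-≤-trans i7 Lf))
  private et = Ee.extend(Fin n)d N w l(topWeights am p l)mD(pL L rD xs)(tW p l)bt N.≤-refl ty
  degree : ℕ → Fin n → ℤ
  degree = proj₁ et
  d3 : ∀ γ → γ N.< l → ∀ x → mD γ x ≡ degree γ x
  d3 = proj₁(proj₂ et)
  gd : Ga.Lb(Fin n)N degree w l(topWeights am p l)tD(pL L rD xs)
  gd = proj₂(proj₂ et)
  module _(t : Fin n → ℂˣ)(u : Point d n)(ge : ∀ s → Unit(eval h(if s then rescale t u else u)))where
   open Tw am dd p l w Δ va t u ge hiding(N;xs)
   open Mo t hiding(pc;pz;pd)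
   open Fm ri d
   open Po ri d aS using(Ko;FO;CF)
   cB c^ : Bool → Fin N → ℂ
   cB true γ = c true γ * mo(λ i → I.- degree(toℕ γ)i)
   cB false γ = c false γ
   c^ true γ = ca true γ * mo(degree(toℕ γ))
   c^ false γ = ca false γ
   cY : ∀ s γ → cB s γ * c^ s γ ≈ 1#
   cY true γ = trans(solve 4(λ a b c e → a ac b ac(c ac e):=(a ac c)ac(e ac b))refl(c true γ)_(ca true γ)_)
    (trans(*-cong(cv true γ)(mn(degree(toℕ γ))))(*-identityˡ 1#))
   cY false γ = cv false γ
   module CD = WP ri d aS cB c^ cY
   mI : ∀ δ m → mo δ ^ m ≈ mo(λ i → + m I.* δ i)
   mI δ zero = sym(trans(mc λ i → I.*-zeroˡ(δ i))m0)
   mI δ(suc m)= trans(*-congˡ(mI δ m))(trans(sym(ma δ(λ i → + m I.* δ i)))(mc λ i →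
    P.sym(P.trans(P.cong(I._* δ i)(I.pos-+ 1 m))(P.trans(I.*-distribʳ-+(δ i)(+ 1)(+ m))(P.cong(I._+(+ m I.* δ i))(I.*-identityˡ(δ i)))))))
   mj : ∀{m}(f : Fin m → Fin n → ℤ)→ product(λ γ → mo(f γ))≈ mo(λ i → su λ γ → f γ i)
   mj{zero}f = sym m0
   mj{suc m}f = trans(*-congˡ(mj{m}(f ∘ Fin.suc)))(sym(ma(f Fin.zero)(λ i → su λ γ → f(Fin.suc γ)i)))
   vP : ∀ a s → CD.value a s ≈ aV(C.value a)(λ i → wi N(λ γ → degree γ i)a)s
   vP a false = refl
   vP a true = trans(C.pc{N}λ γ → ^-distrib-*(c true γ)_(a(toℕ γ)))(trans(C.pz{N}(λ γ → c true γ ^ a(toℕ γ))(λ γ → mo(λ i → I.- degree(toℕ γ)i)^ a(toℕ γ)))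
    (*-congˡ(trans(C.pc{N}λ γ → mI(λ i → I.- degree(toℕ γ)i)(a(toℕ γ)))(trans(mj{N}λ γ i → + a(toℕ γ)I.* I.- degree(toℕ γ)i)
     (mc λ i → P.trans(sm{N}λ γ → P.sym(I.neg-distribʳ-*(+ a(toℕ γ))(degree(toℕ γ)i)))(nO{N}λ γ → + a(toℕ γ)I.* degree(toℕ γ)i))))))
    where
    nO : ∀{m}(f : Fin m → ℤ)→ su(λ γ → I.- f γ)≡ I.- su f
    nO{zero}f = P.refl
    nO{suc m}f = P.trans(P.cong(λ y → I.- f Fin.zero I.+ y)(nO{m}(f ∘ Fin.suc)))(P.sym(I.neg-distrib-+(f Fin.zero)_))
   combine : ∀{k a G H A B}→ VL d k → C.Cs k a G H → Ga.Gb(Fin n)N degree k a A B → CD.Cs k a(a4 G A)(a4 H B)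
   combine{k}{a}{G}{H}{A}{B}vK C g = record
    {crossing = λ s → Rs.c4 d(trans(Cy s)(sym(vP a s)))(CF.crossing Ay s)
    ;ta = CF.ta Ay ;t1 = λ s → trans(*-congʳ(trans(vP a s)(sym(Cy s))))(CF.t1 Ay s)}
    where
    Ay = a0 A B vK(Ga.Gb.same g)C
    Cy : ∀ s → aV(C.value a)(cD k A B)s ≈ aV(C.value a)(λ i → wi N(λ γ → degree γ i)a)s
    Cy false = refl
    Cy true = *-congˡ(mc λ i → P.cong I.-_(P.trans(P.cong(I._-(A(k ∸ 1)i I.+ A(suc k)i))(Ga.Gb.ch g i))
     (so.solve 2(λ s t → s so.:+ t so.:+ so.:- s so.:= t)P.refl(A(k ∸ 1)i I.+ A(suc k)i)(wi N(λ γ → degree γ i)a))))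
   module Z = Zi{P = C.Cs}{Q = Ga.Gb(Fin n)N degree}{R = CD.Cs}{d = d}a4(λ{k}{a}{G}{H}{A}{B}→ combine{k}{a}{G}{H}{A}{B})
   Ah = Z.zL(pL L rn xs)(pL L rD xs)
   a& : La.Lb CD.Cs w l(topWeights am p l)(a4 U tD)Ah
   a& = Z.zf w(pL L rn xs)(pL L rD xs)(tW p l)lg gd
   kq : CD.KL Ah
   kq = go xs
    where
    go : ∀ xs → CD.KL(Z.zL(pL L rn xs)(pL L rD xs))
    go [] = tt
    go(x ∷ xs)= kL x , go xs
   dN : 1 N.≤ d ∸ 1
   dN = N.∸-monoˡ-≤ 1 dd
   d9 : d ∸ 1 N.< d
   d9 = N.≤-reflexive(N.m+[n∸m]≡n df)
   vD : ∀ a(γ : Fin N)→ a(toℕ γ)≡ 1 →(∀ j → j ≢ toℕ γ → a j ≡ 0)→ ∀ s → C.value a s ≈ c s γ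
   vD a γ A3 om s = trans(C.pk{N}{λ j → c s j ^ a(toℕ j)}{λ _ → 1#}γ(c s γ)
    (trans(reflexive(P.cong(c s γ ^_)A3))refl)
    (λ j jf → reflexive(P.cong(c s j ^_)(om(toℕ j)(jf ∘ O.toℕ-injective)))))
    (trans(*-congˡ(C.pd N))(*-identityʳ _))
   Ki : CD.KB l
   Ki γ l/ = trans(*-cong(sym(vD(mH(toℕ γ , d ∸ 1))γ(mO(toℕ γ))(my(toℕ γ)(d ∸ 1))true))
    (mc λ i → P.cong I.-_(P.sym(d3(toℕ γ)l/ i))))
    (trans(cX(toℕ γ)(d ∸ 1)l/ dN d9)(vD(mH(toℕ γ , d ∸ 1))γ(mO(toℕ γ))(my(toℕ γ)(d ∸ 1))false))
   a1 : ∀ γ → cB true γ ≈ cB false γ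
   a1 γ = Co.stable _ _(¬¬-map(λ frame →
    CD.d6 w(tW p l)Ki bt frame kE a& kq N.≤-refl γ(O.toℕ<n γ))
    (a>{U}{tD}(F.Sm(topWeights am p l)_(F.te w(dq false)))kE))
   ht : ∀ γ → let x = Δ γ in
    eval(function(num x))(rescale t u)* eval(function(den x))u ≈ mo(degree(toℕ γ))*(eval(function(num x))u * eval(function(den x))(rescale t u))
   ht γ = trans(*-congʳ(proj₂(hV true)))(trans(*-congʳ(*-congʳ rA))(trans
    (solve 4(λ c m d dc → c ac m ac d ac dc := m ac(c ac dc ac d))refl(c false γ)(mo(degree(toℕ γ)))_ _)
    (*-congˡ(*-congʳ(sym(proj₂(hV false)))))))
    where
    hV : ∀ s → HasValue(Δ γ)(po s)(c s γ)
    hV s = proj₁(proj₁(proj₂(dt s))γ)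
    rA : c true γ ≈ c false γ * mo(degree(toℕ γ))
    rA = trans(sym(*-identityʳ _))(trans(*-congˡ(sym(mn(degree(toℕ γ)))))(trans
     (solve 3(λ c m mM → c ac(m ac mM):= c ac mM ac m)refl(c true γ)_ _)(*-congʳ(a1 γ))))
  hm : ∀ γ → HomogeneousOfDegree(degree(toℕ γ))(Δ γ)
  hm γ t u = trans(*-congʳ(sym(er t Nc u)))(trans(Co.stable _ _(¬¬-map identity
   (nn h(rs t h)(proj₁(proj₂ va))(nr t h(proj₁(proj₂ va))))))
   (*-congˡ(*-congˡ(er t Da u))))
   where
   Nc = function(num(Δ γ))
   Da = function(den(Δ γ))
   bE : ∀ u → Unit(eval(h :* rs t h)u)→ ∀ s → Unit(eval h(if s then rescale t u else u))
   bE u(z , uz)true = ur(er t h u)(eval h u * z , trans(solve 3(λ a b z → b ac(a ac z):= a ac b ac z)refl(eval h u)(eval(rs t h)u)z)uz)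
   bE u(z , uz)false = eval(rs t h)u * z , trans(sym(*-assoc _ _ _))uz
   f = rs t Nc :* Da
   g = const(Mo.mo t(degree(toℕ γ))):*(Nc :* rs t Da)
   identity : Nonvanishing(h :* rs t h)→ eval f u ≈ eval g u
   identity nP = gn f g(h :* rs t h)nP(λ u un → trans(*-congʳ(er t Nc u))
    (trans(ht t u(bE u un)γ)(*-congˡ(*-congˡ(sym(er t Da u))))))u
module LF where
 open IS
 open CN
 open Ex
 open FB using(module Fm)
 open Sl
 open KF
 open KW
 open To
 open Ln
 open CL
 open De
 open RF
 open Tr using(s1)
 open import Defs using(_:+_;_:*_)
 open CommutativeRing ri
 open RingProperties ring
 open EA ri
 open SemiringExp semiring using(_^_)
 open In ri using(⟦_ah;+-homo;nh;*-homo;solve;_:=_)renaming(_:+_ to _al_;_:*_ to _ac_;:-_ to aC_)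
 open Pl ri
 open KG
 lo : ∀{m}(j : Fin m)→ Li(λ v → v j)
 lo j = record{resp = λ eq → eq j ;add = λ v w → refl ;tG = λ c v → refl}
 lN : ∀{m}→ Li{m}(λ v → 0#)
 lN = record{resp = λ _ → refl ;add = λ _ _ → sym(+-identityˡ 0#);tG = λ c _ → sym(zeroʳ c)}
 lK : ∀{m}{L M : Fu m}→ Li L → Li M → Li(λ v → L v + M v)
 lK{L = L}{M}l m = record
  {resp = λ eq → +-cong(Li.resp l eq)(Li.resp m eq)
  ;add = λ v w → trans(+-cong(Li.add l v w)(Li.add m v w))(solve 4(λ a b c d →(a al b)al(c al d):=(a al c)al(b al d))refl(L v)(L w)(M v)(M w))
  ;tG = λ c v → trans(+-cong(Li.tG l c v)(Li.tG m c v))(sym(distribˡ c _ _))}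
 lB : ∀{m}a{L : Fu m}→ Li L → Li(λ v → a * L v)
 lB a{L}l = record
  {resp = λ eq → *-congˡ(Li.resp l eq)
  ;add = λ v w → trans(*-congˡ(Li.add l v w))(distribˡ a _ _)
  ;tG = λ c v → trans(*-congˡ(Li.tG l c v))(solve 3(λ a c x → a ac(c ac x):= c ac(a ac x))refl a c(L v))}
 l5 : ∀{m}{L M : Fu m}→(∀ v → L v ≈ M v)→ Li M → Li L
 l5 eq l = record
  {resp = λ{v}{w}e → trans(eq v)(trans(Li.resp l e)(sym(eq w)))
  ;add = λ v w → trans(eq _)(trans(Li.add l v w)(sym(+-cong(eq v)(eq w))))
  ;tG = λ c v → trans(eq _)(trans(Li.tG l c v)(sym(*-congˡ(eq v))))}
 l3 : ∀{m}b{L : Fu m}→ Li L → Li(λ v → if b then L v else 0#)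
 l3 true l = l
 l3 false l = lN
 lW : ∀{m k}{L : Fin k → Fu m}→(∀ i → Li(L i))→ Li(λ v → Defs.sum(λ i → L i v))
 lW{k = zero}l = lN
 lW{k = suc k}l = lK(l Fin.zero)(lW(l ∘ Fin.suc))
 lh : ∀{m d n}(f : Polynomial d n)(u : Point d n)(ξ :(Fin m → ℂ)→ Point d n)→(∀ i c → Li(λ v → ξ v i c))→ Li(λ v → c₁(li f u(ξ v)))
 lh(const a)u ξ l& = lN
 lh(var i c)u ξ l& = l& i c
 lh(f :+ g)u ξ l& = l5(λ v → cT(li f u(ξ v))(li g u(ξ v)))(lK(lh f u ξ l&)(lh g u ξ l&))
 lh(f :* g)u ξ l& = l5(λ v → trans(cH(li f u(ξ v))(li g u(ξ v)))
  (+-cong(trans(*-congˡ(cl g u(ξ v)))(*-comm _ _))(*-congʳ(cl f u(ξ v)))))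
  (lK(lB(eval g u)(lh f u ξ l&))(lB(eval f u)(lh g u ξ l&)))
 module Ci(d : ℕ)where
  open Fm ri d
  pM : ℕ → ℂ
  pM zero = 1#
  pM(suc p)= - pM p
  sS : ℕ → ℕ → ℂ
  sS p zero = 1#
  sS p(suc q)= pM p * sS p q
  bP : ∀ f p → bh(we f p)ap pM p aX we f p
  bP f zero S = trans(bu S)(sym(*-identityˡ _))
  bP f(suc p)S = trans(bj(we f p)(vf(f(suc p)))S)(trans(co(bP f p)(bC(f(suc p)))S)
   (trans(a2(pM p aX we f p)(vf(f(suc p)))S)(trans(-‿cong(ak(pM p)(we f p)(vf(f(suc p)))S))(-‿distribˡ-* _ _))))
  wj : ∀ f p g q → we g q aI we f p ap sS p q aX(we f p aI we g q)
  wj f p g zero S = trans(iy(we f p)S)(trans(sym(ie(we f p)S))(sym(*-identityˡ _)))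
  wj f p g(suc q)S = trans(aA(we g q)(vf x)(we f p)S)
   (trans(co(ra{u = we g q})(tr(vF x(we f p))(tr(co(bP f p)(ra{u = vf x}))(ak(pM p)(we f p)(vf x))))S)
   (trans(ay(pM p)(we g q)(we f p aI vf x)S)(trans(*-congˡ(trans(sym(aA(we g q)(we f p)(vf x)S))
    (trans(co(wj f p g q)(ra{u = vf x})S)(trans(ak(sS p q)(we f p aI we g q)(vf x)S)(*-congˡ(aA(we f p)(we g q)(vf x)S))))))
    (sym(*-assoc _ _ _)))))
   where x = g(suc q)
  p> : ∀ p → pM p * pM p ≈ 1#
  p> zero = *-identityˡ 1#
  p>(suc p)= trans(solve 1(λ a → aC a ac aC a := a ac a)refl(pM p))(p> p)
  Sn : ∀ p q → sS p q * sS p q ≈ 1#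
  Sn p zero = *-identityˡ 1#
  Sn p(suc q)= trans(solve 2(λ a b → a ac b ac(a ac b):=(a ac a)ac(b ac b))refl(pM p)(sS p q))(trans(*-cong(p> p)(Sn p q))(*-identityˡ 1#))
 bk : ∀{d}(S : Subset d)→ basis S S ≡ 1#
 bk [] = P.refl
 bk(inside ∷ S)= bk S
 bk(outside ∷ S)= bk S
 sQ : ∀{n}(f : Fin n → ℂ)i →(∀ j → j ≢ i → f j ≈ 0#)→ Defs.sum f ≈ f i
 sQ{suc n}f Fin.zero oa = trans(+-congˡ(s*(f ∘ Fin.suc)λ j → oa(Fin.suc j)λ()))(+-identityʳ _)
 sQ{suc n}f(Fin.suc i)oa = trans(+-cong(oa Fin.zero λ())(sQ(f ∘ Fin.suc)i λ j ji → oa(Fin.suc j)(ji ∘ O.suc-injective)))(+-identityˡ _)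
 bp : ∀{d}{i j : Fin d}→ j ≢ i → basis ⁅ j ⁆ ⁅ i ⁆ ≡ 0#
 bp{i = Fin.zero}{Fin.zero}ji = ⊥-elim(ji P.refl)
 bp{i = Fin.zero}{Fin.suc j}ji = P.refl
 bp{i = Fin.suc i}{Fin.zero}ji = P.refl
 bp{i = Fin.suc i}{Fin.suc j}ji = bp(ji ∘ P.cong Fin.suc)
 bo : ∀{d}{i j : Fin d}→ j ≢ i → basis(∁ ⁅ j ⁆)(∁ ⁅ i ⁆)≡ 0#
 bo{i = Fin.zero}{Fin.zero}ji = ⊥-elim(ji P.refl)
 bo{i = Fin.zero}{Fin.suc j}ji = P.refl
 bo{i = Fin.suc i}{Fin.zero}ji = P.refl
 bo{i = Fin.suc i}{Fin.suc j}ji = bo(ji ∘ P.cong Fin.suc)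
 vX : ∀{d}(x : Fin d → ℂ)i → vector x ⁅ i ⁆ ≈ x i
 vX x i = trans(sQ(λ j → x j * basis ⁅ j ⁆ ⁅ i ⁆)i λ j ji → trans(*-congˡ(reflexive(bp ji)))(zeroʳ _))
  (trans(*-congˡ(reflexive(bk ⁅ i ⁆)))(*-identityʳ _))
 Cd : ∀{d}(φ : Fin d → ℂ)i → covector φ(∁ ⁅ i ⁆)≈ φ i * sgn ⁅ i ⁆(∁ ⁅ i ⁆)
 Cd φ i = trans(sQ(λ j → φ j *(sgn ⁅ j ⁆(∁ ⁅ j ⁆)* basis(∁ ⁅ j ⁆)(∁ ⁅ i ⁆)))i
  λ j ji → trans(*-congˡ(trans(*-congˡ(reflexive(bo ji)))(zeroʳ _)))(zeroʳ _))
  (*-congˡ(trans(*-congˡ(reflexive(bk(∁ ⁅ i ⁆))))(*-identityʳ _)))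
 f< : ∀{d}(A B : Subset d)→ sgn A B * sgn A B ≈ 1#
 f< A B = Sj(Defs.inversions A B)
  where
  Sj : ∀ n →(- 1#)^ n *(- 1#)^ n ≈ 1#
  Sj zero = *-identityˡ 1#
  Sj(suc n)= trans(solve 2(λ a x → a ac x ac(a ac x):=(a ac a)ac(x ac x))refl(- 1#)((- 1#)^ n))
   (trans(*-cong(trans(-1*x≈-x(- 1#))(-‿involutive 1#))(Sj n))(*-identityˡ 1#))
 module RM(h : Py)(ha : Unit(cf h))where
  private
   DQ = Ge.Dm h ha
   Gr = Ge.Gr h ha
  ga : ∀{r}{f : DQ → ℂ}m → Gr r f → Gr(⟦ + m ah * r)(λ s → f s ^ m)
  ga zero g = Ge.gr h ha(sym(zeroˡ _))(Ge.gc h ha 1#)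
  ga{r}(suc m)g = Ge.gr h ha(sym(trans(distribʳ r 1# ⟦ + m ah)(+-congʳ(*-identityˡ r))))(Ge.gz h ha g(ga m g))
  gp : ∀{n}{r : Fin n → ℂ}{f : DQ → Fin n → ℂ}→(∀ γ → Gr(r γ)(λ s → f s γ))→ Gr(Defs.sum r)(λ s → Defs.product(f s))
  gp{zero}g = Ge.gc h ha 1#
  gp{suc n}g = Ge.gz h ha(g Fin.zero)(gp{n}(g ∘ Fin.suc))
 Ca : ∀{d n}{σ : Signature n}(am : Admissible d σ){p q la lb a' a*}(w₁ : Weave(topWord am p la)a')(w₂ : Weave(topWord am q lb)a*)→
  1 N.≤ d → la N.+ lb ≡ n → 2 N.* length a' ≡ d N.*(d ∸ 1)→ 2 N.* length a* ≡ d N.*(d ∸ 1)→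
  d N.* d N.+((la N.+ trivalents w₁)N.+(lb N.+ trivalents w₂))N.< n N.* d N.+ suc(suc(d ∸ 1))
 Ca{suc e}{n}am{p}{q}{la}{lb}{a'}{a*}w₁ w₂ _ Lj Lp Lq = N.s≤s⁻¹(N.≤-reflexive(P.trans(P.cong(suc ∘ suc)m$)
  (P.trans(P.sym(P.trans(N.+-suc(n N.* suc e)(suc(suc e)))(P.cong suc(N.+-suc(n N.* suc e)(suc e)))))(N.+-suc(n N.* suc e)(suc(suc e))))))
  where
  open Data.Nat.Solver.+-*-Solver renaming(solve to S?;_:=_ to _⟨=⟩_;_:+_ to _bR_;_:*_ to _⊛_;con to Cb)
  Ta = trivalents w₁ ;Tb = trivalents w₂ ;Bb = length a' ;Ba = length a*
  tU : Ta N.+ Bb ≡ la N.* e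
  tU = P.trans(tl w₁)(TW.tx am p la)
  tP : Tb N.+ Ba ≡ lb N.* e
  tP = P.trans(tl w₂)(TW.tx am q lb)
  B : Bb N.+ Ba ≡ suc e N.* e
  B = N.*-cancelˡ-≡(Bb N.+ Ba)(suc e N.* e)2(P.trans(N.*-distribˡ-+ 2 Bb Ba)(P.trans(P.cong₂ N._+_ Lp Lq)(S? 1(λ e → e bR e ⟨=⟩ Cb 2 ⊛ e)P.refl(suc e N.* e))))
  m$ : suc e N.* suc e N.+((la N.+ Ta)N.+(lb N.+ Tb))≡ n N.* suc e N.+ suc e
  m$ = N.+-cancelʳ-≡(Bb N.+ Ba)_ _(P.trans(S? 7(λ D la lb Ta Tb Bb Ba → D bR((la bR Ta)bR(lb bR Tb))bR(Bb bR Ba)⟨=⟩ D bR((la bR(Ta bR Bb))bR(lb bR(Tb bR Ba))))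
   P.refl(suc e N.* suc e)la lb Ta Tb Bb Ba)
   (P.trans(P.cong₂(λ x y → suc e N.* suc e N.+((la N.+ x)N.+(lb N.+ y)))tU tP)
   (P.trans(S? 3(λ e a b →(Cb 1 bR e)⊛(Cb 1 bR e)bR((a bR a ⊛ e)bR(b bR b ⊛ e))⟨=⟩(a bR b)⊛(Cb 1 bR e)bR(Cb 1 bR e)bR(Cb 1 bR e)⊛ e)P.refl e la lb)
    (P.cong₂(λ x y → x N.* suc e N.+ suc e N.+ y)Lj(P.sym B)))))
module We where
 open IS
 open CN
 open Ex
 open FB using(module Fm)
 open Sl
 open KF
 open KW
 open Wo using(Ac)
 open BP using(module Aa)
 open To
 open Bt
 open SS
 open Du
 open CL
 open De
 open RF
 open TP using(module Pa;module TG)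
 open import Defs using(sign)
 open CommutativeRing ri
 open EA ri
 module WF{d n : ℕ}{σ : Signature n}(am : Admissible d σ)(dd : 2 N.≤ d)(p : ℤ)(l : ℕ)(Dr : d N.< l)
  {ae}(w : Weave(topWord am p l)ae)(ve : All(VL d)ae)(aG : Ac id ae)
  (Δ : Fin(l N.+ trivalents w)→ K d σ)(va : AreWeaveVariables am p l w Δ)
  {S : Set}(aO : FF ri S)(po : S → Point d n)(ge : ∀ s → Unit(eval(proj₁ va)(po s)))where
  open TW am
  open PS am dd
  open TG am dd p using(L;mH;df)
  open Fm ri d
  open Po ri d aO
  open FF aO
  open DD am dd p l Dr w ve aG using(ci;bottom;rr)public
  N = l N.+ trivalents w
  xs = positions am l
  dt = λ s → proj₂(proj₂ va)(po s)(ge s)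
  c ca : S → Fin N → ℂ
  c s = proj₁(dt s)
  ca s γ = proj₁(proj₂(proj₁(proj₂(dt s))γ))
  cv : ∀ s γ → c s γ * ca s γ ≈ 1#
  cv s γ = proj₂(proj₂(proj₁(proj₂(dt s))γ))
  hV : ∀ s γ → Defs.HasValue(Δ γ)(po s)(c s γ)
  hV s γ = proj₁(proj₁(proj₂(dt s))γ)
  private
   module W = WP ri d aO c ca cv
   module F = Fi d dd aO c ca cv
   module B = Bo ri Co.stable d aO c ca cv
  open W public using()renaming(value to wV;vl to wC;kF to kZ;Kf to k*)
  open B public using()renaming(vu to wH;r1 to r$)
  U : S → Fl
  U s = intermediate am(po s)p 1
  rn : ℕ × ℕ → S → Fl
  rn(i , k)s = intermediate am(po s)(p I.+ + i)(suc k)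
  dq : ∀ s → Decoration(c s)w l(topWeights am p l)(U s)(B.ea s(pL L rn xs))
  dq s = P.subst(Decoration(c s)w l(topWeights am p l)(U s))(P.sym(Pa.ep am dd aO c ca cv L rn xs s))(proj₂(proj₂(dt s)))
  lg : La.Lb W.Cs w l(topWeights am p l)U(pL L rn xs)
  lg = F.family w l(topWeights am p l)U(pL L rn xs)dq
  fE : ∀ s → ¬ ¬ ∃ λ g → de g ≈ 1# × Re g(U s)
  fE s = Fg.fj d dd(F.Sm(topWeights am p l)_(F.te w(dq s)))
  Bk = La.bL W.Cs w lg
  private module A = B.AR bottom{U}Bk ve aG rr(La.bS W.Cs w lg)fE
  open A public using()renaming(sign to mS;Kc to k>;k< to Kj;b to fV;Bi to fJ)
  nx : ∀ i → p I.+ + i I.+ + 1 ≡ p I.+ + suc i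
  nx i = P.trans(I.+-assoc p(+ i)(+ 1))(P.cong(λ j → p I.+ + j)(N.+-comm i 1))
  Ul : ∀ s k → U s k ≡ 𝓕 am(po s)p k
  Ul s k = ig am df(po s)p k
  rW : ∀ i s k → rn(i , d ∸ 1)s k ≡ 𝓕 am(po s)(p I.+ + suc i)k
  rW i s k = P.trans(P.cong(λ m → intermediate am(po s)(p I.+ + i)m k)(N.m+[n∸m]≡n df))
   (P.trans(iA am df(po s)(p I.+ + i)k)(P.cong(λ j → 𝓕 am(po s)j k)(nx i)))
  Vl : ∀ s k → A.V s k ≡ 𝓕 am(po s)(p I.+ + l)k
  Vl s k = P.trans(P.cong(λ V → V s k)(P.trans(La.ll W.Cs w lg)(pI L rn U l)))(l8 l(N.<-≤-trans(N.s≤s N.z≤n)Dr))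
   where
   l8 : ∀ l → 1 N.≤ l → lq U rn l 1 s k ≡ 𝓕 am(po s)(p I.+ + l)k
   l8(suc l)_ = rW l s k
  mK : ℕ → S → ℂ
  mK κ s = top(𝓕 am(po s)p κ aI 𝓕 am(po s)(p I.+ + l)(d ∸ κ))
  mN : ∀ κ s → κ N.≤ d → mK κ s ≈ A.sign κ s * W.value(ci κ)s
  mN κ s da = trans(reflexive(P.cong₂(λ u v → top(u aI v))(P.sym(Ul s κ))(P.sym(Vl s(d ∸ κ)))))(A.hv s κ da)
  S^ : ∀ κ s → A.sign κ s * A.sign κ s ≈ 1#
  S^ κ s = A.S^ κ s
  fL : ℕ → S → ℂ
  fL k s = A.Fc k s *(A.sign k s * B.vu(ci k)s)
  eJ : ℕ → Fin d → S → ℂ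
  eJ k i s = top(𝓕 am(po s)p k aI ct i(𝓕 am(po s)(p I.+ + l)(suc(d ∸ k))))
  eM : ∀ k i s → eJ k i s ≈ A.E k i s
  eM k i s = reflexive(P.cong₂(λ u v → top(u aI ct i v))(P.sym(Ul s k))(P.sym(Vl s(suc(d ∸ k)))))
  k8 :(∀ a → Known(W.value a))→(∀ k i → 1 N.≤ k → k N.≤ d → Known(eJ k i))→ Kw A.b
  k8 kv ke k i = B.k% k λ kk kd → ko(A.k< kv k)(kr(eM k i)(ke k i kk kd))
  private
   KC : ℕ →(ℕ → ℕ)→(S → Fl)→(S → Fl)→ Set
   KC k a U W = Ko W
   kT : ∀{β}(γs : Weights β)U Gs → W.KL Gs → La.Slice KC γs U Gs
   kT [] U [] _ = tt
   kT(a ∷ γs)U(W ∷ Gs)(kW , k)= kW , kT γs W Gs k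
  k4 :(∀ a → Known(W.value a))→ Kw A.b → ∀ i → i N.≤ l → ∀ k → k N.≤ d → Kn(λ s → 𝓕 am(po s)(p I.+ + i)k)
  k4 kv kb zero _ k kd T = kr(λ s → reflexive(P.cong(λ x → x T)(P.trans(Ul s k)
   (P.cong(λ j → 𝓕 am(po s)j k)(P.sym(I.+-identityʳ p))))))(proj₁(A.kq kv kb)k kd T)
  k4 kv kb(suc i)i7 k kd T = kr(λ s → reflexive(P.cong(λ x → x T)(rW i s k)))
   (pA KC L mH rn U l(kT(topWeights am p l)U(pL L rn xs)kE)i(d ∸ 1)i7
    (N.∸-monoˡ-≤ 1 dd)(N.≤-reflexive(N.m+[n∸m]≡n df))k kd T)
   where
   kE : W.KL(pL L rn xs)
   kE = W.uA w(tW p l)kv(A.fW kv kb)(proj₁(A.kq kv kb))lg(proj₂(A.kq kv kb))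
module Ft where
 open IS
 open CN
 open Ex
 open FB using(module Fm)
 open Sl
 open KF
 open KW
 open Wo using(Ac)
 open Ie using(module Cu;sd;wa)
 open To
 open Gd using(wi;su;rc;ro)
 open Bt
 open Du
 open Ln
 open CL
 open De
 open RF
 open LF
 open We
 open import Defs using(sign;_:+_;_:*_;num;den)
 open CommutativeRing ri
 open RingProperties ring
 open EA ri
 open In ri using(⟦_ah;+-homo;nh;*-homo;solve;_:=_)renaming(_:+_ to _al_;_:*_ to _ac_;:-_ to aC_)
 open Pl ri
 open KG
 module MR(h : Py)(ha : Unit(cf h))where
  private
   S = Ge.Dm h ha
   Gr = Ge.Gr h ha
  open Closure ri(FF.functionRing(Ge.gF h ha))using(Kn;kB)
  Go : ∀{m}→ ℂ →(S → Et m)→ Set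
  Go r u = ∀ T → Gr r(λ s → u s T)
  gk : ∀{r}{f g : S → ℂ}→ Gr 0# f → Gr r g → Gr r(λ s → f s * g s)
  gk{r}kf kg = Ge.gr h ha(+-identityˡ r)(Ge.gz h ha kf kg)
  gw : ∀{m r}{u v : S → Et m}→ Kn u → Go r v → Go r(λ s → u s aI v s)
  gw ku gv [] = gk(ku [])(gv [])
  gw ku gv(inside ∷ T)= Ge.gL h ha(gw(ku ∘(inside ∷_))(gv ∘(outside ∷_))T)
   (gw(kB(ku ∘(outside ∷_)))(gv ∘(inside ∷_))T)
  gw ku gv(outside ∷ T)= gw(ku ∘(outside ∷_))(gv ∘(outside ∷_))T
  gJ : ∀ r → Gr r(λ _ → 0#)
  gJ r = record{num = [] ;den = 1# ∷ [] ;dm = 1# , *-identityˡ 1# ;rA = λ s → zeroˡ _}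
   , trans(+-cong(zeroˡ _)(trans(-‿cong(zeroˡ _))-0#≈0#))(trans(+-identityˡ 0#)(sym(trans(*-congˡ(zeroˡ _))(zeroʳ r))))
  gi : ∀{m r}{x : S → Fin m → ℂ}→(∀ c → Gr r(λ s → x s c))→ Go r(λ s → vf(x s))
  gi{r = r}gx [] = gJ r
  gi{r = r}{x}gx(inside ∷ T)= Ge.gr h ha(+-identityʳ r)
   (Ge.gz h ha(gx Fin.zero)(Ge.gc h ha(un T)))
  gi gx(outside ∷ T)= gi(gx ∘ Fin.suc)T
  gK : ∀{d n}(f : Polynomial d n)u ξ r → c₁(li f u ξ)≈ r * eval f u → Gr r(λ(s : S)→ eval f(Av u ξ(proj₁ s)))
  gK f u ξ r r6 = record{num = li f u ξ ;den = 1# ∷ [] ;dm = 1# , *-identityˡ 1#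
   ;rA = λ s → trans(*-congˡ(trans(+-congˡ(zeroʳ(proj₁ s)))(+-identityʳ 1#)))(trans(*-identityʳ _)(sym(ei f u ξ(proj₁ s))))}
   , trans(+-cong(*-identityʳ _)(trans(-‿cong(zeroʳ _))-0#≈0#))(trans(+-identityʳ _)(trans r6(*-congˡ(sym(trans(*-identityʳ _)(cl f u ξ))))))
  gq : ∀{d n}(f g : Polynomial d n)u ξ r(c : S → ℂ)→ Unit(eval g u)→(∀ s → eval f(Av u ξ(proj₁ s))≈ c s * eval g(Av u ξ(proj₁ s)))→
   c₁(li f u ξ)* eval g u + -(eval f u * c₁(li g u ξ))≈ r *(eval f u * eval g u)→ Gr r c
  gq f g u ξ r c gP value r6 = record{num = li f u ξ ;den = li g u ξ ;dm = ur(sym(cl g u ξ))gP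
   ;rA = λ s → trans(*-congˡ(ei g u ξ(proj₁ s)))(trans(sym(value s))(sym(ei f u ξ(proj₁ s))))}
   , trans(+-cong(*-congˡ(cl g u ξ))(-‿cong(*-congʳ(cl f u ξ))))(trans r6(*-congˡ(*-cong(sym(cl f u ξ))(sym(cl g u ξ)))))
 module _{d n : ℕ}{σ : Signature n}(am : Admissible d σ)(dd : 2 N.≤ d){S : Set}(aO : FR ri S)(po : S → Point d n)where
  open FR aO
  open Closure ri aO using(Kn)
  fF : ∀ j →(∀ k → k N.≤ d → Kn(λ s → 𝓕 am(po s)j k))→ ∀ c → Known(λ s → po s(rd am j)c)
  fF j Kr c = b0(cW am j)
   where
   b0 : sign σ j ≡ Sign.+ ⊎ sign σ j ≡ Sign.- → Known(λ s → po s(rd am j)c)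
   b0(inj₁ bl)= kr(λ s → trans(reflexive(P.cong(λ x → x ⁅ c ⁆)(b6 am dd{po s}bl)))(vX(po s(rd am j))c))
    (Kr 1(N.≤-trans(N.s≤s N.z≤n)dd)⁅ c ⁆)
   b0(inj₂ wh)= kr(λ s → trans(*-congʳ{ε}(trans(reflexive(P.cong(λ x → x(∁ ⁅ c ⁆))(l< s)))(Cd(po s(rd am j))c)))
    (trans(*-assoc(po s(rd am j)c)ε ε)(trans(*-congˡ(f< ⁅ c ⁆(∁ ⁅ c ⁆)))(*-identityʳ _))))
    (ko(Kr(d ∸ 1)(N.m∸n≤m d 1)(∁ ⁅ c ⁆))(kn ε))
    where
    ε = sgn ⁅ c ⁆(∁ ⁅ c ⁆)
    l< : ∀ s → 𝓕 am(po s)j(d ∸ 1)≡ covector(component am(po s)j)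
    l< s = t0 d dd P.refl
     where
     t0 : ∀ e → 2 N.≤ e → e ≡ d → 𝓕 am(po s)j(e ∸ 1)≡ covector(component am(po s)j)
     t0(suc(suc e))_ eq = wK am eq{po s}wh
     t0(suc zero)(N.s≤s())eq
module LS where
 open IS
 open CN
 open Ex
 open FB using(module Fm;rl;fa)
 open Sl
 open KF
 open KW
 open Wo using(Ac)
 open Ie using(module Cu;sd;wa)
 open To
 open Gd using(wi;su;rc;ro)
 open Bt
 open Du
 open Ln
 open CL
 open De
 open RF
 open LF
 open We
 open Ft
 open import Defs using(_:+_;_:*_;num;den)
 open import Data.Fin.Base using(combine)
 open CommutativeRing ri
 open RingProperties ring
 open EA ri
 open In ri using(⟦_ah;+-homo;nh;*-homo;solve;_:=_)renaming(_:+_ to _al_;_:*_ to _ac_;:-_ to aC_)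
 open Pl ri
 open KG
 private
  module g! = CommutativeMonoidSum +-commutativeMonoid
  module g> = SemiringSum semiring
 module Qu(R : CommutativeRing 0ℓ 0ℓ)where
  private module R = CommutativeRing R
  qu : ∀{c cB m e w}→ e R.* w R.≈ R.1# → m R.≈ c R.* e → m R.≈ cB R.* e → c R.≈ cB
  qu{c}{cB}{m}{e}{w}ew Mf m^ = R.trans(R.sym(Dq c))(R.trans(R.*-congʳ(R.trans(R.sym Mf)m^))(Dq cB))
   where
   Dq : ∀ c → c R.* e R.* w R.≈ c
   Dq c = R.trans(R.*-assoc c e w)(R.trans(R.*-congˡ ew)(R.*-identityʳ c))
 module It(R : CommutativeRing 0ℓ 0ℓ)where
  private module R = CommutativeRing R
  open In R using()renaming(⟦_ah to ⟦_⟧;+-homo to Ik;*-homo to Il)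
  private
   module Ry = CommutativeMonoidSum R.+-commutativeMonoid
   module RE = SemiringSum R.semiring
  open Ry using(sum)
  SE : ∀{n}(f : Fin n → ℤ)→ ⟦ su f ⟧ R.≈ sum(λ i → ⟦ f i ⟧)
  SE{zero}f = R.refl
  SE{suc n}f = R.trans(Ik(f Fin.zero)(su(f ∘ Fin.suc)))(R.+-congˡ(SE{n}(f ∘ Fin.suc)))
  S3 : ∀{N m}(a : Fin N → ℤ)(D : Fin m → Fin N → ℤ)(x : Fin m → R.Carrier)→
   sum(λ γ → ⟦ a γ ⟧ R.* sum(λ j → ⟦ D j γ ⟧ R.* x j))R.≈ sum(λ j → x j R.* ⟦ su(λ γ → a γ I.* D j γ)⟧)
  S3{N}{m}a D x = R.trans
   (Ry.sum-cong-≋{N}λ γ → R.trans(RE.*-distribˡ-sum ⟦ a γ ⟧(λ j → ⟦ D j γ ⟧ R.* x j))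
    (Ry.sum-cong-≋{m}λ j → R.trans(R.sym(R.*-assoc _ _ _))(R.trans(R.*-congʳ(R.sym(Il(a γ)(D j γ))))(R.*-comm _ _))))
   (R.trans(Ry.∑-comm{N}{m}(λ γ j → x j R.* ⟦ a γ I.* D j γ ⟧))
    (Ry.sum-cong-≋{m}λ j → R.trans(R.sym(RE.*-distribˡ-sum(x j)(λ(γ : Fin N)→ ⟦ a γ I.* D j γ ⟧)))(R.*-congˡ(R.sym(SE{N}λ γ → a γ I.* D j γ)))))
 record C3{d n : ℕ}{σ : Signature n}(am : Admissible d σ)(dd : 2 N.≤ d): Set where
  field
   p q : ℤ
   la lb : ℕ
   dA : d N.< la
   dC : d N.< lb
   ln : la N.+ lb ≡ n
   a' a* : Word
   w₁ : Weave(topWord am p la)a'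
   w₂ : Weave(topWord am q lb)a*
   vd : All(VL d)a'
   ao : Ac id a'
   vc : All(VL d)a*
   ax : Ac id a*
   Δ₁ : Fin(la N.+ trivalents w₁)→ K d σ
   variables₁ : AreWeaveVariables am p la w₁ Δ₁
   Δ₂ : Fin(lb N.+ trivalents w₂)→ K d σ
   variables₂ : AreWeaveVariables am q lb w₂ Δ₂
   p* : ∀ u k → 𝓕 am u(p I.+ + la)k ≡ 𝓕 am u q k
   qb : ∀ u k → 𝓕 am u(q I.+ + lb)k ≡ 𝓕 am u p k
   covering : ∀ r →(∃ λ i → i N.< la × rd am(p I.+ + i)≡ r)⊎(∃ λ i → i N.< lb × rd am(q I.+ + i)≡ r)
   ag : ℕ
   vg : VL d ag
   b' : Fin(la N.+ trivalents w₁)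
   ε : ℂ
   Cz : ∀ u → Unit(eval(proj₁ variables₁)u)→ Unit(eval(proj₁ variables₂)u)→
    eval(function(num(Δ₁ b')))u ≈ ε * top(𝓕 am u p ag aI 𝓕 am u q(d ∸ ag))* eval(function(den(Δ₁ b')))u
 module Id{d n : ℕ}{σ : Signature n}(am : Admissible d σ)(dd : 2 N.≤ d)(C4 : C3 am dd)where
  open C3 C4
  module Db = DD am dd p la dA w₁ vd ao
  module Dc = DD am dd q lb dC w₂ vc ax
  Na = la N.+ trivalents w₁
  Nb = lb N.+ trivalents w₂
  hF = proj₁ variables₁
  hG = proj₁ variables₂
  h = hF :* hG
  m = d ∸ 1
  M = n N.* d N.+ suc(suc m)
  df : 1 N.≤ d
  df = N.≤-trans(N.s≤s N.z≤n)dd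
  mJ : suc m ≡ d
  mJ = N.m+[n∸m]≡n df
  iE : ∀(k : Fin m)→ VL d(suc(toℕ k))
  iE k = N.s≤s N.z≤n , P.subst(suc(toℕ k)N.<_)mJ(N.s≤s(O.toℕ<n k))
  d2 : Fin m → ℕ → ℤ
  d2 k = Dc.dD(suc(toℕ k))(iE k)
  dZ :(Fin M → ℂ)→ Point d n
  dZ v i c = v(combine i c ↑ˡ suc(suc m))
  x* xt :(Fin M → ℂ)→ ℂ
  x* v = v(n N.* d ↑ʳ Fin.zero)
  xt v = v(n N.* d ↑ʳ Fin.suc Fin.zero)
  xq :(Fin M → ℂ)→ Fin m → ℂ
  xq v k = v(n N.* d ↑ʳ Fin.suc(Fin.suc k))
  eA : ∀ k i → ∃ λ(E : Polynomial d n)→ ∀ u → eval E u ≈ top(𝓕 am u p k aI ct i(𝓕 am u(p I.+ + la)(suc(d ∸ k))))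
  eA k i = C.kC(pC am p k)(C.ki i(pC am(p I.+ + la)(suc(d ∸ k))))full
   where module C = Closure ri(pR d n)
  Dh : Fin(d N.* d N.+(Na N.+ Nb))→(Fin d × Fin d)⊎(Fin Na ⊎ Fin Nb)
  Dh r = Sum.map(remQuot{d}d)(splitAt Na)(splitAt(d N.* d)r)
  eN :(Fin d × Fin d)⊎(Fin Na ⊎ Fin Nb)→ Fin(d N.* d N.+(Na N.+ Nb))
  eN(inj₁(k , i))= combine k i ↑ˡ(Na N.+ Nb)
  eN(inj₂(inj₁ γ))= d N.* d ↑ʳ(γ ↑ˡ Nb)
  eN(inj₂(inj₂ γ))= d N.* d ↑ʳ(Na ↑ʳ γ)
  dF : ∀ x → Dh(eN x)≡ x
  dF(inj₁(k , i))= P.trans(P.cong(Sum.map(remQuot{d}d)(splitAt Na))(O.splitAt-↑ˡ(d N.* d)(combine k i)(Na N.+ Nb)))(P.cong inj₁(O.remQuot-combine{d}{d}k i))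
  dF(inj₂(inj₁ γ))= P.trans(P.cong(Sum.map(remQuot{d}d)(splitAt Na))(O.splitAt-↑ʳ(d N.* d)(Na N.+ Nb)(γ ↑ˡ Nb)))(P.cong inj₂(O.splitAt-↑ˡ Na γ Nb))
  dF(inj₂(inj₂ γ))= P.trans(P.cong(Sum.map(remQuot{d}d)(splitAt Na))(O.splitAt-↑ʳ(d N.* d)(Na N.+ Nb)(Na ↑ʳ γ)))(P.cong inj₂(O.splitAt-↑ʳ Na Nb γ))
  module b&(aM : Fin Na)(ua : Point d n)(ha : Unit(eval h ua))where
   rm : ℕ →(Fin M → ℂ)→ ℂ
   rm k v = if k N.≡ᵇ d then xt v else 0#
   rq : Fin Na →(Fin M → ℂ)→ ℂ
   rq γ v = if does(γ O.≟ aM)then x* v else 0#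
   rF : Fin Nb →(Fin M → ℂ)→ ℂ
   rF γ v = Defs.sum λ k → ⟦ d2 k(toℕ γ)ah * xq v k
   dr : Polynomial d n →(Fin M → ℂ)→ ℂ
   dr f v = c₁(li f ua(dZ v))
   Rq : Fin d → Fin d → Fu M
   Rq k i v = dr E v + - 1# *(eval E ua * rm(suc(toℕ k))v)
    where E = proj₁(eA(suc(toℕ k))i)
   r7 :(f g : Polynomial d n)→ Fu M → Fu M
   r7 f g r6 v =(eval g ua * dr f v + - eval f ua * dr g v)+ -(eval f ua * eval g ua)* r6 v
   lk : ∀ f → Li(dr f)
   lk f = lh f ua dZ λ i c → lo(combine i c ↑ˡ suc(suc m))
   l! : Li xt
   l! = lo(n N.* d ↑ʳ Fin.suc Fin.zero)
   lZ : ∀ k → Li(rm k)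
   lZ k = l3(k N.≡ᵇ d){xt}l!
   l4 : ∀ k i → Li(Rq k i)
   l4 k i = lK{L = dr E}{λ v → - 1# *(eval E ua * rm(suc(toℕ k))v)}(lk E)
    (lB(- 1#){λ v → eval E ua * rm(suc(toℕ k))v}(lB(eval E ua){rm(suc(toℕ k))}(lZ(suc(toℕ k)))))
    where E = proj₁(eA(suc(toℕ k))i)
   l6 : ∀ f g{r6}→ Li r6 → Li(r7 f g r6)
   l6 f g{r6}l& = lK{L = λ v → eval g ua * dr f v + - eval f ua * dr g v}{λ v → -(eval f ua * eval g ua)* r6 v}
    (lK{L = λ v → eval g ua * dr f v}{λ v → - eval f ua * dr g v}
     (lB(eval g ua){dr f}(lk f))(lB(- eval f ua){dr g}(lk g)))
    (lB(-(eval f ua * eval g ua)){r6}l&)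
   l0 : ∀ γ → Li(rq γ)
   l0 γ = l3(does(γ O.≟ aM)){x*}(lo(n N.* d ↑ʳ Fin.zero))
   l2 : ∀ γ → Li(rF γ)
   l2 γ = lW{L = λ k v → ⟦ d2 k(toℕ γ)ah * xq v k}λ k →
    lB ⟦ d2 k(toℕ γ)ah{λ v → xq v k}(lo(n N.* d ↑ʳ Fin.suc(Fin.suc k)))
   Rz : Fin Na → Fu M
   Rz γ = r7(function(num(Δ₁ γ)))(function(den(Δ₁ γ)))(rq γ)
   RA : Fin Nb → Fu M
   RA γ = r7(function(num(Δ₂ γ)))(function(den(Δ₂ γ)))(rF γ)
   Ra :(Fin d × Fin d)⊎(Fin Na ⊎ Fin Nb)→ Fu M
   Ra(inj₁(k , i))= Rq k i
   Ra(inj₂(inj₁ γ))= Rz γ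
   Ra(inj₂(inj₂ γ))= RA γ
   lG : ∀ r → Li(Ra r)
   lG(inj₁(k , i))= l4 k i
   lG(inj₂(inj₁ γ))= l6(function(num(Δ₁ γ)))(function(den(Δ₁ γ))){rq γ}(l0 γ)
   lG(inj₂(inj₂ γ))= l6(function(num(Δ₂ γ)))(function(den(Δ₂ γ))){rF γ}(l2 γ)
   rV : Fin(d N.* d N.+(Na N.+ Nb))→ Fu M
   rV = Ra ∘ Dh
   rX : ∀{v}→(∀ r → rV r v ≈ 0#)→ ∀ x → Ra x v ≈ 0#
   rX{v}s^ x = trans(reflexive(P.cong(λ y → Ra y v)(P.sym(dF x))))(s^(eN x))
   eC : d N.* d N.+(Na N.+ Nb)N.< M
   eC = Ca am{p}{q}{la}{lb}w₁ w₂ df ln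
    (Cu.lu d vd ao λ j jj jd → P.trans(P.sym(wa w₁ id j))(TW.tp am p la(N.<⇒≤ dA)j jj jd))
    (Cu.lu d vc ax λ j jj jd → P.trans(P.sym(wa w₂ id j))(TW.tp am q lb(N.<⇒≤ dC)j jj jd))
   module f'(v : Fin M → ℂ)(s^ : ∀ r → rV r v ≈ 0#)where
    ξ = dZ v
    H = li h ua ξ
    Ha : Unit(cf H)
    Ha = ur(sym(cl h ua ξ))ha
    S = Ge.Dm H Ha
    Gr = Ge.Gr H Ha
    open MR H Ha
    open RM H Ha
    po : S → Point d n
    po s = Av ua ξ(proj₁ s)
    ge : ∀ s → Unit(eval hF(po s)* eval hG(po s))
    ge s = ur(ei h ua ξ(proj₁ s))(proj₂ s)
    gC : ∀ s → Unit(eval hF(po s))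
    gC s = eval hG(po s)* proj₁(ge s), trans(sym(*-assoc _ _ _))(proj₂(ge s))
    gD : ∀ s → Unit(eval hG(po s))
    gD s = eval hF(po s)* proj₁(ge s), trans(solve 3(λ a b z → b ac(a ac z):= a ac b ac z)refl(eval hF(po s))(eval hG(po s))(proj₁(ge s)))(proj₂(ge s))
    aO = Ge.gF H Ha
    module Fa = WF am dd p la dA w₁ vd ao Δ₁ variables₁ aO po gC
    module Fb = WF am dd q lb dC w₂ vc ax Δ₂ variables₂ aO po gD
    or = Ge.or H Ha
    uo : ∀ g → Unit(eval g(po or))→ Unit(eval g ua)
    uo g = ur(ec g λ i c → trans(+-congˡ(zeroˡ _))(+-identityʳ(ua i c)))
    Rb : ∀ f g{r6 : Fu M}→ r7 f g r6 v ≈ 0# → c₁(li f ua ξ)* eval g ua + -(eval f ua * c₁(li g ua ξ))≈ r6 v *(eval f ua * eval g ua)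
    Rb f g{r6}eq = trans(sym(+-identityʳ _))(trans(+-congˡ(sym(-‿inverseˡ _)))
     (trans(solve 5(λ fc g gO f r → fc ac g al aC(f ac gO)al(aC(r ac(f ac g))al r ac(f ac g)):=(g ac fc al aC f ac gO)al aC(f ac g)ac r al r ac(f ac g))refl
      (c₁(li f ua ξ))(eval g ua)(c₁(li g ua ξ))(eval f ua)(r6 v))
      (trans(+-congʳ eq)(+-identityˡ _))))
    gb : ∀ γ → Gr(rq γ v)(λ s → Fa.c s γ)
    gb γ = gq f g ua ξ(rq γ v)(λ s → Fa.c s γ)(uo g(proj₁(Fa.hV or γ)))
     (λ s → proj₂(Fa.hV s γ))(Rb f g{rq γ}(rX{v}s^(inj₂(inj₁ γ))))
     where
     f = function(num(Δ₁ γ))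
     g = function(den(Δ₁ γ))
    gE : ∀ γ → Gr(rF γ v)(λ s → Fb.c s γ)
    gE γ = gq f g ua ξ(rF γ v)(λ s → Fb.c s γ)(uo g(proj₁(Fb.hV or γ)))
     (λ s → proj₂(Fb.hV s γ))(Rb f g{rF γ}(rX{v}s^(inj₂(inj₂ γ))))
     where
     f = function(num(Δ₂ γ))
     g = function(den(Δ₂ γ))
    open FF aO
    open Po ri d aO using(Kw;Kn)
    tg :(ℕ → ℕ)→ ℂ
    tg a = Defs.sum λ γ → ⟦ + a(toℕ γ)ah * rq γ v
    tj :(ℕ → ℕ)→ ℂ
    tj a = Defs.sum λ γ → ⟦ + a(toℕ γ)ah * rF γ v
    gl : ∀ a → Gr(tg a)(Fa.wV a)
    gl a = gp{Na}{λ γ → ⟦ + a(toℕ γ)ah * rq γ v}{λ s γ → Fa.c s γ Defs.^ a(toℕ γ)}λ γ → ga(a(toℕ γ))(gb γ)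
    gf : ∀ a → Gr(tj a)(Fb.wV a)
    gf a = gp{Nb}{λ γ → ⟦ + a(toℕ γ)ah * rF γ v}{λ s γ → Fb.c s γ Defs.^ a(toℕ γ)}λ γ → ga(a(toℕ γ))(gE γ)
    tk : ∀ a → tg a ≈ ⟦ + a(toℕ aM)ah * x* v
    tk a = trans(sQ(λ γ → ⟦ + a(toℕ γ)ah * rq γ v)aM(λ γ bW → trans(*-congˡ(reflexive(ot γ bW)))(zeroʳ _)))
     (*-congˡ(reflexive gV))
     where
     ot : ∀ γ → γ ≢ aM → rq γ v ≡ 0#
     ot γ bW with γ O.≟ aM
     ... | yes eq = ⊥-elim(bW eq)
     ... | no _ = P.refl
     gV : rq aM v ≡ x* v
     gV with aM O.≟ aM
     ... | yes _ = P.refl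
     ... | no ≢ = ⊥-elim(≢ P.refl)
    tQ : ∀ k → tj(Dc.ci(suc(toℕ k)))≈ xq v k
    tQ k = trans(It.S3 ri{Nb}{m}(λ γ → + a(toℕ γ))(λ j γ → d2 j(toℕ γ))(xq v))
     (trans(sQ(λ j → xq v j * ⟦ wi Nb(d2 j)a ah)k(λ j jk → trans(*-congˡ(reflexive(P.cong ⟦_ah(oa j jk))))(zeroʳ(xq v j))))
      (trans(*-congˡ(trans(reflexive(P.cong ⟦_ah on))(+-identityʳ 1#)))(*-identityʳ(xq v k))))
     where
     a = Dc.ci(suc(toℕ k))
     oa : ∀ j → j ≢ k → wi Nb(d2 j)a ≡ I.0ℤ
     oa j jk = P.trans(Dc.d2(suc(toℕ j))(iE j)(suc(toℕ k))(iE k))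
      (P.cong(λ f → f _)(ro(λ _ → + 1)(λ _ _ → I.0ℤ)(λ eq → jk(P.sym(O.toℕ-injective(N.suc-injective eq))))))
     on : wi Nb(d2 k)a ≡ + 1
     on = P.trans(Dc.d2(suc(toℕ k))(iE k)(suc(toℕ k))(iE k))(P.cong(λ f → f _)(rc(suc(toℕ k))(λ _ → + 1)(λ _ _ → I.0ℤ)))
    private
     module Cm = Ci d
     module Fr = Fm ri d
    mK : ℕ → S → ℂ
    mK κ s = top(𝓕 am(po s)p κ aI 𝓕 am(po s)q(d ∸ κ))
    mW : ∀ κ s → κ N.≤ d → mK κ s ≈ Fa.mS κ s * Fa.wV(Db.ci κ)s
    mW κ s da = trans(reflexive(P.cong(λ x → top(𝓕 am(po s)p κ aI x))(P.sym(p*(po s)(d ∸ κ)))))(Fa.mN κ s da)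
    m6 : ∀ κ s → κ N.≤ d → mK κ s ≈ Cm.sS κ(d ∸ κ)*(Fb.mS(d ∸ κ)s * Fb.wV(Dc.ci(d ∸ κ))s)
    m6 κ s da = trans(Co.stable _ _ λ k → Fa.fE s λ(f , _ , rf)→ Fb.fE s λ(g , _ , rg)→ k(swap f g rf rg))
     (*-congˡ{Cm.sS κ(d ∸ κ)}(Fb.mN(d ∸ κ)s(N.m∸n≤m d κ)))
     where
     A = 𝓕 am(po s)p κ
     B = 𝓕 am(po s)q(d ∸ κ)
     C = 𝓕 am(po s)(q I.+ + lb)(d ∸(d ∸ κ))
     CZ : C ≡ A
     CZ = P.trans(qb(po s)(d ∸(d ∸ κ)))(P.cong(𝓕 am(po s)p)(N.m∸[m∸n]≡n da))
     swap : ∀ f g → Fr.Re f(Fa.U s)→ Fr.Re g(Fb.U s)→ top(A aI B)≈ Cm.sS κ(d ∸ κ)* top(B aI C)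
     swap f g rf rg = trans(co AZ Br full)(trans(sym(*-identityˡ(top(Fr.we f κ aI Fr.we g(d ∸ κ)))))
      (trans(*-congʳ(sym(Cm.Sn κ(d ∸ κ))))(trans(*-assoc(Cm.sS κ(d ∸ κ))(Cm.sS κ(d ∸ κ))(top(Fr.we f κ aI Fr.we g(d ∸ κ))))
       (*-congˡ{Cm.sS κ(d ∸ κ)}(trans(sym(Cm.wj f κ g(d ∸ κ)full))(co(sy Br)(tr(sy AZ)(λ T → reflexive(P.cong(λ x → x T)(P.sym CZ))))full))))))
      where
      AZ : A ap Fr.we f κ
      AZ = tr(λ T → reflexive(P.cong(λ x → x T)(P.sym(Fa.Ul s κ))))(rf κ da)
      Br : B ap Fr.we g(d ∸ κ)
      Br = tr(λ T → reflexive(P.cong(λ x → x T)(P.sym(Fb.Ul s(d ∸ κ)))))(rg(d ∸ κ)(N.m∸n≤m d κ))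
    gm : ∀ κ → κ N.≤ d → Gr(tg(Db.ci κ))(mK κ)
    gm κ da = Ge.gs H Ha(λ s → sym(mW κ s da))(gk{tg(Db.ci κ)}{Fa.mS κ}{Fa.wV(Db.ci κ)}(Fa.k> κ)(gl(Db.ci κ)))
    gg : ∀ κ → κ N.≤ d → Gr(tj(Dc.ci(d ∸ κ)))(mK κ)
    gg κ da = Ge.gs H Ha(λ s → sym(m6 κ s da))(gk{tj a}{λ _ → Cm.sS κ(d ∸ κ)}{λ s → Fb.mS(d ∸ κ)s * Fb.wV a s}(kn _)
     (gk{tj a}{Fb.mS(d ∸ κ)}{Fb.wV a}(Fb.k>(d ∸ κ))(gf a)))
     where a = Dc.ci(d ∸ κ)
    S9 : ∀{x y}→ x * x ≈ 1# → Unit y → Unit(x * y)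
    S9{x}{y}xx = ui(x , xx)
    mX : ∀ κ → κ N.≤ d → Unit(mK κ or)
    mX κ da = ur(sym(mW κ or da))(S9{Fa.mS κ or}{Fa.wV(Db.ci κ)or}(Fa.S^ κ or)
     (Fa.wH(Db.ci κ)or , Fa.wC(Db.ci κ)or))
    bn : ∀ κ → κ N.≤ d → tg(Db.ci κ)≈ tj(Dc.ci(d ∸ κ))
    bn κ da = Ge.gu H Ha(mX κ da)(gm κ da)(gg κ da)
    CQ : ∀ s → Fa.c s b' ≈ ε * mK ag s
    CQ s = Qu.qu ri{Fa.c s b'}{ε * mK ag s}{eval(function(num(Δ₁ b')))(po s)}{eval(function(den(Δ₁ b')))(po s)}
     (proj₂(proj₁(Fa.hV s b')))(proj₂(Fa.hV s b'))(Cz(po s)(gC s)(gD s))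
    d$ : ag N.≤ d
    d$ = N.<⇒≤(proj₂ vg)
    gh : ∀{r f g}→(∀ s → f s ≈ ε * g s)→ Gr r g → Gr r f
    gh{r}{f}{g}f? kg = Ge.gs H Ha(λ s → sym(f? s))(gk{r}{λ _ → ε}{g}(kn ε)kg)
    gB : Gr(tg(Db.ci ag))(λ s → Fa.c s b')
    gB = gh{tg(Db.ci ag)}{λ s → Fa.c s b'}{mK ag}CQ(gm ag d$)
    uI : ∀ s → Unit(Fa.c s b')
    uI s = Fa.ca s b' , Fa.cv s b'
    uh : ∀{r rK f}→(∀ s → Unit(f s))→ Gr r f → Gr rK f → r ≈ rK
    uh{r}{rK}{f}un kf K> = Ge.gu H Ha{r}{rK}{f}(un or)kf K>
    Ro : rq b' v ≈ ⟦ + Db.ci ag(toℕ aM)ah * x* v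
    Ro = trans(uh{rq b' v}{tg(Db.ci ag)}{λ s → Fa.c s b'}uI(gb b')gB)(tk(Db.ci ag))
    module Zero(Di : + Db.ci ag(toℕ aM)≢(if does(b' O.≟ aM)then + 1 else I.0ℤ))where
     xo : x* v ≈ 0#
     xo = fu(does(b' O.≟ aM))(λ e → Di(I.i-j≡0⇒i≡j _ _ e))Ro
      where
      a = + Db.ci ag(toℕ aM)
      fu : ∀ b → a I.-(if b then + 1 else I.0ℤ)≢ I.0ℤ →(if b then x* v else 0#)≈ ⟦ a ah * x* v → x* v ≈ 0#
      fu b A6 eq = cQ(proj₂(iM A6))(trans(*-comm _ _)(trans(*-congʳ(+-homo a(I.-(if b then + 1 else I.0ℤ))))
       (trans(distribʳ(x* v)⟦ a ah ⟦ I.-(if b then + 1 else I.0ℤ)ah)(trans(+-cong(sym eq)(by b))(-‿inverseʳ _)))))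
       where
       by : ∀ b → ⟦ I.-(if b then + 1 else I.0ℤ)ah * x* v ≈ -(if b then x* v else 0#)
       by true = trans(*-congʳ(-‿cong(+-identityʳ 1#)))(-1*x≈-x(x* v))
       by false = trans(zeroˡ(x* v))(sym -0#≈0#)
     tR : ∀ a → tg a ≈ 0#
     tR a = trans(tk a)(trans(*-congˡ xo)(zeroʳ ⟦ + a(toℕ aM)ah))
     xz : ∀ k → xq v k ≈ 0#
     xz k = trans(sym(tQ k))(trans(reflexive(P.cong(tj ∘ Dc.ci)(P.sym(N.m∸[m∸n]≡n kd))))
      (trans(sym(bn(d ∸ suc(toℕ k))(N.m∸n≤m d(suc(toℕ k)))))(tR(Db.ci(d ∸ suc(toℕ k))))))
      where
      kd : suc(toℕ k)N.≤ d
      kd = N.<⇒≤(proj₂(iE k))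
     r< : ∀ γ → rq γ v ≈ 0#
     r< γ = by(does(γ O.≟ aM))
      where
      by : ∀ b →(if b then x* v else 0#)≈ 0#
      by true = xo
      by false = refl
     r> : ∀ γ → rF γ v ≈ 0#
     r> γ = s*(λ k → ⟦ d2 k(toℕ γ)ah * xq v k)λ k → trans(*-congˡ(xz k))(zeroʳ ⟦ d2 k(toℕ γ)ah)
     kO : ∀ a → Known(Fa.wV a)
     kO a = Fa.kZ{Na}{λ s γ → Fa.c s γ Defs.^ a(toℕ γ)}λ γ → Fa.k*(a(toℕ γ))(Ge.gr H Ha(r< γ)(gb γ))
     k0 : ∀ a → Known(Fb.wV a)
     k0 a = Fb.kZ{Nb}{λ s γ → Fb.c s γ Defs.^ a(toℕ γ)}λ γ → Fb.k*(a(toℕ γ))(Ge.gr H Ha(r> γ)(gE γ))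
     gj : ∀ k i → 1 N.≤ k → k N.≤ d → Gr(rm k v)(Fa.eJ k i)
     gj(suc k)i _ kh = Ge.gs H Ha(λ s → proj₂(eA(suc k)i)(po s))(gK E ua ξ(rm(suc k)v)
      (P.subst(λ j → c₁(li(proj₁(eA(suc j)i))ua ξ)≈ rm(suc j)v * eval(proj₁(eA(suc j)i))ua)(O.toℕ-fromℕ< kh)
       (S<(dr Eo v)(eval Eo ua)(rm(suc(toℕ K7))v)(rX{v}s^(inj₁(K7 , i))))))
      where
      E = proj₁(eA(suc k)i)
      K7 = Fin.fromℕ< kh
      Eo = proj₁(eA(suc(toℕ K7))i)
      S< : ∀ x e r → x + - 1# *(e * r)≈ 0# → x ≈ r * e
      S< x e r eq = trans(solve 3(λ x e r → x :=(x al aC(e ac r))al r ac e)refl x e r)(trans(+-congʳ(trans(+-congˡ(sym(-1*x≈-x(e * r))))eq))(+-identityˡ(r * e)))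
     gM : ∀ k c → 1 N.≤ k → k N.≤ d → Gr(rm k v)(λ s → Fa.fV s k c)
     gM k c kk kd = Ge.gs H Ha(λ s → trans(*-congˡ(Fa.eM k c s))(reflexive(P.sym(Fa.r$ kk kd))))
      (gk{rm k v}{Fa.fL k}{Fa.eJ k c}(Fa.Kj kO k)(gj k c kk kd))
     rY : ∀{k}→ k ≢ d → rm k v ≡ 0#
     rY{k}KD rewrite fa KD = P.refl
     r? : rm d v ≡ xt v
     r? rewrite rl d = P.refl
     kV : ∀ j → j N.< d → Kn(λ s → Fr.we(Fa.fV s)j)
     kV zero _ T = kn(un T)
     kV(suc j)jr T = gw{r = 0#}{λ s → Fr.we(Fa.fV s)j}{λ s → vf(Fa.fV s(suc j))}(kV j(N.<⇒≤ jr))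
      (gi{r = 0#}{λ s → Fa.fV s(suc j)}λ c → Ge.gr H Ha(reflexive(rY(N.<⇒≢ jr)))(gM(suc j)c(N.s≤s N.z≤n)(N.<⇒≤ jr)))T
     xr : xt v ≈ 0#
     xr = Ge.gu H Ha{f = λ _ → 1#}(1# , *-identityˡ 1#)(Ge.gs H Ha(λ s → trans(reflexive(P.cong(λ k → top(Fr.we(Fa.fV s)k))mJ))(Fa.fJ s))
      (gw{r = xt v}{λ s → Fr.we(Fa.fV s)m}{λ s → vf(Fa.fV s(suc m))}(kV m(N.≤-reflexive mJ))
       (gi{r = xt v}{λ s → Fa.fV s(suc m)}λ c → Ge.gr H Ha(reflexive(P.trans(P.cong(λ k → rm k v)mJ)r?))
        (gM(suc m)c(N.s≤s N.z≤n)(N.≤-reflexive mJ)))full))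
      (Ge.gc H Ha 1#)
     r& : ∀ k → rm k v ≈ 0#
     r& k with k N.≟ d
     ... | yes P.refl = trans(reflexive r?)xr
     ... | no KD = reflexive(rY KD)
     fA : ∀ i → i N.≤ la → ∀ k → k N.≤ d → Kn(λ s → 𝓕 am(po s)(p I.+ + i)k)
     fA = Fa.k4 kO(Fa.k8 kO λ k i kk kd → Ge.gr H Ha(r& k)(gj k i kk kd))
     KM : ∀ k → k N.≤ d → Kn(λ s → 𝓕 am(po s)(q I.+ + lb)k)
     KM k kd T = kr(λ s → reflexive(P.cong(λ x → x T)(P.trans(P.cong(λ j → 𝓕 am(po s)j k)(I.+-identityʳ p))(P.sym(qb(po s)k)))))(fA 0 N.z≤n k kd T)
     KN : ∀ k → k N.≤ d → Kn(λ s → 𝓕 am(po s)q k)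
     KN k kd T = kr(λ s → reflexive(P.cong(λ x → x T)(p*(po s)k)))(fA la N.≤-refl k kd T)
     fQ : ∀ i → i N.≤ lb → ∀ k → k N.≤ d → Kn(λ s → 𝓕 am(po s)(q I.+ + i)k)
     fQ = Fb.k4 k0(Fb.k8 k0 λ k i kk kd →
      C.kC(KN k kd)(C.ki i(KM(suc(d ∸ k))(N.≤-trans(N.s≤s(N.∸-monoʳ-≤ d kk))(N.≤-reflexive mJ))))full)
      where module C = Closure ri functionRing
     k+ : ∀ r c → Known(λ s → po s r c)
     k+ r = CA(covering r)
      where
      CA :(∃ λ i → i N.< la × rd am(p I.+ + i)≡ r)⊎(∃ λ i → i N.< lb × rd am(q I.+ + i)≡ r)→ ∀ c → Known(λ s → po s r c)
      CA(inj₁(i , i7 , eq))c = P.subst(λ r → Known(λ s → po s r c))eq(fF am dd functionRing po(p I.+ + i)(fA i(N.<⇒≤ i7))c)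
      CA(inj₂(i , i7 , eq))c = P.subst(λ r → Known(λ s → po s r c))eq(fF am dd functionRing po(q I.+ + i)(fQ i(N.<⇒≤ i7))c)
     zG : ∀ r c → ξ r c ≈ 0#
     zG r c = Ge.l^ H Ha{ua r c}{ξ r c}{λ s → po s r c}(λ s → refl)(k+ r c)
     SH : ∀ j → v j ≈ 0#
     SH j = P.subst(λ j → v j ≈ 0#)(O.join-splitAt(n N.* d)(suc(suc m))j)(by(splitAt(n N.* d)j))
      where
      by : ∀ x → v(Fin.join(n N.* d)(suc(suc m))x)≈ 0#
      by(inj₁ e)= P.subst(λ e → v(e ↑ˡ suc(suc m))≈ 0#)(O.combine-remQuot{n}d e)(zG(proj₁(remQuot{n}d e))(proj₂(remQuot{n}d e)))
      by(inj₂ Fin.zero)= xo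
      by(inj₂(Fin.suc Fin.zero))= xr
      by(inj₂(Fin.suc(Fin.suc k)))= xz k
  cZ : ∀ γ → + Db.ci ag(toℕ γ)≡(if does(b' O.≟ γ)then + 1 else I.0ℤ)
  cZ γ = decidable-stable(_ I.≟ _)λ Di → nn hF hG(proj₁(proj₂ variables₁))(proj₁(proj₂ variables₂))λ(ua , ha)→
   KH M _(b&.eC γ ua ha)(b&.rV γ ua ha)(b&.lG γ ua ha ∘ Dh)λ(v , s^ , v*)→
   v*(b&.f'.Zero.SH γ ua ha v s^ Di)
module SI where
 open IS
 open Sl
 open KF
 open Wo hiding(at;aH;oa)
 open BP hiding(ze)
 open Gd
 open ES using(sp;aq)
 open Du using(aQ)
 open TP using(ws)
 open import Relation.Binary.PropositionalEquality.Core using(refl;sym;trans;cong;subst)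
 open import Data.Nat.Base using(_≤_;_<_)
 Le : ∀{β}→(ℕ → ℕ →(ℕ → ℕ)→ Set)→(ℕ → ℕ)→ Weights β → Set
 Le Q w [] = ⊤
 Le Q w(_∷_{x = k}a γs)= Q(w k)(w(suc k))a × Le Q(w ∘ transposition k)γs
 lH : ∀{β}{Q : ℕ → ℕ → ℕ →(ℕ → ℕ)→ Set}N w(γs : Weights β)→(∀ γ → γ < N → Le(Q γ)w γs)→ Le(λ x y a → ∀ γ → γ < N → Q γ x y a)w γs
 lH N w [] f = tt
 lH N w(_∷_{x = k}a γs)f =(λ γ Ne → proj₁(f γ Ne)), lH N(w ∘ transposition k)γs λ γ Ne → proj₂(f γ Ne)
 So : ∀{κ x y}a → x ≤ κ → κ < y → sp κ x y a ≡ a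
 So{κ}{x}{y}a xd yc with x N.≤? κ | κ N.<? y
 ... | yes _ | yes _ = refl
 ... | yes _ | no yb = ⊥-elim(yb yc)
 ... | no xi | _ = ⊥-elim(xi xd)
 module CT(d : ℕ)where
  open Aa d
  open Ar
  lP : ∀{β}κ w{k a}(γs : Weights β){γ}→ aq κ w(_∷_{x = k}a γs)γ ≡ 0 → w k ≤ κ → κ < w(suc k)→ a γ ≡ 0
  lP κ w{k}{a}γs{γ}eq xd yc = trans(cong(λ f → f γ)(sym(So a xd yc)))(N.m+n≡0⇒m≡0 _ eq)
  r% : ∀{β}κ w{k a}(γs : Weights β){γ}→ aq κ w(_∷_{x = k}a γs)γ ≡ 0 → aq κ(w ∘ transposition k)γs γ ≡ 0
  r% κ w{k}{a}γs{γ}eq = N.m+n≡0⇒n≡0(sp κ(w k)(w(suc k))a γ)eq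
  aT : ∀{β}(γs : Weights β){w}γ → Ar w → All(VL d)β → Ac w β →(∀ κ → VL d κ → aq κ w γs γ ≡ 0)→
   Le(λ x y a → a γ ≡ 0)w γs
  aT [] γ a _ _ z = tt
  aT(_∷_{x = k}b γs){w}γ a(v ∷ vs)(xf , as)z =
   lP(w k)w γs(z(w k)(l1 a(proj₁ v), N.<-≤-trans xf(ld a(proj₂ v))))N.≤-refl xf ,
   aT γs γ(ar v a)vs as λ κ vV → r% κ w γs(z κ vV)
  b/ : ∀ ag x y → Dec(x ≡ ag × y ≡ suc ag)
  b/ ag x y with x N.≟ ag | y N.≟ suc ag
  ... | yes p | yes q = yes(p , q)
  ... | no p | _ = no(p ∘ proj₁)
  ... | yes _ | no q = no(q ∘ proj₂)
  nz : ∀{β}ag(γs : Weights β){w}γ → Ar w → All(VL d)β → Ac w β →(∀ κ → VL d κ → κ ≢ ag → aq κ w γs γ ≡ 0)→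
   Le(λ x y a → ¬(x ≡ ag × y ≡ suc ag)→ a γ ≡ 0)w γs
  nz ag [] γ a _ _ z = tt
  nz ag(_∷_{x = k}b γs){w}γ a(v ∷ vs)(xf , as)z = fk ,
   nz ag γs γ(ar v a)vs as λ κ vV gW → r% κ w γs(z κ vV gW)
   where
   yd = ld a(proj₂ v)
   xb = l1 a(proj₁ v)
   fk : ¬(w k ≡ ag × w(suc k)≡ suc ag)→ b γ ≡ 0
   fk ot with w k N.≟ ag
   ... | no xG = lP(w k)w γs(z(w k)(xb , N.<-≤-trans xf yd)xG)N.≤-refl xf
   ... | yes xu = lP(suc(w k))w γs(z(suc(w k))(s≤s z≤n , N.<-≤-trans xE yd)(λ e → N.1+n≢n(trans e(sym xu))))(N.n≤1+n _)xE
    where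
    xE : suc(w k)< w(suc k)
    xE = N.≤∧≢⇒< xf λ e → ot(xu , trans(sym e)(cong suc xu))
  io : ∀{β}ag(γs : Weights β){w}(a : Ar w)→ All(VL d)β → Ac w β → position a(suc ag)< position a ag →
   Le(λ x y _ → ¬(x ≡ ag × y ≡ suc ag))w γs
  io ag [] a _ _ inv = tt
  io ag(_∷_{x = k}b γs){w}a(v ∷ vs)(xf , as)inv =
   (λ(xu , yg)→ N.<-asym inv(P.subst₂ _<_(trans(sym(pw a k))(cong(position a)xu))(trans(sym(pw a(suc k)))(cong(position a)yg))N.≤-refl)),
   io ag γs(ar v a)vs as(tm k inv λ(p , q)→ N.<-asym xf
    (P.subst₂ _<_(trans(sym(wo a ag))(cong w q))(trans(sym(wo a(suc ag)))(cong w p))N.≤-refl))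
  zt : ∀{β}ag(γs : Weights β)w γ → Le(λ x y a → ¬(x ≡ ag × y ≡ suc ag)→ a γ ≡ 0)w γs → Le(λ x y _ → ¬(x ≡ ag × y ≡ suc ag))w γs → AW(λ a → a γ ≡ 0)γs
  zt ag [] w γ _ _ = []
  zt ag(a ∷ γs)w γ(z , zs)(n , ns)= z n ∷ zt ag γs _ γ zs ns
  Sp : ∀{β}ag(γs : Weights β){w}γ(a : Ar w)→ All(VL d)β → Ac w β →
   Le(λ x y a → ¬(x ≡ ag × y ≡ suc ag)→ a γ ≡ 0)w γs → aq ag w γs γ ≡ 1 → Le(λ x y a → x ≡ ag × y ≡ suc ag → a γ ≡ 1)w γs
  Sp ag [] γ a _ _ _ _ = tt
  Sp ag(_∷_{x = k}b γs){w}γ a(v ∷ vs)(xf , as)(z , zs)one = by(b/ ag(w k)(w(suc k)))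
   where
   rt = aq ag(w ∘ transposition k)γs γ
   by : Dec(w k ≡ ag × w(suc k)≡ suc ag)→ Le(λ x y a → x ≡ ag × y ≡ suc ag → a γ ≡ 1)w(_∷_{x = k}b γs)
   by(no n)=(λ Sq → ⊥-elim(n Sq)), Sp ag γs γ(ar v a)vs as zs(trans(cong(N._+ rt)(sym(e> n)))one)
    where
    e> : ¬(w k ≡ ag × w(suc k)≡ suc ag)→ sp ag(w k)(w(suc k))b γ ≡ 0
    e> n with w k N.≤? ag | ag N.<? w(suc k)
    ... | yes _ | yes _ = z n
    ... | yes _ | no _ = refl
    ... | no _ | _ = refl
   by(yes(xu , yg))=(λ _ → trans(cong(λ f → f γ)(sym(So b(N.≤-reflexive xu)(N.≤-reflexive(sym yg)))))(trans(sym(N.+-identityʳ _))(trans(cong(sp ag(w k)(w(suc k))b γ N.+_)(sym Rp))one))),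
    AK γs(io ag γs(ar v a)vs as iY)
    where
    iY : transposition k(position a(suc ag))< transposition k(position a ag)
    iY = P.subst₂ _<_(sym(trans(cong(transposition k)(trans(cong(position a)(sym yg))(pw a(suc k))))(tb k)))
     (sym(trans(cong(transposition k)(trans(cong(position a)(sym xu))(pw a k)))(tF k)))N.≤-refl
    Rp : rt ≡ 0
    Rp = aQ ag(w ∘ transposition k)γs γ(zt ag γs _ γ zs(io ag γs(ar v a)vs as iY))
    AK : ∀{β}(γs : Weights β){w}→ Le(λ x y _ → ¬(x ≡ ag × y ≡ suc ag))w γs → Le(λ x y a → x ≡ ag × y ≡ suc ag → a γ ≡ 1)w γs
    AK [] _ = tt
    AK(_ ∷ γs)(n , ns)=(λ Sq → ⊥-elim(n Sq)), AK γs ns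
  SW :(ℕ → ℕ)→ ℕ → ℕ → ℕ →(ℕ → ℕ)→ Set
  SW c γ x y a = a γ ≡(if(suc x N.≡ᵇ y)∧(c x N.≡ᵇ γ)then 1 else 0)
  lp : ∀{β}{Q Qa : ℕ → ℕ →(ℕ → ℕ)→ Set}(γs : Weights β){w}→ Ar w → All(VL d)β → Ac w β →
   (∀{x y a}→ 1 ≤ x → x < y → y ≤ d → Q x y a → Qa x y a)→ Le Q w γs → Le Qa w γs
  lp [] a _ _ f _ = tt
  lp(b ∷ γs)a(v ∷ vs)(xf , as)f(q , qs)= f(l1 a(proj₁ v))xf(ld a(proj₂ v))q , lp γs(ar v a)vs as f qs
  lQ : ∀{β}{Q Qa : ℕ → ℕ →(ℕ → ℕ)→ Set}(γs : Weights β){w}→ Le Q w γs → Le Qa w γs → Le(λ x y a → Q x y a × Qa x y a)w γs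
  lQ [] _ _ = tt
  lQ(_ ∷ γs)(q , qs)(qa , qH)=(q , qa), lQ γs qs qH
  SC : ∀{β}(γs : Weights β)→ All(VL d)β → Ac id β → ∀ N(c : ℕ → ℕ)→
   (∀ κ bK → VL d κ → VL d bK → c κ ≡ c bK → κ ≡ bK)→
   (∀ κ γ → VL d κ → γ < N → aq κ id γs γ ≡(if c κ N.≡ᵇ γ then 1 else 0))→
   Le(λ x y a → ∀ γ → γ < N → SW c γ x y a)id γs
  SC γs vs as N c injective H = lH N id γs λ γ Ne → by γ Ne(b$ γ d)
   where
   b$ : ∀ γ n →(∃ λ κ → VL d κ × c κ ≡ γ)⊎(∀ κ → VL d κ → κ < n → c κ ≢ γ)
   b$ γ zero = inj₂ λ κ _()
   b$ γ(suc n)with b$ γ n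
   ... | inj₁ Fk = inj₁ Fk
   ... | inj₂ nf with 1 N.≤? n | n N.<? d | c n N.≟ γ
   ... | yes n+ | yes n> | yes eq = inj₁(n ,(n+ , n>), eq)
   ... | no n~ | _ | _ = inj₂ λ κ vV nm → Lc κ vV nm(λ e → n~(subst(1 ≤_)e(proj₁ vV)))
    where
    Lc : ∀ κ → VL d κ → κ < suc n → κ ≢ n → c κ ≢ γ
    Lc κ vV nm ny = nf κ vV(N.≤∧≢⇒<(N.s≤s⁻¹ nm)ny)
   ... | yes _ | no n^ | _ = inj₂ λ κ vV nm → nf κ vV(N.≤∧≢⇒<(N.s≤s⁻¹ nm)(λ e → n^(subst(_< d)e(proj₂ vV))))
   ... | yes _ | yes _ | no n7 = inj₂ λ κ vV nm → C1 κ vV nm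
    where
    C1 : ∀ κ → VL d κ → κ < suc n → c κ ≢ γ
    C1 κ vV nm with κ N.≟ n
    ... | yes refl = n7
    ... | no ny = nf κ vV(N.≤∧≢⇒<(N.s≤s⁻¹ nm)ny)
   oa : ∀{κ γ}→ c κ ≢ γ →(if c κ N.≡ᵇ γ then 1 else 0)≡ 0
   oa ne rewrite fa ne = refl
   on : ∀ κ →(if c κ N.≡ᵇ c κ then 1 else 0)≡ 1
   on κ rewrite rl(c κ)= refl
   wm : ∀{x y γ}→ ¬(y ≡ suc x × c x ≡ γ)→(if(suc x N.≡ᵇ y)∧(c x N.≡ᵇ γ)then 1 else 0)≡ 0
   wm{x}{y}{γ}n with suc x N.≟ y
   ... | no ne rewrite fa ne = refl
   ... | yes refl rewrite rl x | fa(λ e → n(refl , e))= refl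
   wL : ∀ κ →(if(suc κ N.≡ᵇ suc κ)∧(c κ N.≡ᵇ c κ)then 1 else 0)≡ 1
   wL κ rewrite rl κ | rl(c κ)= refl
   by : ∀ γ → γ < N →(∃ λ κ → VL d κ × c κ ≡ γ)⊎(∀ κ → VL d κ → κ < d → c κ ≢ γ)→ Le(SW c γ)id γs
   by γ Ne(inj₂ nf)= lp γs ai vs as(λ{x}{y}xb xf yd A4 → trans A4(sym(wm{x}{y}λ(_ , Cj)→
    nf _(xb , N.<-≤-trans xf yd)(N.<-≤-trans xf yd)Cj)))
    (aT γs γ ai vs as λ κ vV → trans(H κ γ vV Ne)(oa(nf κ vV(proj₂ vV))))
   by γ Ne(inj₁(ag , v4 , refl))= lp γs ai vs as(λ{x}{y}{a}→ Sq{x}{y}{a})(lQ γs ze(Sp ag γs γ ai vs as ze(trans(H ag γ v4 Ne)(on ag))))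
    where
    ze = nz ag γs γ ai vs as λ κ vV e3 → trans(H κ γ vV Ne)(oa(e3 ∘ injective κ ag vV v4))
    Sq : ∀{x y a}→ 1 ≤ x → x < y → y ≤ d →(¬(x ≡ ag × y ≡ suc ag)→ a γ ≡ 0)×(x ≡ ag × y ≡ suc ag → a γ ≡ 1)→ SW c γ x y a
    Sq{x}{y}xb xf yd(zO , oq)with b/ ag x y
    ... | yes(refl , refl)= trans(oq(refl , refl))(sym(wL ag))
    ... | no n = trans(zO n)(sym(wm{x}{y}λ{(refl , Cj)→ n(xj Cj , cong suc(xj Cj))}))
     where
     xj : c x ≡ γ → x ≡ ag
     xj = injective x ag(xb , N.<-≤-trans xf yd)v4
module CP where
 open IS
 open Sl
 open KF
 open Wo hiding(at;aH;oa)
 open BP hiding(ze)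
 open Gd
 open Fx
 open SI
 open import Relation.Binary.PropositionalEquality.Core using(refl;sym;trans;cong;cong₂;subst)
 open import Data.Nat.Base using(_≤_)
 data Pt(δ χ : ℕ → ℕ → ℤ):(ℕ → ℕ)→(ℕ → ℤ)→ Word →(ℕ → ℤ)→ ℤ → Set where
  stop : ∀{w U V f}→(∀ l → U l ≡ V l)→ f ≡ I.0ℤ → Pt δ χ w U [] V f
  step : ∀{w U W V k β f g}→(∀ l → l ≢ k → U l ≡ W l)→ U k I.+ W k ≡ U(k ∸ 1)I.+ U(suc k)I.+ δ(w k)(w(suc k))→
   g ≡ χ(w k)(w(suc k))I.*(W k I.- U k)I.+ f → Pt δ χ(w ∘ transposition k)W β V f → Pt δ χ w U(k ∷ β)V g
 Ae : ∀{A : Set}{P : A → Set}{xs}→ All P xs → All P(reverse xs)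
 Ae{xs = []}[] = []
 Ae{P = P}{x ∷ xs}(p ∷ ps)= subst(All P)(sym(List.unfold-reverse x xs))(++⁺(Ae ps)(p ∷ []))
 pt : ∀ β x → permutation β(permutation(reverse β)x)≡ x
 pt [] x = refl
 pt(k ∷ β)x = trans(cong(permutation(k ∷ β))(trans(cong(λ α → permutation α x)(List.unfold-reverse k β))(pb(reverse β)(k ∷ [])x)))
  (trans(cong(transposition k)(pt β(transposition k x)))(tv k x))
 module Ps(d : ℕ)where
  open Aa d
  open Ar
  p! : ∀{δ χ w wb U β V f}→(∀ x → w x ≡ wb x)→ Pt δ χ w U β V f → Pt δ χ wb U β V f
  p! eq(stop p z)= stop p z
  p!{δ}{χ}eq(step{U = U}{W}{k = k}s c g p)= step s
   (trans c(cong(λ z → U(k ∸ 1)I.+ U(suc k)I.+ z)(cong₂ δ(eq k)(eq(suc k)))))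
   (trans g(cong(λ z → z I.*(W k I.- U k)I.+ _)(cong₂ χ(eq k)(eq(suc k)))))(p!(eq ∘ transposition k)p)
  p8 : ∀{δ χ w U β V W k f g}→ Pt δ χ w U β V f →(∀ l → l ≢ k → V l ≡ W l)→
   V k I.+ W k ≡ V(k ∸ 1)I.+ V(suc k)I.+ δ(w(permutation β k))(w(permutation β(suc k)))→
   g ≡ χ(w(permutation β k))(w(permutation β(suc k)))I.*(W k I.- V k)I.+ f → Pt δ χ w U(β ++ k ∷ [])W g
  p8{δ}{χ}{w}{U}{V = V}{W}{k}(stop{f = f}UV z)s c g = step(λ l lJ → trans(UV l)(s l lJ))
   (trans(cong(λ u → u I.+ W k)(UV k))(trans c(cong(λ u → u I.+ δ(w k)(w(suc k)))(sym(cong₂ I._+_(UV(k ∸ 1))(UV(suc k)))))))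
   (trans g(cong₂(λ u f → χ(w k)(w(suc k))I.*(W k I.- u)I.+ f)(sym(UV k))z))(stop(λ _ → refl)refl)
  p8{δ}{χ}{w}{U}{β = _ ∷ β}{V}{W}{k}(step{W = X}{k = j}{f = f}S4 cB gO p)s c e = step S4 cB
   (trans e(trans(cong(λ z → l8 I.+ z)gO)(eY l8(χ(w j)(w(suc j))I.*(X j I.- U j))f)))(p8 p s c refl)
   where
   l8 = χ(w(permutation(j ∷ β)k))(w(permutation(j ∷ β)(suc k)))I.*(W k I.- V k)
   eY : ∀ a b f → a I.+(b I.+ f)≡ b I.+(a I.+ f)
   eY = so.solve 3(λ a b f → a so.:+(b so.:+ f)so.:= b so.:+(a so.:+ f))refl
  mr : ℕ → ℕ
  mr x = suc d ∸ x
  Mi :(δ a! : ℕ → ℕ → ℤ)→ Set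
  Mi δ a! = ∀{x y}→ 1 ≤ x → x ≤ d → 1 ≤ y → y ≤ d → a!(mr y)(mr x)≡ δ x y
  pY : ∀{δ a! χ b^}→ Mi δ a! → Mi χ b^ → ∀{w U β V f}→ Ar w → All(VL d)β →
   Pt δ χ w U β V f → Pt a! b^(mr ∘ w ∘ permutation β)V(reverse β)U(I.- f)
  pY Mg Mh a [](stop p z)= stop(λ l → sym(p l))(cong I.-_ z)
  pY{δ}{a!}{χ}{b^}Mg Mh{w}{U}{k ∷ β}{V}a(v ∷ vs)(step{W = W}{f = f}s c g p)=
   subst(λ α → Pt a! b^(mr ∘ w ∘ permutation(k ∷ β))V α U _)(sym(List.unfold-reverse k β))
    (p8(pY{δ}{a!}{χ}{b^}Mg Mh(ar v a)vs p)(λ l lJ → sym(s l lJ))ch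
     (trans(cong I.-_ g)(trans(so.solve 4(λ x w u f → so.:-(x so.:*(w so.:+ so.:- u)so.:+ f)
      so.:= x so.:*(u so.:+ so.:- w)so.:+ so.:- f)refl(χ(w k)(w(suc k)))(W k)(U k)f)
      (cong(λ z → z I.*(U k I.- W k)I.+ I.- f)(sym(eT{χ}{b^}Mh))))))
   where
   kk = proj₁ v
   eT : ∀{δ a!}→ Mi δ a! → a!(mr(w(permutation(k ∷ β)(permutation(reverse β)k))))(mr(w(permutation(k ∷ β)(permutation(reverse β)(suc k)))))≡ δ(w k)(w(suc k))
   eT{δ}{a!}m = trans(cong₂(λ x y → a!(mr(w x))(mr(w y)))(trans(cong(transposition k)(pt β k))(tF k))
    (trans(cong(transposition k)(pt β(suc k)))(tb k)))
    (m(l1 a kk)(ld a(N.<⇒≤(proj₂ v)))(l1 a(s≤s z≤n))(ld a(proj₂ v)))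
   ch : W k I.+ U k ≡ W(k ∸ 1)I.+ W(suc k)I.+ a!(mr(w(permutation(k ∷ β)(permutation(reverse β)k))))(mr(w(permutation(k ∷ β)(permutation(reverse β)(suc k)))))
   ch = trans(I.+-comm(W k)(U k))(trans c(cong₂ I._+_(cong₂ I._+_(s(k ∸ 1)(k1 kk))(s(suc k)N.1+n≢n))(sym(eT{δ}{a!}Mg))))
  p3 : ∀{δ χ w wb U Ub β V Va f fc}→(∀ x → 1 ≤ x → x ≤ d → w x ≡ wb x)→(∀ l → U l ≡ Ub l)→ All(VL d)β →
   Pt δ χ w U β V f → Pt δ χ wb Ub β Va fc → f ≡ fc
  p3 ww uu [](stop _ z)(stop _ za)= trans z(sym za)
  p3{δ}{χ}{w}{wb}{U}{Ub}ww uu(v@(kk , kh)∷ vs)(step{W = W}{k = k}s c g p)(step{W = Wa}S4 cB gO p′)=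
   trans g(trans(cong₂(λ x y → x I.+ y)(cong₂ I._*_(cong₂ χ Ep e!)(cong₂ I._-_(WW k)(uu k)))(p3 wR WW vs p p′))(sym gO))
   where
   Ep = ww k kk(N.<⇒≤ kh)
   e! = ww(suc k)(s≤s z≤n)kh
   WW : ∀ l → W l ≡ Wa l
   WW l with l N.≟ k
   ... | no lJ = trans(sym(s l lJ))(trans(uu l)(S4 l lJ))
   ... | yes refl = trans(sY c)(trans(cong₂ I._-_(cong₂ I._+_(cong₂ I._+_(uu(l ∸ 1))(uu(suc l)))(cong₂ δ Ep e!))(uu l))(sym(sY cB)))
    where
    sY : ∀{u w t}→ u I.+ w ≡ t → w ≡ t I.- u
    sY{u}{w}refl = so.solve 2(λ u w → w so.:= u so.:+ w so.:+ so.:- u)refl u w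
   wR : ∀ x → 1 ≤ x → x ≤ d → w(transposition k x)≡ wb(transposition k x)
   wR x xb xe = ww _(l1 e? xb)(ld e? xe)
    where e? = ar v ai
  si :(ℕ → ℤ)→ ℕ → ℕ → ℤ
  si ζ x y = if suc x N.≡ᵇ y then ζ x else I.0ℤ
  mu : ∀{x y}→ x ≤ d → y ≤ d → suc x ≢ y → suc(suc d ∸ y)≢ suc d ∸ x
  mu{x}{y}xe yd ne eq = ne(N.+-cancelˡ-≡(suc d ∸ y)(suc x)y(trans(N.+-suc(suc d ∸ y)x)(trans(cong(N._+ x)eq)
   (trans(N.m∸n+n≡m(N.m≤n⇒m≤1+n xe))(sym(N.m∸n+n≡m(N.m≤n⇒m≤1+n yd)))))))
  sL : ∀ ζ{x y}→ suc x ≡ y → si ζ x y ≡ ζ x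
  sL ζ{x}refl = cong(λ b → if b then ζ x else I.0ℤ)(rl x)
  sC : ∀ ζ{x y}→ suc x ≢ y → si ζ x y ≡ I.0ℤ
  sC ζ{x}ne = cong(λ b → if b then ζ x else I.0ℤ)(fa ne)
  sI : ∀ ζ → Mi(si ζ)(si(λ x → ζ(d ∸ x)))
  sI ζ{x}{y}xb xe yl yd with suc x N.≟ y
  ... | yes refl = trans(sL(λ x → ζ(d ∸ x))(sym(N.+-∸-assoc 1 xe)))(trans(cong ζ(N.m∸[m∸n]≡n xe))(sym(sL ζ refl)))
  ... | no ne = trans(sC(λ x → ζ(d ∸ x))(mu xe yd ne))(sym(sC ζ ne))
  module FS(I : Set)(N : ℕ)(dg : ℕ → I → ℤ)(i : I)(ad : ℕ)where
   open Ga I N dg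
   open Te I d N dg i ad using(fl)
   Sr : ∀{β δ χ}(γs : Weights β){w U}Gs → Slice γs U Gs → Le(λ x y a → wi N(λ γ → dg γ i)a ≡ δ x y × + a ad ≡ χ x y)w γs →
    Pt δ χ w(λ l → U l i)β(λ l → lL U Gs l i)(fl γs U Gs)
   Sr [] [] _ _ = stop(λ _ → refl)refl
   Sr(_∷_{x = k}a γs){w}{U}(W ∷ Gs)(g , s)((wd , wU), ls)= step(λ l lJ → Gb.same g l lJ i)
    (trans(Gb.ch g i)(cong(λ z → U(k ∸ 1)i I.+ U(suc k)i I.+ z)wd))(cong(λ z → z I.*(W k i I.- U k i)I.+ fl γs W Gs)wU)(Sr γs Gs s ls)
  fI : ∀{β ζ χ U V Ub Va f fc}→ All(VL d)β → Rv(permutation β)→ Pt(si ζ)(si χ)id U β V f →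
   (∀ l → V l ≡ Ub l)→ Pt(si(λ x → ζ(d ∸ x)))(si(λ x → χ(d ∸ x)))id Ub(reverse β)Va fc → f I.+ fc ≡ I.0ℤ
  fI{β}{ζ}{χ}{f = f}vs Rh p eq p′ = trans(cong(λ z → f I.+ z)(sym(p3
   (λ x xb xe → trans(cong mr(Rh x xb xe))(N.m∸[m∸n]≡n(N.m≤n⇒m≤1+n xe)))eq(Ae vs)
   (pY{si ζ}{_}{si χ}(sI ζ)(sI χ)ai vs p)p′)))(I.+-inverseʳ f)
module Ct where
 open IS
 open Sl
 open KF
 open Wo hiding(at;aH;oa)
 open BP hiding(ze)
 open To
 open Gd
 open Fx
 open Bl
 open ES using(aq)
 open SS
 open Du
 open Tr using(module FD)
 open TP using(ws;module TG)
 open WD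
 open SI
 open CP
 open import Relation.Binary.PropositionalEquality.Core using(refl;sym;trans;cong;cong₂;subst)
 open import Data.Nat.Base using(_≤_;_<_)
 ii : Bool → ℕ
 ii b = if b then 1 else 0
 i2 : ∀{A : Set}(d : Dec A)→ A → ii(does d)≡ 1
 i2(yes _)_ = refl
 i2(no AT)a = ⊥-elim(AT a)
 i< : ∀{A : Set}(d : Dec A)→ ¬ A → ii(does d)≡ 0
 i<(yes a)AT = ⊥-elim(AT a)
 i<(no _)_ = refl
 module _(I : Set)(d N : ℕ)(dg : ℕ → I → ℤ)(i : I)(ad : ℕ)where
  open Te I d N dg i ad using(fl)
  fz : ∀{β}{γs : Weights β}{U}Gs → AW(λ a → a ad ≡ 0)γs → fl γs U Gs ≡ I.0ℤ
  fz [] [] = refl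
  fz{γs = _∷_{x = k}a γs}{U}(W ∷ Gs)(z ∷ zs)= trans(cong₂(λ a f → + a I.*(W k i I.- U k i)I.+ f)z(fz Gs zs))(cong(I._+ I.0ℤ)(I.*-zeroˡ(W k i I.- U k i)))
 iN : ∀{β}(γs : Weights β)γ → isNonzeroOn γs γ ≡ false → AW(λ a → a γ ≡ 0)γs
 iN [] γ _ = []
 iN(a ∷ γs)γ e with a γ in eq
 ... | zero = eq ∷ iN γs γ e
 module CB{d n : ℕ}{σ : Signature n}(am : Admissible d σ)(dd : 2 ≤ d)(p : ℤ)(l : ℕ)(Dr : d < l)
  {ae}(w : Weave(topWord am p l)ae)(ve : All(VL d)ae)(aG : Ac id ae)
  (Δ : Fin(l N.+ trivalents w)→ K d σ)(va : AreWeaveVariables am p l w Δ)(c : ℕ → Fin(l N.+ trivalents w))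
  (Cf : ∀ κ → VL d κ → ∀ γ → DD.ci am dd p l Dr w ve aG κ(toℕ γ)≡ ii(does(c κ O.≟ γ)))where
  open TW am
  open PS am dd
  open FD am using(fD;ft;iD)
  open TG am dd p using(L;tD;rD;lj)
  open DD am dd p l Dr w ve aG using(bottom;ci;cF;dD;d2;ul;rr)
  open GW am dd p l w Δ va using(degree;gd;bt)
  open Ga(Fin n)(l N.+ trivalents w)degree using(Slice;bL;bS;ll)
  open CT d
  open Ps d
  open Aa d using(ai)
  N = l N.+ trivalents w
  df : 1 ≤ d
  df = N.≤-trans(s≤s z≤n)dd
  sn : ℕ → ℕ → ℕ
  sn κ γ = ii(toℕ(c κ)N.≡ᵇ γ)
  SD : ∀ κ → sn κ(toℕ(c κ))≡ 1
  SD κ = cong ii(rl(toℕ(c κ)))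
  Ss : ∀ κ{γ}→ γ ≢ toℕ(c κ)→ sn κ γ ≡ 0
  Ss κ f5 = cong ii(fa(f5 ∘ sym))
  SU : ∀ κ γ → sn κ(toℕ γ)≡ ii(does(c κ O.≟ γ))
  SU κ γ = by(c κ O.≟ γ)
   where
   by :(e : Dec(c κ ≡ γ))→ sn κ(toℕ γ)≡ ii(does e)
   by(yes refl)= SD κ
   by(no gX)= Ss κ λ e → gX(O.toℕ-injective(sym e))
  cG : ∀ κ γ → VL d κ → γ < N → ci κ γ ≡ sn κ γ
  cG κ γ v Ne = subst(λ γ → ci κ γ ≡ sn κ γ)(O.toℕ-fromℕ< Ne)
   (trans(Cf κ v(Fin.fromℕ< Ne))(sym(SU κ(Fin.fromℕ< Ne))))
  wu : ∀(f : ℕ → ℤ){a b}→(∀ γ → γ < N → a γ ≡ b γ)→ wi N f a ≡ wi N f b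
  wu f{a}{b}eq = wn N{f}{f}{a}{b}λ γ Ne → cong(λ x → + x I.* f γ)(eq γ Ne)
  wE : ∀ κ(f : ℕ → ℤ){a}→(∀ γ → γ < N → a γ ≡ sn κ γ)→ wi N f a ≡ f(toℕ(c κ))
  wE κ f{a}eq = trans(wu f{a}{sn κ}eq)(ws N f(sn κ)(toℕ(c κ))(O.toℕ<n(c κ))(SD κ)λ γ → Ss κ)
  wM : ∀(f : ℕ → ℤ){a}→(∀ γ → γ < N → a γ ≡ 0)→ wi N f a ≡ I.0ℤ
  wM f{a}eq = trans(wu f{a}{λ _ → 0}eq)(trans(sm{N}λ γ → I.*-zeroˡ(f(toℕ γ)))(a9.sum-replicate-zero N))
  c3 : ∀ κ bK → VL d κ → VL d bK → toℕ(c κ)≡ toℕ(c bK)→ κ ≡ bK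
  c3 κ bK v vb eq with κ N.≟ bK
  ... | yes e4 = e4
  ... | no e5 = ⊥-elim(f>(trans(sym(d7 κ v))(trans(cong(dD κ v)eq)(d7 bK vb))))
   where
   d7 : ∀ x → VL d x → dD κ v(toℕ(c x))≡ ul κ v x tt
   d7 x vx = trans(sym(wE x(dD κ v){ci x}λ γ → cG x γ vx))(d2 κ v x vx)
   f> : ul κ v κ tt ≢ ul κ v bK tt
   f> e with()← trans(sym(cong(λ f → f tt)(rc κ(λ _ → + 1)λ _ _ → I.0ℤ)))(trans e(cong(λ f → f tt)(ro(λ _ → + 1)(λ _ _ → I.0ℤ)(e5 ∘ sym))))
  c! : ∀ κ → VL d κ → l ≤ toℕ(c κ)
  c! κ v = N.≮⇒≥ λ C5 → N.1+n≢0(trans(sym(trans(Cf κ v(c κ))(i2(c κ O.≟ c κ)refl)))(cF κ(toℕ(c κ))C5))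
  labels = bL w gd
  lS : ∀ m i → lL tD labels m i ≡ fD(p I.+ + l)m i
  lS m i = trans(cong(λ V → V m i)(trans(ll w gd)(pI L rD tD l)))
   (trans(lj l 1 N.≤-refl m i)(iD df(p I.+ + l)m i))
  fd : ∀ m i → tD m i ≡ fD p m i
  fd = iD df p
  d? : ∀ κ → VL d κ → ∀ i → degree(toℕ(c κ))i ≡ fD p κ i I.+ fD(p I.+ + l)(d ∸ κ)i
  d? κ v i = trans(sym(wE κ(λ γ → degree γ i){ci κ}λ γ → cG κ γ v))
   (trans(SG.a/(Fin n)d N degree κ bottom labels i(N.<⇒≤(proj₂ v))ve aG rr(bS w gd)
    (λ i → trans(fd d i)(ft p i df N.≤-refl))(lS 0))
    (cong₂ I._+_(fd κ i)(lS(d ∸ κ)i)))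
  ou : Fin N → Fin n → ℤ
  ou ad i = Te.fl(Fin n)d N degree i(toℕ ad)bottom tD labels
  Cv : ∀ ad i ζ χ →(∀ x → VL d x → degree(toℕ(c x))i ≡ ζ x)→(∀ x → VL d x → + ii(does(c x O.≟ ad))≡ χ x)→
   Pt(si ζ)(si χ)id(λ m → tD m i)ae(λ m → lL tD labels m i)(ou ad i)
  Cv ad i ζ χ gY gZ = FS.Sr(Fin n)N degree i(toℕ ad)bottom labels(bS w gd)
   (lp bottom ai ve aG(λ{x}{y}{a}→ f!{x}{y}{a})(SC bottom ve aG N(toℕ ∘ c)c3 cG))
   where
   f! : ∀{x y a}→ 1 ≤ x → x < y → y ≤ d →(∀ γ → γ < N → SW(toℕ ∘ c)γ x y a)→
    wi N(λ γ → degree γ i)a ≡ si ζ x y × + a(toℕ ad)≡ si χ x y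
   f!{x}{y}{a}xb xf yd Sq = by(suc x N.≟ y)
    where
    f = λ γ → degree γ i
    by : Dec(suc x ≡ y)→ wi N f a ≡ si ζ x y × + a(toℕ ad)≡ si χ x y
    by(yes e)= trans(wE x f{a}A0)(trans(gY x v)(sym(sL ζ e))),
     trans(cong +_(trans(A0(toℕ ad)(O.toℕ<n ad))(SU x ad)))(trans(gZ x v)(sym(sL χ e)))
     where
     v : VL d x
     v = xb , N.<-≤-trans xf yd
     A0 : ∀ γ → γ < N → a γ ≡ sn x γ
     A0 γ Ne = trans(Sq γ Ne)(cong(λ b → ii(b ∧(toℕ(c x)N.≡ᵇ γ)))(trans(cong(suc x N.≡ᵇ_)(sym e))(rl x)))
    by(no ne)= trans(wM f{a}nf)(sym(sC ζ ne)), trans(cong +_(nf(toℕ ad)(O.toℕ<n ad)))(sym(sC χ ne))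
     where
     nf : ∀ γ → γ < N → a γ ≡ 0
     nf γ Ne = trans(Sq γ Ne)(cong(λ b → ii(b ∧(toℕ(c x)N.≡ᵇ γ)))(fa ne))
  i3 : Fin N → Fin n → ℚ
  i3 ad i = sumℚ{N}λ γ → arrows am p l w γ ad Q.* ι(degree(toℕ γ)i)
  ub : ∀ ad i → l ≤ toℕ ad → i3 ad i ≡ ι(I.- ou ad i)
  ub ad i Lk = trans(Bn.b2(Fin n)d N degree i(toℕ ad)w l(topWeights am p l)(pL L rD(positions am l))(tW p l)gd)
   (cong ι(trans(cong(λ z → z I.- ou ad i)(fz(Fin n)d N degree i(toℕ ad)(pL L rD(positions am l))(m*(λ b → b(toℕ ad)Lk)bt)))
    (I.+-identityˡ(I.- ou ad i))))
  mf : ∀ ad i → isFrozen am p l w ad ≡ false → i3 ad i ≡ 0ℚ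
  mf ad i mutable = trans(ub ad i(uG(toℕ ad N.<ᵇ l)refl mutable))
   (cong(λ z → ι(I.- z))(fz(Fin n)d N degree i(toℕ ad)labels(iN bottom(toℕ ad)(ob(toℕ ad N.<ᵇ l)mutable))))
   where
   uG : ∀ b →(toℕ ad N.<ᵇ l)≡ b → b ∨ isNonzeroOn bottom(toℕ ad)≡ false → l ≤ toℕ ad
   uG false e _ = N.≮⇒≥ λ l/ → subst Data.Bool.Base.T e(N.<⇒<ᵇ l/)
    where import Data.Bool.Base
   ob : ∀ b → b ∨ isNonzeroOn bottom(toℕ ad)≡ false → isNonzeroOn bottom(toℕ ad)≡ false
   ob false e = e
module C2 where
 open IS
 open CN
 open Ex
 open FB using(module Fm;rl;fa)
 open Sl
 open KF
 open KW
 open Wo using(Ac)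
 open Ie using(module Cu;sd;wa)
 open To
 open Gd using(wi;su;rc;ro)
 open Bt
 open Du
 open CL
 open De
 open RF
 open LF
 open LS
 open Ct using(ii)
 open import Defs using(det;num;den)
 open CommutativeRing ri
 open EA ri
 Su : ∀{d N β}{Δ : Fin N → ℂ}{γs : Defs.Weights β}{U : Flag d}{Gs}→ Defs.SliceDecoration Δ γs U Gs → Defs.IsDecoratedFlag U
 Su{γs = All.[]}{Gs = All.[]}fR = fR
 Su{γs = _ All.∷ _}{Gs = _ All.∷ _}(fR , _)= fR
 dJ : ∀{d N β ae}{Δ : Fin N → ℂ}(w : Weave β ae){v}{γs : Defs.Weights β}{U : Flag d}{Gs}→ Defs.Decoration Δ w v γs U Gs → Defs.IsDecoratedFlag U
 dJ Defs.[]{γs = γs}s = Su{γs = γs}s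
 dJ(m Defs.∷ w){γs = γs}(s , _)= Su{γs = γs}s
 module Ir{d n : ℕ}{σ : Signature n}(am : Admissible d σ)(dd : 2 N.≤ d)(p q : ℤ)(la lb : ℕ)(dA : d N.< la)(dC : d N.< lb)(ln : la N.+ lb ≡ n)
  {a' a*}(w₁ : Weave(topWord am p la)a')(w₂ : Weave(topWord am q lb)a*)
  (vd : All(VL d)a')(ao : Ac id a')(vc : All(VL d)a*)(ax : Ac id a*)
  (Δ₁ : Fin(la N.+ trivalents w₁)→ K d σ)(variables₁ : AreWeaveVariables am p la w₁ Δ₁)
  (Δ₂ : Fin(lb N.+ trivalents w₂)→ K d σ)(variables₂ : AreWeaveVariables am q lb w₂ Δ₂)
  (p* : ∀ u k → 𝓕 am u(p I.+ + la)k ≡ 𝓕 am u q k)(qb : ∀ u k → 𝓕 am u(q I.+ + lb)k ≡ 𝓕 am u p k)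
  (covering : ∀ r →(∃ λ i → i N.< la × rd am(p I.+ + i)≡ r)⊎(∃ λ i → i N.< lb × rd am(q I.+ + i)≡ r))
  (c₁ : Fin(d ∸ 1)→ Fin(la N.+ trivalents w₁))(c₂ : Fin(d ∸ 1)→ Fin(lb N.+ trivalents w₂))
  (carries₁ : ∀ i u → eval(function(num(Δ₁(c₁ i))))u ≈ det(𝓕 am u p(suc(toℕ i))Defs.∧ 𝓕 am u q(d ∸ suc(toℕ i)))* eval(function(den(Δ₁(c₁ i))))u)
  (carries₂ : ∀ i u → eval(function(num(Δ₂(c₂ i))))u ≈ det(𝓕 am u p(suc(toℕ i))Defs.∧ 𝓕 am u q(d ∸ suc(toℕ i)))* eval(function(den(Δ₂(c₂ i))))u)where
  private
   module Fr = Fm ri d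
   module Cm = Ci d
   df : 1 N.≤ d
   df = N.≤-trans(N.s≤s N.z≤n)dd
  i+ : ℕ → Fin(d ∸ 1)
  i+ κ with κ ∸ 1 N.<? d ∸ 1
  ... | yes Dl = Fin.fromℕ< Dl
  ... | no _ = Fin.fromℕ<(N.∸-monoˡ-≤ 1 dd)
  tB : ∀{κ}→ VL d κ → suc(toℕ(i+ κ))≡ κ
  tB{suc κ}(_ , Dl)with κ N.<? d ∸ 1
  ... | yes DF = P.cong suc(O.toℕ-fromℕ< DF)
  ... | no Dv = ⊥-elim(Dv(N.∸-monoˡ-≤ 1 Dl))
  me : ∀{κ}→ VL d κ → VL d(d ∸ κ)
  me{κ}(f6 , Dl)= N.m<n⇒0<n∸m Dl , N.∸-monoʳ-< f6(N.<⇒≤ Dl)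
  t8 : ∀ p l{β}(w : Weave(topWord am p l)β)Δ(va : AreWeaveVariables am p l w Δ)u → Unit(eval(proj₁ va)u)→
   ¬ ¬ ∃ λ f → ∀ k → k N.≤ d → 𝓕 am u p k ap Fr.we f k
  t8 p l w Δ va u un = λ nf → Fg.fj d dd(dJ w(proj₂(proj₂(proj₂(proj₂ va)u un))))
   λ(f , _ , r)→ nf(f , λ k kd → tr(λ T → reflexive(P.cong(λ x → x T)(P.sym(ig am df u p k))))(r k kd))
  mY : ∀ κ → κ N.≤ d → ∀ u → Unit(eval(proj₁ variables₁)u)→ Unit(eval(proj₁ variables₂)u)→
   top(𝓕 am u p(d ∸ κ)aI 𝓕 am u q κ)≈ Cm.sS κ(d ∸ κ)* top(𝓕 am u q κ aI 𝓕 am u p(d ∸ κ))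
  mY κ da u uC uE = Co.stable _ _ λ nf → t8 p la w₁ Δ₁ variables₁ u uC λ(g , rg)→ t8 q lb w₂ Δ₂ variables₂ u uE λ(f , rf)→ nf
   (trans(co(rg(d ∸ κ)(N.m∸n≤m d κ))(rf κ da)full)(trans(Cm.wj f κ g(d ∸ κ)full)
    (*-congˡ{Cm.sS κ(d ∸ κ)}(co(sy(rf κ da))(sy(rg(d ∸ κ)(N.m∸n≤m d κ)))full))))
  ck : ℕ → Fin(la N.+ trivalents w₁)
  ck κ = c₁(i+ κ)
  cm : ℕ → Fin(lb N.+ trivalents w₂)
  cm κ = c₂(i+(d ∸ κ))
  iR : ∀{m}b → + m ≡(if b then + 1 else I.0ℤ)→ m ≡ ii b
  iR true = I.+-injective
  iR false = I.+-injective
  Cw : ∀ κ → VL d κ → ∀ u → eval(function(num(Δ₁(ck κ))))u ≈ 1# * top(𝓕 am u p κ aI 𝓕 am u q(d ∸ κ))* eval(function(den(Δ₁(ck κ))))u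
  Cw κ v u = P.subst(λ j → eval(function(num(Δ₁(ck κ))))u ≈ 1# * top(𝓕 am u p j aI 𝓕 am u q(d ∸ j))* eval(function(den(Δ₁(ck κ))))u)(tB v)
   (trans(carries₁(i+ κ)u)(*-congʳ{eval(function(den(Δ₁(ck κ))))u}(trans(aL(𝓕 am u p(suc(toℕ(i+ κ))))(𝓕 am u q(d ∸ suc(toℕ(i+ κ))))full)(sym(*-identityˡ _)))))
  Cx : ∀ κ → VL d κ → ∀ u → Unit(eval(proj₁ variables₂)u)→ Unit(eval(proj₁ variables₁)u)→
   eval(function(num(Δ₂(cm κ))))u ≈ Cm.sS κ(d ∸ κ)* top(𝓕 am u q κ aI 𝓕 am u p(d ∸ κ))* eval(function(den(Δ₂(cm κ))))u
  Cx κ v u uE uC = trans(carries₂ k u)(*-congʳ{eval(function(den(Δ₂(cm κ))))u}(trans(aL(𝓕 am u p(suc(toℕ k)))(𝓕 am u q(d ∸ suc(toℕ k)))full)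
   (trans(reflexive(P.cong(λ j → top(𝓕 am u p j aI 𝓕 am u q(d ∸ j)))(tB(me v))))
    (trans(reflexive(P.cong(λ j → top(𝓕 am u p(d ∸ κ)aI 𝓕 am u q j))(N.m∸[m∸n]≡n(N.<⇒≤(proj₂ v)))))(mY κ(N.<⇒≤(proj₂ v))u uC uE)))))
   where
   k = i+(d ∸ κ)
  c+ : ∀ κ → VL d κ → ∀ γ → DD.ci am dd p la dA w₁ vd ao κ(toℕ γ)≡ ii(does(ck κ O.≟ γ))
  c+ κ v γ = iR(does(ck κ O.≟ γ))(Id.cZ am dd(record{p = p ;q = q ;la = la ;lb = lb ;dA = dA ;dC = dC ;ln = ln
   ;a' = a' ;a* = a* ;w₁ = w₁ ;w₂ = w₂ ;vd = vd ;ao = ao ;vc = vc ;ax = ax ;Δ₁ = Δ₁ ;variables₁ = variables₁ ;Δ₂ = Δ₂ ;variables₂ = variables₂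
   ;p* = p* ;qb = qb ;covering = covering ;ag = κ ;vg = v ;b' = ck κ ;ε = 1# ;Cz = λ u _ _ → Cw κ v u})γ)
  c~ : ∀ κ → VL d κ → ∀ γ → DD.ci am dd q lb dC w₂ vc ax κ(toℕ γ)≡ ii(does(cm κ O.≟ γ))
  c~ κ v γ = iR(does(cm κ O.≟ γ))(Id.cZ am dd(record{p = q ;q = p ;la = lb ;lb = la ;dA = dC ;dC = dA ;ln = P.trans(N.+-comm lb la)ln
   ;a' = a* ;a* = a' ;w₁ = w₂ ;w₂ = w₁ ;vd = vc ;ao = ax ;vc = vd ;ax = ao ;Δ₁ = Δ₂ ;variables₁ = variables₂ ;Δ₂ = Δ₁ ;variables₂ = variables₁
   ;p* = qb ;qb = p* ;covering = λ r → Sum.swap(covering r);ag = κ ;vg = v ;b' = cm κ ;ε = Cm.sS κ(d ∸ κ);Cz = Cx κ v})γ)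
module e6 where
 open KF
 open Wo using(Ac;rk)
 open BP using(module Aa)
 open To
 open Bl using(ι;b>)
 open Du using(module DD)
 open RF using(rd;ru;pO)
 open Tr using(module FD)
 open WD using(module GW)
 open CP
 open TP using(module TG)
 open Ct
 open C2
 open Sl using(lL)
 open FB using(rl;fa)
 open import Relation.Binary.PropositionalEquality.Core using(refl;sym;trans;cong;cong₂;subst)
 open import Data.Nat.Base using(_≤_;_<_)
 vw : ∀{d β ae}→ Weave β ae → All(VL d)β → All(VL d)ae
 vw [] vs = vs
 vw(m ∷ w)vs = vw w(vm m vs)
 module Hl{d n : ℕ}{σ : Signature n}(am : Admissible d σ)(dd : 2 ≤ d)(A : InitialSeed d σ am)where
  open InitialSeed A
  open FD am using(fD;fp)
  private instance
   n≢0 : N.NonZero n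
   n≢0 = N.>-nonZero(N.≤-trans(s≤s z≤n)(size σ))
  la lb : ℕ
  la = q ∸ p
  lb = p N.+ n ∸ q
  p6 : p N.+ la ≡ q
  p6 = N.m+[n∸m]≡n p≤q
  qv : q ≤ p N.+ n
  qv = N.≤-trans q≤n(N.m≤n+m n p)
  qn : q N.+ lb ≡ p N.+ n
  qn = N.m+[n∸m]≡n qv
  ln : la N.+ lb ≡ n
  ln = N.+-cancelˡ-≡ p(la N.+ lb)n(trans(sym(N.+-assoc p la lb))(trans(cong(N._+ lb)p6)qn))
  dA : d < la
  dA = N.m≤n⊓o⇒m≤n(q ∸ p)(n ∸(q ∸ p))valid-cut
  dC : d < lb
  dC = subst(d <_)(trans(cong(_∸ la)(sym ln))(N.m+n∸m≡n la lb))(N.m≤n⊓o⇒m≤o(q ∸ p)(n ∸(q ∸ p))valid-cut)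
  fB : ∀(u : Point d n)k → 𝓕 am u(+ p I.+ + la)k ≡ 𝓕 am u(+ q)k
  fB u k = cong(λ j → 𝓕 am u(+ j)k)p6
  fC : ∀(u : Point d n)k → 𝓕 am u(+ q I.+ + lb)k ≡ 𝓕 am u(+ p)k
  fC u k = trans(cong(λ j → 𝓕 am u(+ j)k)qn)(pO am u p k)
  dM : ∀ k i → fD(+ p I.+ + la)k i ≡ fD(+ q)k i
  dM k i = cong(λ j → fD(+ j)k i)p6
  dW : ∀ k i → fD(+ q I.+ + lb)k i ≡ fD(+ p)k i
  dW k i = trans(cong(λ j → fD(+ j)k i)qn)(fp p k i)
  rG : ∀ r → rd am(+ toℕ r)≡ r
  rG r = O.toℕ-injective(trans(O.toℕ-fromℕ< _)(N.m<n⇒m%n≡m(O.toℕ<n r)))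
  Cg : ∀ r →(∃ λ i → i < la × rd am(+ p I.+ + i)≡ r)⊎(∃ λ i → i < lb × rd am(+ q I.+ + i)≡ r)
  Cg r = by(p N.≤? toℕ r)(toℕ r N.<? q)
   where
   by : Dec(p ≤ toℕ r)→ Dec(toℕ r < q)→(∃ λ i → i < la × rd am(+ p I.+ + i)≡ r)⊎(∃ λ i → i < lb × rd am(+ q I.+ + i)≡ r)
   by(yes Pi)(yes RP)= inj₁(toℕ r ∸ p , N.∸-monoˡ-< RP Pi , trans(cong(λ j → rd am(+ j))(N.m+[n∸m]≡n Pi))(rG r))
   by(yes Pi)(no RG)= inj₂(toℕ r ∸ q , N.∸-monoˡ-<(N.<-≤-trans(O.toℕ<n r)(N.m≤n+m n p))(N.≮⇒≥ RG),
    trans(cong(λ j → rd am(+ j))(N.m+[n∸m]≡n(N.≮⇒≥ RG)))(rG r))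
   by(no PC)_ = inj₂(toℕ r N.+ n ∸ q , N.∸-monoˡ-<(N.+-monoˡ-< n(N.≰⇒> PC))qr ,
    trans(cong(λ j → rd am(+ j))(N.m+[n∸m]≡n qr))(trans(ru am(toℕ r))(rG r)))
    where
    qr : q ≤ toℕ r N.+ n
    qr = N.≤-trans q≤n(N.m≤n+m n(toℕ r))
  vd : All(VL d)β₁′
  vd = vw w₁(TW.tW am(+ p)la)
  vc : All(VL d)β₂′
  vc = vw w₂(TW.tW am(+ q)lb)
  ao : Ac id β₁′
  ao = rk β₁′ vd reduced₁
  ax : Ac id β₂′
  ax = rk β₂′ vc reduced₂
  open Ir am dd(+ p)(+ q)la lb dA dC ln w₁ w₂ vd ao vc ax Δ₁ variables₁ Δ₂ variables₂
   fB fC Cg c₁ c₂ carries₁ carries₂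
  module Bb = CB am dd(+ p)la dA w₁ vd ao Δ₁ variables₁ ck c+
  module Ba = CB am dd(+ q)lb dC w₂ vc ax Δ₂ variables₂ cm c~
  open Ps d
  open Aa d using(Rv)
  Na = la N.+ trivalents w₁
  Nb = lb N.+ trivalents w₂
  dk : Fin Na → Fin n → ℤ
  dk γ = GW.degree am dd(+ p)la w₁ Δ₁ variables₁(toℕ γ)
  dl : Fin Nb → Fin n → ℤ
  dl γ = GW.degree am dd(+ q)lb w₂ Δ₂ variables₂(toℕ γ)
  hi : ∀ γ → HomogeneousOfDegree(dk γ)(Δ₁ γ)
  hi = GW.hm am dd(+ p)la w₁ Δ₁ variables₁
  hj : ∀ γ → HomogeneousOfDegree(dl γ)(Δ₂ γ)
  hj = GW.hm am dd(+ q)lb w₂ Δ₂ variables₂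
  cK : Fin n → ℕ → ℤ
  cK i x = fD(+ p)x i I.+ fD(+ q)(d ∸ x)i
  dX : ∀ κ → VL d κ → ∀ i → dk(ck κ)i ≡ cK i κ
  dX κ v i = trans(Bb.d? κ v i)(cong(λ z → fD(+ p)κ i I.+ z)(dM(d ∸ κ)i))
  dY : ∀ κ → VL d κ → ∀ i → dl(cm κ)i ≡ cK i(d ∸ κ)
  dY κ v i = trans(Ba.d? κ v i)(trans(cong₂ I._+_(cong(λ x → fD(+ q)x i)(sym(N.m∸[m∸n]≡n(N.<⇒≤(proj₂ v)))))(dW(d ∸ κ)i))
   (I.+-comm(fD(+ q)(d ∸(d ∸ κ))i)(fD(+ p)(d ∸ κ)i)))
  m3 : ℕ → ℕ → ℤ
  m3 κ x = + ii(x N.≡ᵇ κ)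
  mQ : ∀{A : Set}κ x(e : Dec A)→(A → x ≡ κ)→(x ≡ κ → A)→ + ii(does e)≡ m3 κ x
  mQ κ x(yes a)to fP with refl ← to a = cong(λ b → + ii b)(sym(rl κ))
  mQ κ x(no AT)to fP = cong(λ b → + ii b)(sym(fa(AT ∘ fP)))
  ml : ∀{κ}→ VL d κ → d ∸(d ∸ κ)≡ κ
  ml v = N.m∸[m∸n]≡n(N.<⇒≤(proj₂ v))
  ol : ∀ κ → VL d κ → ∀ i → Bb.ou(ck κ)i I.+ Ba.ou(cm(d ∸ κ))i ≡ I.0ℤ
  ol κ v i = fI{β₁′}{cK i}{m3 κ}vd(DD.rr am dd(+ p)la dA w₁ vd ao)Pk
   (λ m → trans(Bb.lS m i)(trans(dM m i)(sym(Ba.fd m i))))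
   (subst(λ β → Pt(si(λ x → cK i(d ∸ x)))(si(λ x → m3 κ(d ∸ x)))id(λ m → TG.tD am dd(+ q)m i)β
    (λ m → lL(TG.tD am dd(+ q))Ba.labels m i)(Ba.ou(cm(d ∸ κ))i))reversed Pm)
   where
   Pk = Bb.Cv(ck κ)i(cK i)(m3 κ)(λ x vx → dX x vx i)
    λ x vx → mQ κ x(ck x O.≟ ck κ)(λ e → Bb.c3 x κ vx v(cong toℕ e))(cong ck)
   Pm = Ba.Cv(cm(d ∸ κ))i(λ x → cK i(d ∸ x))(λ x → m3 κ(d ∸ x))(λ x vx → dY x vx i)
    λ x vx → mQ κ(d ∸ x)(cm x O.≟ cm(d ∸ κ))
     (λ e → trans(cong(d ∸_)(Ba.c3 x(d ∸ κ)vx(me v)(cong toℕ e)))(ml v))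
     (λ e → cong cm(trans(sym(ml vx))(cong(d ∸_)e)))
  c0 : ∀ k → VL d(suc(toℕ{d ∸ 1}k))
  c0 k = s≤s z≤n , N.<-≤-trans(s≤s(O.toℕ<n k))(N.≤-reflexive(N.m+[n∸m]≡n(N.≤-trans(s≤s z≤n)dd)))
  i* : ∀ k → i+(suc(toℕ k))≡ k
  i* k = O.toℕ-injective(N.suc-injective(tB(c0 k)))
  c? : ∀ k → c₁ k ≡ ck(suc(toℕ k))
  c? k = cong c₁(sym(i* k))
  c% : ∀ k → c₂ k ≡ cm(d ∸ suc(toℕ k))
  c% k = cong c₂(sym(trans(cong i+(ml(c0 k)))(i* k)))
  dP : ∀ k i → dk(c₁ k)i ≡ dl(c₂ k)i
  dP k i = trans(cong(λ γ → dk γ i)(c? k))(trans(dX(suc(toℕ k))v i)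
   (trans(cong(cK i)(sym(ml v)))(trans(sym(dY(d ∸ suc(toℕ k))(me v)i))(cong(λ γ → dl γ i)(sym(c% k))))))
   where v = c0 k
  Ch : ∀ k i → Bb.i3(c₁ k)i Q.+ Ba.i3(c₂ k)i ≡ 0ℚ
  Ch k i = trans(cong₂ Q._+_(trans(cong(λ γ → Bb.i3 γ i)(c? k))(Bb.ub(ck κ)i(Bb.c! κ v)))
   (trans(cong(λ γ → Ba.i3 γ i)(c% k))(Ba.ub(cm(d ∸ κ))i(Ba.c!(d ∸ κ)(me v)))))
   (trans(sym(b>(I.- Bb.ou(ck κ)i)(I.- Ba.ou(cm(d ∸ κ))i)))
    (cong ι(trans(sym(I.neg-distrib-+(Bb.ou(ck κ)i)(Ba.ou(cm(d ∸ κ))i)))(cong I.-_(ol κ v i)))))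
   where
   κ = suc(toℕ k)
   v = c0 k
module Fo where
 open IS
 open CN
 open Gd using(su)
 open CL
 open Tr
 open TP
 open import Defs using(_:+_;_:*_;Fraction)
 module RJ(R : CommutativeRing 0ℓ 0ℓ)where
  open CommutativeRing R
  open In R using(solve;_:=_)renaming(_:+_ to _al_;_:*_ to _ac_)
  Rl :(m n d na dc : Carrier)→ Set
  Rl m n d na dc = na * d ≈ m *(n * dc)
  Rd : ∀{m< nE dR ng dh m> nG dS ni dj}→ Rl m< nE dR ng dh → Rl m> nG dS ni dj → Rl(m< * m>)(nE * nG)(dR * dS)(ng * ni)(dh * dj)
  Rd{m<}{nE}{dR}{ng}{dh}{m>}{nG}{dS}{ni}{dj}RK RL = trans(S* ng ni dR dS)(trans(*-cong RK RL)
   (trans(S* m<(nE * dh)m>(nG * dj))(*-congˡ(S* nE dh nG dj))))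
   where
   S* : ∀ a b c d → a * b *(c * d)≈ a * c *(b * d)
   S* = solve 4(λ a b c d → a ac b ac(c ac d):= a ac c ac(b ac d))refl
  Rf : ∀{m nE dR ng dh nG dS ni dj}→ Rl m nE dR ng dh → Rl m nG dS ni dj →
   Rl m(nE * dS + nG * dR)(dR * dS)(ng * dj + ni * dh)(dh * dj)
  Rf{m}{nE}{dR}{ng}{dh}{nG}{dS}{ni}{dj}RK RL = trans
   (solve 6(λ ng dh ni dj dR dS →(ng ac dj al ni ac dh)ac(dR ac dS):= ng ac dR ac(dS ac dj)al ni ac dS ac(dR ac dh))refl ng dh ni dj dR dS)
   (trans(+-cong(*-congʳ RK)(*-congʳ RL))
    (solve 7(λ m nE dR nG dS dh dj → m ac(nE ac dh)ac(dS ac dj)al m ac(nG ac dj)ac(dR ac dh):= m ac((nE ac dS al nG ac dR)ac(dh ac dj)))refl m nE dR nG dS dh dj))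
  c5 : ∀{a b x w}→ x * w ≈ 1# → a * x ≈ b * x → a ≈ b
  c5{a}{b}{x}{w}xw eq = trans(sym(uJ a))(trans(*-congʳ eq)(uJ b))
   where
   uJ : ∀ c → c * x * w ≈ c
   uJ c = trans(*-assoc c x w)(trans(*-congˡ xw)(*-identityʳ c))
  r! : ∀{m n d na dc N D Nc Da w}→ d * dc * w ≈ 1# → n * D ≈ N * d → na * Da ≈ Nc * dc → Rl m n d na dc → Rl m N D Nc Da
  r!{m}{n}{d}{na}{dc}{N}{D}{Nc}{Da}un e ed r = c5 un(trans
   (solve 4(λ Nc D d dc → Nc ac D ac(d ac dc):= Nc ac dc ac(D ac d))refl Nc D d dc)(trans(*-congʳ(sym ed))(trans
   (solve 4(λ na Da D d → na ac Da ac(D ac d):= na ac d ac(Da ac D))refl na Da D d)(trans(*-congʳ r)(trans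
   (solve 5(λ m n dc Da D → m ac(n ac dc)ac(Da ac D):= m ac(n ac D)ac(Da ac dc))refl m n dc Da D)(trans(*-congʳ(*-congˡ e))
   (solve 5(λ m N d Da dc → m ac(N ac d)ac(Da ac dc):= m ac(N ac Da)ac(d ac dc))refl m N d Da dc)))))))
  Rc : ∀{m M mh n d na dc y z ya za N D Nc Da w}→ na * d *(Da * D)* w ≈ 1# → m * mh ≈ 1# →
   n * y * D ≈ N *(d * z)→ na * ya * Da ≈ Nc *(dc * za)→ Rl m n d na dc → Rl M N D Nc Da → Rl(M * mh)y z ya za
  Rc{m}{M}{mh}{n}{d}{na}{dc}{y}{z}{ya}{za}{N}{D}{Nc}{Da}un m! e ed r R = c5 un(trans lq(sym RH))
   where
   m7 = M *(Da * dc * za)*(n * y * D)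
   lq : ya * z *(na * d *(Da * D))≈ m7
   lq = trans(solve 6(λ ya z na d Da D → ya ac z ac(na ac d ac(Da ac D)):= na ac ya ac Da ac(z ac d ac D))refl ya z na d Da D)(trans(*-congʳ ed)(trans
    (solve 6(λ Nc dc za z d D → Nc ac(dc ac za)ac(z ac d ac D):= Nc ac D ac(dc ac za ac(d ac z)))refl Nc dc za z d D)(trans(*-congʳ R)(trans
    (solve 7(λ M N Da dc za d z → M ac(N ac Da)ac(dc ac za ac(d ac z)):= M ac(Da ac dc ac za)ac(N ac(d ac z)))refl M N Da dc za d z)(*-congˡ(sym e))))))
   RH : M * mh *(y * za)*(na * d *(Da * D))≈ m7
   RH = trans(solve 8(λ M mh y za na d Da D → M ac mh ac(y ac za)ac(na ac d ac(Da ac D)):= na ac d ac(M ac mh ac y ac za ac Da ac D))refl M mh y za na d Da D)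
    (trans(*-congʳ r)(trans
    (solve 9(λ m n dc M mh y za Da D → m ac(n ac dc)ac(M ac mh ac y ac za ac Da ac D):= m ac mh ac(M ac(Da ac dc ac za)ac(n ac y ac D)))refl m n dc M mh y za Da D)
    (trans(*-congʳ m!)(*-identityˡ m7))))
 open CommutativeRing ri
 module HF(d n : ℕ)where
  open RawSemiring(fractions d n)using()renaming(_≈_ to _≈ᶠ_;_+_ to _+ᶠ_;_*_ to _*ᶠ_;1# to g1)
  open RawSemiringDefs(fractions d n)using()renaming(product to productᶠ;_^_ to _^ᶠ_)
  open RJ ri
  Ho :(Fin n → ℤ)→ Fraction d n → Set
  Ho δ x = ∀(t : Fin n → ℂˣ)(u : Point d n)→
   eval(numerator x)(rescale t u)* eval(denominator x)u ≈ Mo.mo t δ *(eval(numerator x)u * eval(denominator x)(rescale t u))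
  hc : ∀{δ ε x}→(∀ i → δ i ≡ ε i)→ Ho δ x → Ho ε x
  hc{δ}{ε}{x}eq h t u = trans(h t u)(*-congʳ{eval(numerator x)u * eval(denominator x)(rescale t u)}(Mo.mc t eq))
  h1 : Ho(λ _ → I.0ℤ)g1
  h1 t u = sym(trans(*-congʳ{1# * 1#}(Mo.m0 t))(*-identityˡ(1# * 1#)))
  hd : ∀{δ ε x y}→ Ho δ x → Ho ε y → Ho(λ i → δ i I.+ ε i)(x *ᶠ y)
  hd{δ}{ε}{x}{y}hx hy t u = trans
   (Rd{Mo.mo t δ}{eval(numerator x)u}{eval(denominator x)u}{eval(numerator x)(rescale t u)}{eval(denominator x)(rescale t u)}
    {Mo.mo t ε}{eval(numerator y)u}{eval(denominator y)u}{eval(numerator y)(rescale t u)}{eval(denominator y)(rescale t u)}(hx t u)(hy t u))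
   (*-congʳ{eval(numerator(x *ᶠ y))u * eval(denominator(x *ᶠ y))(rescale t u)}(sym(Mo.ma t δ ε)))
  hq : ∀{δ x y}→ Ho δ x → Ho δ y → Ho δ(x +ᶠ y)
  hq{δ}{x}{y}hx hy t u =
   Rf{Mo.mo t δ}{eval(numerator x)u}{eval(denominator x)u}{eval(numerator x)(rescale t u)}{eval(denominator x)(rescale t u)}
    {eval(numerator y)u}{eval(denominator y)u}{eval(numerator y)(rescale t u)}{eval(denominator y)(rescale t u)}(hx t u)(hy t u)
  hs : ∀{δ x}m → Ho δ x → Ho(λ i → + m I.* δ i)(x ^ᶠ m)
  hs{δ}{x}zero h = hc{λ _ → I.0ℤ}{λ i → + 0 I.* δ i}{g1}(λ i → P.sym(I.*-zeroˡ(δ i)))h1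
  hs{δ}{x}(suc m)h = hc{λ i → δ i I.+ + m I.* δ i}{λ i → + suc m I.* δ i}{x *ᶠ(x ^ᶠ m)}(λ i → P.sym(I.suc-*(+ m)(δ i)))
   (hd{δ}{λ i → + m I.* δ i}{x}{x ^ᶠ m}h(hs{δ}{x}m h))
  hp : ∀{N}{δ : Fin N → Fin n → ℤ}{x : Fin N → Fraction d n}→(∀ j → Ho(δ j)(x j))→ Ho(λ i → su λ j → δ j i)(productᶠ x)
  hp{zero}h = h1
  hp{suc N}{δ}{x}h = hd{δ Fin.zero}{λ i → su λ j → δ(Fin.suc j)i}{x Fin.zero}{productᶠ(x ∘ Fin.suc)}
   (h Fin.zero)(hp{N}{δ ∘ Fin.suc}{x ∘ Fin.suc}(h ∘ Fin.suc))
  hg : ∀{δ x}h → ¬ ¬ Nonvanishing h →(∀ t u → Unit(eval h u)→ Unit(eval h(rescale t u))→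
   eval(numerator x)(rescale t u)* eval(denominator x)u ≈ Mo.mo t δ *(eval(numerator x)u * eval(denominator x)(rescale t u)))→ Ho δ x
  hg{δ}{x}h h0 ge t u = trans(*-congʳ{eval D u}(sym(er t N u)))(trans(Co.stable _ _ λ nf → h0 λ h0 →
   nn h(rs t h)h0(nr t h h0)λ bE → nf(gn f g(h :* rs t h)bE pi u))
   (*-congˡ{Mo.mo t δ}(*-congˡ{eval N u}(er t D u))))
   where
   N = numerator x
   D = denominator x
   f = rs t N :* D
   g = const(Mo.mo t δ):*(N :* rs t D)
   pi : ∀ u → Unit(eval(h :* rs t h)u)→ eval f u ≈ eval g u
   pi u(z , uz)= trans(*-congʳ{eval D u}(er t N u))(trans(ge t u(eval(rs t h)u * z , trans(sym(*-assoc(eval h u)(eval(rs t h)u)z))uz)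
    (ur(er t h u)(eval h u * z , trans(sym(*-assoc(eval(rs t h)u)(eval h u)z))(trans(*-congʳ{z}(*-comm(eval(rs t h)u)(eval h u)))uz))))
    (*-congˡ{Mo.mo t δ}(*-congˡ{eval N u}(sym(er t D u)))))
  hr : ∀{δ x y}→ Nonvanishing(denominator x)→ x ≈ᶠ y → Ho δ x → Ho δ y
  hr{δ}{x}{y}d0 xl hx = hg{δ}{y}(denominator x)(λ nf → nf d0)λ t u un uj →
   r!{Mo.mo t δ}{eval(numerator x)u}{eval(denominator x)u}{eval(numerator x)(rescale t u)}{eval(denominator x)(rescale t u)}
    {eval(numerator y)u}{eval(denominator y)u}{eval(numerator y)(rescale t u)}{eval(denominator y)(rescale t u)}
    (proj₂(ui un uj))(xl u)(xl(rescale t u))(hx t u)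
  hk : ∀{δ ε x y z}→ Nonvanishing(numerator x)→ Nonvanishing(denominator x)→ ¬ ¬ Nonvanishing(denominator z)→(x *ᶠ y)≈ᶠ z →
   Ho δ x → Ho ε z → Ho(λ i → ε i I.- δ i)y
  hk{δ}{ε}{x}{y}{z}n< d0 D0 xF hx hz = hg{λ i → ε i I.- δ i}{y}(numerator x :*(denominator x :* denominator z))h0 pi
   where
   h0 : ¬ ¬ Nonvanishing(numerator x :*(denominator x :* denominator z))
   h0 nf = D0 λ D0 → nn(denominator x)(denominator z)d0 D0 λ DG → nn(numerator x)(denominator x :* denominator z)n< DG nf
   sJ : ∀{a b}→ Unit(a * b)→ Unit a × Unit b
   sJ{a}{b}(w , e)=(b * w , trans(sym(*-assoc a b w))e),(a * w , trans(sym(*-assoc b a w))(trans(*-congʳ{w}(*-comm b a))e))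
   pi : ∀ t u → Unit(eval(numerator x :*(denominator x :* denominator z))u)→ Unit(eval(numerator x :*(denominator x :* denominator z))(rescale t u))→
    eval(numerator y)(rescale t u)* eval(denominator y)u ≈ Mo.mo t(λ i → ε i I.- δ i)*(eval(numerator y)u * eval(denominator y)(rescale t u))
   pi t u un uj = trans
    (Rc{Mo.mo t δ}{Mo.mo t ε}{Mo.mo t(λ i → I.- δ i)}{eval(numerator x)u}{eval(denominator x)u}{eval(numerator x)(rescale t u)}{eval(denominator x)(rescale t u)}
     {eval(numerator y)u}{eval(denominator y)u}{eval(numerator y)(rescale t u)}{eval(denominator y)(rescale t u)}
     {eval(numerator z)u}{eval(denominator z)u}{eval(numerator z)(rescale t u)}{eval(denominator z)(rescale t u)}
     (proj₂(ui(ui(proj₁(sJ{eval(numerator x)(rescale t u)}uj))(proj₁(sJ{eval(denominator x)u}(proj₂(sJ{eval(numerator x)u}un)))))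
      (ui(proj₂(sJ{eval(denominator x)(rescale t u)}(proj₂(sJ{eval(numerator x)(rescale t u)}uj))))(proj₂(sJ{eval(denominator x)u}(proj₂(sJ{eval(numerator x)u}un)))))))
     (Mo.mn t δ)(xF u)(xF(rescale t u))(hx t u)(hz t u))
    (*-congʳ{eval(numerator y)u * eval(denominator y)(rescale t u)}(sym(Mo.ma t ε(λ i → I.- δ i))))
  n1 : Nonvanishing(const{d}{n}1#)
  n1 =(λ _ _ → 0#), 1# , *-identityˡ 1#
  dG : ∀{x}m → Nonvanishing(denominator x)→ ¬ ¬ Nonvanishing(denominator(x ^ᶠ m))
  dG zero d0 nf = nf n1
  dG{x}(suc m)d0 nf = dG{x}m d0 λ Er → nn(denominator x)(denominator(x ^ᶠ m))d0 Er nf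
  dp : ∀{N}{x : Fin N → Fraction d n}→(∀ j → ¬ ¬ Nonvanishing(denominator(x j)))→ ¬ ¬ Nonvanishing(denominator(productᶠ x))
  dp{zero}d0 nf = nf n1
  dp{suc N}{x}d0 nf = d0 Fin.zero λ a → dp{N}{x ∘ Fin.suc}(d0 ∘ Fin.suc)λ b →
   nn(denominator(x Fin.zero))(denominator(productᶠ(x ∘ Fin.suc)))a b nf
module Gc where
 open IS
 open CN
 open Gd using(su;sm)
 open Bl using(ι;b>;f1;nD;iL;S5;sc;s6;sX;sz)
 open CL using(nn)
 open Fo
 open import Relation.Binary.PropositionalEquality.Core using(refl;sym;trans;cong;cong₂)
 open import Defs using(Fraction)
 module SV = In Q.+-*-commutativeRing
 pg : ∀ r → [ r ]₊ Q.- [ Q.- r ]₊ ≡ r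
 pg r with Q.≤-total r 0ℚ
 ... | inj₁ Rj = trans(cong₂ Q._-_(Q.p≤q⇒p⊔q≡q Rj)(Q.p≥q⇒p⊔q≡p(Q.neg-antimono-≤ Rj)))(solve 1(λ r → con(+ 0):+ :-(:- r):= r)refl r)
  where open SV
 ... | inj₂ Ri = trans(cong₂ Q._-_(Q.p≥q⇒p⊔q≡p Ri)(Q.p≤q⇒p⊔q≡q(Q.neg-antimono-≤ Ri)))(solve 1(λ r → r :+ :- con(+ 0):= r)refl r)
  where open SV
 SJ : ∀ r → r ≡ Q.- r → r ≡ 0ℚ
 SJ r e = trans(sym(pg r))(trans(cong(λ s → [ r ]₊ Q.- [ s ]₊)(sym e))(Q.+-inverseʳ [ r ]₊))
 module Mt{N : ℕ}(b bd : Fin N → Fin N → ℚ)(k : Fin N)(aF : ∀ i j → b i j ≡ Q.- b j i)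
  (Ai : ∀ i j → i ≡ k ⊎ j ≡ k → bd i j ≡ Q.- b i j)
  (ok : ∀ i j → i ≢ k → j ≢ k → bd i j ≡ b i j Q.+([ b i k ]₊ Q.* [ b k j ]₊ Q.- [ b j k ]₊ Q.* [ b k i ]₊))where
  open SV
  bI : ∀ i j → [ b i j ]₊ Q.- [ b j i ]₊ ≡ b i j
  bI i j = trans(cong(λ z → [ b i j ]₊ Q.- [ z ]₊)(aF j i))(pg(b i j))
  Bm : b k k ≡ 0ℚ
  Bm = SJ(b k k)(aF k k)
  Ad : ∀ i j → bd i j ≡ Q.- bd j i
  Ad i j = by(i O.≟ k)(j O.≟ k)
   where
   nd : i ≡ k ⊎ j ≡ k → j ≡ k ⊎ i ≡ k → bd i j ≡ Q.- bd j i
   nd e ed = trans(Ai i j e)(cong Q.-_(trans(aF i j)(sym(Ai j i ed))))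
   by : Dec(i ≡ k)→ Dec(j ≡ k)→ bd i j ≡ Q.- bd j i
   by(yes e)_ = nd(inj₁ e)(inj₂ e)
   by(no _)(yes e)= nd(inj₂ e)(inj₁ e)
   by(no Ia)(no ja)= trans(ok i j Ia ja)(trans(cong(Q._+([ b i k ]₊ Q.* [ b k j ]₊ Q.- [ b j k ]₊ Q.* [ b k i ]₊))(aF i j))
    (trans(solve 5(λ x a b c e → :- x :+(a :* b :+ :-(c :* e)):= :-(x :+(c :* e :+ :-(a :* b))))refl(b j i)[ b i k ]₊ [ b k j ]₊ [ b j k ]₊ [ b k i ]₊)
     (cong Q.-_(sym(ok j i ja Ia)))))
  module _(D Da : Fin N → ℚ)(b7 : sumℚ(λ i → b i k Q.* D i)≡ 0ℚ)
   (Dk : Da k ≡ sumℚ(λ i → [ b i k ]₊ Q.* D i)Q.- D k)(Do : ∀ i → i ≢ k → Da i ≡ D i)where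
   P Q : ℚ
   P = sumℚ λ i → [ b i k ]₊ Q.* D i
   Q = sumℚ λ i → [ b k i ]₊ Q.* D i
   sE : P ≡ Q
   sE = trans(trans(sc{N}th)(s6{N}(λ i → b i k Q.* D i)(λ i → [ b k i ]₊ Q.* D i)))
    (trans(cong(Q._+ Q)b7)(Q.+-identityˡ Q))
    where
    th : ∀ i → [ b i k ]₊ Q.* D i ≡ b i k Q.* D i Q.+ [ b k i ]₊ Q.* D i
    th i = trans(solve 3(λ x y e → x :* e :=(x :+ :- y):* e :+ y :* e)refl [ b i k ]₊ [ b k i ]₊(D i))(cong(λ z → z Q.* D i Q.+ [ b k i ]₊ Q.* D i)(bI i k))
   bT : sumℚ(λ i → bd i k Q.* Da i)≡ 0ℚ
   bT = trans(sc{N}λ i → th i(i O.≟ k))(trans(sX{N}(Q.- Q.1ℚ)(λ i → b i k Q.* D i))(cong(Q.- Q.1ℚ Q.*_)b7))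
    where
    th : ∀ i → Dec(i ≡ k)→ bd i k Q.* Da i ≡ Q.- Q.1ℚ Q.*(b i k Q.* D i)
    th i(no Ia)= trans(cong₂ Q._*_(Ai i k(inj₂ refl))(Do i Ia))(solve 2(λ x e → :- x :* e := :- con(+ 1):*(x :* e))refl(b i k)(D i))
    th i(yes refl)= trans(cong(Q._* Da k)(trans(Ai k k(inj₂ refl))(cong Q.-_ Bm)))(trans(Q.*-zeroˡ(Da k))
     (sym(trans(cong(λ z → Q.- Q.1ℚ Q.*(z Q.* D k))Bm)(cong(Q.- Q.1ℚ Q.*_)(Q.*-zeroˡ(D k))))))
   e% : ℚ → Fin N → ℚ
   e% x i = if does(k O.≟ i)then x else 0ℚ
   bM : ∀ j → j ≢ k → sumℚ(λ i → b i j Q.* D i)≡ 0ℚ → sumℚ(λ i → bd i j Q.* Da i)≡ 0ℚ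
   bM j ja bn = trans(sc{N}λ i → th i(k O.≟ i)refl)(trans(s6{N}(λ i → b i j Q.* D i Q.+ x Q.*([ b i k ]₊ Q.* D i))(λ i → y Q.*([ b k i ]₊ Q.* D i)Q.+ e% z i))
    (trans(cong₂ Q._+_(trans(s6{N}(λ i → b i j Q.* D i)(λ i → x Q.*([ b i k ]₊ Q.* D i)))(cong₂ Q._+_ bn(sX{N}x(λ i → [ b i k ]₊ Q.* D i))))
     (trans(s6{N}(λ i → y Q.*([ b k i ]₊ Q.* D i))(e% z))(cong₂ Q._+_(trans(sX{N}y(λ i → [ b k i ]₊ Q.* D i))(cong(y Q.*_)(sym sE)))(sw k λ _ → z))))
     (trans(cong(λ w → 0ℚ Q.+ x Q.* P Q.+(y Q.* P Q.+ Q.-(w Q.* P)))(sym(bI k j)))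
      (solve 3(λ x y P → con(+ 0):+ x :* P :+(:- y :* P :+ :-((x :+ :- y):* P)):= con(+ 0))refl x [ b j k ]₊ P))))
    where
    x = [ b k j ]₊
    y = Q.- [ b j k ]₊
    z = Q.-(b k j Q.* P)
    sw : ∀{n}(a : Fin n)(h : Fin n → ℚ)→ sumℚ(λ i → if does(a O.≟ i)then h i else 0ℚ)≡ h a
    sw{suc n}Fin.zero h = trans(cong(h Fin.zero Q.+_)(sz{n}λ _ → refl))(Q.+-identityʳ(h Fin.zero))
    sw{suc n}(Fin.suc a)h = trans(Q.+-identityˡ _)(sw{n}a(h ∘ Fin.suc))
    th : ∀ i(e : Dec(k ≡ i))→(k O.≟ i)≡ e → bd i j Q.* Da i ≡(b i j Q.* D i Q.+ x Q.*([ b i k ]₊ Q.* D i))Q.+(y Q.*([ b k i ]₊ Q.* D i)Q.+ e% z i)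
    th i(no K1)e = trans(cong₂ Q._*_(ok i j(K1 ∘ sym)ja)(Do i(K1 ∘ sym)))(trans
     (solve 6(λ β u x v w e →(β :+(u :* x :+ :-(v :* w))):* e :=(β :* e :+ x :*(u :* e)):+(:- v :*(w :* e):+ con(+ 0)))refl(b i j)[ b i k ]₊ x [ b j k ]₊ [ b k i ]₊(D i))
     (cong(λ s →(b i j Q.* D i Q.+ x Q.*([ b i k ]₊ Q.* D i))Q.+(y Q.*([ b k i ]₊ Q.* D i)Q.+ s))(cong(λ e → if does e then z else 0ℚ)(sym e))))
    th i(yes refl)e = trans(cong₂ Q._*_(Ai k j(inj₁ refl))Dk)(trans
     (solve 6(λ β P e x y o → :- β :*(P :+ :- e):=(β :* e :+ x :*(con(+ 0):* e)):+(y :*(con(+ 0):* e):+ :-(β :* P)))refl(b k j)P(D k)x y 0ℚ)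
     (cong₂(λ o s →(b k j Q.* D k Q.+ x Q.*(o Q.* D k))Q.+(y Q.*(o Q.* D k)Q.+ s))(sym(cong [_]₊ Bm))(cong(λ e → if does e then z else 0ℚ)(sym e))))
 module _{d n : ℕ}{σ : Signature n}where
  open HF d n
  record GS{N : ℕ}(S : Seed d σ N): Set where
   field
    degree : Fin N → Fin n → ℤ
    hm : ∀ i → HomogeneousOfDegree(degree i)(extendedCluster S i)
    aF : ∀ i j → arrow S i j ≡ Q.- arrow S j i
    bn : ∀ j → frozen S j ≡ false → ∀ x → sumℚ(λ i → arrow S i j Q.* ι(degree i x))≡ 0ℚ
  ho : ∀{δ ε}(x y : K d σ)→ x ≈ᴷ y →(∀ i → δ i ≡ ε i)→ HomogeneousOfDegree δ y → HomogeneousOfDegree ε x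
  ho{δ}{ε}x y xl f* h = hc{δ}{ε}{fraction x}f*
   (hr{δ}{fraction y}{fraction x}(den≠0 y)(λ u → CommutativeRing.sym ri(xl u))h)
  m~ : ∀{N}{k : Fin N}{S S7 : Seed d σ N}→ IsMutation k S S7 → GS S → GS S7
  m~{N}{k}{S}{S7}μ G = record
   {degree = λ i → dE i(i O.≟ k)
   ;hm = λ i → hb i(i O.≟ k)
   ;aF = M.Ad
   ;bn = λ j fT x → bN j(trans(sym(frozen-same j))fT)x(j O.≟ k)
   }
   where
   open IsMutation μ
   open GS G
   open RawSemiring(fractions d n)using()renaming(_+_ to _+ᶠ_)
   open RawSemiringDefs(fractions d n)using()renaming(product to productᶠ;_^_ to _^ᶠ_)
   module M = Mt(arrow S)(arrow S7)k aF arrow-at-k arrow-off-k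
   eD :(Fin N → ℕ)→ Fin n → ℤ
   eD e x = su{N}λ j → + e j I.* degree j x
   dE : ∀ i → Dec(i ≡ k)→ Fin n → ℤ
   dE i(yes _)x = eD in# x I.- degree k x
   dE i(no _)= degree i
   eh : ∀ e(r : Fin N → ℚ)→(∀ i →(+ e i)Q./ 1 ≡ r i)→ ∀ x → ι(eD e x)≡ sumℚ{N}(λ i → r i Q.* ι(degree i x))
   eh e r eq x = trans(sym(S5{N}λ j → + e j I.* degree j x))
    (sc{N}λ j → trans(f1(+ e j)(degree j x))(cong(Q._* ι(degree j x))(eq j)))
   D Da : Fin n → Fin N → ℚ
   D x i = ι(degree i x)
   Da x i = ι(dE i(i O.≟ k)x)
   Dk : ∀ x → Da x k ≡ sumℚ{N}(λ i → [ arrow S i k ]₊ Q.* D x i)Q.- D x k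
   Dk x = by(k O.≟ k)
    where
    by :(e : Dec(k ≡ k))→ ι(dE k e x)≡ sumℚ{N}(λ i → [ arrow S i k ]₊ Q.* D x i)Q.- D x k
    by(no K!)= ⊥-elim(K! refl)
    by(yes _)= trans(b>(eD in# x)(I.- degree k x))(cong₂ Q._+_(eh in#(λ i → [ arrow S i k ]₊)in#-arrows x)(nD(degree k x)))
   Do : ∀ x i → i ≢ k → Da x i ≡ D x i
   Do x i ix = by(i O.≟ k)
    where
    by :(e : Dec(i ≡ k))→ ι(dE i e x)≡ D x i
    by(yes Iw)= ⊥-elim(ix Iw)
    by(no _)= refl
   eg : ∀ x → eD out# x ≡ eD in# x
   eg x = iL(trans(eh out#(λ i → [ arrow S k i ]₊)out#-arrows x)
    (trans(sym(M.sE(D x)(Da x)(bn k mutable x)(Dk x)(Do x)))(sym(eh in#(λ i → [ arrow S i k ]₊)in#-arrows x))))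
   bN : ∀ j → frozen S j ≡ false → ∀ x → Dec(j ≡ k)→ sumℚ{N}(λ i → arrow S7 i j Q.* Da x i)≡ 0ℚ
   bN j fT x(yes refl)= M.bT(D x)(Da x)(bn k mutable x)(Dk x)(Do x)
   bN j fT x(no jk)= M.bM(D x)(Da x)(bn k mutable x)(Dk x)(Do x)j jk(bn j fT x)
   pT :(Fin N → ℕ)→ Fin N → Fraction d n
   pT e i = fraction(extendedCluster S i)^ᶠ e i
   he : ∀ e → Ho(eD e)(productᶠ(pT e))
   he e = hp{N}{λ j x → + e j I.* degree j x}{pT e}λ j → hs{degree j}{fraction(extendedCluster S j)}(e j)(hm j)
   dy : ∀ e → ¬ ¬ Nonvanishing(denominator(productᶠ(pT e)))
   dy e = dp{N}{pT e}λ j → dG{fraction(extendedCluster S j)}(e j)(den≠0(extendedCluster S j))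
   eG : Fraction d n
   eG = productᶠ(pT in#)+ᶠ productᶠ(pT out#)
   hn : Ho(eD in#)eG
   hn = hq{eD in#}{productᶠ(pT in#)}{productᶠ(pT out#)}(he in#)
    (hc{eD out#}{eD in#}{productᶠ(pT out#)}eg(he out#))
   dB : ¬ ¬ Nonvanishing(denominator eG)
   dB nf = dy in# λ a → dy out# λ b → nn(denominator(productᶠ(pT in#)))(denominator(productᶠ(pT out#)))a b nf
   hb : ∀ i(e : Dec(i ≡ k))→ HomogeneousOfDegree(dE i e)(extendedCluster S7 i)
   hb i(no ix)= ho{degree i}{degree i}(extendedCluster S7 i)(extendedCluster S i)(variable-off-k i ix)(λ _ → refl)(hm i)
   hb i(yes refl)= hk{degree k}{eD in#}{fraction(extendedCluster S k)}{fraction(extendedCluster S7 k)}{eG}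
    divisor≠0(den≠0(extendedCluster S k))dB exchange(hm k)hn
module Pp where
 open IS
 open Gd using(su;module so)
 open Fx using(mv)
 open Bl
 open Ct using(module CB)
 open e6
 open Gc
 open import Relation.Binary.PropositionalEquality.Core using(refl;sym;trans;cong;cong₂)
 open import Data.Nat.Base using(_≤_;_<_)
 open import Defs using(D)
 open import Data.Nat.Divisibility using(_∣_)
 open import Relation.Binary.Construct.Closure.ReflexiveTransitive using(ε)
 Dn : ∀ x y z xa ya za → D x y z xa ya za ≡ I.- D xa ya za x y z
 Dn x y z xa ya za = solve 6(λ x y z xa ya za →
  ((y :* za):+ :-(z :* ya)):+ :-((x :* za):+ :-(z :* xa)):+((x :* ya):+ :-(y :* xa))
  := :-(((ya :* z):+ :-(za :* y)):+ :-((xa :* z):+ :-(za :* x)):+((xa :* y):+ :-(ya :* x))))refl(+ x)(+ y)(+ z)(+ xa)(+ ya)(+ za)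
  where open so
 nC : ∀{a b a′ bd}→ a ≡ I.- a′ → b ≡ I.- bd → a I.+ b ≡ I.-(a′ I.+ bd)
 nC{a′ = a′}{bd}refl refl = sym(I.neg-distrib-+ a′ bd)
 mF : ∀{β ae}(m : Move β ae)v(γs : Weights β)γ ad → mv m v γs γ ad ≡ I.- mv m v γs ad γ
 mF trivalent v(a ∷ c ∷ _)γ ad = nC AU AU
  where
  b = trivalentOut v a c
  AU = Dn(a γ)(b γ)(c γ)(a ad)(b ad)(c ad)
 mF(4-valent _)v γs γ ad = refl
 mF(6-valent _)v(a ∷ f ∷ e ∷ _)γ ad = nC(Dn(a γ)(S.c γ)(e γ)(a ad)(S.c ad)(e ad))(Dn(S.b γ)(S.d γ)(f γ)(S.b ad)(S.d ad)(f ad))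
  where module S = SixValent a f e
 mF(skip m)v(_ ∷ γs)γ ad = mF m v γs γ ad
 pn : ∀{β ae}(w : Weave β ae)v(γs : Weights β)γ ad → pairing w v γs γ ad ≡ Q.- pairing w v γs ad γ
 pn [] v γs γ ad = refl
 pn(m ∷ w)v γs γ ad = trans(cong₂ Q._+_ fk(pn w(v N.+ moveTrivalents m)(moveWeights m v γs)γ ad))
  (sym(Q.neg-distrib-+(movePairing m v γs ad γ)(pairing w(v N.+ moveTrivalents m)(moveWeights m v γs)ad γ)))
  where
  fk : movePairing m v γs γ ad ≡ Q.- movePairing m v γs ad γ
  fk = trans(mP m v γs γ ad)(trans(cong(λ z → ½ Q.* ι z)(mF m v γs γ ad))(trans(cong(½ Q.*_)(nD(mv m v γs ad γ)))
   (trans(sym(Q.neg-distribʳ-* ½(ι(mv m v γs ad γ))))(cong Q.-_(sym(mP m v γs ad γ))))))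
 s< : ∀{n}(f : Fin n → ℚ)→ sumℚ(λ i → Q.- f i)≡ Q.- sumℚ f
 s<{zero}f = refl
 s<{suc n}f = trans(cong(Q.- f Fin.zero Q.+_)(s<{n}(f ∘ Fin.suc)))(sym(Q.neg-distrib-+(f Fin.zero)(sumℚ(f ∘ Fin.suc))))
 SX : ∀{n}c(f : Fin n → ℚ)→ sumℚ f Q.* c ≡ sumℚ(λ i → f i Q.* c)
 SX{n}c f = trans(Q.*-comm(sumℚ f)c)(trans(sym(sX{n}c f))(sc{n}λ i → Q.*-comm c(f i)))
 s& : ∀{m n}(f : Fin m → Fin n → ℚ)→ sumℚ(λ i → sumℚ λ j → f i j)≡ sumℚ(λ j → sumℚ λ i → f i j)
 s&{m}{n}f = f2.∑-comm{m}{n}f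
 sw : ∀{n}(a : Fin n)(h : Fin n → ℚ)→ sumℚ(λ i → if does(a O.≟ i)then h i else 0ℚ)≡ h a
 sw{suc n}Fin.zero h = trans(cong(h Fin.zero Q.+_)(sz{n}λ _ → refl))(Q.+-identityʳ(h Fin.zero))
 sw{suc n}(Fin.suc a)h = trans(Q.+-identityˡ _)(sw{n}a(h ∘ Fin.suc))
 dQ : ∀{A B : Set}(a : Dec A)(b : Dec B)→(A → B)→(B → A)→ does a ≡ does b
 dQ(yes _)(yes _)f g = refl
 dQ(yes a)(no BA)f g = ⊥-elim(BA(f a))
 dQ(no AT)(yes b)f g = ⊥-elim(AT(g b))
 dQ(no _)(no _)f g = refl
 module Pu{M N : ℕ}(f : Fin M → Fin N)(b : Fin M → Fin M → ℚ)where
  bE : Bool → Bool → ℚ → ℚ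
  bE p q x = if p ∧ q then x else 0ℚ
  ph :(∀ γ ad → b γ ad ≡ Q.- b ad γ)→ ∀ i j → pushforward f b i j ≡ Q.- pushforward f b j i
  ph AU i j = trans(sc{M}λ γ → trans(sc{M}λ ad → th(does(f γ O.≟ i))(does(f ad O.≟ j))γ ad)
   (s<{M}λ ad → bE(does(f ad O.≟ j))(does(f γ O.≟ i))(b ad γ)))
   (trans(s<{M}λ γ → sumℚ{M}λ ad → bE(does(f ad O.≟ j))(does(f γ O.≟ i))(b ad γ))
    (cong Q.-_(s&{M}{M}λ γ ad → bE(does(f ad O.≟ j))(does(f γ O.≟ i))(b ad γ))))
   where
   th : ∀ p q γ ad → bE p q(b γ ad)≡ Q.- bE q p(b ad γ)
   th true true γ ad = AU γ ad
   th true false γ ad = refl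
   th false true γ ad = refl
   th false false γ ad = refl
  CV :(Fin N → ℚ)→ Fin N → Fin M → Fin M → ℚ
  CV g j γ ad = if does(f ad O.≟ j)then b γ ad Q.* g(f γ)else 0ℚ
  pU : ∀(g : Fin N → ℚ)j → sumℚ(λ i → pushforward f b i j Q.* g i)≡ sumℚ(λ γ → sumℚ λ ad → CV g j γ ad)
  pU g j = trans(sc{N}λ i → trans(SX{M}(g i)λ γ → sumℚ{M}λ ad → bE(does(f γ O.≟ i))(does(f ad O.≟ j))(b γ ad))
   (sc{M}λ γ → trans(SX{M}(g i)λ ad → bE(does(f γ O.≟ i))(does(f ad O.≟ j))(b γ ad))
    (sc{M}λ ad → th(does(f γ O.≟ i))(does(f ad O.≟ j))(b γ ad)(g i))))
   (trans(s&{N}{M}λ i γ → sumℚ{M}λ ad → eJ i γ ad)(sc{M}λ γ → trans(s&{N}{M}λ i ad → eJ i γ ad)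
    (sc{M}λ ad → sw{N}(f γ)λ i → if does(f ad O.≟ j)then b γ ad Q.* g i else 0ℚ)))
   where
   eJ : Fin N → Fin M → Fin M → ℚ
   eJ i γ ad = if does(f γ O.≟ i)then(if does(f ad O.≟ j)then b γ ad Q.* g i else 0ℚ)else 0ℚ
   th : ∀ p q x y → bE p q x Q.* y ≡(if p then(if q then x Q.* y else 0ℚ)else 0ℚ)
   th true true x y = refl
   th true false x y = Q.*-zeroˡ y
   th false q x y = Q.*-zeroˡ y
  p1 :(∀{γ ad}→ f γ ≡ f ad → γ ≡ ad)→ ∀(g : Fin N → ℚ)aM → sumℚ(λ i → pushforward f b i(f aM)Q.* g i)≡ sumℚ(λ γ → b γ aM Q.* g(f γ))
  p1 injective g aM = trans(pU g(f aM))(sc{M}λ γ → trans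
   (sc{M}λ ad → cong(λ e → if e then b γ ad Q.* g(f γ)else 0ℚ)(dQ(f ad O.≟ f aM)(aM O.≟ ad)(sym ∘ injective)(cong f ∘ sym)))
   (sw{M}aM λ ad → b γ ad Q.* g(f γ)))
  pV : ∀(g : Fin N → ℚ)j →(∀ γ → f γ ≢ j)→ sumℚ(λ i → pushforward f b i j Q.* g i)≡ 0ℚ
  pV g j m? = trans(pU g j)(sz{M}λ γ → sz{M}λ ad → nf(b γ ad Q.* g(f γ))(f ad O.≟ j)(m? ad))
   where
   nf : ∀ x{A : Set}(e : Dec A)→ ¬ A →(if does e then x else 0ℚ)≡ 0ℚ
   nf x(yes a)AT = ⊥-elim(AT a)
   nf x(no _)_ = refl
 module An{d n : ℕ}{σ : Signature n}(am : Admissible d σ)(dd : 2 ≤ d)(A : InitialSeed d σ am)where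
  open InitialSeed A using(rank;seed;amalgam;c₁;c₂;p;q;w₁;w₂;Δ₁;Δ₂)
  open Hl am dd A
  module Am = IsAmalgamation amalgam
  p$ : ∀{i}→(∃ λ γ → Am.ι₁ γ ≡ i)⊎(∃ λ γ → Am.ι₂ γ ≡ i)→ Fin n → ℤ
  p$(inj₁(γ , _))= dk γ
  p$(inj₂(γ , _))= dl γ
  sD : Fin rank → Fin n → ℤ
  sD i = p$(Am.covering i)
  s2 : ∀ γ x → sD(Am.ι₁ γ)x ≡ dk γ x
  s2 γ x = by(Am.covering(Am.ι₁ γ))
   where
   by : ∀ e → p$ e x ≡ dk γ x
   by(inj₁(ad , e))= cong(λ γ → dk γ x)(Am.ι₁-injective e)
   by(inj₂(ad , e))= let k , b8 , b9 = Am.separated(sym e)in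
    trans(cong(λ γ → dl γ x)b9)(trans(sym(dP k x))(cong(λ γ → dk γ x)(sym b8)))
  s3 : ∀ γ x → sD(Am.ι₂ γ)x ≡ dl γ x
  s3 γ x = by(Am.covering(Am.ι₂ γ))
   where
   by : ∀ e → p$ e x ≡ dl γ x
   by(inj₂(ad , e))= cong(λ γ → dl γ x)(Am.ι₂-injective e)
   by(inj₁(ad , e))= let k , b9 , b8 = Am.separated e in
    trans(cong(λ γ → dk γ x)b9)(trans(dP k x)(cong(λ γ → dl γ x)(sym b8)))
  a+ = arrows am(+ p)la w₁
  a~ = arrows am(+ q)lb w₂
  module Px = Pu Am.ι₁ a+
  module Pz = Pu Am.ι₂ a~
  g : Fin n → Fin rank → ℚ
  g x i = ι(sD i x)
  total : Fin n → Fin rank → ℚ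
  total x j = sumℚ{rank}λ i → arrow seed i j Q.* g x i
  Pe p& : Fin n → Fin rank → ℚ
  Pe x j = sumℚ{rank}λ i → pushforward Am.ι₁ a+ i j Q.* g x i
  p& x j = sumℚ{rank}λ i → pushforward Am.ι₂ a~ i j Q.* g x i
  tC : ∀ x j → total x j ≡ Pe x j Q.+ p& x j
  tC x j = trans(sc{rank}λ i → trans(cong(Q._* g x i)(Am.arrow-sum i j))(Q.*-distribʳ-+(g x i)(pushforward Am.ι₁ a+ i j)(pushforward Am.ι₂ a~ i j)))
   (s6{rank}(λ i → pushforward Am.ι₁ a+ i j Q.* g x i)(λ i → pushforward Am.ι₂ a~ i j Q.* g x i))
  p+ : ∀ x γ → Pe x(Am.ι₁ γ)≡ Bb.i3 γ x
  p+ x γ = trans(Px.p1 Am.ι₁-injective(g x)γ)(sc{Na}λ ad → cong(λ z → a+ ad γ Q.* ι z)(s2 ad x))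
  p~ : ∀ x γ → p& x(Am.ι₂ γ)≡ Ba.i3 γ x
  p~ x γ = trans(Pz.p1 Am.ι₂-injective(g x)γ)(sc{Nb}λ ad → cong(λ z → a~ ad γ Q.* ι z)(s3 ad x))
  iK : ∀ x k → total x(Am.ι₁(c₁ k))≡ 0ℚ
  iK x k = trans(tC x(Am.ι₁(c₁ k)))(trans(cong₂ Q._+_(p+ x(c₁ k))(trans(cong(p& x)(Am.identified k))(p~ x(c₂ k))))(Ch k x))
  SK : ∀ j → frozen seed j ≡ false → ∀ x → total x j ≡ 0ℚ
  SK j fT x = by(Am.covering j)
   where
   fk : ∀ γ → Am.ι₁ γ ≡ j → Dec(∃ λ k → γ ≡ c₁ k)→ total x j ≡ 0ℚ
   fk γ refl(yes(k , refl))= iK x k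
   fk γ refl(no ot)= trans(tC x(Am.ι₁ γ))(cong₂ Q._+_
    (trans(p+ x γ)(Bb.mf γ x(trans(sym(Am.frozen₁ γ λ k e → ot(k , e)))fT)))
    (Pz.pV(g x)(Am.ι₁ γ)λ g* e → let k , b8 , _ = Am.separated(sym e)in ot(k , b8)))
   e7 : ∀ γ → Am.ι₂ γ ≡ j → Dec(∃ λ k → γ ≡ c₂ k)→ total x j ≡ 0ℚ
   e7 γ refl(yes(k , refl))= trans(cong(total x)(sym(Am.identified k)))(iK x k)
   e7 γ refl(no ot)= trans(tC x(Am.ι₂ γ))(cong₂ Q._+_
    (Px.pV(g x)(Am.ι₂ γ)λ g+ e → let k , _ , b8 = Am.separated e in ot(k , b8))
    (trans(p~ x γ)(Ba.mf γ x(trans(sym(Am.frozen₂ γ λ k e → ot(k , e)))fT))))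
   by :(∃ λ γ → Am.ι₁ γ ≡ j)⊎(∃ λ γ → Am.ι₂ γ ≡ j)→ total x j ≡ 0ℚ
   by(inj₁(γ , e))= fk γ e(O.any? λ k → γ O.≟ c₁ k)
   by(inj₂(γ , e))= e7 γ e(O.any? λ k → γ O.≟ c₂ k)
  s$ : ∀ i → HomogeneousOfDegree(sD i)(extendedCluster seed i)
  s$ i = by(Am.covering i)
   where
   by :(∃ λ γ → Am.ι₁ γ ≡ i)⊎(∃ λ γ → Am.ι₂ γ ≡ i)→ HomogeneousOfDegree(sD i)(extendedCluster seed i)
   by(inj₁(γ , refl))= ho{δ = dk γ}{sD i}(extendedCluster seed(Am.ι₁ γ))(Δ₁ γ)(Am.variable₁ γ)(λ x → sym(s2 γ x))(hi γ)
   by(inj₂(γ , refl))= ho{δ = dl γ}{sD i}(extendedCluster seed(Am.ι₂ γ))(Δ₂ γ)(Am.variable₂ γ)(λ x → sym(s3 γ x))(hj γ)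
  s> : ∀ i j → arrow seed i j ≡ Q.- arrow seed j i
  s> i j = trans(Am.arrow-sum i j)(trans(cong₂ Q._+_
   (Px.ph(λ γ ad → pn w₁ la _(toℕ γ)(toℕ ad))i j)(Pz.ph(λ γ ad → pn w₂ lb _(toℕ γ)(toℕ ad))i j))
   (trans(sym(Q.neg-distrib-+(pushforward Am.ι₁ a+ j i)(pushforward Am.ι₂ a~ j i)))(cong Q.-_(sym(Am.arrow-sum j i)))))
  gH : GS seed
  gH = record{degree = sD ;hm = s$ ;aF = s> ;bn = SK}
 mG : ∀{d n N}{σ : Signature n}{S S7 : Seed d σ N}→ Star(λ S S7 → ∃ λ k → IsMutation k S S7)S S7 → GS S → GS S7
 mG ε G = G
 mG((k , μ)◅ rt)G = mG rt(m~ μ G)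
open import Data.Nat.Base using(_≤_;_<_;_*_)
open import Data.Nat.Divisibility using(_∣_)
open Gc using(module GS;ho)
open Pp using(module An;mG)
proposition5p11 :(d n : ℕ)→ 3 ≤ d → ¬(2 ∣ d)→ d * d < n →
 (σ : Signature n)(am : Admissible d σ)(A : InitialSeed d σ am)→
 (x : K d σ)→ IsVariable A x → MultiHomogeneous x
proposition5p11 d n DM _ _ σ am A x(S , PF , i , xO)= degree i , ho{δ = degree i}{degree i}x(extendedCluster S i)xO(λ _ → P.refl)(hm i)
 where
 open GS(mG PF(An.gH am(N.≤-trans(N.n≤1+n 2)DM)A))
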